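{- For every integer $b\ge 2$, there exist constants $\alpha=\alpha_b$, $\gamma=\gamma_b$ and $\kappa=\kappa_b<1$ such that the number $q_b(m)$ of compositions of $1$ into $n=(b-1)m+1$ powers of $b$, which is also equal to the maximum number $\mathcal{W}_b(1,n)$ of representations of a power of $b$ as an ordered sum of $n$ powers of $b$, satisfies $$\frac{\mathcal{W}_b(1,n)}{n!} = \frac{q_b(m)}{n!} = \alpha\,\gamma^m\bigl(1+O(\kappa^m)\bigr) \quad (m\to\infty).$$ More generally, for every fixed integer $s\ge 1$, the maximum number $\mathcal{W}_b(s,n)$ of representations of a positive integer with $b$-ary sum of digits $s$ as an ordered sum of $n=(b-1)m+s$ powers of $b$ is asymptotically given by $$\frac{\mathcal{W}_b(s,n)}{n!} = P_{b,s}(m)\,\gamma^m\bigl(1+O(\kappa^m)\bigr) \quad (m\to\infty),$$ where $P_{b,s}(m)$ is a polynomial in $m$ with leading term $\alpha^s m^{s-1}/(s-1)!$.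
   Context: $\mathbb{N}_0$ denotes the nonnegative integers. For an integer $b\ge2$ and positive integers $\ell,n$, let $$\mathcal{U}_b(\ell,n)=\#\{(a_1,\ldots,a_n)\in\mathbb{N}_0^n : b^{a_1}+\cdots+b^{a_n}=\ell\}.$$ For a positive integer $s$, $\mathcal{W}_b(s,n)$ is the maximum of $\mathcal{U}_b(\ell,n)$ over all positive integers $\ell$ whose $b$-ary sum of digits equals $s$. For $m\ge 0$, $q_b(m)$ denotes the number of $n$-tuples $(k_1,\ldots,k_n)$ of nonnegative integers, $n=(b-1)m+1$, with $b^{ -k_1}+b^{ -k_2}+\cdots+b^{ -k_n}=1$ (such a tuple is called a composition of $1$ into $n$ powers of $b$). The implied constants in the $O$-terms may depend on $b$ and $s$. -}

module Defs where

open import Algebra.Bundles using (CommutativeMonoid)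
open import Data.Fin using (Fin; toℕ)
open import Data.Digit using (toDigits)
import Data.Integer as ℤ
import Data.List as List
open import Data.Nat as ℕ
  using (ℕ; zero; suc; NonZero; NonTrivial; nonTrivial⇒n>1; nonTrivial⇒nonZero; _!)
open import Data.Nat.ListAction using (sum)
import Data.Nat.Properties as ℕ
open import Data.Product using (Σ-syntax; ∃-syntax; _×_; _,_; proj₁; proj₂)
open import Data.Rational as ℚ using (ℚ; 0ℚ; 1ℚ; ½; ∣_∣)
import Data.Rational.Properties as ℚ
open import Data.Sum using (inj₁; inj₂)
open import Data.Vec as Vec using (Vec; []; _∷_)
open import Function using (_↔_)
open import Relation.Binary.PropositionalEquality
  using (_≡_; sym; trans; cong; cong₂; subst; subst₂)
open import Relation.Nullary.Decidable using (fromWitness)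

Eventually : (ℕ → Set) → Set
Eventually P = ∃[ N ] ∀ n → N ℕ.≤ n → P n

-- Real numbers: Cauchy sequences of rationals, compared with the setoid
-- equality _≃_. Constructively, IsCauchy contains a modulus of
-- convergence.

IsCauchy : (ℕ → ℚ) → Set
IsCauchy x = ∀ ε → 0ℚ ℚ.< ε →
  ∃[ N ] ∀ m n → N ℕ.≤ m → N ℕ.≤ n → ∣ x m ℚ.- x n ∣ ℚ.≤ ε

record ℝ : Set where
  constructor mkℝ
  field
    seq    : ℕ → ℚ
    cauchy : IsCauchy seq

open ℝ public

infix 4 _≃_ _≤ᴿ_ _<ᴿ_

_≃_ : ℝ → ℝ → Set
x ≃ y = ∀ ε → 0ℚ ℚ.< ε → Eventually λ n → ∣ seq x n ℚ.- seq y n ∣ ℚ.≤ ε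

_≤ᴿ_ : ℝ → ℝ → Set
x ≤ᴿ y = ∀ ε → 0ℚ ℚ.< ε → Eventually λ n → seq x n ℚ.≤ seq y n ℚ.+ ε

_<ᴿ_ : ℝ → ℝ → Set
x <ᴿ y = ∃[ ε ] 0ℚ ℚ.< ε × Eventually λ n → seq x n ℚ.+ ε ℚ.≤ seq y n

open import Algebra.Properties.AbelianGroup ℚ.+-0-abelianGroup
  using (⁻¹-anti-homo‿-)
open import Algebra.Properties.CommutativeSemigroup
  (CommutativeMonoid.commutativeSemigroup ℚ.+-0-commutativeMonoid)
  using (interchange)

p-p≡0 : ∀ p → p ℚ.- p ≡ 0ℚ
p-p≡0 = ℚ.+-inverseʳ

p-r+r≡p : ∀ p r → (p ℚ.- r) ℚ.+ r ≡ p
p-r+r≡p p r = trans (ℚ.+-assoc p (ℚ.- r) r)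
  (trans (cong (p ℚ.+_) (ℚ.+-inverseˡ r)) (ℚ.+-identityʳ p))

telescope : ∀ p q r → p ℚ.- r ≡ (p ℚ.- q) ℚ.+ (q ℚ.- r)
telescope p q r = sym (trans (sym (ℚ.+-assoc (p ℚ.- q) q (ℚ.- r)))
  (cong (ℚ._- r) (p-r+r≡p p q)))

½ε+½ε≡ε : ∀ ε → ½ ℚ.* ε ℚ.+ ½ ℚ.* ε ≡ ε
½ε+½ε≡ε ε = trans (sym (ℚ.*-distribʳ-+ ε ½ ½)) (ℚ.*-identityˡ ε)

pos* : ∀ {p q} → 0ℚ ℚ.< p → 0ℚ ℚ.< q → 0ℚ ℚ.< p ℚ.* q
pos* {p} {q} p>0 q>0 = ℚ.positive⁻¹ (p ℚ.* q)
  {{ℚ.pos*pos⇒pos p {{ℚ.positive p>0}} q {{ℚ.positive q>0}}}}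

0<½ : 0ℚ ℚ.< ½
0<½ = ℚ.positive⁻¹ ½

∣p∣-∣q∣≤∣p-q∣ : ∀ p q → ∣ p ∣ ℚ.- ∣ q ∣ ℚ.≤ ∣ p ℚ.- q ∣
∣p∣-∣q∣≤∣p-q∣ p q = begin
  ∣ p ∣ ℚ.- ∣ q ∣                       ≡⟨ cong (λ r → ∣ r ∣ ℚ.- ∣ q ∣) (sym (p-r+r≡p p q)) ⟩
  ∣ (p ℚ.- q) ℚ.+ q ∣ ℚ.- ∣ q ∣         ≤⟨ ℚ.+-monoˡ-≤ (ℚ.- ∣ q ∣) (ℚ.∣p+q∣≤∣p∣+∣q∣ (p ℚ.- q) q) ⟩
  (∣ p ℚ.- q ∣ ℚ.+ ∣ q ∣) ℚ.- ∣ q ∣     ≡⟨ ℚ.+-assoc ∣ p ℚ.- q ∣ ∣ q ∣ (ℚ.- ∣ q ∣) ⟩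
  ∣ p ℚ.- q ∣ ℚ.+ (∣ q ∣ ℚ.- ∣ q ∣)     ≡⟨ cong (∣ p ℚ.- q ∣ ℚ.+_) (p-p≡0 ∣ q ∣) ⟩
  ∣ p ℚ.- q ∣ ℚ.+ 0ℚ                    ≡⟨ ℚ.+-identityʳ _ ⟩
  ∣ p ℚ.- q ∣                           ∎
  where open ℚ.≤-Reasoning

∣p-q∣≡∣q-p∣ : ∀ p q → ∣ p ℚ.- q ∣ ≡ ∣ q ℚ.- p ∣
∣p-q∣≡∣q-p∣ p q =
  trans (cong ∣_∣ (sym (⁻¹-anti-homo‿- q p))) (ℚ.∣-p∣≡∣p∣ (q ℚ.- p))

∣∣p∣-∣q∣∣≤∣p-q∣ : ∀ p q → ∣ ∣ p ∣ ℚ.- ∣ q ∣ ∣ ℚ.≤ ∣ p ℚ.- q ∣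
∣∣p∣-∣q∣∣≤∣p-q∣ p q with ℚ.∣p∣≡p∨∣p∣≡-p (∣ p ∣ ℚ.- ∣ q ∣)
... | inj₁ eq = subst (ℚ._≤ ∣ p ℚ.- q ∣) (sym eq) (∣p∣-∣q∣≤∣p-q∣ p q)
... | inj₂ eq = subst₂ ℚ._≤_
  (sym (trans eq (⁻¹-anti-homo‿- ∣ p ∣ ∣ q ∣))) (∣p-q∣≡∣q-p∣ q p)
  (∣p∣-∣q∣≤∣p-q∣ q p)

eventuallyBounded : ∀ {x} → IsCauchy x →
  ∃[ B ] 0ℚ ℚ.< B × Eventually λ n → ∣ x n ∣ ℚ.≤ B
eventuallyBounded {x} cx with cx 1ℚ (ℚ.positive⁻¹ 1ℚ)
... | N , close = 1ℚ ℚ.+ ∣ x N ∣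
    , ℚ.+-mono-<-≤ (ℚ.positive⁻¹ 1ℚ) (ℚ.0≤∣p∣ (x N))
    , N , λ n N≤n → begin
      ∣ x n ∣                           ≡⟨ cong ∣_∣ (sym (p-r+r≡p (x n) (x N))) ⟩
      ∣ (x n ℚ.- x N) ℚ.+ x N ∣         ≤⟨ ℚ.∣p+q∣≤∣p∣+∣q∣ (x n ℚ.- x N) (x N) ⟩
      ∣ x n ℚ.- x N ∣ ℚ.+ ∣ x N ∣       ≤⟨ ℚ.+-monoˡ-≤ ∣ x N ∣ (close n N N≤n ℕ.≤-refl) ⟩
      1ℚ ℚ.+ ∣ x N ∣                    ∎
  where open ℚ.≤-Reasoning

scaled : ∀ B ε → 0ℚ ℚ.< B → 0ℚ ℚ.< ε →
  ∃[ δ ] 0ℚ ℚ.< δ × B ℚ.* δ ≡ ε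
scaled B ε B>0 ε>0 = B⁻¹ ℚ.* ε
  , pos* (ℚ.positive⁻¹ B⁻¹ {{ℚ.1/pos⇒pos B}}) ε>0
  , trans (sym (ℚ.*-assoc B B⁻¹ ε))
      (trans (cong (ℚ._* ε) (ℚ.*-inverseʳ B)) (ℚ.*-identityˡ ε))
  where
  instance
    B-positive : ℚ.Positive B
    B-positive = ℚ.positive B>0
    B-nonZero : ℚ.NonZero B
    B-nonZero = ℚ.pos⇒nonZero B
  B⁻¹ : ℚ
  B⁻¹ = ℚ.1/ B

∣p*q∣≤B*δ : ∀ {p q B δ} → ∣ p ∣ ℚ.≤ B → ∣ q ∣ ℚ.≤ δ → 0ℚ ℚ.< B →
  ∣ p ℚ.* q ∣ ℚ.≤ B ℚ.* δ
∣p*q∣≤B*δ {p} {q} {B} {δ} p≤B q≤δ B>0 = begin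
  ∣ p ℚ.* q ∣        ≡⟨ ℚ.∣p*q∣≡∣p∣*∣q∣ p q ⟩
  ∣ p ∣ ℚ.* ∣ q ∣    ≤⟨ ℚ.*-monoʳ-≤-nonNeg ∣ q ∣ {{ℚ.∣-∣-nonNeg q}} p≤B ⟩
  B ℚ.* ∣ q ∣        ≤⟨ ℚ.*-monoˡ-≤-nonNeg B {{ℚ.nonNegative (ℚ.<⇒≤ B>0)}} q≤δ ⟩
  B ℚ.* δ            ∎
  where open ℚ.≤-Reasoning

fromℚ : ℚ → ℝ
fromℚ p = mkℝ (λ _ → p) λ ε ε>0 → 0 , λ _ _ _ _ →
  subst (ℚ._≤ ε) (cong ∣_∣ (sym (p-p≡0 p))) (ℚ.<⇒≤ ε>0)

fromℕ : ℕ → ℝ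
fromℕ n = fromℚ (ℤ.+ n ℚ./ 1)

0ᴿ 1ᴿ : ℝ
0ᴿ = fromℚ 0ℚ
1ᴿ = fromℚ 1ℚ

infixl 6 _+ᴿ_
infixl 7 _*ᴿ_
infixr 8 _^ᴿ_

_+ᴿ_ : ℝ → ℝ → ℝ
mkℝ x cx +ᴿ mkℝ y cy = mkℝ (λ n → x n ℚ.+ y n) c
  where
  open ℚ.≤-Reasoning
  c : IsCauchy (λ n → x n ℚ.+ y n)
  c ε ε>0 with cx (½ ℚ.* ε) (pos* 0<½ ε>0) | cy (½ ℚ.* ε) (pos* 0<½ ε>0)
  ... | M , closeˣ | N , closeʸ = M ℕ.⊔ N , λ m n hm hn → begin
    ∣ (x m ℚ.+ y m) ℚ.- (x n ℚ.+ y n) ∣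
      ≡⟨ cong (λ z → ∣ x m ℚ.+ y m ℚ.+ z ∣) (ℚ.neg-distrib-+ (x n) (y n)) ⟩
    ∣ (x m ℚ.+ y m) ℚ.+ (ℚ.- x n ℚ.+ ℚ.- y n) ∣
      ≡⟨ cong ∣_∣ (interchange (x m) (y m) (ℚ.- x n) (ℚ.- y n)) ⟩
    ∣ (x m ℚ.- x n) ℚ.+ (y m ℚ.- y n) ∣
      ≤⟨ ℚ.∣p+q∣≤∣p∣+∣q∣ (x m ℚ.- x n) (y m ℚ.- y n) ⟩
    ∣ x m ℚ.- x n ∣ ℚ.+ ∣ y m ℚ.- y n ∣
      ≤⟨ ℚ.+-mono-≤
           (closeˣ m n (ℕ.m⊔n≤o⇒m≤o M N hm) (ℕ.m⊔n≤o⇒m≤o M N hn))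
           (closeʸ m n (ℕ.m⊔n≤o⇒n≤o M N hm) (ℕ.m⊔n≤o⇒n≤o M N hn)) ⟩
    ½ ℚ.* ε ℚ.+ ½ ℚ.* ε
      ≡⟨ ½ε+½ε≡ε ε ⟩
    ε ∎

_*ᴿ_ : ℝ → ℝ → ℝ
mkℝ x cx *ᴿ mkℝ y cy = mkℝ (λ n → x n ℚ.* y n) c
  where
  open ℚ.≤-Reasoning

  split : ∀ p q r s →
    p ℚ.* q ℚ.- r ℚ.* s ≡ p ℚ.* (q ℚ.- s) ℚ.+ s ℚ.* (p ℚ.- r)
  split p q r s = trans (telescope (p ℚ.* q) (p ℚ.* s) (r ℚ.* s))
    (cong₂ ℚ._+_
      (sym (trans (ℚ.*-distribˡ-+ p q (ℚ.- s))
        (cong (p ℚ.* q ℚ.+_) (sym (ℚ.neg-distribʳ-* p s)))))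
      (sym (trans (ℚ.*-comm s (p ℚ.- r)) (trans (ℚ.*-distribʳ-+ s p (ℚ.- r))
        (cong (p ℚ.* s ℚ.+_) (sym (ℚ.neg-distribˡ-* r s)))))))

  c : IsCauchy (λ n → x n ℚ.* y n)
  c ε ε>0 with eventuallyBounded cx | eventuallyBounded cy
  ... | A , A>0 , K , boundˣ | B , B>0 , L , boundʸ
    with scaled A (½ ℚ.* ε) A>0 (pos* 0<½ ε>0)
       | scaled B (½ ℚ.* ε) B>0 (pos* 0<½ ε>0)
  ... | δ , δ>0 , Aδ≡ | η , η>0 , Bη≡ with cy δ δ>0 | cx η η>0
  ... | M , closeʸ | N , closeˣ =
    (K ℕ.⊔ L) ℕ.⊔ (M ℕ.⊔ N) , λ m n hm hn →
    let KLm = ℕ.m⊔n≤o⇒m≤o (K ℕ.⊔ L) (M ℕ.⊔ N) hm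
        KLn = ℕ.m⊔n≤o⇒m≤o (K ℕ.⊔ L) (M ℕ.⊔ N) hn
        MNm = ℕ.m⊔n≤o⇒n≤o (K ℕ.⊔ L) (M ℕ.⊔ N) hm
        MNn = ℕ.m⊔n≤o⇒n≤o (K ℕ.⊔ L) (M ℕ.⊔ N) hn
    in begin
    ∣ x m ℚ.* y m ℚ.- x n ℚ.* y n ∣
      ≡⟨ cong ∣_∣ (split (x m) (y m) (x n) (y n)) ⟩
    ∣ x m ℚ.* (y m ℚ.- y n) ℚ.+ y n ℚ.* (x m ℚ.- x n) ∣
      ≤⟨ ℚ.∣p+q∣≤∣p∣+∣q∣ (x m ℚ.* (y m ℚ.- y n)) (y n ℚ.* (x m ℚ.- x n)) ⟩
    ∣ x m ℚ.* (y m ℚ.- y n) ∣ ℚ.+ ∣ y n ℚ.* (x m ℚ.- x n) ∣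
      ≤⟨ ℚ.+-mono-≤
           (∣p*q∣≤B*δ {x m} (boundˣ m (ℕ.m⊔n≤o⇒m≤o K L KLm))
             (closeʸ m n (ℕ.m⊔n≤o⇒m≤o M N MNm) (ℕ.m⊔n≤o⇒m≤o M N MNn)) A>0)
           (∣p*q∣≤B*δ {y n} (boundʸ n (ℕ.m⊔n≤o⇒n≤o K L KLn))
             (closeˣ m n (ℕ.m⊔n≤o⇒n≤o M N MNm) (ℕ.m⊔n≤o⇒n≤o M N MNn)) B>0) ⟩
    A ℚ.* δ ℚ.+ B ℚ.* η
      ≡⟨ cong₂ ℚ._+_ Aδ≡ Bη≡ ⟩
    ½ ℚ.* ε ℚ.+ ½ ℚ.* ε
      ≡⟨ ½ε+½ε≡ε ε ⟩
    ε ∎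

∣_∣ᴿ : ℝ → ℝ
∣ mkℝ x cx ∣ᴿ = mkℝ (λ n → ∣ x n ∣) λ ε ε>0 →
  proj₁ (cx ε ε>0) , λ m n hm hn →
    ℚ.≤-trans (∣∣p∣-∣q∣∣≤∣p-q∣ (x m) (x n)) (proj₂ (cx ε ε>0) m n hm hn)

_^ᴿ_ : ℝ → ℕ → ℝ
x ^ᴿ zero  = 1ᴿ
x ^ᴿ suc n = x *ᴿ x ^ᴿ n

_/!_ : ℕ → ℕ → ℝ
w /! n = fromℚ ((ℤ.+ w ℚ./ n !) {{n ℕ.!≢0}})

-- Coefficients are listed in order of increasing degree.
evalPoly : ∀ {d} → Vec ℝ d → ℝ → ℝ
evalPoly []       x = 0ᴿ
evalPoly (c ∷ cs) x = c +ᴿ x *ᴿ evalPoly cs x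

_IsO_ : (ℕ → ℝ) → (ℕ → ℝ) → Set
f IsO g = ∃[ C ] Eventually λ m → ∣ f m ∣ᴿ ≤ᴿ C *ᴿ ∣ g m ∣ᴿ

-- f(m) = g(m) (1 + O(h(m))) as m → ∞
_≈_[1+O_] : (f g h : ℕ → ℝ) → Set
f ≈ g [1+O h ] =
  ∃[ E ] E IsO h × Eventually λ m → f m ≃ g m *ᴿ (1ᴿ +ᴿ E m)

_HasCardinality_ : Set → ℕ → Set
A HasCardinality k = A ↔ Fin k

Representation : (b ℓ n : ℕ) → Set
Representation b ℓ n = Σ[ a ∈ Vec ℕ n ] Vec.sum (Vec.map (b ℕ.^_) a) ≡ ℓ

_^-_ : (b k : ℕ) .{{_ : NonZero b}} → ℚ
b ^- k = (ℤ.1ℤ ℚ./ b ℕ.^ k) {{ℕ.m^n≢0 b k}}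

Composition : (b n : ℕ) .{{_ : NonZero b}} → Set
Composition b n =
  Σ[ k ∈ Vec ℕ n ] Vec.foldr′ ℚ._+_ 0ℚ (Vec.map (b ^-_) k) ≡ 1ℚ

digitSum : (b : ℕ) .{{_ : NonTrivial b}} → ℕ → ℕ
digitSum b ℓ = sum (List.map toℕ
  (proj₁ (toDigits b {fromWitness (nonTrivial⇒n>1 b)} ℓ)))

-- U_b(ℓ, n) = u
IsU : (b ℓ n u : ℕ) → Set
IsU b ℓ n u = Representation b ℓ n HasCardinality u

-- q_b(m) = q
IsQ : (b m q : ℕ) .{{_ : NonTrivial b}} → Set
IsQ b m q = Composition b ((b ℕ.∸ 1) ℕ.* m ℕ.+ 1) HasCardinality q
  where instance _ = nonTrivial⇒nonZero b

-- W_b(s, n) = w. The second component also asserts that each count exists,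
-- so that the upper bound cannot hold vacuously.
IsW : (b s n w : ℕ) .{{_ : NonTrivial b}} → Set
IsW b s n w =
  (∃[ ℓ ] 0 ℕ.< ℓ × digitSum b ℓ ≡ s × IsU b ℓ n w) ×
  (∀ ℓ → 0 ℕ.< ℓ → digitSum b ℓ ≡ s → ∃[ u ] IsU b ℓ n u × u ℕ.≤ w)

{-# OPTIONS --safe #-}

-- Merging b equal parts b ^ a into one part b ^ (a + 1) turns a representation
-- into a sequence of levels, in which a level with i internal nodes has i b
-- nodes below it. Divided by n!, the number of representations is a sum of
-- products of the factors 1 / (number of leaves)!, taken level by level from the
-- leading digit down, so that the digits of ℓ only contribute additional nodes.
-- Since the weight of a level of r₁ + r₂ nodes is at most the product
-- (convolution) of the weights for r₁ and r₂, the count for digit sum s is at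
-- most n! times the s-fold convolution power of c(m) = q(m) / n!, with equality
-- when the digits of ℓ are s ones separated by at least m zeros.
--
-- Cutting a level sequence at its first level with a single internal node gives
-- a renewal equation y(m + 1) = Σ f(k) y(m − k) + g(m) for (a rescaling of)
-- c. It makes the ratio y(m + 1) / y(m) an average of its own past, and once
-- f decays fast enough this averaging is a contraction, so that the ratios
-- converge geometrically to γ, and c(m) / γᵐ to α. The decay of f follows from
-- an explicit supersolution of the linear system for its generating function
-- and those started at the other levels. Convolving sequences α + O(κᵐ) gives
-- polynomials plus O(κᵐ).
module Submission where

-- A level with a single internal node is a point of regeneration: what follows depends on nothing
-- before it. Between two such levels every level has at least two internal nodes, which costs
-- factorials, so f decays although γ is not known beforehand. The contraction asks for two things
-- at once: μ < ξ, where 1/μ is a guaranteed growth factor of y, and θ < 1, where θ bounds the sums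
-- of k f(k) ξᵏ⁺¹. For b ≥ 3 one supersolution in closed form, evaluated beyond the normalised point
-- by the factor 6/5, allows ξ = 1. For b = 2 the margins are thin (θ is about 0.994, and μ =
-- 200/221 lies just below ξ = 10/11), whence the separate treatment.
--
-- All of this happens in the rationals. Reals enter only with γ and α, and there the n-th
-- approximation of c(m)/γᵐ uses the n-th ratio in place of γ, so that algebraic identities hold
-- exactly for every n and only bounds carry an ε.

-- Rational arithmetic, powers and inverses.

module Rationals where

  import Data.Integer as ℤ
  import Data.Integer.Properties as ℤ
  open import Data.Nat as ℕ using (ℕ; zero; suc)
  import Data.Nat.Properties as ℕ
  open import Data.Rational as ℚ
    using (ℚ; 0ℚ; 1ℚ; _+_; _*_; _-_; -_; _≤_; _<_; ∣_∣; _/_)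
  open import Data.Rational.Properties as ℚ using (≤-refl; ≤-trans; <⇒≤)
  open import Data.Rational.Unnormalised as ℚᵘ using (mkℚᵘ; *≡*)
  import Data.Rational.Unnormalised.Properties as ℚᵘ
  open import Data.Product using (∃-syntax; _,_; proj₁; proj₂)
  open import Data.Sum using (inj₁; inj₂)
  open import Relation.Binary.PropositionalEquality
  open import Relation.Nullary using (yes; no; contradiction)
  open import Relation.Nullary.Decidable using (dec⇒maybe; True; toWitness)
  open import Tactic.RingSolver.Core.AlmostCommutativeRing
    using (AlmostCommutativeRing; fromCommutativeRing)
  open import Tactic.RingSolver using (solve-∀)
  open import Defs using (pos*)

  ℚ-ring : AlmostCommutativeRing _ _
  ℚ-ring = fromCommutativeRing ℚ.+-*-commutativeRing (λ p → dec⇒maybe (0ℚ ℚ.≟ p))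

  infixr 8 _^_

  _^_ : ℚ → ℕ → ℚ
  x ^ zero  = 1ℚ
  x ^ suc n = x * x ^ n

  ≤! : ∀ {p q} {_ : True (p ℚ.≤? q)} → p ≤ q
  ≤! {_} {_} {t} = toWitness t

  <! : ∀ {p q} {_ : True (p ℚ.<? q)} → p < q
  <! {_} {_} {t} = toWitness t

  ≤≡ : ∀ {p q r} → p ≤ q → q ≡ r → p ≤ r
  ≤≡ p≤q refl = p≤q

  ≡≤ : ∀ {p q r} → p ≡ q → q ≤ r → p ≤ r
  ≡≤ refl q≤r = q≤r

  infixl 6 _+≤+_ _0+_
  infixl 7 _0*_

  _+≤+_ : ∀ {p q r s} → p ≤ q → r ≤ s → p + r ≤ q + s
  _+≤+_ = ℚ.+-mono-≤

  _0+_ : ∀ {p q} → 0ℚ ≤ p → 0ℚ ≤ q → 0ℚ ≤ p + q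
  _0+_ = ℚ.+-mono-≤

  *≤ : ∀ {p q} r → 0ℚ ≤ r → p ≤ q → r * p ≤ r * q
  *≤ r 0≤r = ℚ.*-monoˡ-≤-nonNeg r {{ℚ.nonNegative 0≤r}}

  ≤* : ∀ {p q} r → 0ℚ ≤ r → p ≤ q → p * r ≤ q * r
  ≤* r 0≤r = ℚ.*-monoʳ-≤-nonNeg r {{ℚ.nonNegative 0≤r}}

  _0*_ : ∀ {p q} → 0ℚ ≤ p → 0ℚ ≤ q → 0ℚ ≤ p * q
  _0*_ {p} {q} 0≤p 0≤q = ≡≤ (sym (ℚ.*-zeroʳ p)) (*≤ p 0≤p 0≤q)

  *≤* : ∀ {p q r s} → 0ℚ ≤ p → 0ℚ ≤ s → p ≤ q → r ≤ s → p * r ≤ q * s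
  *≤* {p} {q} {r} {s} 0≤p 0≤s p≤q r≤s = ≤-trans (*≤ p 0≤p r≤s) (≤* s 0≤s p≤q)

  -- Reduces a polynomial inequality to a certificate d ≥ 0 and a ring identity.
  ≤-by : ∀ {p q} d → 0ℚ ≤ d → q ≡ p + d → p ≤ q
  ≤-by {p} d 0≤d refl = ≡≤ (sym (ℚ.+-identityʳ p)) (ℚ.+-monoʳ-≤ p 0≤d)

  p≤p+q : ∀ {p q} → 0ℚ ≤ q → p ≤ p + q
  p≤p+q 0≤q = ≤-by _ 0≤q refl

  p≤q+p : ∀ {p q} → 0ℚ ≤ q → p ≤ q + p
  p≤q+p {p} {q} 0≤q = ≤-by q 0≤q (ℚ.+-comm q p)

  0≤1 : 0ℚ ≤ 1ℚ
  0≤1 = ≤!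

  0<1 : 0ℚ < 1ℚ
  0<1 = <!

  0≤q-p : ∀ {p q} → p ≤ q → 0ℚ ≤ q - p
  0≤q-p {p} p≤q = ≡≤ (sym (ℚ.+-inverseʳ p)) (ℚ.+-monoˡ-≤ (- p) p≤q)

  p≤q : ∀ {p q} → 0ℚ ≤ q - p → p ≤ q
  p≤q {p} {q} h = ≤-by (q - p) h (lem p q)
    where
    lem : ∀ p q → q ≡ p + (q - p)
    lem = solve-∀ ℚ-ring

  0<q-p : ∀ {p q} → p < q → 0ℚ < q - p
  0<q-p {p} {q} p<q = subst (_< q - p) (ℚ.+-inverseʳ p) (ℚ.+-monoˡ-< (- p) p<q)

  *-cancel-≤ : ∀ {p q} r → 0ℚ < r → r * p ≤ r * q → p ≤ q
  *-cancel-≤ r 0<r = ℚ.*-cancelˡ-≤-pos r {{ℚ.positive 0<r}}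

  *<* : ∀ {p q} r → 0ℚ < r → p < q → r * p < r * q
  *<* r 0<r = ℚ.*-monoʳ-<-pos r {{ℚ.positive 0<r}}

  0≤^ : ∀ {x} n → 0ℚ ≤ x → 0ℚ ≤ x ^ n
  0≤^ zero    0≤x = 0≤1
  0≤^ (suc n) 0≤x = 0≤x 0* 0≤^ n 0≤x

  0<^ : ∀ {x} n → 0ℚ < x → 0ℚ < x ^ n
  0<^ zero    0<x = 0<1
  0<^ (suc n) 0<x = pos* 0<x (0<^ n 0<x)

  ^-mono : ∀ {x y} n → 0ℚ ≤ x → x ≤ y → x ^ n ≤ y ^ n
  ^-mono zero    0≤x x≤y = ≤-refl
  ^-mono (suc n) 0≤x x≤y =
    *≤* 0≤x (0≤^ n (≤-trans 0≤x x≤y)) x≤y (^-mono n 0≤x x≤y)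

  ^-+ : ∀ x m n → x ^ (m ℕ.+ n) ≡ x ^ m * x ^ n
  ^-+ x zero    n = sym (ℚ.*-identityˡ (x ^ n))
  ^-+ x (suc m) n = trans (cong (x *_) (^-+ x m n)) (sym (ℚ.*-assoc x (x ^ m) (x ^ n)))

  *-^ : ∀ x y n → (x * y) ^ n ≡ x ^ n * y ^ n
  *-^ x y zero    = refl
  *-^ x y (suc n) = trans (cong (x * y *_) (*-^ x y n)) (lem x y (x ^ n) (y ^ n))
    where
    lem : ∀ a b c d → a * b * (c * d) ≡ a * c * (b * d)
    lem = solve-∀ ℚ-ring

  1^ : ∀ n → 1ℚ ^ n ≡ 1ℚ
  1^ zero    = refl
  1^ (suc n) = trans (ℚ.*-identityˡ (1ℚ ^ n)) (1^ n)

  ^≤1 : ∀ {x} n → 0ℚ ≤ x → x ≤ 1ℚ → x ^ n ≤ 1ℚ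
  ^≤1 n 0≤x x≤1 = ≤≡ (^-mono n 0≤x x≤1) (1^ n)

  1≤^ : ∀ {x} n → 1ℚ ≤ x → 1ℚ ≤ x ^ n
  1≤^ n 1≤x = ≡≤ (sym (1^ n)) (^-mono n 0≤1 1≤x)

  ^-anti : ∀ {x m n} → 0ℚ ≤ x → x ≤ 1ℚ → m ℕ.≤ n → x ^ n ≤ x ^ m
  ^-anti {n = n} 0≤x x≤1 ℕ.z≤n       = ^≤1 n 0≤x x≤1
  ^-anti {x} 0≤x x≤1 (ℕ.s≤s m≤n) = *≤ x 0≤x (^-anti 0≤x x≤1 m≤n)

  opaque
    -- The default value 0 at 0 makes inversion total, so that ratios can be written down before
    -- positivity is known.
    inv : ℚ → ℚ
    inv p with p ℚ.≟ 0ℚ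
    ... | yes _   = 0ℚ
    ... | no  p≢0 = (ℚ.1/ p) {{ℚ.≢-nonZero p≢0}}

    *-inv : ∀ {p} → 0ℚ < p → p * inv p ≡ 1ℚ
    *-inv {p} 0<p with p ℚ.≟ 0ℚ
    ... | yes p≡0 = contradiction (sym p≡0) (ℚ.<⇒≢ 0<p)
    ... | no  p≢0 = ℚ.*-inverseʳ p {{ℚ.≢-nonZero p≢0}}

    0<inv : ∀ {p} → 0ℚ < p → 0ℚ < inv p
    0<inv {p} 0<p with p ℚ.≟ 0ℚ
    ... | yes p≡0 = contradiction (sym p≡0) (ℚ.<⇒≢ 0<p)
    ... | no  p≢0 = ℚ.positive⁻¹ _ {{ℚ.1/pos⇒pos p {{ℚ.positive 0<p}}}}

  0≤inv : ∀ {p} → 0ℚ < p → 0ℚ ≤ inv p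
  0≤inv 0<p = <⇒≤ (0<inv 0<p)

  inv-≤ : ∀ {p q} → 0ℚ < p → p ≤ q → inv q ≤ inv p
  inv-≤ {p} {q} 0<p p≤q = *-cancel-≤ (p * q) (pos* 0<p 0<q) (begin
    p * q * inv q    ≡⟨ ℚ.*-assoc p q (inv q) ⟩
    p * (q * inv q)  ≡⟨ cong (p *_) (*-inv 0<q) ⟩
    p * 1ℚ           ≡⟨ ℚ.*-identityʳ p ⟩
    p                ≤⟨ p≤q ⟩
    q                ≡⟨ ℚ.*-identityʳ q ⟨
    q * 1ℚ           ≡⟨ cong (q *_) (*-inv 0<p) ⟨
    q * (p * inv p)  ≡⟨ lem p q (inv p) ⟩
    p * q * inv p    ∎)
    where
    open ℚ.≤-Reasoning
    0<q = ℚ.<-≤-trans 0<p p≤q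
    lem : ∀ p q r → q * (p * r) ≡ p * q * r
    lem = solve-∀ ℚ-ring

  inv-unique : ∀ {p q} → 0ℚ < p → p * q ≡ 1ℚ → q ≡ inv p
  inv-unique {p} {q} 0<p pq≡1 = begin
    q                ≡⟨ ℚ.*-identityʳ q ⟨
    q * 1ℚ           ≡⟨ cong (q *_) (*-inv 0<p) ⟨
    q * (p * inv p)  ≡⟨ lem p q (inv p) ⟩
    p * q * inv p    ≡⟨ cong (_* inv p) pq≡1 ⟩
    1ℚ * inv p       ≡⟨ ℚ.*-identityˡ (inv p) ⟩
    inv p            ∎
    where
    open ≡-Reasoning
    lem : ∀ p q r → q * (p * r) ≡ p * q * r
    lem = solve-∀ ℚ-ring

  ι : ℕ → ℚ
  ι n = ℤ.+ n / 1

  ι-+ : ∀ m n → ι (m ℕ.+ n) ≡ ι m + ι n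
  ι-+ m n = ℚ.toℚᵘ-injective (begin
    ℚ.toℚᵘ (ι (m ℕ.+ n))
      ≈⟨ ℚ.toℚᵘ-fromℚᵘ (mkℚᵘ (ℤ.+ (m ℕ.+ n)) 0) ⟩
    mkℚᵘ (ℤ.+ (m ℕ.+ n)) 0
      ≈⟨ *≡* (cong (ℤ._* ℤ.1ℤ) (cong₂ ℤ._+_ (sym (ℤ.*-identityʳ (ℤ.+ m))) (sym (ℤ.*-identityʳ (ℤ.+ n))))) ⟩
    mkℚᵘ (ℤ.+ m) 0 ℚᵘ.+ mkℚᵘ (ℤ.+ n) 0
      ≈⟨ ℚᵘ.+-cong (ℚ.toℚᵘ-fromℚᵘ (mkℚᵘ (ℤ.+ m) 0)) (ℚ.toℚᵘ-fromℚᵘ (mkℚᵘ (ℤ.+ n) 0)) ⟨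
    ℚ.toℚᵘ (ι m) ℚᵘ.+ ℚ.toℚᵘ (ι n)
      ≈⟨ ℚ.toℚᵘ-homo-+ (ι m) (ι n) ⟨
    ℚ.toℚᵘ (ι m + ι n) ∎)
    where open ℚᵘ.≃-Reasoning

  ι-* : ∀ m n → ι (m ℕ.* n) ≡ ι m * ι n
  ι-* zero    n = sym (ℚ.*-zeroˡ (ι n))
  ι-* (suc m) n = begin
    ι (n ℕ.+ m ℕ.* n)     ≡⟨ ι-+ n (m ℕ.* n) ⟩
    ι n + ι (m ℕ.* n)     ≡⟨ cong (ι n +_) (ι-* m n) ⟩
    ι n + ι m * ι n       ≡⟨ lem (ι m) (ι n) ⟩
    (1ℚ + ι m) * ι n      ≡⟨ cong (_* ι n) (ι-+ 1 m) ⟨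
    ι (suc m) * ι n       ∎
    where
    open ≡-Reasoning
    lem : ∀ m n → n + m * n ≡ (1ℚ + m) * n
    lem = solve-∀ ℚ-ring

  ι-suc : ∀ n → ι (suc n) ≡ 1ℚ + ι n
  ι-suc = ι-+ 1

  0≤ι : ∀ n → 0ℚ ≤ ι n
  0≤ι zero    = ≤-refl
  0≤ι (suc n) = ≤≡ (0≤1 0+ 0≤ι n) (sym (ι-suc n))

  0<ι : ∀ n → 0ℚ < ι (suc n)
  0<ι n = subst (0ℚ <_) (sym (ι-suc n)) (ℚ.+-mono-<-≤ 0<1 (0≤ι n))

  ι-mono : ∀ {m n} → m ℕ.≤ n → ι m ≤ ι n
  ι-mono {m} {n} m≤n = ≤-by (ι (n ℕ.∸ m)) (0≤ι (n ℕ.∸ m))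
    (trans (cong ι (sym (ℕ.m+[n∸m]≡n m≤n))) (ι-+ m (n ℕ.∸ m)))

  ι-mono-< : ∀ {m n} → m ℕ.< n → ι m < ι n
  ι-mono-< {m} {n} m<n = ℚ.<-≤-trans
    (subst₂ _<_ (ℚ.+-identityˡ (ι m)) (sym (ι-suc m)) (ℚ.+-monoˡ-< (ι m) 0<1))
    (ι-mono m<n)

  ι-cancel-≤ : ∀ {m n} → ι m ≤ ι n → m ℕ.≤ n
  ι-cancel-≤ {m} {n} h with m ℕ.≤? n
  ... | yes m≤n = m≤n
  ... | no  m≰n = contradiction (ℚ.<-≤-trans (ι-mono-< (ℕ.≰⇒> m≰n)) h) (ℚ.<-irrefl refl)

  ι-injective : ∀ {m n} → ι m ≡ ι n → m ≡ n
  ι-injective eq = ℕ.≤-antisym (ι-cancel-≤ (ℚ.≤-reflexive eq)) (ι-cancel-≤ (ℚ.≤-reflexive (sym eq)))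

  /-as-inv : ∀ m n → (ℤ.+ m / suc n) ≡ ι m * inv (ι (suc n))
  /-as-inv m n = begin
    p                                ≡⟨ ℚ.*-identityʳ p ⟨
    p * 1ℚ                           ≡⟨ cong (p *_) (*-inv (0<ι n)) ⟨
    p * (ι (suc n) * inv (ι (suc n))) ≡⟨ ℚ.*-assoc p (ι (suc n)) _ ⟨
    p * ι (suc n) * inv (ι (suc n))  ≡⟨ cong (_* inv (ι (suc n))) cancel ⟩
    ι m * inv (ι (suc n))            ∎
    where
    open ≡-Reasoning
    p = ℤ.+ m / suc n
    cancel : p * ι (suc n) ≡ ι m
    cancel = ℚ.toℚᵘ-injective (ER.begin
      ℚ.toℚᵘ (p * ι (suc n))
        ER.≈⟨ ℚ.toℚᵘ-homo-* p (ι (suc n)) ⟩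
      ℚ.toℚᵘ p ℚᵘ.* ℚ.toℚᵘ (ι (suc n))
        ER.≈⟨ ℚᵘ.*-cong (ℚ.toℚᵘ-fromℚᵘ (mkℚᵘ (ℤ.+ m) n)) (ℚ.toℚᵘ-fromℚᵘ (mkℚᵘ (ℤ.+ suc n) 0)) ⟩
      mkℚᵘ (ℤ.+ m) n ℚᵘ.* mkℚᵘ (ℤ.+ suc n) 0
        ER.≈⟨ *≡* (trans (ℤ.*-identityʳ _) (cong (ℤ.+ m ℤ.*_) (cong (λ k → ℤ.+ suc k) (sym (ℕ.*-identityʳ n))))) ⟩
      mkℚᵘ (ℤ.+ m) 0
        ER.≈⟨ ℚ.toℚᵘ-fromℚᵘ (mkℚᵘ (ℤ.+ m) 0) ⟨
      ℚ.toℚᵘ (ι m) ER.∎)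
      where module ER = ℚᵘ.≃-Reasoning

  ∣p-r∣≤ : ∀ p q r → ∣ p - r ∣ ≤ ∣ p - q ∣ + ∣ q - r ∣
  ∣p-r∣≤ p q r = ≡≤ (cong ∣_∣ (lem p q r)) (ℚ.∣p+q∣≤∣p∣+∣q∣ (p - q) (q - r))
    where
    lem : ∀ p q r → p - r ≡ (p - q) + (q - r)
    lem = solve-∀ ℚ-ring

  p≤∣p∣ : ∀ p → p ≤ ∣ p ∣
  p≤∣p∣ p with ℚ.≤-total 0ℚ p
  ... | inj₁ 0≤p = ℚ.≤-reflexive (sym (ℚ.0≤p⇒∣p∣≡p 0≤p))
  ... | inj₂ p≤0 = ≤-trans p≤0 (ℚ.0≤∣p∣ p)

  -p≤∣p∣ : ∀ p → - p ≤ ∣ p ∣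
  -p≤∣p∣ p = ≤≡ (p≤∣p∣ (- p)) (ℚ.∣-p∣≡∣p∣ p)

  ∣p*q∣≤ : ∀ {p q a b} → ∣ p ∣ ≤ a → ∣ q ∣ ≤ b → ∣ p * q ∣ ≤ a * b
  ∣p*q∣≤ {p} {q} {a} {b} hp hq = ≡≤ (ℚ.∣p*q∣≡∣p∣*∣q∣ p q)
    (*≤* (ℚ.0≤∣p∣ p) (≤-trans (ℚ.0≤∣p∣ q) hq) hp hq)

  ∣p+q∣≤ : ∀ {p q a b} → ∣ p ∣ ≤ a → ∣ q ∣ ≤ b → ∣ p + q ∣ ≤ a + b
  ∣p+q∣≤ {p} {q} hp hq = ≤-trans (ℚ.∣p+q∣≤∣p∣+∣q∣ p q) (hp +≤+ hq)

  archimedean : ∀ p → ∃[ n ] p ≤ ι n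
  archimedean p@(ℚ.mkℚ (ℤ.+ n) d c) = n , ≤≡ bound refl
    where
    bound : p ≤ ι n
    bound = ℚ.toℚᵘ-cancel-≤ (ℚᵘ.≤-respʳ-≃ (ℚᵘ.≃-sym (ℚ.toℚᵘ-fromℚᵘ (mkℚᵘ (ℤ.+ n) 0)))
      (ℚᵘ.*≤* (subst₂ ℤ._≤_ (ℤ.pos-* n 1) (ℤ.pos-* n (suc d))
        (ℤ.+≤+ (ℕ.*-monoʳ-≤ n (ℕ.s≤s ℕ.z≤n))))))
  archimedean p@(ℚ.mkℚ (ℤ.-[1+ n ]) d c) = 0 , <⇒≤ (ℚ.negative⁻¹ p)

  -- Bernoulli's inequality, with x = 1/(1 + h).
  inv^-bound : ∀ {x h} n → 0ℚ ≤ x → 0ℚ ≤ h → x * (1ℚ + h) ≤ 1ℚ → x ^ n * (1ℚ + ι n * h) ≤ 1ℚ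
  inv^-bound {x} {h} zero 0≤x 0≤h hx = ℚ.≤-reflexive (lem h)
    where
    lem : ∀ h → 1ℚ * (1ℚ + 0ℚ * h) ≡ 1ℚ
    lem = solve-∀ ℚ-ring
  inv^-bound {x} {h} (suc n) 0≤x 0≤h hx = begin
    x * x ^ n * (1ℚ + ι (suc n) * h)
      ≡⟨ cong (λ t → x * x ^ n * (1ℚ + t * h)) (ι-suc n) ⟩
    x * x ^ n * (1ℚ + (1ℚ + ι n) * h)
      ≤⟨ ≤-by (x * x ^ n * (h * (ι n * h))) ((0≤x 0* 0≤^ n 0≤x) 0* (0≤h 0* (0≤ι n 0* 0≤h)))
           (lem x (x ^ n) h (ι n)) ⟩
    (x * (1ℚ + h)) * (x ^ n * (1ℚ + ι n * h))
      ≤⟨ *≤* (0≤x 0* (0≤1 0+ 0≤h)) 0≤1 hx (inv^-bound n 0≤x 0≤h hx) ⟩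
    1ℚ ∎
    where
    open ℚ.≤-Reasoning
    lem : ∀ x y h n → (x * (1ℚ + h)) * (y * (1ℚ + n * h)) ≡ x * y * (1ℚ + (1ℚ + n) * h) + x * y * (h * (n * h))
    lem = solve-∀ ℚ-ring

  -- With h = 1 - x one has x (1 + h) = 1 - h² ≤ 1, so Bernoulli's inequality bounds xᴺ by 1 / (1 +
  -- N h), and any N ≥ 1 / (ε h) is large enough.
  ^→0 : ∀ {x} → 0ℚ ≤ x → x < 1ℚ → ∀ ε → 0ℚ < ε → ∃[ N ] ∀ n → N ℕ.≤ n → x ^ n ≤ ε
  ^→0 {x} 0≤x x<1 ε 0<ε = N , λ n N≤n → ≤-trans (^-anti 0≤x (<⇒≤ x<1) N≤n) small
    where
    h = 1ℚ - x
    0<h : 0ℚ < h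
    0<h = 0<q-p x<1
    N = proj₁ (archimedean (inv (ε * h)))
    N≥ = proj₂ (archimedean (inv (ε * h)))
    x[1+h]≤1 : x * (1ℚ + h) ≤ 1ℚ
    x[1+h]≤1 = ≤-by (h * h) (<⇒≤ 0<h 0* <⇒≤ 0<h) (lem x)
      where
      lem : ∀ x → 1ℚ ≡ x * (1ℚ + (1ℚ - x)) + (1ℚ - x) * (1ℚ - x)
      lem = solve-∀ ℚ-ring
    open ℚ.≤-Reasoning
    small : x ^ N ≤ ε
    small = begin
      x ^ N ≡⟨ ℚ.*-identityʳ _ ⟨
      x ^ N * 1ℚ ≡⟨ cong (x ^ N *_) (*-inv (pos* 0<ε 0<h)) ⟨
      x ^ N * (ε * h * inv (ε * h))
        ≤⟨ *≤ (x ^ N) (0≤^ N 0≤x) (*≤ (ε * h) (<⇒≤ (pos* 0<ε 0<h)) N≥) ⟩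
      x ^ N * (ε * h * ι N)
        ≤⟨ ≤-by (ε * x ^ N) (<⇒≤ 0<ε 0* 0≤^ N 0≤x) (lem (x ^ N) ε h (ι N)) ⟩
      ε * (x ^ N * (1ℚ + ι N * h))
        ≤⟨ *≤ ε (<⇒≤ 0<ε) (inv^-bound N 0≤x (<⇒≤ 0<h) x[1+h]≤1) ⟩
      ε * 1ℚ ≡⟨ ℚ.*-identityʳ ε ⟩
      ε ∎
      where
      lem : ∀ y e h n → e * (y * (1ℚ + n * h)) ≡ y * (e * h * n) + e * y
      lem = solve-∀ ℚ-ring

-- Power series as sequences: convolution, shifts, fixed points and exponentials.

module Sums where

  open import Data.Nat as ℕ using (ℕ; zero; suc; z≤n; s≤s)
  import Data.Nat.Properties as ℕ
  open import Data.Rational as ℚ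
    using (ℚ; 0ℚ; 1ℚ; _+_; _*_; _≤_; _<_)
  open import Data.Rational.Properties as ℚ using (≤-refl; ≤-trans; <⇒≤)
  open import Function using (_∘_)
  open import Relation.Binary.PropositionalEquality
  open import Tactic.RingSolver using (solve-∀)
  open import Defs using (pos*)
  open Rationals

  Seq : Set
  Seq = ℕ → ℚ

  ∑ : Seq → Seq
  ∑ f zero    = f 0
  ∑ f (suc m) = ∑ f m + f (suc m)

  infixl 7 _⋆_

  -- The Cauchy product of power series. The recursion peels off the head of the first factor, so no
  -- truncated subtraction occurs.
  _⋆_ : Seq → Seq → Seq
  (x ⋆ y) zero    = x 0 * y 0
  (x ⋆ y) (suc m) = x 0 * y (suc m) + (x ∘ suc ⋆ y) m

  δ : Seq
  δ zero    = 1ℚ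
  δ (suc _) = 0ℚ

  𝟙 : Seq
  𝟙 _ = 1ℚ

  ∑-cong : ∀ {f g} m → (∀ i → i ℕ.≤ m → f i ≡ g i) → ∑ f m ≡ ∑ g m
  ∑-cong zero    h = h 0 z≤n
  ∑-cong (suc m) h = cong₂ _+_ (∑-cong m (λ i i≤m → h i (ℕ.m≤n⇒m≤1+n i≤m))) (h (suc m) ℕ.≤-refl)

  ∑-mono : ∀ {f g} m → (∀ i → i ℕ.≤ m → f i ≤ g i) → ∑ f m ≤ ∑ g m
  ∑-mono zero    h = h 0 z≤n
  ∑-mono (suc m) h = ∑-mono m (λ i i≤m → h i (ℕ.m≤n⇒m≤1+n i≤m)) +≤+ h (suc m) ℕ.≤-refl

  ∑-≥0 : ∀ {f} m → (∀ i → 0ℚ ≤ f i) → 0ℚ ≤ ∑ f m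
  ∑-≥0 zero    h = h 0
  ∑-≥0 (suc m) h = ∑-≥0 m h 0+ h (suc m)

  ∑-+ : ∀ f g m → ∑ (λ i → f i + g i) m ≡ ∑ f m + ∑ g m
  ∑-+ f g zero    = refl
  ∑-+ f g (suc m) = trans (cong (_+ (f (suc m) + g (suc m))) (∑-+ f g m))
    (lem (∑ f m) (∑ g m) (f (suc m)) (g (suc m)))
    where
    lem : ∀ a b c d → a + b + (c + d) ≡ a + c + (b + d)
    lem = solve-∀ ℚ-ring

  ∑-*ˡ : ∀ c f m → ∑ (λ i → c * f i) m ≡ c * ∑ f m
  ∑-*ˡ c f zero    = refl
  ∑-*ˡ c f (suc m) = trans (cong (_+ c * f (suc m)) (∑-*ˡ c f m))
    (sym (ℚ.*-distribˡ-+ c (∑ f m) (f (suc m))))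

  ∑-mono-index : ∀ {f m n} → (∀ i → 0ℚ ≤ f i) → m ℕ.≤ n → ∑ f m ≤ ∑ f n
  ∑-mono-index {f} 0≤f m≤n = go (ℕ.≤⇒≤′ m≤n)
    where
    go : ∀ {m n} → m ℕ.≤′ n → ∑ f m ≤ ∑ f n
    go ℕ.≤′-refl          = ≤-refl
    go (ℕ.≤′-step m≤′n) = ≤-trans (go m≤′n) (p≤p+q (0≤f _))

  term≤∑ : ∀ {f} m → (∀ i → 0ℚ ≤ f i) → f m ≤ ∑ f m
  term≤∑ zero    0≤f = ≤-refl
  term≤∑ (suc m) 0≤f = p≤q+p (∑-≥0 m 0≤f)

  ∑-head : ∀ f m → ∑ f (suc m) ≡ f 0 + ∑ (f ∘ suc) m
  ∑-head f zero    = refl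
  ∑-head f (suc m) = trans (cong (_+ f (2 ℕ.+ m)) (∑-head f m)) (ℚ.+-assoc (f 0) _ _)

  ⋆-cong : ∀ {x x′ y y′} m → (∀ i → i ℕ.≤ m → x i ≡ x′ i) → (∀ i → i ℕ.≤ m → y i ≡ y′ i) →
    (x ⋆ y) m ≡ (x′ ⋆ y′) m
  ⋆-cong zero    hx hy = cong₂ _*_ (hx 0 z≤n) (hy 0 z≤n)
  ⋆-cong (suc m) hx hy = cong₂ _+_ (cong₂ _*_ (hx 0 z≤n) (hy (suc m) ℕ.≤-refl))
    (⋆-cong m (λ i i≤m → hx (suc i) (s≤s i≤m)) (λ i i≤m → hy i (ℕ.m≤n⇒m≤1+n i≤m)))

  ⋆-congˡ : ∀ {x x′} y m → (∀ i → x i ≡ x′ i) → (x ⋆ y) m ≡ (x′ ⋆ y) m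
  ⋆-congˡ y m h = ⋆-cong {y = y} m (λ i _ → h i) (λ _ _ → refl)

  ⋆-congʳ : ∀ x {y y′} m → (∀ i → y i ≡ y′ i) → (x ⋆ y) m ≡ (x ⋆ y′) m
  ⋆-congʳ x m h = ⋆-cong {x = x} m (λ _ _ → refl) (λ i _ → h i)

  ⋆-mono : ∀ {x x′ y y′} m → (∀ i → 0ℚ ≤ x i) → (∀ i → 0ℚ ≤ y′ i) →
    (∀ i → i ℕ.≤ m → x i ≤ x′ i) → (∀ i → i ℕ.≤ m → y i ≤ y′ i) → (x ⋆ y) m ≤ (x′ ⋆ y′) m
  ⋆-mono zero    0≤x 0≤y′ hx hy = *≤* (0≤x 0) (0≤y′ 0) (hx 0 z≤n) (hy 0 z≤n)
  ⋆-mono (suc m) 0≤x 0≤y′ hx hy =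
    *≤* (0≤x 0) (0≤y′ (suc m)) (hx 0 z≤n) (hy (suc m) ℕ.≤-refl) +≤+
    ⋆-mono m (0≤x ∘ suc) 0≤y′ (λ i i≤m → hx (suc i) (s≤s i≤m)) (λ i i≤m → hy i (ℕ.m≤n⇒m≤1+n i≤m))

  ⋆-≥0 : ∀ {x y} m → (∀ i → 0ℚ ≤ x i) → (∀ i → 0ℚ ≤ y i) → 0ℚ ≤ (x ⋆ y) m
  ⋆-≥0 zero    0≤x 0≤y = 0≤x 0 0* 0≤y 0
  ⋆-≥0 (suc m) 0≤x 0≤y = (0≤x 0 0* 0≤y (suc m)) 0+ ⋆-≥0 m (0≤x ∘ suc) 0≤y

  ⋆-head≤ : ∀ {x y} m → (∀ i → 0ℚ ≤ x i) → (∀ i → 0ℚ ≤ y i) → x 0 * y m ≤ (x ⋆ y) m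
  ⋆-head≤ zero    0≤x 0≤y = ≤-refl
  ⋆-head≤ (suc m) 0≤x 0≤y = p≤p+q (⋆-≥0 m (0≤x ∘ suc) 0≤y)

  ⋆-last : ∀ x y m → (x ⋆ y) (suc m) ≡ (x ⋆ y ∘ suc) m + x (suc m) * y 0
  ⋆-last x y zero    = refl
  ⋆-last x y (suc m) = trans (cong (x 0 * y (2 ℕ.+ m) +_) (⋆-last (x ∘ suc) y m))
    (sym (ℚ.+-assoc (x 0 * y (2 ℕ.+ m)) _ _))

  ⋆-comm : ∀ x y m → (x ⋆ y) m ≡ (y ⋆ x) m
  ⋆-comm x y zero    = ℚ.*-comm (x 0) (y 0)
  ⋆-comm x y (suc m) = begin
    x 0 * y (suc m) + (x ∘ suc ⋆ y) m   ≡⟨ cong₂ _+_ (ℚ.*-comm (x 0) _) (⋆-comm (x ∘ suc) y m) ⟩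
    y (suc m) * x 0 + (y ⋆ x ∘ suc) m   ≡⟨ ℚ.+-comm (y (suc m) * x 0) _ ⟩
    (y ⋆ x ∘ suc) m + y (suc m) * x 0   ≡⟨ ⋆-last y x m ⟨
    (y ⋆ x) (suc m)                     ∎
    where open ≡-Reasoning

  ⋆-+ˡ : ∀ x x′ y m → ((λ i → x i + x′ i) ⋆ y) m ≡ (x ⋆ y) m + (x′ ⋆ y) m
  ⋆-+ˡ x x′ y zero    = ℚ.*-distribʳ-+ (y 0) (x 0) (x′ 0)
  ⋆-+ˡ x x′ y (suc m) = trans (cong ((x 0 + x′ 0) * y (suc m) +_) (⋆-+ˡ (x ∘ suc) (x′ ∘ suc) y m))
    (lem (x 0) (x′ 0) (y (suc m)) _ _)
    where
    lem : ∀ a b c d e → (a + b) * c + (d + e) ≡ a * c + d + (b * c + e)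
    lem = solve-∀ ℚ-ring

  ⋆-*ˡ : ∀ c x y m → ((λ i → c * x i) ⋆ y) m ≡ c * (x ⋆ y) m
  ⋆-*ˡ c x y zero    = ℚ.*-assoc c (x 0) (y 0)
  ⋆-*ˡ c x y (suc m) = trans (cong (c * x 0 * y (suc m) +_) (⋆-*ˡ c (x ∘ suc) y m))
    (lem c (x 0) (y (suc m)) _)
    where
    lem : ∀ a b c d → a * b * c + a * d ≡ a * (b * c + d)
    lem = solve-∀ ℚ-ring

  ⋆-+ʳ : ∀ x y y′ m → (x ⋆ (λ i → y i + y′ i)) m ≡ (x ⋆ y) m + (x ⋆ y′) m
  ⋆-+ʳ x y y′ m = trans (⋆-comm x _ m) (trans (⋆-+ˡ y y′ x m)
    (cong₂ _+_ (⋆-comm y x m) (⋆-comm y′ x m)))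

  ⋆-*ʳ : ∀ c x y m → (x ⋆ (λ i → c * y i)) m ≡ c * (x ⋆ y) m
  ⋆-*ʳ c x y m = trans (⋆-comm x _ m) (trans (⋆-*ˡ c y x m) (cong (c *_) (⋆-comm y x m)))

  ⋆-zeroˡ : ∀ {x} y m → (∀ i → i ℕ.≤ m → x i ≡ 0ℚ) → (x ⋆ y) m ≡ 0ℚ
  ⋆-zeroˡ y zero    h = trans (cong (_* y 0) (h 0 z≤n)) (ℚ.*-zeroˡ (y 0))
  ⋆-zeroˡ y (suc m) h = trans (cong₂ _+_
    (trans (cong (_* y (suc m)) (h 0 z≤n)) (ℚ.*-zeroˡ (y (suc m))))
    (⋆-zeroˡ y m (λ i i≤m → h (suc i) (s≤s i≤m)))) refl

  δ-⋆ : ∀ y m → (δ ⋆ y) m ≡ y m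
  δ-⋆ y zero    = ℚ.*-identityˡ (y 0)
  δ-⋆ y (suc m) = trans (cong₂ _+_ (ℚ.*-identityˡ (y (suc m))) (⋆-zeroˡ y m (λ _ _ → refl)))
    (ℚ.+-identityʳ (y (suc m)))

  𝟙-⋆ : ∀ y m → (𝟙 ⋆ y) m ≡ ∑ y m
  𝟙-⋆ y zero    = ℚ.*-identityˡ (y 0)
  𝟙-⋆ y (suc m) = trans (cong₂ _+_ (ℚ.*-identityˡ (y (suc m))) (𝟙-⋆ y m)) (ℚ.+-comm (y (suc m)) _)

  -- Convolution is linear in its first argument, hence commutes with the sums
  -- ∑ᵢ w(r − i) Aᵢ.
  ⋆-exchange : ∀ (A : ℕ → Seq) w y r m →
    ((λ i → (A i ⋆ y) m) ⋆ w) r ≡ ((λ k → ((λ i → A i k) ⋆ w) r) ⋆ y) m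
  ⋆-exchange A w y zero m = trans (ℚ.*-comm _ (w 0)) (trans (sym (⋆-*ˡ (w 0) (A 0) y m))
    (⋆-congˡ y m (λ i → ℚ.*-comm (w 0) (A 0 i))))
  ⋆-exchange A w y (suc r) m = begin
    (A 0 ⋆ y) m * w (suc r) + ((λ i → (A (suc i) ⋆ y) m) ⋆ w) r
      ≡⟨ cong₂ _+_ (trans (ℚ.*-comm _ (w (suc r))) (sym (⋆-*ˡ (w (suc r)) (A 0) y m)))
           (⋆-exchange (A ∘ suc) w y r m) ⟩
    ((λ k → w (suc r) * A 0 k) ⋆ y) m + ((λ k → ((λ i → A (suc i) k) ⋆ w) r) ⋆ y) m
      ≡⟨ ⋆-+ˡ _ _ y m ⟨
    ((λ k → w (suc r) * A 0 k + ((λ i → A (suc i) k) ⋆ w) r) ⋆ y) m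
      ≡⟨ ⋆-congˡ y m (λ k → cong (_+ ((λ i → A (suc i) k) ⋆ w) r) (ℚ.*-comm (w (suc r)) (A 0 k))) ⟩
    ((λ k → ((λ i → A i k) ⋆ w) (suc r)) ⋆ y) m ∎
    where open ≡-Reasoning

  ⋆-assoc : ∀ x y z m → ((x ⋆ y) ⋆ z) m ≡ (x ⋆ (y ⋆ z)) m
  ⋆-assoc x y z zero    = ℚ.*-assoc (x 0) (y 0) (z 0)
  ⋆-assoc x y z (suc m) = begin
    x 0 * y 0 * z (suc m) + ((λ i → x 0 * y (suc i) + (x ∘ suc ⋆ y) i) ⋆ z) m
      ≡⟨ cong (x 0 * y 0 * z (suc m) +_) (trans (⋆-+ˡ _ _ z m)
           (cong₂ _+_ (⋆-*ˡ (x 0) (y ∘ suc) z m) (⋆-assoc (x ∘ suc) y z m))) ⟩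
    x 0 * y 0 * z (suc m) + (x 0 * (y ∘ suc ⋆ z) m + (x ∘ suc ⋆ (y ⋆ z)) m)
      ≡⟨ lem (x 0) (y 0) (z (suc m)) _ _ ⟩
    x 0 * (y 0 * z (suc m) + (y ∘ suc ⋆ z) m) + (x ∘ suc ⋆ (y ⋆ z)) m ∎
    where
    open ≡-Reasoning
    lem : ∀ a b c d e → a * b * c + (a * d + e) ≡ a * (b * c + d) + e
    lem = solve-∀ ℚ-ring

  ∑-⋆ : ∀ x y m → ∑ (x ⋆ y) m ≡ (∑ x ⋆ y) m
  ∑-⋆ x y m = begin
    ∑ (x ⋆ y) m       ≡⟨ 𝟙-⋆ (x ⋆ y) m ⟨
    (𝟙 ⋆ (x ⋆ y)) m   ≡⟨ ⋆-assoc 𝟙 x y m ⟨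
    ((𝟙 ⋆ x) ⋆ y) m   ≡⟨ ⋆-congˡ y m (𝟙-⋆ x) ⟩
    (∑ x ⋆ y) m       ∎
    where open ≡-Reasoning

  ∑-exchange : ∀ (A : ℕ → Seq) w r m →
    ∑ (λ k → ((λ i → A i k) ⋆ w) r) m ≡ ((λ i → ∑ (A i) m) ⋆ w) r
  ∑-exchange A w r zero    = refl
  ∑-exchange A w r (suc m) = trans (cong (_+ ((λ i → A i (suc m)) ⋆ w) r) (∑-exchange A w r m))
    (sym (⋆-+ˡ _ _ w r))

  -- For rescaling: the substitution z ↦ X z is a ring homomorphism of power series.
  *^-⋆ : ∀ X x y m → (x ⋆ y) m * X ^ m ≡ ((λ i → x i * X ^ i) ⋆ (λ i → y i * X ^ i)) m
  *^-⋆ X x y zero = lem (x 0) (y 0)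
    where
    lem : ∀ a b → a * b * 1ℚ ≡ a * 1ℚ * (b * 1ℚ)
    lem = solve-∀ ℚ-ring
  *^-⋆ X x y (suc m) = begin
    (x 0 * y (suc m) + (x ∘ suc ⋆ y) m) * (X * X ^ m)
      ≡⟨ lem (x 0) (y (suc m)) ((x ∘ suc ⋆ y) m) X (X ^ m) ⟩
    x 0 * 1ℚ * (y (suc m) * (X * X ^ m)) + X * ((x ∘ suc ⋆ y) m * X ^ m)
      ≡⟨ cong (λ t → x 0 * 1ℚ * (y (suc m) * (X * X ^ m)) + X * t) (*^-⋆ X (x ∘ suc) y m) ⟩
    x 0 * 1ℚ * (y (suc m) * (X * X ^ m)) + X * ((λ i → x (suc i) * X ^ i) ⋆ (λ i → y i * X ^ i)) m
      ≡⟨ cong (x 0 * 1ℚ * (y (suc m) * (X * X ^ m)) +_)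
           (trans (sym (⋆-*ˡ X _ _ m)) (⋆-congˡ _ m (λ i → lem′ X (x (suc i)) (X ^ i)))) ⟩
    ((λ i → x i * X ^ i) ⋆ (λ i → y i * X ^ i)) (suc m) ∎
    where
    open ≡-Reasoning
    lem : ∀ a b c X Y → (a * b + c) * (X * Y) ≡ a * 1ℚ * (b * (X * Y)) + X * (c * Y)
    lem = solve-∀ ℚ-ring
    lem′ : ∀ a b c → a * (b * c) ≡ b * (a * c)
    lem′ = solve-∀ ℚ-ring

  -- Multiplication of a power series by zᵏ.
  sh : ℕ → Seq → Seq
  sh zero    x m       = x m
  sh (suc k) x zero    = 0ℚ
  sh (suc k) x (suc m) = sh k x m

  sh-cong : ∀ k {x y} m → (∀ i → i ℕ.≤ m → x i ≡ y i) → sh k x m ≡ sh k y m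
  sh-cong zero    m       h = h m ℕ.≤-refl
  sh-cong (suc k) zero    h = refl
  sh-cong (suc k) (suc m) h = sh-cong k m (λ i i≤m → h i (ℕ.m≤n⇒m≤1+n i≤m))

  -- A positive shift reads only strictly earlier entries, which is what makes the operators on
  -- levels causal.
  sh-cong-< : ∀ k {x y} m → (∀ i → i ℕ.< m → x i ≡ y i) → sh (suc k) x m ≡ sh (suc k) y m
  sh-cong-< k zero    h = refl
  sh-cong-< k (suc m) h = sh-cong k m (λ i i≤m → h i (s≤s i≤m))

  sh-≤ : ∀ k {x C} m → 0ℚ ≤ C → (∀ i → i ℕ.≤ m → x i ≤ C) → sh k x m ≤ C
  sh-≤ zero    m       0≤C h = h m ℕ.≤-refl
  sh-≤ (suc k) zero    0≤C h = 0≤C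
  sh-≤ (suc k) (suc m) 0≤C h = sh-≤ k m 0≤C (λ i i≤m → h i (ℕ.m≤n⇒m≤1+n i≤m))

  sh-≤-< : ∀ k {x C} m → 0ℚ ≤ C → (∀ i → i ℕ.< m → x i ≤ C) → sh (suc k) x m ≤ C
  sh-≤-< k zero    0≤C h = 0≤C
  sh-≤-< k (suc m) 0≤C h = sh-≤ k m 0≤C (λ i i≤m → h i (s≤s i≤m))

  sh-mono : ∀ k {x y} m → (∀ i → i ℕ.≤ m → x i ≤ y i) → sh k x m ≤ sh k y m
  sh-mono zero    m       h = h m ℕ.≤-refl
  sh-mono (suc k) zero    h = ≤-refl
  sh-mono (suc k) (suc m) h = sh-mono k m (λ i i≤m → h i (ℕ.m≤n⇒m≤1+n i≤m))

  sh-mono-< : ∀ k {x y} m → (∀ i → i ℕ.< m → x i ≤ y i) → sh (suc k) x m ≤ sh (suc k) y m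
  sh-mono-< k zero    h = ≤-refl
  sh-mono-< k (suc m) h = sh-mono k m (λ i i≤m → h i (s≤s i≤m))

  sh-≥0 : ∀ k {x} m → (∀ i → 0ℚ ≤ x i) → 0ℚ ≤ sh k x m
  sh-≥0 zero    m       h = h m
  sh-≥0 (suc k) zero    h = ≤-refl
  sh-≥0 (suc k) (suc m) h = sh-≥0 k m h

  sh-⋆ : ∀ k x y m → (sh k x ⋆ y) m ≡ sh k (x ⋆ y) m
  sh-⋆ zero    x y m       = refl
  sh-⋆ (suc k) x y zero    = ℚ.*-zeroˡ (y 0)
  sh-⋆ (suc k) x y (suc m) = trans (cong₂ _+_ (ℚ.*-zeroˡ (y (suc m))) (sh-⋆ k x y m)) (ℚ.+-identityˡ _)

  sh-sh : ∀ k l x m → sh k (sh l x) m ≡ sh (k ℕ.+ l) x m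
  sh-sh zero    l x m       = refl
  sh-sh (suc k) l x zero    = refl
  sh-sh (suc k) l x (suc m) = sh-sh k l x m

  sh-+ : ∀ k x y m → sh k (λ i → x i + y i) m ≡ sh k x m + sh k y m
  sh-+ zero    x y m       = refl
  sh-+ (suc k) x y zero    = refl
  sh-+ (suc k) x y (suc m) = sh-+ k x y m

  sh-* : ∀ k c x m → sh k (λ i → c * x i) m ≡ c * sh k x m
  sh-* zero    c x m       = refl
  sh-* (suc k) c x zero    = sym (ℚ.*-zeroʳ c)
  sh-* (suc k) c x (suc m) = sh-* k c x m

  ∑-sh : ∀ k x m → ∑ (sh k x) m ≡ sh k (∑ x) m
  ∑-sh zero    x m       = refl
  ∑-sh (suc k) x zero    = refl
  ∑-sh (suc k) x (suc m) = trans (∑-head (sh (suc k) x) m)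
    (trans (ℚ.+-identityˡ _) (∑-sh k x m))

  sh-*^ : ∀ k x X m → sh k x m * X ^ m ≡ X ^ k * sh k (λ i → x i * X ^ i) m
  sh-*^ zero    x X m       = sym (ℚ.*-identityˡ _)
  sh-*^ (suc k) x X zero    = trans (ℚ.*-zeroˡ (X ^ 0)) (sym (ℚ.*-zeroʳ (X ^ suc k)))
  sh-*^ (suc k) x X (suc m) = trans (lem (sh k x m) X (X ^ m)) (trans (cong (X *_) (sh-*^ k x X m))
    (sym (ℚ.*-assoc X (X ^ k) _)))
    where
    lem : ∀ a X Y → a * (X * Y) ≡ X * (a * Y)
    lem = solve-∀ ℚ-ring

  sh-diag : ∀ k x m → sh k x (k ℕ.+ m) ≡ x m
  sh-diag zero    x m = refl
  sh-diag (suc k) x m = sh-diag k x m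

  sh-below : ∀ k x m → m ℕ.< k → sh k x m ≡ 0ℚ
  sh-below (suc k) x zero    _         = refl
  sh-below (suc k) x (suc m) (s≤s m<k) = sh-below k x m m<k

  -- Fixed points of operators Ω for which the entries of Ω X at m only depend on
  -- the entries of X below m.

  Family : Set
  Family = ℕ → Seq

  Causal : (Family → Family) → Set
  Causal Ω = ∀ X Y i m → (∀ j k → k ℕ.< m → X j k ≡ Y j k) → Ω X i m ≡ Ω Y i m

  iter : (Family → Family) → ℕ → Family
  iter Ω zero    = λ _ _ → 0ℚ
  iter Ω (suc L) = Ω (iter Ω L)

  -- Each application of a causal operator settles one further entry, so the entries below L no
  -- longer change after L iterations.
  iter-stable : ∀ {Ω} → Causal Ω → ∀ L L′ i m → m ℕ.< L → m ℕ.< L′ → iter Ω L i m ≡ iter Ω L′ i m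
  iter-stable c (suc L) (suc L′) i m (s≤s m≤L) (s≤s m≤L′) = c _ _ i m λ j k k<m →
    iter-stable c L L′ j k (ℕ.<-≤-trans k<m m≤L) (ℕ.<-≤-trans k<m m≤L′)

  opaque
    fix : (Family → Family) → Family
    fix Ω i m = iter Ω (suc m) i m

    fix-unfold : ∀ {Ω} → Causal Ω → ∀ i m → fix Ω i m ≡ Ω (fix Ω) i m
    fix-unfold {Ω} c i m = c (iter Ω m) (fix Ω) i m λ j k k<m →
      iter-stable c m (suc k) j k k<m ℕ.≤-refl

  opaque
    ifac : Seq
    ifac zero    = 1ℚ
    ifac (suc n) = inv (ι (suc n)) * ifac n

    ifac₀ : ifac 0 ≡ 1ℚ
    ifac₀ = refl

    ifac-suc : ∀ n → ifac (suc n) ≡ inv (ι (suc n)) * ifac n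
    ifac-suc n = refl

    0<ifac : ∀ n → 0ℚ < ifac n
    0<ifac zero    = 0<1
    0<ifac (suc n) = pos* (0<inv (0<ι n)) (0<ifac n)

  0≤ifac : ∀ n → 0ℚ ≤ ifac n
  0≤ifac n = <⇒≤ (0<ifac n)

  suc-ifac : ∀ n → ι (suc n) * ifac (suc n) ≡ ifac n
  suc-ifac n = trans (cong (ι (suc n) *_) (ifac-suc n)) (trans (sym (ℚ.*-assoc (ι (suc n)) _ _))
    (trans (cong (_* ifac n) (*-inv (0<ι n))) (ℚ.*-identityˡ (ifac n))))

  -- Leibniz rule for the derivative x ↦ (n ↦ (n + 1) x(n + 1)) of power series.
  ⋆-leibniz : ∀ x y m → ι (suc m) * (x ⋆ y) (suc m) ≡
    ((λ i → ι (suc i) * x (suc i)) ⋆ y) m + (x ⋆ (λ i → ι (suc i) * y (suc i))) m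
  ⋆-leibniz x y zero = lem (x 0) (x 1) (y 0) (y 1)
    where
    lem : ∀ a b c d → 1ℚ * (a * d + b * c) ≡ 1ℚ * b * c + a * (1ℚ * d)
    lem = solve-∀ ℚ-ring
  ⋆-leibniz x y (suc m) = begin
    ι (2 ℕ.+ m) * (x 0 * y (2 ℕ.+ m) + (x ∘ suc ⋆ y) (suc m))
      ≡⟨ lem₁ (x 0) (y (2 ℕ.+ m)) (ι (2 ℕ.+ m)) (ι (suc m)) ((x ∘ suc ⋆ y) (suc m)) (ι-suc (suc m)) ⟩
    x 0 * (ι (2 ℕ.+ m) * y (2 ℕ.+ m)) + ((x ∘ suc ⋆ y) (suc m) + ι (suc m) * (x ∘ suc ⋆ y) (suc m))
      ≡⟨ cong (λ t → x 0 * (ι (2 ℕ.+ m) * y (2 ℕ.+ m)) + ((x ∘ suc ⋆ y) (suc m) + t)) (⋆-leibniz (x ∘ suc) y m) ⟩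
    x 0 * (ι (2 ℕ.+ m) * y (2 ℕ.+ m)) + ((x 1 * y (suc m) + (x ∘ suc ∘ suc ⋆ y) m) + (U + V))
      ≡⟨ lem₂ (x 0 * (ι (2 ℕ.+ m) * y (2 ℕ.+ m))) (x 1) (y (suc m)) _ U V ⟩
    (1ℚ * x 1 * y (suc m) + ((x ∘ suc ∘ suc ⋆ y) m + U)) + (x 0 * (ι (2 ℕ.+ m) * y (2 ℕ.+ m)) + V)
      ≡⟨ cong (λ t → (1ℚ * x 1 * y (suc m) + t) + (x 0 * (ι (2 ℕ.+ m) * y (2 ℕ.+ m)) + V))
           (trans (sym (⋆-+ˡ _ _ y m)) (⋆-congˡ y m λ i → step i)) ⟩
    ((λ i → ι (suc i) * x (suc i)) ⋆ y) (suc m) + (x ⋆ (λ i → ι (suc i) * y (suc i))) (suc m) ∎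
    where
    open ≡-Reasoning
    U = ((λ i → ι (suc i) * x (2 ℕ.+ i)) ⋆ y) m
    V = (x ∘ suc ⋆ (λ i → ι (suc i) * y (suc i))) m
    lem₁ : ∀ a b n n′ c → n ≡ 1ℚ + n′ → n * (a * b + c) ≡ a * (n * b) + (c + n′ * c)
    lem₁ a b n n′ c refl = go a b n′ c
      where
      go : ∀ a b n′ c → (1ℚ + n′) * (a * b + c) ≡ a * ((1ℚ + n′) * b) + (c + n′ * c)
      go = solve-∀ ℚ-ring
    lem₂ : ∀ A b c d U V → A + ((b * c + d) + (U + V)) ≡ (1ℚ * b * c + (d + U)) + (A + V)
    lem₂ = solve-∀ ℚ-ring
    step : ∀ i → x (2 ℕ.+ i) + ι (suc i) * x (2 ℕ.+ i) ≡ ι (2 ℕ.+ i) * x (2 ℕ.+ i)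
    step i = trans (lem₃ (x (2 ℕ.+ i)) (ι (suc i))) (cong (_* x (2 ℕ.+ i)) (sym (ι-suc (suc i))))
      where
      lem₃ : ∀ a n → a + n * a ≡ (1ℚ + n) * a
      lem₃ = solve-∀ ℚ-ring

  exp : ℚ → Seq
  exp y n = y ^ n * ifac n

  exp-deriv : ∀ y n → ι (suc n) * exp y (suc n) ≡ y * exp y n
  exp-deriv y n = trans (lem (ι (suc n)) y (y ^ n) (ifac (suc n))) (cong (λ t → y * (y ^ n * t)) (suc-ifac n))
    where
    lem : ∀ a b c d → a * (b * c * d) ≡ b * (c * (a * d))
    lem = solve-∀ ℚ-ring

  -- The binomial theorem as the identity exp(yz) exp(z) = exp((1 + y)z): by the Leibniz rule the
  -- coefficients of both sides satisfy the same first-order recurrence.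
  exp-⋆-ifac : ∀ y n → (exp y ⋆ ifac) n ≡ exp (1ℚ + y) n
  exp-⋆-ifac y zero    = trans (cong (exp y 0 *_) ifac₀) (ℚ.*-identityʳ _)
  exp-⋆-ifac y (suc n) = ℚ.≤-antisym (cancel (ℚ.≤-reflexive eq)) (cancel (ℚ.≤-reflexive (sym eq)))
    where
    cancel : ∀ {p q} → ι (suc n) * p ≤ ι (suc n) * q → p ≤ q
    cancel = *-cancel-≤ (ι (suc n)) (0<ι n)
    open ≡-Reasoning
    lem : ∀ y a → y * a + a ≡ (1ℚ + y) * a
    lem = solve-∀ ℚ-ring
    eq : ι (suc n) * (exp y ⋆ ifac) (suc n) ≡ ι (suc n) * exp (1ℚ + y) (suc n)
    eq = begin
      ι (suc n) * (exp y ⋆ ifac) (suc n)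
        ≡⟨ ⋆-leibniz (exp y) ifac n ⟩
      ((λ i → ι (suc i) * exp y (suc i)) ⋆ ifac) n + (exp y ⋆ (λ i → ι (suc i) * ifac (suc i))) n
        ≡⟨ cong₂ _+_ (trans (⋆-congˡ ifac n (exp-deriv y)) (⋆-*ˡ y (exp y) ifac n)) (⋆-congʳ (exp y) n suc-ifac) ⟩
      y * (exp y ⋆ ifac) n + (exp y ⋆ ifac) n   ≡⟨ lem y _ ⟩
      (1ℚ + y) * (exp y ⋆ ifac) n               ≡⟨ cong ((1ℚ + y) *_) (exp-⋆-ifac y n) ⟩
      (1ℚ + y) * exp (1ℚ + y) n                 ≡⟨ exp-deriv (1ℚ + y) n ⟨
      ι (suc n) * exp (1ℚ + y) (suc n)          ∎

-- Renewal equations and the contraction of their ratios.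

module Ratios where

  open import Data.Nat as ℕ using (ℕ; zero; suc; z≤n)
  import Data.Nat.Properties as ℕ
  open import Data.Nat.Induction using (<-rec)
  open import Data.Product using (∃-syntax; _,_)
  open import Data.Rational as ℚ
    using (ℚ; 0ℚ; 1ℚ; _+_; _*_; _-_; -_; _≤_; _<_; ∣_∣)
  open import Data.Rational.Properties as ℚ using (≤-refl; ≤-trans; <⇒≤)
  open import Function using (_∘_)
  open import Relation.Binary.PropositionalEquality
  open import Tactic.RingSolver using (solve-∀)
  open import Defs using (pos*; ∣p-q∣≡∣q-p∣)
  open Rationals
  open Sums

  ∣⋆∣≤ : ∀ {x y z} m → (∀ i → 0ℚ ≤ x i) → (∀ i → i ℕ.≤ m → ∣ y i ∣ ≤ z i) →
    ∣ (x ⋆ y) m ∣ ≤ (x ⋆ z) m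
  ∣⋆∣≤ {x} zero    0≤x h = ∣p*q∣≤ {x 0} (ℚ.≤-reflexive (ℚ.0≤p⇒∣p∣≡p (0≤x 0))) (h 0 z≤n)
  ∣⋆∣≤ {x} {y} (suc m) 0≤x h = ∣p+q∣≤ {x 0 * y (suc m)}
    (∣p*q∣≤ {x 0} (ℚ.≤-reflexive (ℚ.0≤p⇒∣p∣≡p (0≤x 0))) (h (suc m) ℕ.≤-refl))
    (∣⋆∣≤ m (0≤x ∘ suc) (λ i i≤m → h i (ℕ.m≤n⇒m≤1+n i≤m)))

  ⋆-reversed : ∀ x h m → (x ⋆ (λ j → h (m ℕ.∸ j))) m ≡ ∑ (λ k → x k * h k) m
  ⋆-reversed x h zero    = refl
  ⋆-reversed x h (suc m) = begin
    x 0 * h (suc m ℕ.∸ suc m) + (x ∘ suc ⋆ (λ j → h (suc m ℕ.∸ j))) m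
      ≡⟨ cong₂ (λ a b → x 0 * h a + b) (ℕ.n∸n≡0 m)
           (⋆-cong {x ∘ suc} m (λ _ _ → refl) (λ j j≤m → cong h (ℕ.+-∸-assoc 1 j≤m))) ⟩
    x 0 * h 0 + (x ∘ suc ⋆ (λ j → h (suc (m ℕ.∸ j)))) m
      ≡⟨ cong (x 0 * h 0 +_) (⋆-reversed (x ∘ suc) (h ∘ suc) m) ⟩
    x 0 * h 0 + ∑ (λ k → x (suc k) * h (suc k)) m
      ≡⟨ ∑-head (λ k → x k * h k) m ⟨
    ∑ (λ k → x k * h k) (suc m) ∎
    where open ≡-Reasoning

  Renewal : Seq → Seq → Seq → Set
  Renewal f g y = ∀ m → y (suc m) ≡ g m + (f ⋆ y) m

  ratio : Seq → Seq
  ratio y m = y (suc m) * inv (y m)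

  ratio-* : ∀ {y} m → 0ℚ < y m → ratio y m * y m ≡ y (suc m)
  ratio-* {y} m 0<ym = trans (lem (y (suc m)) (inv (y m)) (y m))
    (trans (cong (y (suc m) *_) (*-inv 0<ym)) (ℚ.*-identityʳ _))
    where
    lem : ∀ a b c → a * b * c ≡ a * (c * b)
    lem = solve-∀ ℚ-ring

  -- The equation survives dropping y 0: the last term f(m + 1) y(0) of the convolution joins the
  -- inhomogeneous part.
  Renewal-suc : ∀ {f g y} → Renewal f g y →
    Renewal f (λ m → g (suc m) + f (suc m) * y 0) (y ∘ suc)
  Renewal-suc {f} {g} {y} r m = trans (r (suc m)) (trans (cong (g (suc m) +_) (⋆-last f y m))
    (lem (g (suc m)) _ _))
    where
    lem : ∀ a b c → a + (b + c) ≡ a + c + b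
    lem = solve-∀ ℚ-ring

  -- R = ratio y is an average of its own past with weights fₖ y(i − k) / y(i + 1),
  -- so each increment of R is a linear combination of earlier increments. The
  -- condition on θ makes that combination a contraction for the weights κⁱ.
  module Contraction
    (f g y : Seq) (A B μ ξ θ : ℚ)
    (0≤f : ∀ i → 0ℚ ≤ f i) (0≤g : ∀ i → 0ℚ ≤ g i) (0<y : ∀ i → 0ℚ < y i)
    (renewal : Renewal f g y)
    (f≤A : ∀ i → f i ≤ A) (g≤A : ∀ i → g i ≤ A)
    (y-upper : ∀ m → y (suc m) ≤ B * y m) (y-lower : ∀ m → y m ≤ μ * y (suc m))
    (0<μ : 0ℚ < μ) (μ<ξ : μ < ξ) (ξ≤1 : ξ ≤ 1ℚ) (θ<1 : θ < 1ℚ)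
    (mean : ∀ m → ∑ (λ k → f k * (ι k * ξ ^ suc k)) m ≤ θ)
    where

    private
      0<ξ : 0ℚ < ξ
      0<ξ = ℚ.<-trans 0<μ μ<ξ

      0≤A : 0ℚ ≤ A
      0≤A = ≤-trans (0≤f 0) (f≤A 0)

      0≤y : ∀ i → 0ℚ ≤ y i
      0≤y i = <⇒≤ (0<y i)

      R : Seq
      R = ratio y

      0≤R : ∀ i → 0ℚ ≤ R i
      0≤R i = 0≤y (suc i) 0* 0≤inv (0<y i)

      R≤B : ∀ i → R i ≤ B
      R≤B i = ≤≡ (≤* (inv (y i)) (0≤inv (0<y i)) (y-upper i))
        (trans (ℚ.*-assoc B (y i) _) (trans (cong (B *_) (*-inv (0<y i))) (ℚ.*-identityʳ B)))

    -- In `Z-bound`, with j + k = i, differences of ratios are of order κʲ, and y j is at most μᵏ⁺¹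
    -- y(i + 1). Since μ = ξ κ, the powers combine to ξᵏ⁺¹ κⁱ⁺¹: part of the growth of y pays for
    -- the age of the increments, and the rest stays in `mean`.
    κ : ℚ
    κ = μ * inv ξ

    0<κ : 0ℚ < κ
    0<κ = pos* 0<μ (0<inv 0<ξ)

    ξκ≡μ : ξ * κ ≡ μ
    ξκ≡μ = trans (lem ξ μ (inv ξ)) (trans (cong (μ *_) (*-inv 0<ξ)) (ℚ.*-identityʳ μ))
      where
      lem : ∀ a b c → a * (b * c) ≡ b * (a * c)
      lem = solve-∀ ℚ-ring

    κ<1 : κ < 1ℚ
    κ<1 = subst₂ _<_ (ℚ.*-comm (inv ξ) μ) (trans (ℚ.*-comm (inv ξ) ξ) (*-inv 0<ξ)) (*<* (inv ξ) (0<inv 0<ξ) μ<ξ)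

    private
      0≤κ : 0ℚ ≤ κ
      0≤κ = <⇒≤ 0<κ

      0≤κ^ : ∀ n → 0ℚ ≤ κ ^ n
      0≤κ^ n = 0≤^ n 0≤κ

      μ≤κ : μ ≤ κ
      μ≤κ = ≡≤ (sym ξκ≡μ) (≤≡ (≤* κ 0≤κ ξ≤1) (ℚ.*-identityˡ κ))

      y-growth : ∀ j k → y j ≤ μ ^ k * y (j ℕ.+ k)
      y-growth j zero    = ℚ.≤-reflexive (trans (cong y (sym (ℕ.+-identityʳ j))) (sym (ℚ.*-identityˡ _)))
      y-growth j (suc k) = ≤-trans (y-growth j k)
        (≤≡ (*≤ (μ ^ k) (0≤^ k (<⇒≤ 0<μ)) (y-lower (j ℕ.+ k)))
          (trans (lem (μ ^ k) μ (y (suc (j ℕ.+ k)))) (cong (λ n → μ * μ ^ k * y n) (sym (ℕ.+-suc j k)))))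
        where
        lem : ∀ a b c → a * (b * c) ≡ b * a * c
        lem = solve-∀ ℚ-ring

      -- A′ bounds the defect, E measures it in units of y 0, and D solves E + D θ = D: it is the
      -- constant that the induction in `increments` reproduces.
      A′ E D : ℚ
      A′ = A + A * y 0 + B * A
      E  = A′ * inv (y 0)
      D  = E * inv (1ℚ - θ)

      0≤B : 0ℚ ≤ B
      0≤B = ≤-trans (0≤R 0) (R≤B 0)

      0≤A′ : 0ℚ ≤ A′
      0≤A′ = 0≤A 0+ (0≤A 0* 0≤y 0) 0+ (0≤B 0* 0≤A)

      0≤E : 0ℚ ≤ E
      0≤E = 0≤A′ 0* 0≤inv (0<y 0)

      0≤D : 0ℚ ≤ D
      0≤D = 0≤E 0* 0≤inv (0<q-p θ<1)

      E+Dθ≡D : E + D * θ ≡ D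
      E+Dθ≡D = trans (cong (_+ D * θ) (sym (trans (lem E (inv (1ℚ - θ)) (1ℚ - θ))
        (trans (cong (E *_) (*-inv (0<q-p θ<1))) (ℚ.*-identityʳ E))))) (lem′ D θ)
        where
        lem : ∀ a b c → a * b * c ≡ a * (c * b)
        lem = solve-∀ ℚ-ring
        lem′ : ∀ d t → d * (1ℚ - t) + d * t ≡ d
        lem′ = solve-∀ ℚ-ring

      Z : ℕ → Seq
      Z i j = y (suc j) - R i * y j

      defect : ℕ → ℚ
      defect i = g (suc i) + f (suc i) * y 0 - R i * g i

      -- The renewal equation for y(i + 2) minus R i times that for y(i + 1). The entries Z i j = (R
      -- j - R i) y j of the remaining convolution involve only differences of earlier ratios.
      identity : ∀ i → (R (suc i) - R i) * y (suc i) ≡ defect i + (f ⋆ Z i) i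
      identity i = begin
        (R (suc i) - R i) * y (suc i)
          ≡⟨ lem₁ (R (suc i)) (R i) (y (suc i)) ⟩
        R (suc i) * y (suc i) - R i * y (suc i)
          ≡⟨ cong₂ (λ a b → a - R i * b) (trans (ratio-* {y} (suc i) (0<y (suc i))) (Renewal-suc {f} {g} {y} renewal i)) (renewal i) ⟩
        (g (suc i) + f (suc i) * y 0 + (f ⋆ y ∘ suc) i) - R i * (g i + (f ⋆ y) i)
          ≡⟨ lem₂ (g (suc i) + f (suc i) * y 0) ((f ⋆ y ∘ suc) i) (R i) (g i) ((f ⋆ y) i) ⟩
        defect i + ((f ⋆ y ∘ suc) i + - R i * (f ⋆ y) i)
          ≡⟨ cong (defect i +_) (trans (cong ((f ⋆ y ∘ suc) i +_) (sym (⋆-*ʳ (- R i) f y i)))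
               (trans (sym (⋆-+ʳ f _ _ i)) (⋆-congʳ f i (λ j → lem₃ (y (suc j)) (R i) (y j))))) ⟩
        defect i + (f ⋆ Z i) i ∎
        where
        open ≡-Reasoning
        lem₁ : ∀ a b c → (a - b) * c ≡ a * c - b * c
        lem₁ = solve-∀ ℚ-ring
        lem₂ : ∀ a b r c d → (a + b) - r * (c + d) ≡ a - r * c + (b + - r * d)
        lem₂ = solve-∀ ℚ-ring
        lem₃ : ∀ a r b → a + - r * b ≡ a - r * b
        lem₃ = solve-∀ ℚ-ring

      -- The defect stays bounded, while y(i + 1) exceeds y 0 at least by the factor 1/μⁱ⁺¹, and μ ≤
      -- κ.
      defect-bound : ∀ i → ∣ defect i ∣ ≤ E * κ ^ i * y (suc i)
      defect-bound i = begin
        ∣ defect i ∣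
          ≤⟨ ∣p+q∣≤ {g (suc i) + f (suc i) * y 0}
               (≡≤ (ℚ.0≤p⇒∣p∣≡p (0≤g (suc i) 0+ (0≤f (suc i) 0* 0≤y 0)))
                 (g≤A (suc i) +≤+ ≤* (y 0) (0≤y 0) (f≤A (suc i))))
               (≡≤ (trans (ℚ.∣-p∣≡∣p∣ (R i * g i)) (ℚ.0≤p⇒∣p∣≡p (0≤R i 0* 0≤g i)))
                 (*≤* (0≤R i) 0≤A (R≤B i) (g≤A i))) ⟩
        A′
          ≡⟨ trans (sym (ℚ.*-identityʳ A′)) (trans (cong (A′ *_) (sym (*-inv (0<y 0)))) (lem A′ (y 0) (inv (y 0)))) ⟩
        E * y 0
          ≤⟨ *≤ E 0≤E (y-growth 0 (suc i)) ⟩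
        E * (μ ^ suc i * y (suc i))
          ≤⟨ *≤ E 0≤E (≤* (y (suc i)) (0≤y (suc i)) (≤-trans (^-mono (suc i) (<⇒≤ 0<μ) μ≤κ)
               (^-anti 0≤κ (<⇒≤ κ<1) (ℕ.n≤1+n i)))) ⟩
        E * (κ ^ i * y (suc i))
          ≡⟨ ℚ.*-assoc E (κ ^ i) (y (suc i)) ⟨
        E * κ ^ i * y (suc i) ∎
        where
        open ℚ.≤-Reasoning
        lem : ∀ a b c → a * (b * c) ≡ a * c * b
        lem = solve-∀ ℚ-ring

      Increments : ℕ → Set
      Increments i = ∣ R (suc i) - R i ∣ ≤ D * κ ^ i

      differences : ∀ j k → (∀ l → l ℕ.< j ℕ.+ k → Increments l) →
        ∣ R (j ℕ.+ k) - R j ∣ ≤ D * ι k * κ ^ j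
      differences j zero h rewrite ℕ.+-identityʳ j = ≡≤ (cong ∣_∣ (ℚ.+-inverseʳ (R j)))
        (0≤D 0* 0≤ι 0 0* 0≤κ^ j)
      differences j (suc k) h rewrite ℕ.+-suc j k = begin
        ∣ R (suc (j ℕ.+ k)) - R j ∣
          ≤⟨ ∣p-r∣≤ (R (suc (j ℕ.+ k))) (R (j ℕ.+ k)) (R j) ⟩
        ∣ R (suc (j ℕ.+ k)) - R (j ℕ.+ k) ∣ + ∣ R (j ℕ.+ k) - R j ∣
          ≤⟨ h (j ℕ.+ k) ℕ.≤-refl +≤+ differences j k (λ l l< → h l (ℕ.m≤n⇒m≤1+n l<)) ⟩
        D * κ ^ (j ℕ.+ k) + D * ι k * κ ^ j
          ≤⟨ *≤ D 0≤D (^-anti 0≤κ (<⇒≤ κ<1) (ℕ.m≤m+n j k)) +≤+ ≤-refl ⟩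
        D * κ ^ j + D * ι k * κ ^ j
          ≡⟨ trans (lem D (κ ^ j) (ι k)) (cong (λ t → D * t * κ ^ j) (sym (ι-suc k))) ⟩
        D * ι (suc k) * κ ^ j ∎
        where
        open ℚ.≤-Reasoning
        lem : ∀ d x k → d * x + d * k * x ≡ d * (1ℚ + k) * x
        lem = solve-∀ ℚ-ring

      -- The factor k counts the increments between R j and R(j + k); the power of ξ is what is left
      -- of μᵏ⁺¹ after κᵏ⁺¹ has been extracted.
      weight : ℕ → ℚ
      weight k = ι k * ξ ^ suc k

      Z-bound : ∀ j k → (∀ l → l ℕ.< j ℕ.+ k → Increments l) →
        ∣ Z (j ℕ.+ k) j ∣ ≤ D * κ ^ suc (j ℕ.+ k) * y (suc (j ℕ.+ k)) * weight k
      Z-bound j k h = begin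
        ∣ y (suc j) - R (j ℕ.+ k) * y j ∣
          ≡⟨ cong ∣_∣ (trans (cong (_- R (j ℕ.+ k) * y j) (sym (ratio-* {y} j (0<y j))))
               (lem₁ (R j) (y j) (R (j ℕ.+ k)))) ⟩
        ∣ (R j - R (j ℕ.+ k)) * y j ∣
          ≤⟨ ∣p*q∣≤ {R j - R (j ℕ.+ k)} (≡≤ (∣p-q∣≡∣q-p∣ (R j) (R (j ℕ.+ k))) (differences j k h))
               (≡≤ (ℚ.0≤p⇒∣p∣≡p (0≤y j)) (≤≡ (y-growth j (suc k)) (cong (λ n → μ ^ suc k * y n) (ℕ.+-suc j k)))) ⟩
        D * ι k * κ ^ j * (μ ^ suc k * y (suc (j ℕ.+ k)))
          ≡⟨ cong (λ t → D * ι k * κ ^ j * (t * y (suc (j ℕ.+ k)))) (trans (cong (_^ suc k) (sym ξκ≡μ)) (*-^ ξ κ (suc k))) ⟩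
        D * ι k * κ ^ j * (ξ ^ suc k * κ ^ suc k * y (suc (j ℕ.+ k)))
          ≡⟨ lem₂ D (ι k) (κ ^ j) (ξ ^ suc k) (κ ^ suc k) (y (suc (j ℕ.+ k))) ⟩
        D * (κ ^ j * κ ^ suc k) * y (suc (j ℕ.+ k)) * weight k
          ≡⟨ cong (λ t → D * t * y (suc (j ℕ.+ k)) * weight k) (trans (sym (^-+ κ j (suc k))) (cong (κ ^_) (ℕ.+-suc j k))) ⟩
        D * κ ^ suc (j ℕ.+ k) * y (suc (j ℕ.+ k)) * weight k ∎
        where
        open ℚ.≤-Reasoning
        lem₁ : ∀ a b c → a * b - c * b ≡ (a - c) * b
        lem₁ = solve-∀ ℚ-ring
        lem₂ : ∀ d i x e z w → d * i * x * (e * z * w) ≡ d * (x * z) * w * (i * e)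
        lem₂ = solve-∀ ℚ-ring

      sum-bound : ∀ i → (∀ l → l ℕ.< i → Increments l) →
        ∣ (f ⋆ Z i) i ∣ ≤ D * θ * κ ^ i * y (suc i)
      sum-bound i h = begin
        ∣ (f ⋆ Z i) i ∣
          ≤⟨ ∣⋆∣≤ i 0≤f Z≤ ⟩
        (f ⋆ (λ j → c * weight (i ℕ.∸ j))) i
          ≡⟨ ⋆-*ʳ c f _ i ⟩
        c * (f ⋆ (λ j → weight (i ℕ.∸ j))) i
          ≡⟨ cong (c *_) (⋆-reversed f weight i) ⟩
        c * ∑ (λ k → f k * weight k) i
          ≤⟨ *≤ c 0≤c (mean i) ⟩
        D * κ ^ suc i * y (suc i) * θ
          ≡⟨ lem D (κ ^ suc i) (y (suc i)) θ ⟩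
        D * θ * y (suc i) * κ ^ suc i
          ≤⟨ *≤ (D * θ * y (suc i)) (0≤D 0* 0≤θ 0* 0≤y (suc i)) (^-anti 0≤κ (<⇒≤ κ<1) (ℕ.n≤1+n i)) ⟩
        D * θ * y (suc i) * κ ^ i
          ≡⟨ lem′ D θ (y (suc i)) (κ ^ i) ⟩
        D * θ * κ ^ i * y (suc i) ∎
        where
        open ℚ.≤-Reasoning
        c = D * κ ^ suc i * y (suc i)
        0≤c : 0ℚ ≤ c
        0≤c = 0≤D 0* 0≤κ^ (suc i) 0* 0≤y (suc i)
        0≤θ : 0ℚ ≤ θ
        0≤θ = ≤-trans (∑-≥0 0 (λ k → 0≤f k 0* (0≤ι k 0* 0≤^ (suc k) (<⇒≤ 0<ξ)))) (mean 0)
        lem : ∀ a b c d → a * b * c * d ≡ a * d * c * b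
        lem = solve-∀ ℚ-ring
        lem′ : ∀ a b c d → a * b * c * d ≡ a * b * d * c
        lem′ = solve-∀ ℚ-ring
        Z≤ : ∀ j → j ℕ.≤ i → ∣ Z i j ∣ ≤ c * weight (i ℕ.∸ j)
        Z≤ j j≤i = subst (λ n → ∣ Z n j ∣ ≤ D * κ ^ suc n * y (suc n) * weight (i ℕ.∸ j)) i≡
          (Z-bound j (i ℕ.∸ j) (λ l l< → h l (subst (l ℕ.<_) i≡ l<)))
          where i≡ = ℕ.m+[n∸m]≡n j≤i

    increments : ∀ i → ∣ R (suc i) - R i ∣ ≤ D * κ ^ i
    increments = <-rec Increments λ i h → *-cancel-≤ (y (suc i)) (0<y (suc i)) (begin
      y (suc i) * ∣ R (suc i) - R i ∣
        ≡⟨ cong (_* ∣ R (suc i) - R i ∣) (ℚ.0≤p⇒∣p∣≡p (0≤y (suc i))) ⟨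
      ∣ y (suc i) ∣ * ∣ R (suc i) - R i ∣
        ≡⟨ trans (sym (ℚ.∣p*q∣≡∣p∣*∣q∣ (y (suc i)) _)) (cong ∣_∣ (trans (ℚ.*-comm (y (suc i)) _) (identity i))) ⟩
      ∣ defect i + (f ⋆ Z i) i ∣
        ≤⟨ ∣p+q∣≤ {defect i} (defect-bound i) (sum-bound i (λ l l<i → h l<i)) ⟩
      E * κ ^ i * y (suc i) + D * θ * κ ^ i * y (suc i)
        ≡⟨ lem E D θ (κ ^ i) (y (suc i)) ⟩
      y (suc i) * ((E + D * θ) * κ ^ i)
        ≡⟨ cong (λ t → y (suc i) * (t * κ ^ i)) E+Dθ≡D ⟩
      y (suc i) * (D * κ ^ i) ∎)
      where
      open ℚ.≤-Reasoning
      lem : ∀ e d t k y → e * k * y + d * t * k * y ≡ y * ((e + d * t) * k)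
      lem = solve-∀ ℚ-ring

    ratio-increments : ∃[ C ] ∀ i → ∣ ratio y (suc i) - ratio y i ∣ ≤ C * κ ^ i
    ratio-increments = D , increments

-- Weights of level sequences and their renewal decomposition.

module Trees where

  open import Data.Nat as ℕ using (ℕ; zero; suc)
  import Data.Nat.Properties as ℕ
  open import Data.Nat.Induction using (<-rec)
  open import Data.Rational as ℚ
    using (ℚ; 0ℚ; 1ℚ; _+_; _*_; _≤_; _<_)
  open import Data.Rational.Properties as ℚ using (≤-refl; ≤-trans)
  open import Relation.Binary.PropositionalEquality
  open import Tactic.RingSolver using (solve-∀)
  open Rationals
  open Sums
  open Ratios

  sh-suc : ∀ k x m → sh k (sh 1 x) m ≡ sh (suc k) x m
  sh-suc zero    x m       = refl
  sh-suc (suc k) x zero    = refl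
  sh-suc (suc k) x (suc m) = sh-suc k x m

  -- Throughout, b = β + 2.
  module _ (β : ℕ) where

    private
      b : ℕ
      b = suc (suc β)

    -- The case 0 is fixed to δ because an unshifted X 0 would make the operator read the very entry
    -- that it defines; `D₀` recovers the uniform formula.
    below : Family → Family
    below X zero    = δ
    below X (suc i) = sh (suc i) (X (suc i))

    DΩ : Family → Family
    DΩ X i m = ((λ j → below X j m) ⋆ ifac) (i ℕ.* b)

    DΩ-causal : Causal DΩ
    DΩ-causal X Y i m h = ⋆-congˡ ifac (i ℕ.* b) λ where
      zero    → refl
      (suc j) → sh-cong-< j m (h (suc j))

    -- D i m is the total weight of the ways to continue a level with i internal
    -- nodes by levels with m internal nodes in all; a level with r nodes of which
    -- j are internal has weight 1/(r − j)!.
    D : Family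
    D = fix DΩ

    D₀ : ∀ m → D 0 m ≡ δ m
    D₀ m = trans (fix-unfold DΩ-causal 0 m) (trans (cong (δ m *_) ifac₀) (ℚ.*-identityʳ (δ m)))

    -- As C i m, but starting from a level with r nodes.
    C : Family
    C r m = ((λ i → sh i (D i) m) ⋆ ifac) r

    D≡C : ∀ i m → D i m ≡ C (i ℕ.* b) m
    D≡C i m = trans (fix-unfold DΩ-causal i m) (⋆-congˡ ifac (i ℕ.* b) λ where
      zero    → sym (D₀ m)
      (suc j) → refl)

    c : Seq
    c = C 1

    ifac₁ : ifac 1 ≡ 1ℚ
    ifac₁ = trans (sym (ℚ.*-identityˡ (ifac 1))) (trans (suc-ifac 0) ifac₀)

    c-unfold : ∀ m → c m ≡ δ m + sh 1 (D 1) m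
    c-unfold m = cong₂ _+_ (trans (cong₂ _*_ (D₀ m) ifac₁) (ℚ.*-identityʳ (δ m)))
      (trans (cong (sh 1 (D 1) m *_) ifac₀) (ℚ.*-identityʳ _))

    c₀ : c 0 ≡ 1ℚ
    c₀ = c-unfold 0

    c-suc : ∀ m → c (suc m) ≡ D 1 m
    c-suc m = trans (c-unfold (suc m)) (ℚ.+-identityˡ (D 1 m))

    -- The part of a level's weight in which at least two nodes are internal: the summation index j
    -- stands for j + 2 internal nodes, so k is the number of nodes minus 2.
    tail : Family → Family
    tail X k m = ((λ j → sh (2 ℕ.+ j) (X (2 ℕ.+ j)) m) ⋆ ifac) k

    tail-cong : ∀ {X Y} k m → (∀ j l → l ℕ.< m → X j l ≡ Y j l) → tail X k m ≡ tail Y k m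
    tail-cong k m h = ⋆-congˡ ifac k λ j → sh-cong-< (suc j) m (h (2 ℕ.+ j))

    -- F i: the continuations up to the first level with one internal node;
    -- G i: those which end without such a level.
    FΩ GΩ : Family → Family
    FΩ X i m = ifac (i ℕ.* b ℕ.∸ 1) * δ m + tail X (i ℕ.* b ℕ.∸ 2) m
    GΩ X i m = ifac (i ℕ.* b) * δ m + tail X (i ℕ.* b ℕ.∸ 2) m

    FΩ-causal : Causal FΩ
    FΩ-causal X Y i m h = cong (ifac (i ℕ.* b ℕ.∸ 1) * δ m +_) (tail-cong {X} {Y} (i ℕ.* b ℕ.∸ 2) m h)

    GΩ-causal : Causal GΩ
    GΩ-causal X Y i m h = cong (ifac (i ℕ.* b) * δ m +_) (tail-cong {X} {Y} (i ℕ.* b ℕ.∸ 2) m h)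

    F G : Family
    F = fix FΩ
    G = fix GΩ

    F-unfold : ∀ i m → F i m ≡ ifac (i ℕ.* b ℕ.∸ 1) * δ m + tail F (i ℕ.* b ℕ.∸ 2) m
    F-unfold = fix-unfold FΩ-causal

    G-unfold : ∀ i m → G i m ≡ ifac (i ℕ.* b) * δ m + tail G (i ℕ.* b ℕ.∸ 2) m
    G-unfold = fix-unfold GΩ-causal

    private
      -- Convolution with D 1 commutes with the sums and shifts that define F, so z F ⋆ D 1
      -- satisfies the recursion of F with z D 1 in the inhomogeneous term, which is the
      -- contribution of a level with one internal node.
      sh-F : ∀ i m → sh 1 (F (suc i) ⋆ D 1) m ≡
        ifac (1 ℕ.+ (β ℕ.+ i ℕ.* b)) * sh 1 (D 1) m +
        tail (λ j → sh 1 (F j ⋆ D 1)) (β ℕ.+ i ℕ.* b) m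
      sh-F i zero = sym (trans (cong₂ _+_ (ℚ.*-zeroʳ (ifac (1 ℕ.+ (β ℕ.+ i ℕ.* b)))) (⋆-zeroˡ ifac (β ℕ.+ i ℕ.* b) (λ _ _ → refl))) refl)
      sh-F i (suc m) = begin
        (F (suc i) ⋆ D 1) m
          ≡⟨ ⋆-congˡ (D 1) m (F-unfold (suc i)) ⟩
        ((λ l → ifac (suc k) * δ l + tail F k l) ⋆ D 1) m
          ≡⟨ ⋆-+ˡ _ (tail F k) (D 1) m ⟩
        ((λ l → ifac (suc k) * δ l) ⋆ D 1) m + (tail F k ⋆ D 1) m
          ≡⟨ cong₂ _+_ (trans (⋆-*ˡ (ifac (suc k)) δ (D 1) m) (cong (ifac (suc k) *_) (δ-⋆ (D 1) m)))
               (sym (⋆-exchange (λ j → sh (2 ℕ.+ j) (F (2 ℕ.+ j))) ifac (D 1) k m)) ⟩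
        ifac (suc k) * D 1 m + ((λ j → (sh (2 ℕ.+ j) (F (2 ℕ.+ j)) ⋆ D 1) m) ⋆ ifac) k
          ≡⟨ cong (ifac (suc k) * D 1 m +_) (⋆-congˡ ifac k λ j →
               trans (sh-⋆ (2 ℕ.+ j) (F (2 ℕ.+ j)) (D 1) m) (sym (sh-suc (suc j) (F (2 ℕ.+ j) ⋆ D 1) m))) ⟩
        ifac (suc k) * D 1 m + tail (λ j → sh 1 (F j ⋆ D 1)) k (suc m) ∎
        where
        open ≡-Reasoning
        k = β ℕ.+ i ℕ.* b

    -- Adding the recursions of G and of z F ⋆ D 1 gives that of D: the summand without internal
    -- nodes comes from G, the one with a single internal node from F, and the tails agree by
    -- induction on m.
    D-decompose : ∀ m i → D (suc i) m ≡ G (suc i) m + sh 1 (F (suc i) ⋆ D 1) m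
    D-decompose = <-rec (λ m → ∀ i → D (suc i) m ≡ G (suc i) m + sh 1 (F (suc i) ⋆ D 1) m) step
      where
      open ≡-Reasoning
      lem : ∀ a b c d e → a * b + (c * d + e) ≡ b * a + (d * c + e)
      lem = solve-∀ ℚ-ring
      lem′ : ∀ a b c d → a + (b + (c + d)) ≡ a + c + (b + d)
      lem′ = solve-∀ ℚ-ring
      step : ∀ m → (∀ {l} → l ℕ.< m → ∀ i → D (suc i) l ≡ G (suc i) l + sh 1 (F (suc i) ⋆ D 1) l) →
        ∀ i → D (suc i) m ≡ G (suc i) m + sh 1 (F (suc i) ⋆ D 1) m
      step m ih i = begin
        D (suc i) m
          ≡⟨ fix-unfold DΩ-causal (suc i) m ⟩
        δ m * ifac (2 ℕ.+ k) + (sh 1 (D 1) m * ifac (suc k) + tail D k m)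
          ≡⟨ lem (δ m) (ifac (2 ℕ.+ k)) (sh 1 (D 1) m) (ifac (suc k)) _ ⟩
        ifac (2 ℕ.+ k) * δ m + (ifac (suc k) * sh 1 (D 1) m + tail D k m)
          ≡⟨ cong (λ t → ifac (2 ℕ.+ k) * δ m + (ifac (suc k) * sh 1 (D 1) m + t))
               (trans (⋆-congˡ ifac k λ j → trans (sh-cong-< (suc j) m (λ l l<m → ih l<m (suc j)))
                 (sh-+ (2 ℕ.+ j) (G (2 ℕ.+ j)) (sh 1 (F (2 ℕ.+ j) ⋆ D 1)) m))
               (⋆-+ˡ _ _ ifac k)) ⟩
        ifac (2 ℕ.+ k) * δ m + (ifac (suc k) * sh 1 (D 1) m + (tail G k m + tail (λ j → sh 1 (F j ⋆ D 1)) k m))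
          ≡⟨ lem′ (ifac (2 ℕ.+ k) * δ m) (ifac (suc k) * sh 1 (D 1) m) (tail G k m) (tail (λ j → sh 1 (F j ⋆ D 1)) k m) ⟩
        ifac (2 ℕ.+ k) * δ m + tail G k m + (ifac (suc k) * sh 1 (D 1) m + tail (λ j → sh 1 (F j ⋆ D 1)) k m)
          ≡⟨ cong₂ _+_ (sym (G-unfold (suc i) m)) (sym (sh-F i m)) ⟩
        G (suc i) m + sh 1 (F (suc i) ⋆ D 1) m ∎
        where k = β ℕ.+ i ℕ.* b

    private
      δ≥0 : ∀ m → 0ℚ ≤ δ m
      δ≥0 zero    = 0≤1
      δ≥0 (suc m) = ≤-refl

      sh≥0 : ∀ k (x : Seq) m → (∀ {i} → i ℕ.< m → 0ℚ ≤ x i) → 0ℚ ≤ sh (suc k) x m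
      sh≥0 k x zero          h = ≤-refl
      sh≥0 zero x (suc m)    h = h ℕ.≤-refl
      sh≥0 (suc k) x (suc m) h = sh≥0 k x m (λ l< → h (ℕ.m≤n⇒m≤1+n l<))

      tail≥0 : ∀ X k m → (∀ {l} → l ℕ.< m → ∀ i → 0ℚ ≤ X i l) → 0ℚ ≤ tail X k m
      tail≥0 X k m h = ⋆-≥0 k (λ j → sh≥0 (suc j) (X (2 ℕ.+ j)) m (λ l<m → h l<m (2 ℕ.+ j))) 0≤ifac

    F≥0 : ∀ m i → 0ℚ ≤ F i m
    F≥0 = <-rec _ λ m ih i → ≤≡ ((0≤ifac _ 0* δ≥0 m) 0+ tail≥0 F (i ℕ.* b ℕ.∸ 2) m ih) (sym (F-unfold i m))

    G≥0 : ∀ m i → 0ℚ ≤ G i m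
    G≥0 = <-rec _ λ m ih i → ≤≡ ((0≤ifac _ 0* δ≥0 m) 0+ tail≥0 G (i ℕ.* b ℕ.∸ 2) m ih) (sym (G-unfold i m))

    D≥0 : ∀ m i → 0ℚ ≤ D i m
    D≥0 = <-rec _ λ m ih i → ≤≡ (⋆-≥0 (i ℕ.* b) (λ where
        zero    → δ≥0 m
        (suc j) → sh≥0 j (D (suc j)) m (λ l<m → ih l<m (suc j))) 0≤ifac)
      (sym (fix-unfold DΩ-causal i m))

    C≥0 : ∀ r m → 0ℚ ≤ C r m
    C≥0 r m = ⋆-≥0 r (λ i → sh-≥0 i m (λ l → D≥0 l i)) 0≤ifac

    -- The two recursions differ only in the inhomogeneous terms 1/n! and 1/(n - 1)! = n/n!, where n
    -- = (i + 1) b ≥ b. This is what lets g be compared with f in the renewal equation.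
    b*G≤F : ∀ m i → ι b * G (suc i) m ≤ F (suc i) m
    b*G≤F = <-rec _ step
      where
      open ℚ.≤-Reasoning
      step : ∀ m → (∀ {l} → l ℕ.< m → ∀ i → ι b * G (suc i) l ≤ F (suc i) l) →
        ∀ i → ι b * G (suc i) m ≤ F (suc i) m
      step m ih i = begin
        ι b * G (suc i) m
          ≡⟨ trans (cong (ι b *_) (G-unfold (suc i) m)) (lem (ι b) (ifac (2 ℕ.+ k)) (δ m) (tail G k m)) ⟩
        ι b * ifac (2 ℕ.+ k) * δ m + ι b * tail G k m
          ≤⟨ ≤* (δ m) (δ≥0 m) (≤≡ (≤* (ifac (2 ℕ.+ k)) (0≤ifac _) (ι-mono (ℕ.m≤m+n b (i ℕ.* b))))
               (suc-ifac (suc k))) +≤+ ℚ.≤-reflexive (sym (⋆-*ˡ (ι b) (λ j → sh (2 ℕ.+ j) (G (2 ℕ.+ j)) m) ifac k)) ⟩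
        ifac (suc k) * δ m + ((λ j → ι b * sh (2 ℕ.+ j) (G (2 ℕ.+ j)) m) ⋆ ifac) k
          ≤⟨ ℚ.+-monoʳ-≤ (ifac (suc k) * δ m) (⋆-mono k (λ j → 0≤ι b 0* sh-≥0 (2 ℕ.+ j) m (λ l → G≥0 l (2 ℕ.+ j))) 0≤ifac
               (λ j _ → ≡≤ (sym (sh-* (2 ℕ.+ j) (ι b) (G (2 ℕ.+ j)) m))
                 (sh-mono-< (suc j) m (λ l l<m → ih l<m (suc j)))) (λ _ _ → ≤-refl)) ⟩
        ifac (suc k) * δ m + tail F k m
          ≡⟨ F-unfold (suc i) m ⟨
        F (suc i) m ∎
        where
        k = β ℕ.+ i ℕ.* b
        lem : ∀ a b c d → a * (b * c + d) ≡ a * b * c + a * d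
        lem = solve-∀ ℚ-ring

    -- Right-hand sides of the linear system satisfied by the generating functions
    -- φ i of F i at X, for i = 2, 3, …
    system : ℚ → Seq → Seq
    system X φ k = ifac (suc k) + ((λ j → X ^ (2 ℕ.+ j) * φ (2 ℕ.+ j)) ⋆ ifac) k

    module Supersolution (X : ℚ) (φ : Seq) (0≤X : 0ℚ ≤ X) (0≤φ : ∀ i → 0ℚ ≤ φ i)
      (super : ∀ i → system X φ (β ℕ.+ suc i ℕ.* b) ≤ φ (2 ℕ.+ i))
      where

      private
        -- Generating functions truncated at degree m, so that no infinite sum has to converge. The
        -- shifts by at least 2 in `tail` express each truncation through shorter ones, hence a
        -- supersolution dominates them all by induction.
        gen : ℕ → Seq
        gen i m = ∑ (λ l → F i l * X ^ l) m

        gen≤ : ∀ M → (∀ {l} → l ℕ.< M → ∀ i → gen (2 ℕ.+ i) l ≤ φ (2 ℕ.+ i)) →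
          ∀ i → gen (suc i) M ≤ system X φ (β ℕ.+ i ℕ.* b)
        gen≤ M ih i = begin
          ∑ (λ l → F (suc i) l * X ^ l) M
            ≡⟨ ∑-cong M (λ l _ → trans (cong (_* X ^ l) (F-unfold (suc i) l))
                 (trans (lem (ifac (suc k)) (δ l) (tail F k l) (X ^ l))
                   (cong (λ t → ifac (suc k) * (δ l * X ^ l) + t) (sym (⋆-*ˡ (X ^ l) _ ifac k))))) ⟩
          ∑ (λ l → ifac (suc k) * (δ l * X ^ l) + ((λ j → X ^ l * sh (2 ℕ.+ j) (F (2 ℕ.+ j)) l) ⋆ ifac) k) M
            ≡⟨ ∑-+ _ _ M ⟩
          ∑ (λ l → ifac (suc k) * (δ l * X ^ l)) M + ∑ (λ l → ((λ j → X ^ l * sh (2 ℕ.+ j) (F (2 ℕ.+ j)) l) ⋆ ifac) k) M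
            ≡⟨ cong₂ _+_ (trans (∑-*ˡ (ifac (suc k)) _ M) (trans (cong (ifac (suc k) *_) (∑δ M)) (ℚ.*-identityʳ (ifac (suc k)))))
                 (∑-exchange (λ j l → X ^ l * sh (2 ℕ.+ j) (F (2 ℕ.+ j)) l) ifac k M) ⟩
          ifac (suc k) + ((λ j → ∑ (λ l → X ^ l * sh (2 ℕ.+ j) (F (2 ℕ.+ j)) l) M) ⋆ ifac) k
            ≤⟨ ℚ.+-monoʳ-≤ (ifac (suc k)) (⋆-mono k (λ j → ∑-≥0 M (λ l → 0≤^ l 0≤X 0* sh-≥0 (2 ℕ.+ j) l (λ n → F≥0 n (2 ℕ.+ j))))
                 0≤ifac (λ j _ → term j) (λ _ _ → ≤-refl)) ⟩
          ifac (suc k) + ((λ j → X ^ (2 ℕ.+ j) * φ (2 ℕ.+ j)) ⋆ ifac) k ∎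
          where
          open ℚ.≤-Reasoning
          k = β ℕ.+ i ℕ.* b
          lem : ∀ a b c d → (a * b + c) * d ≡ a * (b * d) + d * c
          lem = solve-∀ ℚ-ring
          ∑δ : ∀ m → ∑ (λ l → δ l * X ^ l) m ≡ 1ℚ
          ∑δ zero    = refl
          ∑δ (suc m) = trans (cong₂ _+_ (∑δ m) (ℚ.*-zeroˡ (X ^ suc m))) refl
          term : ∀ j → ∑ (λ l → X ^ l * sh (2 ℕ.+ j) (F (2 ℕ.+ j)) l) M ≤ X ^ (2 ℕ.+ j) * φ (2 ℕ.+ j)
          term j = begin
            ∑ (λ l → X ^ l * sh (2 ℕ.+ j) (F (2 ℕ.+ j)) l) M
              ≡⟨ ∑-cong M (λ l _ → trans (ℚ.*-comm (X ^ l) _) (sh-*^ (2 ℕ.+ j) (F (2 ℕ.+ j)) X l)) ⟩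
            ∑ (λ l → X ^ (2 ℕ.+ j) * sh (2 ℕ.+ j) (λ n → F (2 ℕ.+ j) n * X ^ n) l) M
              ≡⟨ trans (∑-*ˡ (X ^ (2 ℕ.+ j)) _ M) (cong (X ^ (2 ℕ.+ j) *_) (∑-sh (2 ℕ.+ j) _ M)) ⟩
            X ^ (2 ℕ.+ j) * sh (2 ℕ.+ j) (gen (2 ℕ.+ j)) M
              ≤⟨ *≤ (X ^ (2 ℕ.+ j)) (0≤^ (2 ℕ.+ j) 0≤X) (sh-≤-< (suc j) M (0≤φ (2 ℕ.+ j)) (λ l l<M → ih l<M j)) ⟩
            X ^ (2 ℕ.+ j) * φ (2 ℕ.+ j) ∎

        all≤ : ∀ M i → gen (2 ℕ.+ i) M ≤ φ (2 ℕ.+ i)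
        all≤ = <-rec _ λ M ih i → ≤-trans (gen≤ M ih (suc i)) (super i)

      F₁-bound : ∀ M → ∑ (λ l → F 1 l * X ^ l) M ≤ system X φ β
      F₁-bound M = subst (λ k → ∑ (λ l → F 1 l * X ^ l) M ≤ system X φ k) (ℕ.+-identityʳ β) (gen≤ M (λ {l} _ → all≤ l) 0)

-- Explicit estimates that make the contraction applicable.

module Numerics where

  open import Data.Nat as ℕ using (ℕ; zero; suc; z≤n)
  import Data.Nat.Properties as ℕ
  import Data.Integer as ℤ
  open import Data.Product using (∃-syntax; _×_; _,_; proj₁; proj₂)
  open import Data.Rational as ℚ
    using (ℚ; 0ℚ; 1ℚ; ½; _+_; _*_; _-_; -_; _≤_; _<_; ∣_∣; _/_)
  open import Data.Rational.Properties as ℚ using (≤-refl; ≤-trans; <⇒≤)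
  open import Data.Sum using (inj₁; inj₂)
  open import Function using (_∘_)
  open import Relation.Binary.PropositionalEquality
  open import Tactic.RingSolver using (solve-∀)
  open import Defs using (pos*)
  open Rationals
  open Sums
  open Ratios
  open Trees

  -- Eventually geometric convergence of the quotients c(m + 1)/c(m).
  GeometricRatios : Seq → Set
  GeometricRatios c = (∀ m → 0ℚ < c m) ×
    ∃[ l ] 0ℚ < l × (∀ m → l * c m ≤ c (suc m)) ×
    ∃[ κ ] 0ℚ < κ × κ < 1ℚ × ∃[ A ] ∃[ N ] ∀ i →
      ∣ ratio c (suc (N ℕ.+ i)) - ratio c (N ℕ.+ i) ∣ ≤ A * κ ^ i

  BoundedRenewal : Seq → Seq → Set
  BoundedRenewal f y = ∃[ g ] Renewal f g y × (∀ i → 0ℚ ≤ g i) × ∃[ A ] ∀ i → g i ≤ A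

  BoundedRenewal-+ : ∀ {f} B → (∀ i → 0ℚ ≤ f i) → (∀ i → f i ≤ B) →
    ∀ n {y} → (∀ i → 0ℚ ≤ y i) → BoundedRenewal f y → BoundedRenewal f (y ∘ (n ℕ.+_))
  BoundedRenewal-+ B 0≤f f≤B zero    0≤y r = r
  BoundedRenewal-+ {f} B 0≤f f≤B (suc n) {y} 0≤y (g , r , 0≤g , A , g≤A) =
    subst (BoundedRenewal f) refl (BoundedRenewal-+ B 0≤f f≤B n {y ∘ suc} (0≤y ∘ suc)
      ( (λ m → g (suc m) + f (suc m) * y 0) , Renewal-suc {f} {g} {y} r
      , (λ i → 0≤g (suc i) 0+ (0≤f (suc i) 0* 0≤y 0))
      , A + B * y 0 , λ i → g≤A (suc i) +≤+ ≤* (y 0) (0≤y 0) (f≤B (suc i))))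

  module _ (β : ℕ) where

    private
      b : ℕ
      b = suc (suc β)

    -- This is (b - 1)!, the inverse of F 1 0.
    x : ℚ
    x = inv (ifac (suc β))

    0<x : 0ℚ < x
    0<x = 0<inv (0<ifac (suc β))

    x*ifac : x * ifac (suc β) ≡ 1ℚ
    x*ifac = trans (ℚ.*-comm x _) (*-inv (0<ifac (suc β)))

    -- Rescaled so that f 0 = 1.
    f g y : Seq
    f k = x * (F β 1 k * x ^ k)
    g m = G β 1 (suc m) * x ^ suc m
    y m = D β 1 m * x ^ m

    renewal : Renewal f g y
    renewal m = begin
      D β 1 (suc m) * x ^ suc m
        ≡⟨ cong (_* x ^ suc m) (D-decompose β (suc m) 0) ⟩
      (G β 1 (suc m) + (F β 1 ⋆ D β 1) m) * (x * x ^ m)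
        ≡⟨ lem (G β 1 (suc m)) _ x (x ^ m) ⟩
      g m + x * ((F β 1 ⋆ D β 1) m * x ^ m)
        ≡⟨ cong (λ t → g m + x * t) (*^-⋆ x (F β 1) (D β 1) m) ⟩
      g m + x * ((λ i → F β 1 i * x ^ i) ⋆ y) m
        ≡⟨ cong (g m +_) (⋆-*ˡ x _ y m) ⟨
      g m + (f ⋆ y) m ∎
      where
      open ≡-Reasoning
      lem : ∀ a b c d → (a + b) * (c * d) ≡ a * (c * d) + c * (b * d)
      lem = solve-∀ ℚ-ring

    0≤f : ∀ k → 0ℚ ≤ f k
    0≤f k = <⇒≤ 0<x 0* (F≥0 β k 1 0* 0≤^ k (<⇒≤ 0<x))

    0≤g : ∀ m → 0ℚ ≤ g m
    0≤g m = G≥0 β (suc m) 1 0* 0≤^ (suc m) (<⇒≤ 0<x)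

    0≤y : ∀ m → 0ℚ ≤ y m
    0≤y m = D≥0 β m 1 0* 0≤^ m (<⇒≤ 0<x)

    F₁-unfold : ∀ m → F β 1 m ≡ ifac (suc β) * δ m + tail β (F β) β m
    F₁-unfold m = subst (λ k → F β 1 m ≡ ifac (suc k) * δ m + tail β (F β) k m) (ℕ.+-identityʳ β) (F-unfold β 1 m)

    G₁-unfold : ∀ m → G β 1 m ≡ ifac b * δ m + tail β (G β) β m
    G₁-unfold m = subst (λ k → G β 1 m ≡ ifac (suc (suc k)) * δ m + tail β (G β) k m) (ℕ.+-identityʳ β) (G-unfold β 1 m)

    f₀ : f 0 ≡ 1ℚ
    f₀ = begin
      x * (F β 1 0 * 1ℚ)          ≡⟨ cong (λ t → x * (t * 1ℚ)) (F₁-unfold 0) ⟩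
      x * ((ifac (suc β) * 1ℚ + tail β (F β) β 0) * 1ℚ)
        ≡⟨ cong (λ t → x * ((ifac (suc β) * 1ℚ + t) * 1ℚ)) (⋆-zeroˡ ifac β (λ _ _ → refl)) ⟩
      x * ((ifac (suc β) * 1ℚ + 0ℚ) * 1ℚ) ≡⟨ lem x (ifac (suc β)) ⟩
      x * ifac (suc β)            ≡⟨ x*ifac ⟩
      1ℚ ∎
      where
      open ≡-Reasoning
      lem : ∀ a b → a * ((b * 1ℚ + 0ℚ) * 1ℚ) ≡ a * b
      lem = solve-∀ ℚ-ring

    y₀≥ : ifac b ≤ y 0
    y₀≥ = ≤≡ (p≤p+q {q = tail β (G β) β 0} (⋆-≥0 β (λ j → ≤-refl) 0≤ifac)) (sym (begin
      D β 1 0 * 1ℚ                             ≡⟨ ℚ.*-identityʳ _ ⟩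
      D β 1 0                                  ≡⟨ D-decompose β 0 0 ⟩
      G β 1 0 + 0ℚ                             ≡⟨ ℚ.+-identityʳ _ ⟩
      G β 1 0                                  ≡⟨ G₁-unfold 0 ⟩
      ifac b * 1ℚ + tail β (G β) β 0           ≡⟨ cong (_+ tail β (G β) β 0) (ℚ.*-identityʳ (ifac b)) ⟩
      ifac b + tail β (G β) β 0                ∎))
      where open ≡-Reasoning

    -- The head term of the renewal sum alone suffices, thanks to the normalisation f 0 = 1.
    y-mono : ∀ m → y m ≤ y (suc m)
    y-mono m = begin
      y m                ≡⟨ ℚ.*-identityˡ (y m) ⟨
      1ℚ * y m           ≡⟨ cong (_* y m) f₀ ⟨
      f 0 * y m          ≤⟨ ⋆-head≤ m 0≤f 0≤y ⟩
      (f ⋆ y) m          ≤⟨ p≤q+p (0≤g m) ⟩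
      g m + (f ⋆ y) m    ≡⟨ renewal m ⟨
      y (suc m)          ∎
      where
      open ℚ.≤-Reasoning

    y-mono-≤ : ∀ {m n} → m ℕ.≤ n → y m ≤ y n
    y-mono-≤ m≤n = go (ℕ.≤⇒≤′ m≤n)
      where
      go : ∀ {m n} → m ℕ.≤′ n → y m ≤ y n
      go ℕ.≤′-refl        = ≤-refl
      go (ℕ.≤′-step {n} m≤′n) = ≤-trans (go m≤′n) (y-mono n)

    0<y : ∀ m → 0ℚ < y m
    0<y m = ℚ.<-≤-trans (0<ifac b) (≤-trans y₀≥ (y-mono-≤ {0} {m} z≤n))

    -- b G ≤ F and x y₀ ≥ 1/b
    g≤f : ∀ m → g m ≤ f (suc m) * y 0
    g≤f m = begin
      G β 1 (suc m) * x ^ suc m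
        ≡⟨ trans (sym (ℚ.*-identityˡ _)) (cong (_* (G β 1 (suc m) * x ^ suc m)) (sym one)) ⟩
      ι b * (x * ifac b) * (G β 1 (suc m) * x ^ suc m)
        ≡⟨ lem (ι b) x (ifac b) (G β 1 (suc m)) (x ^ suc m) ⟩
      x * (ι b * G β 1 (suc m) * x ^ suc m) * ifac b
        ≤⟨ *≤* (<⇒≤ 0<x 0* ((0≤ι b 0* G≥0 β (suc m) 1) 0* 0≤^ (suc m) (<⇒≤ 0<x))) (0≤y 0)
             (*≤ x (<⇒≤ 0<x) (≤* (x ^ suc m) (0≤^ (suc m) (<⇒≤ 0<x)) (b*G≤F β (suc m) 0))) y₀≥ ⟩
      f (suc m) * y 0 ∎
      where
      open ℚ.≤-Reasoning
      lem : ∀ b x i G X → b * (x * i) * (G * X) ≡ x * (b * G * X) * i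
      lem = solve-∀ ℚ-ring
      lem′ : ∀ b x i → b * (x * i) ≡ x * (b * i)
      lem′ = solve-∀ ℚ-ring
      one : ι b * (x * ifac b) ≡ 1ℚ
      one = trans (lem′ (ι b) x (ifac b)) (trans (cong (x *_) (suc-ifac (suc β))) x*ifac)

    -- Monotonicity bounds every y(m - k) by y m, and g m is at most the missing term f(m + 1) y 0,
    -- so a partial sum of f bounds the growth factor.
    y-upper : ∀ {B} → (∀ m → ∑ f m ≤ B) → ∀ m → y (suc m) ≤ B * y m
    y-upper {B} f≤B m = begin
      y (suc m)                        ≡⟨ renewal m ⟩
      g m + (f ⋆ y) m                  ≤⟨ ≤-trans (g≤f m) (*≤ (f (suc m)) (0≤f (suc m)) (y-mono-≤ {0} {m} z≤n)) +≤+ f⋆y≤ m ⟩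
      f (suc m) * y m + ∑ f m * y m    ≡⟨ lem (f (suc m)) (y m) (∑ f m) ⟩
      ∑ f (suc m) * y m                ≤⟨ ≤* (y m) (0≤y m) (f≤B (suc m)) ⟩
      B * y m                          ∎
      where
      open ℚ.≤-Reasoning
      lem : ∀ a b c → a * b + c * b ≡ (c + a) * b
      lem = solve-∀ ℚ-ring
      f⋆y≤ : ∀ m → (f ⋆ y) m ≤ ∑ f m * y m
      f⋆y≤ m = begin
        (f ⋆ y) m                  ≤⟨ ⋆-mono m 0≤f (λ _ → 0≤y m) (λ _ _ → ≤-refl) (λ _ i≤m → y-mono-≤ i≤m) ⟩
        (f ⋆ (λ _ → y m)) m        ≡⟨ ⋆-reversed f (λ _ → y m) m ⟩
        ∑ (λ k → f k * y m) m      ≡⟨ trans (∑-cong m (λ k _ → ℚ.*-comm (f k) (y m))) (∑-*ˡ (y m) f m) ⟩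
        y m * ∑ f m                ≡⟨ ℚ.*-comm (y m) _ ⟩
        ∑ f m * y m                ∎

    -- Only the terms with f 0 = 1, f 2 and f 4 of the renewal sum are kept; `y-upper`, applied two
    -- and four times, compares y(i + 2) and y i with y(i + 4).
    y-lower : ∀ {B μ l₂ l₄} → (∀ m → ∑ f m ≤ B) → 0ℚ ≤ μ →
      0ℚ ≤ l₂ → 0ℚ ≤ l₄ → l₂ * (B * B) ≤ f 2 → l₄ * (B * B * (B * B)) ≤ f 4 →
      1ℚ ≤ μ * (1ℚ + l₂ + l₄) → ∀ i → y (4 ℕ.+ i) ≤ μ * y (5 ℕ.+ i)
    y-lower {B} {μ} {l₂} {l₄} f≤B 0≤μ 0≤l₂ 0≤l₄ f₂≥ f₄≥ μ≥ i = begin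
      y (4 ℕ.+ i)
        ≡⟨ ℚ.*-identityˡ _ ⟨
      1ℚ * y (4 ℕ.+ i)
        ≤⟨ ≤* (y (4 ℕ.+ i)) (0≤y (4 ℕ.+ i)) μ≥ ⟩
      μ * (1ℚ + l₂ + l₄) * y (4 ℕ.+ i)
        ≡⟨ lem μ l₂ l₄ (y (4 ℕ.+ i)) ⟩
      μ * (1ℚ * y (4 ℕ.+ i) + (l₂ * y (4 ℕ.+ i) + l₄ * y (4 ℕ.+ i)))
        ≤⟨ *≤ μ 0≤μ (ℚ.≤-reflexive (cong (_* y (4 ℕ.+ i)) (sym f₀)) +≤+ (term₂ +≤+ term₄)) ⟩
      μ * (f 0 * y (4 ℕ.+ i) + (f 2 * y (2 ℕ.+ i) + f 4 * y i))
        ≤⟨ *≤ μ 0≤μ (≤-trans (pick (f 0 * y (4 ℕ.+ i)) (f 1 * y (3 ℕ.+ i)) (f 2 * y (2 ℕ.+ i)) (f 3 * y (1 ℕ.+ i))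
             (0≤f 1 0* 0≤y (3 ℕ.+ i)) (0≤f 3 0* 0≤y (1 ℕ.+ i)) (⋆-head≤ i (0≤f ∘ (4 ℕ.+_)) 0≤y)) (p≤q+p (0≤g (4 ℕ.+ i)))) ⟩
      μ * (g (4 ℕ.+ i) + (f ⋆ y) (4 ℕ.+ i))
        ≡⟨ cong (μ *_) (renewal (4 ℕ.+ i)) ⟨
      μ * y (5 ℕ.+ i) ∎
      where
      open ℚ.≤-Reasoning
      lem : ∀ u a b w → u * (1ℚ + a + b) * w ≡ u * (1ℚ * w + (a * w + b * w))
      lem = solve-∀ ℚ-ring
      0≤B : 0ℚ ≤ B
      0≤B = ≤-trans (0≤f 0) (f≤B 0)
      up₂ : ∀ j → y (2 ℕ.+ j) ≤ B * B * y j
      up₂ j = ≤-trans (y-upper f≤B (suc j)) (≤≡ (*≤ B 0≤B (y-upper f≤B j)) (sym (ℚ.*-assoc B B (y j))))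
      term₂ : l₂ * y (4 ℕ.+ i) ≤ f 2 * y (2 ℕ.+ i)
      term₂ = ≤-trans (≤≡ (*≤ l₂ 0≤l₂ (up₂ (2 ℕ.+ i))) (sym (ℚ.*-assoc l₂ (B * B) _))) (≤* (y (2 ℕ.+ i)) (0≤y (2 ℕ.+ i)) f₂≥)
      term₄ : l₄ * y (4 ℕ.+ i) ≤ f 4 * y i
      term₄ = ≤-trans (*≤ l₄ 0≤l₄ (≤-trans (up₂ (2 ℕ.+ i)) (*≤ (B * B) (0≤B 0* 0≤B) (up₂ i))))
        (≡≤ (lem′ l₄ (B * B) (y i)) (≤* (y i) (0≤y i) f₄≥))
        where
        lem′ : ∀ l B y → l * (B * (B * y)) ≡ l * (B * B) * y
        lem′ = solve-∀ ℚ-ring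
      pick : ∀ a b c d {e s} → 0ℚ ≤ b → 0ℚ ≤ d → e ≤ s → a + (c + e) ≤ a + (b + (c + (d + s)))
      pick a b c d {e} {s} 0≤b 0≤d e≤s = ℚ.+-monoʳ-≤ a (≤-trans (ℚ.+-monoʳ-≤ c (≤-trans e≤s (p≤q+p 0≤d))) (p≤q+p 0≤b))

    geometric : ∀ B μ ξ θ → (∀ m → ∑ f m ≤ B) → 0ℚ < μ → μ < ξ → ξ ≤ 1ℚ → θ < 1ℚ →
      (∀ m → ∑ (λ k → f k * (ι k * ξ ^ suc k)) m ≤ θ) →
      (∀ i → y (4 ℕ.+ i) ≤ μ * y (5 ℕ.+ i)) → GeometricRatios (c β)
    -- The index 5: the lower growth bound holds for y from index 4 on, and c is, up to rescaling, y
    -- delayed by one place. The bound l is a minimum because the first quotient of c is D 1 0,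
    -- while the later ones are at least 1 / x.
    geometric B μ ξ θ f≤B 0<μ μ<ξ ξ≤1 θ<1 mean y-low = 0<c , l , 0<l , l-bound , κ , 0<κ , κ<1 , inv x * C₀ , 5 , bound
      where
      f≤ : ∀ i → f i ≤ B
      f≤ i = ≤-trans (term≤∑ i 0≤f) (f≤B i)
      shifted : BoundedRenewal f (y ∘ (4 ℕ.+_))
      shifted = BoundedRenewal-+ B 0≤f f≤ 4 {y} 0≤y (g , renewal , 0≤g , B * y 0 ,
        λ i → ≤-trans (g≤f i) (≤* (y 0) (0≤y 0) (f≤ (suc i))))
      g′ = proj₁ shifted
      A = proj₁ (proj₂ (proj₂ (proj₂ shifted)))
      0≤B : 0ℚ ≤ B
      0≤B = ≤-trans (0≤f 0) (f≤ 0)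
      0≤A : 0ℚ ≤ A
      0≤A = ≤-trans (proj₁ (proj₂ (proj₂ shifted)) 0) (proj₂ (proj₂ (proj₂ (proj₂ shifted))) 0)
      open Contraction f g′ (y ∘ (4 ℕ.+_)) (B + A) B μ ξ θ 0≤f (proj₁ (proj₂ (proj₂ shifted))) (λ i → 0<y (4 ℕ.+ i))
        (proj₁ (proj₂ shifted)) (λ i → ≤-trans (f≤ i) (p≤p+q 0≤A))
        (λ i → ≤-trans (proj₂ (proj₂ (proj₂ (proj₂ shifted))) i) (p≤q+p 0≤B))
        (λ m → y-upper f≤B (4 ℕ.+ m)) y-low 0<μ μ<ξ ξ≤1 θ<1 mean
      C₀ = proj₁ ratio-increments

      0<x^ : ∀ m → 0ℚ < x ^ m
      0<x^ m = 0<^ m 0<x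

      0<D : ∀ m → 0ℚ < D β 1 m
      0<D m = subst (0ℚ <_) (trans (lem (D β 1 m) (x ^ m) (inv (x ^ m))) (trans (cong (D β 1 m *_) (*-inv (0<x^ m))) (ℚ.*-identityʳ _)))
        (pos* (0<y m) (0<inv (0<x^ m)))
        where
        lem : ∀ a b c → a * b * c ≡ a * (b * c)
        lem = solve-∀ ℚ-ring

      0<c : ∀ m → 0ℚ < c β m
      0<c zero    = subst (0ℚ <_) (sym (c₀ β)) 0<1
      0<c (suc m) = subst (0ℚ <_) (sym (c-suc β m)) (0<D m)

      D-lower : ∀ m → inv x * D β 1 m ≤ D β 1 (suc m)
      D-lower m = *-cancel-≤ (x ^ suc m) (0<x^ (suc m)) (begin
        x ^ suc m * (inv x * D β 1 m)    ≡⟨ lem x (x ^ m) (inv x) (D β 1 m) ⟩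
        x * inv x * y m                  ≡⟨ trans (cong (_* y m) (*-inv 0<x)) (ℚ.*-identityˡ (y m)) ⟩
        y m                              ≤⟨ y-mono m ⟩
        y (suc m)                        ≡⟨ ℚ.*-comm (D β 1 (suc m)) (x ^ suc m) ⟩
        x ^ suc m * D β 1 (suc m)        ∎)
        where
        open ℚ.≤-Reasoning
        lem : ∀ x X i d → x * X * (i * d) ≡ x * i * (d * X)
        lem = solve-∀ ℚ-ring

      l : ℚ
      l = inv x ℚ.⊓ D β 1 0

      0<l : 0ℚ < l
      0<l with ℚ.≤-total (inv x) (D β 1 0)
      ... | inj₁ le = subst (0ℚ <_) (sym (ℚ.p≤q⇒p⊓q≡p le)) (0<inv 0<x)
      ... | inj₂ le = subst (0ℚ <_) (sym (ℚ.p≥q⇒p⊓q≡q le)) (0<D 0)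

      l-bound : ∀ m → l * c β m ≤ c β (suc m)
      l-bound zero    = ≡≤ (trans (cong (l *_) (c₀ β)) (ℚ.*-identityʳ l))
        (≤≡ (ℚ.p⊓q≤q (inv x) (D β 1 0)) (sym (c-suc β 0)))
      l-bound (suc m) = ≡≤ (cong (l *_) (c-suc β m)) (≤≡ (≤-trans
        (≤* (D β 1 m) (<⇒≤ (0<D m)) (ℚ.p⊓q≤p (inv x) (D β 1 0))) (D-lower m)) (sym (c-suc β (suc m))))

      ratio-c : ∀ m → ratio (c β) (suc m) ≡ inv x * ratio y m
      ratio-c m = begin
        c β (2 ℕ.+ m) * inv (c β (suc m))
          ≡⟨ cong₂ (λ a b → a * inv b) (c-suc β (suc m)) (c-suc β m) ⟩
        D β 1 (suc m) * inv (D β 1 m)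
          ≡⟨ cong (D β 1 (suc m) *_) (sym (inv-unique (0<D m) inverse)) ⟩
        D β 1 (suc m) * (x ^ m * inv (y m))
          ≡⟨ trans (sym (ℚ.*-identityˡ _)) (cong (_* (D β 1 (suc m) * (x ^ m * inv (y m)))) (sym (*-inv 0<x))) ⟩
        x * inv x * (D β 1 (suc m) * (x ^ m * inv (y m)))
          ≡⟨ lem x (inv x) (D β 1 (suc m)) (x ^ m) (inv (y m)) ⟩
        inv x * ratio y m ∎
        where
        open ≡-Reasoning
        lem : ∀ x i d X u → x * i * (d * (X * u)) ≡ i * (d * (x * X) * u)
        lem = solve-∀ ℚ-ring
        inverse : D β 1 m * (x ^ m * inv (y m)) ≡ 1ℚ
        inverse = trans (sym (ℚ.*-assoc (D β 1 m) (x ^ m) (inv (y m)))) (*-inv (0<y m))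

      bound : ∀ i → ∣ ratio (c β) (suc (5 ℕ.+ i)) - ratio (c β) (5 ℕ.+ i) ∣ ≤ inv x * C₀ * κ ^ i
      bound i = begin
        ∣ ratio (c β) (suc (5 ℕ.+ i)) - ratio (c β) (5 ℕ.+ i) ∣
          ≡⟨ cong ∣_∣ (trans (cong₂ _-_ (ratio-c (5 ℕ.+ i)) (ratio-c (4 ℕ.+ i))) (lem (inv x) (ratio y (5 ℕ.+ i)) (ratio y (4 ℕ.+ i)))) ⟩
        ∣ inv x * (ratio y (5 ℕ.+ i) - ratio y (4 ℕ.+ i)) ∣
          ≤⟨ ∣p*q∣≤ {inv x} (ℚ.≤-reflexive (ℚ.0≤p⇒∣p∣≡p (0≤inv 0<x))) (proj₂ ratio-increments i) ⟩
        inv x * (C₀ * κ ^ i)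
          ≡⟨ ℚ.*-assoc (inv x) C₀ (κ ^ i) ⟨
        inv x * C₀ * κ ^ i ∎
        where
        open ℚ.≤-Reasoning
        lem : ∀ a b c → a * b - a * c ≡ a * (b - c)
        lem = solve-∀ ℚ-ring

    -- Keeps only the continuations whose next level has exactly two internal nodes.
    F₁-lower : ∀ m → F β 2 m * ifac β ≤ F β 1 (2 ℕ.+ m)
    F₁-lower m = begin
      F β 2 m * ifac β
        ≡⟨ cong (_* ifac β) (sh-diag 2 (F β 2) m) ⟨
      sh 2 (F β 2) (2 ℕ.+ m) * ifac β
        ≤⟨ ⋆-head≤ β (λ j → sh-≥0 (2 ℕ.+ j) (2 ℕ.+ m) (λ l → F≥0 β l (2 ℕ.+ j))) 0≤ifac ⟩
      tail β (F β) β (2 ℕ.+ m)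
        ≤⟨ p≤q+p (0≤ifac (suc β) 0* ≤-refl) ⟩
      ifac (suc β) * δ (2 ℕ.+ m) + tail β (F β) β (2 ℕ.+ m)
        ≡⟨ F₁-unfold (2 ℕ.+ m) ⟨
      F β 1 (2 ℕ.+ m) ∎
      where open ℚ.≤-Reasoning

    F₂₀-lower : ifac (2 ℕ.* b ℕ.∸ 1) ≤ F β 2 0
    F₂₀-lower = ≤≡ (≡≤ (sym (ℚ.*-identityʳ (ifac (2 ℕ.* b ℕ.∸ 1)))) (p≤p+q (⋆-≥0 (2 ℕ.* b ℕ.∸ 2) (λ j → ≤-refl) 0≤ifac)))
      (sym (F-unfold β 2 0))

    F₂₂-lower : F β 2 0 * ifac (2 ℕ.* b ℕ.∸ 2) ≤ F β 2 2
    F₂₂-lower = begin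
      sh 2 (F β 2) 2 * ifac (2 ℕ.* b ℕ.∸ 2)
        ≤⟨ ⋆-head≤ (2 ℕ.* b ℕ.∸ 2) (λ j → sh-≥0 (2 ℕ.+ j) 2 (λ l → F≥0 β l (2 ℕ.+ j))) 0≤ifac ⟩
      tail β (F β) (2 ℕ.* b ℕ.∸ 2) 2
        ≤⟨ p≤q+p (0≤ifac (2 ℕ.* b ℕ.∸ 1) 0* ≤-refl) ⟩
      ifac (2 ℕ.* b ℕ.∸ 1) * δ 2 + tail β (F β) (2 ℕ.* b ℕ.∸ 2) 2
        ≡⟨ F-unfold β 2 2 ⟨
      F β 2 2 ∎
      where open ℚ.≤-Reasoning

  -- The sum in `system` for the trial solution φ i = ψⁱ / i! with u = X ψ.
  expTail : ℚ → ℕ → ℚ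
  expTail u k = ((λ j → exp u (2 ℕ.+ j)) ⋆ ifac) k

  -- Splits off the terms 0 and 1 of the expansion of (1 + u)ⁿ / n! for n = k + 2. An exponential
  -- trial solution is convenient because its sum is explicit.
  expTail-exp : ∀ u k → exp (1ℚ + u) (2 ℕ.+ k) ≡ ifac (2 ℕ.+ k) + (u * ifac (suc k) + expTail u k)
  expTail-exp u k = trans (sym (exp-⋆-ifac u (2 ℕ.+ k))) (cong₂ (λ p q → p + (q + expTail u k))
    (trans (cong (_* ifac (2 ℕ.+ k)) (trans (ℚ.*-identityˡ (ifac 0)) ifac₀)) (ℚ.*-identityˡ (ifac (2 ℕ.+ k))))
    (cong (_* ifac (suc k)) (trans (cong (u * 1ℚ *_) (ifac₁ 0)) (trans (ℚ.*-identityʳ _) (ℚ.*-identityʳ u)))))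

  expTail≤exp : ∀ {u} → 0ℚ ≤ u → ∀ k → expTail u k ≤ exp (1ℚ + u) (2 ℕ.+ k)
  expTail≤exp {u} 0≤u k = ≤≡ (≤-trans (p≤q+p (0≤u 0* 0≤ifac (suc k))) (p≤q+p (0≤ifac (2 ℕ.+ k)))) (sym (expTail-exp u k))

  -- The supersolution i ↦ K ψⁱ / i! at X, where ψ = u / X.
  F-generating-bound : ∀ β X u ψ K → 0ℚ ≤ X → 0ℚ ≤ ψ → 0ℚ ≤ K → X * ψ ≡ u →
    (∀ i → let k = β ℕ.+ suc i ℕ.* (2 ℕ.+ β) in ifac (suc k) + K * expTail u k ≤ K * exp ψ (2 ℕ.+ i)) →
    ∀ M → ∑ (λ l → F β 1 l * X ^ l) M ≤ ifac (suc β) + K * expTail u β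
  F-generating-bound β X u ψ K 0≤X 0≤ψ 0≤K refl hyp M =
    ≤≡ (F₁-bound M) (cong (ifac (suc β) +_) (tail≡ β))
    where
    φ : Seq
    φ i = K * exp ψ i
    lem : ∀ a b c d → a * (b * (c * d)) ≡ b * (a * c * d)
    lem = solve-∀ ℚ-ring
    tail≡ : ∀ k → ((λ j → X ^ (2 ℕ.+ j) * φ (2 ℕ.+ j)) ⋆ ifac) k ≡ K * expTail (X * ψ) k
    tail≡ k = trans (⋆-congˡ ifac k λ j → trans (lem (X ^ (2 ℕ.+ j)) K (ψ ^ (2 ℕ.+ j)) (ifac (2 ℕ.+ j)))
        (cong (λ t → K * (t * ifac (2 ℕ.+ j))) (sym (*-^ X ψ (2 ℕ.+ j)))))
      (⋆-*ˡ K _ ifac k)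
    open Supersolution β X φ 0≤X (λ i → 0≤K 0* (0≤^ i 0≤ψ 0* 0≤ifac i))
      (λ i → ≡≤ (cong (ifac (suc (β ℕ.+ suc i ℕ.* (2 ℕ.+ β))) +_) (tail≡ (β ℕ.+ suc i ℕ.* (2 ℕ.+ β)))) (hyp i))

  -- Implies the supersolution inequality (crude⇒) and, unlike it, is inherited
  -- from n to d + n.
  Crude : ℚ → ℚ → ℚ → ℕ → ℕ → Set
  Crude u ψ K n i = (ι n + K * (1ℚ + u) ^ n) * ifac n ≤ K * exp ψ i

  -- Writes 1/(k + 1)! as n/n! with n = k + 2 and completes `expTail` to the full expansion of (1 +
  -- u)ⁿ / n!.
  crude⇒ : ∀ {u ψ K} → 0ℚ ≤ u → 0ℚ ≤ K → ∀ k i → Crude u ψ K (2 ℕ.+ k) i →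
    ifac (suc k) + K * expTail u k ≤ K * exp ψ i
  crude⇒ {u} {ψ} {K} 0≤u 0≤K k i h = ≤-trans
    (≡≤ (cong (_+ K * expTail u k) (sym (suc-ifac (suc k)))) (ℚ.+-monoʳ-≤ (ι (2 ℕ.+ k) * ifac (2 ℕ.+ k)) (*≤ K 0≤K (expTail≤exp 0≤u k))))
    (≡≤ (lem (ι (2 ℕ.+ k)) (ifac (2 ℕ.+ k)) K ((1ℚ + u) ^ (2 ℕ.+ k))) h)
    where
    lem : ∀ n w k e → n * w + k * (e * w) ≡ (n + k * e) * w
    lem = solve-∀ ℚ-ring

  -- If n grows by d while i grows by 1, both sides of Crude shrink, the left one
  -- by the factor r = ifac (d + n) / ifac n.
  crude-step : ∀ {u ψ K r} d n i → 0ℚ ≤ u → 0ℚ ≤ ψ → 0ℚ ≤ K →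
    r * ι (suc i) * ifac (d ℕ.+ n) ≤ ψ * ifac n →
    (1ℚ + u) ^ d ≤ r → ι (d ℕ.+ n) ≤ r * ι n →
    Crude u ψ K n i → Crude u ψ K (d ℕ.+ n) (suc i)
  crude-step {u} {ψ} {K} {r} d n i 0≤u 0≤ψ 0≤K shrink r≥₁ r≥₂ h = *-cancel-≤ (ι (suc i)) (0<ι i) (begin
    ι (suc i) * ((ι (d ℕ.+ n) + K * (1ℚ + u) ^ (d ℕ.+ n)) * ifac (d ℕ.+ n))
      ≤⟨ *≤ (ι (suc i)) (0≤ι (suc i)) (≤* (ifac (d ℕ.+ n)) (0≤ifac (d ℕ.+ n)) (r≥₂ +≤+ *≤ K 0≤K
           (≡≤ (^-+ (1ℚ + u) d n) (≤* ((1ℚ + u) ^ n) (0≤^ n (0≤1 0+ 0≤u)) r≥₁)))) ⟩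
    ι (suc i) * ((r * ι n + K * (r * (1ℚ + u) ^ n)) * ifac (d ℕ.+ n))
      ≡⟨ lem (ι (suc i)) r (ι n) K ((1ℚ + u) ^ n) (ifac (d ℕ.+ n)) ⟩
    (ι n + K * (1ℚ + u) ^ n) * (r * ι (suc i) * ifac (d ℕ.+ n))
      ≤⟨ *≤ (ι n + K * (1ℚ + u) ^ n) (0≤ι n 0+ (0≤K 0* 0≤^ n (0≤1 0+ 0≤u))) shrink ⟩
    (ι n + K * (1ℚ + u) ^ n) * (ψ * ifac n)
      ≡⟨ lem′ (ι n + K * (1ℚ + u) ^ n) ψ (ifac n) ⟩
    ψ * ((ι n + K * (1ℚ + u) ^ n) * ifac n)
      ≤⟨ *≤ ψ 0≤ψ h ⟩
    ψ * (K * exp ψ i)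
      ≡⟨ lem″ ψ K (exp ψ i) ⟩
    K * (ψ * exp ψ i)
      ≡⟨ cong (K *_) (exp-deriv ψ i) ⟨
    K * (ι (suc i) * exp ψ (suc i))
      ≡⟨ lem″ K (ι (suc i)) (exp ψ (suc i)) ⟩
    ι (suc i) * (K * exp ψ (suc i)) ∎)
    where
    open ℚ.≤-Reasoning
    lem : ∀ s r n k e w → s * ((r * n + k * (r * e)) * w) ≡ (n + k * e) * (r * s * w)
    lem = solve-∀ ℚ-ring
    lem′ : ∀ a b c → a * (b * c) ≡ b * (a * c)
    lem′ = solve-∀ ℚ-ring
    lem″ : ∀ a b c → a * (b * c) ≡ b * (a * c)
    lem″ = solve-∀ ℚ-ring

  private
    opaque
      unfolding ifac inv

      -- With u = 6/25 and K = 14 `Crude` fails at the indices 2, 3 and 4, so the supersolution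
      -- inequality itself is evaluated there; `Crude` takes over at index 5.
      supersolution₀ : ifac 3 + (ℤ.+ 14 / 1) * expTail (ℤ.+ 6 / 25) 2 ≤ (ℤ.+ 14 / 1) * exp (ℤ.+ 6 / 25) 2
      supersolution₀ = ≤!

      supersolution₁ : ifac 5 + (ℤ.+ 14 / 1) * expTail (ℤ.+ 6 / 25) 4 ≤ (ℤ.+ 14 / 1) * exp (ℤ.+ 6 / 25) 3
      supersolution₁ = ≤!

      supersolution₂ : ifac 7 + (ℤ.+ 14 / 1) * expTail (ℤ.+ 6 / 25) 6 ≤ (ℤ.+ 14 / 1) * exp (ℤ.+ 6 / 25) 4
      supersolution₂ = ≤!

      crude₃ : Crude (ℤ.+ 6 / 25) (ℤ.+ 6 / 25) (ℤ.+ 14 / 1) 10 5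
      crude₃ = ≤!

      -- Equality holds: 877/625 is 1 + 7 u² at u = 6/25.
      binary-bound : ifac 1 + (ℤ.+ 14 / 1) * expTail (ℤ.+ 6 / 25) 0 ≤ (ℤ.+ 877 / 625)
      binary-bound = ≤!

      -- The left side is about 0.994. Without the corrections from f 2 ≥ 1/6 and f 4 ≥ 1/12 it
      -- would be about 1.41, too large for a contraction.
      binary-θ<1 : let ξ = ℤ.+ 10 / 11; c = ι 10 * ξ ^ 11 in
        c * (ℤ.+ 877 / 625) - (c + ((c - ι 2 * ξ ^ 3) * (ℤ.+ 1 / 6) + (c - ι 4 * ξ ^ 5) * (ℤ.+ 1 / 12))) < 1ℚ
      binary-θ<1 = <!

      binary-f₂ : (ℤ.+ 1 / 6) ≤ ifac 3
      binary-f₂ = ≤!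

      binary-f₄ : (ℤ.+ 1 / 12) ≤ ifac 3 * ifac 2
      binary-f₄ = ≤!

  -- Write w = c - (c - w). The constant contributes at most c B, and the sum with the nonnegative
  -- weights c - w is bounded from below by its terms 0, 2 and 4.
  weighted-sum : ∀ {f w : Seq} {B} c p q → (∀ k → 0ℚ ≤ f k) → (∀ k → 0ℚ ≤ w k) → (∀ m → ∑ f m ≤ B) →
    0ℚ ≤ c → (∀ k → w k ≤ c) → w 0 ≡ 0ℚ → p ≤ f 2 → q ≤ f 4 →
    ∀ m → ∑ (λ k → f k * w k) m ≤ c * B - (c * f 0 + ((c - w 2) * p + (c - w 4) * q))
  weighted-sum {f} {w} {B} c p q 0≤f 0≤w f≤B 0≤c w≤c w₀ f₂ f₄ m = begin
    ∑ (λ k → f k * w k) m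
      ≤⟨ ∑-mono-index (λ k → 0≤f k 0* 0≤w k) (ℕ.m≤n+m m 4) ⟩
    ∑ (λ k → f k * w k) (4 ℕ.+ m)
      ≡⟨ lem₁ (∑ (λ k → f k * w k) (4 ℕ.+ m)) (∑ h (4 ℕ.+ m)) ⟩
    ∑ (λ k → f k * w k) (4 ℕ.+ m) + ∑ h (4 ℕ.+ m) - ∑ h (4 ℕ.+ m)
      ≡⟨ cong (_- ∑ h (4 ℕ.+ m)) (trans (sym (∑-+ _ h (4 ℕ.+ m))) (trans (∑-cong (4 ℕ.+ m) (λ k _ → lem₂ (f k) (w k) c))
           (∑-*ˡ c f (4 ℕ.+ m)))) ⟩
    c * ∑ f (4 ℕ.+ m) - ∑ h (4 ℕ.+ m)
      ≤⟨ *≤ c 0≤c (f≤B (4 ℕ.+ m)) +≤+ ℚ.neg-antimono-≤ (≤-trans h-lower (∑-mono-index 0≤h (ℕ.m≤m+n 4 m))) ⟩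
    c * B - (c * f 0 + ((c - w 2) * p + (c - w 4) * q)) ∎
    where
    open ℚ.≤-Reasoning
    h : Seq
    h k = (c - w k) * f k
    0≤h : ∀ k → 0ℚ ≤ h k
    0≤h k = 0≤q-p (w≤c k) 0* 0≤f k
    lem₁ : ∀ a b → a ≡ a + b - b
    lem₁ = solve-∀ ℚ-ring
    lem₂ : ∀ a w c → a * w + (c - w) * a ≡ c * a
    lem₂ = solve-∀ ℚ-ring
    lem₃ : ∀ c f → (c - 0ℚ) * f ≡ c * f
    lem₃ = solve-∀ ℚ-ring
    lem₄ : ∀ a b c d e → a + b + c + d + e ≡ a + (c + e) + (b + d)
    lem₄ = solve-∀ ℚ-ring
    h-lower : c * f 0 + ((c - w 2) * p + (c - w 4) * q) ≤ ∑ h 4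
    h-lower = begin
      c * f 0 + ((c - w 2) * p + (c - w 4) * q)
        ≤⟨ ℚ.≤-reflexive (trans (sym (lem₃ c (f 0))) (cong (λ t → (c - t) * f 0) (sym w₀)))
           +≤+ (*≤ (c - w 2) (0≤q-p (w≤c 2)) f₂ +≤+ *≤ (c - w 4) (0≤q-p (w≤c 4)) f₄) ⟩
      h 0 + (h 2 + h 4)
        ≤⟨ p≤p+q (0≤h 1 0+ 0≤h 3) ⟩
      h 0 + (h 2 + h 4) + (h 1 + h 3)
        ≡⟨ lem₄ (h 0) (h 1) (h 2) (h 3) (h 4) ⟨
      ∑ h 4 ∎

  binary-ratios : GeometricRatios (c 0)
  binary-ratios = geometric 0 B μ ξ θ f≤B <! <! ≤! binary-θ<1 mean
    -- The constants satisfy 21/250 ≤ 1/(6 B²), 21/1000 ≤ 1/(12 B⁴) and 1 + 21/250 + 21/1000 =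
    -- 221/200 = 1/μ.
    (y-lower 0 {B} {μ} {ℤ.+ 21 / 250} {ℤ.+ 21 / 1000} f≤B ≤! ≤! ≤! (≤-trans ≤! f₂) (≤-trans ≤! f₄) ≤!)
    where
    u B ξ μ c₀′ θ : ℚ
    u = ℤ.+ 6 / 25
    B = ℤ.+ 877 / 625
    ξ = ℤ.+ 10 / 11
    μ = ℤ.+ 200 / 221
    c₀′ = ι 10 * ξ ^ 11
    θ = c₀′ * B - (c₀′ + ((c₀′ - ι 2 * ξ ^ 3) * (ℤ.+ 1 / 6) + (c₀′ - ι 4 * ξ ^ 5) * (ℤ.+ 1 / 12)))

    crude : ∀ j → Crude u u (ι 14) ((5 ℕ.+ j) ℕ.* 2) (5 ℕ.+ j)
    crude zero    = crude₃
    -- Here n = 2 i, so 2 (i + 1) cancels against n + 2, and the condition `shrink` reduces to u (n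
    -- + 1) ≥ 1.
    crude (suc j) = crude-step {u} {u} {ι 14} {ι 2} 2 n (5 ℕ.+ j) ≤! ≤! ≤! shrink ≤! 2+n≤2n (crude j)
      where
      open ℚ.≤-Reasoning
      n = (5 ℕ.+ j) ℕ.* 2
      w = ifac (2 ℕ.+ n)
      2+n≤2n : ι (2 ℕ.+ n) ≤ ι 2 * ι n
      2+n≤2n = ≤≡ (ι-mono (ℕ.≤-trans (ℕ.+-monoˡ-≤ n (ℕ.m≤m+n 2 (8 ℕ.+ j ℕ.* 2))) (ℕ.≤-reflexive (cong (n ℕ.+_) (sym (ℕ.+-identityʳ n)))))) (ι-* 2 n)
      lem : ∀ u m s w → u * ι 2 * m * (s * w) ≡ u * (m * (s * ι 2 * w))
      lem = solve-∀ ℚ-ring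
      2≤ : ι 2 ≤ u * ι 2 * ι (suc n)
      2≤ = ≤-trans {j = u * ι 2 * ι 11} ≤! (*≤ (u * ι 2) ≤! (ι-mono (ℕ.m≤m+n 11 (j ℕ.* 2))))
      shrink : ι 2 * ι (6 ℕ.+ j) * w ≤ u * ifac n
      shrink = begin
        ι 2 * ι (6 ℕ.+ j) * w
          ≡⟨ ℚ.*-assoc (ι 2) (ι (6 ℕ.+ j)) w ⟩
        ι 2 * (ι (6 ℕ.+ j) * w)
          ≤⟨ ≤* (ι (6 ℕ.+ j) * w) (0≤ι (6 ℕ.+ j) 0* 0≤ifac (2 ℕ.+ n)) 2≤ ⟩
        u * ι 2 * ι (suc n) * (ι (6 ℕ.+ j) * w)
          ≡⟨ lem u (ι (suc n)) (ι (6 ℕ.+ j)) w ⟩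
        u * (ι (suc n) * (ι (6 ℕ.+ j) * ι 2 * w))
          ≡⟨ cong (λ t → u * (ι (suc n) * (t * w))) (ι-* (6 ℕ.+ j) 2) ⟨
        u * (ι (suc n) * (ι (2 ℕ.+ n) * w))
          ≡⟨ cong (λ t → u * (ι (suc n) * t)) (suc-ifac (suc n)) ⟩
        u * (ι (suc n) * ifac (suc n))
          ≡⟨ cong (u *_) (suc-ifac n) ⟩
        u * ifac n ∎

    F≤ : ∀ M → ∑ (λ l → F 0 1 l * 1ℚ ^ l) M ≤ B
    F≤ M = ≤-trans (F-generating-bound 0 1ℚ u u (ι 14) ≤! ≤! ≤! refl
      (λ where
        0 → supersolution₀
        1 → supersolution₁
        2 → supersolution₂
        (suc (suc (suc j))) → crude⇒ {u} {u} {ι 14} ≤! ≤! ((4 ℕ.+ j) ℕ.* 2) (5 ℕ.+ j) (crude j)) M) binary-bound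

    x≡1 : x 0 ≡ 1ℚ
    x≡1 = sym (inv-unique (0<ifac 1) (trans (ℚ.*-identityʳ (ifac 1)) (ifac₁ 0)))

    f≡F : ∀ k → f 0 k ≡ F 0 1 k
    f≡F k = trans (cong (λ t → t * (F 0 1 k * t ^ k)) x≡1) (trans (ℚ.*-identityˡ _) (trans (cong (F 0 1 k *_) (1^ k)) (ℚ.*-identityʳ _)))

    f≤B : ∀ m → ∑ (f 0) m ≤ B
    f≤B m = ≡≤ (∑-cong m (λ k _ → trans (f≡F k) (trans (sym (ℚ.*-identityʳ _)) (cong (F 0 1 k *_) (sym (1^ k)))))) (F≤ m)

    f₂ : (ℤ.+ 1 / 6) ≤ f 0 2
    f₂ = ≤-trans binary-f₂ (≤≡ (≤-trans (F₂₀-lower 0) (≡≤ (trans (sym (ℚ.*-identityʳ _)) (cong (F 0 2 0 *_) (sym ifac₀))) (F₁-lower 0 0)))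
      (sym (f≡F 2)))

    f₄ : (ℤ.+ 1 / 12) ≤ f 0 4
    f₄ = ≤-trans binary-f₄ (≤-trans (≤* (ifac 2) (0≤ifac 2) (F₂₀-lower 0)) (≤-trans (F₂₂-lower 0)
      (≤≡ (≡≤ (trans (sym (ℚ.*-identityʳ _)) (cong (F 0 2 2 *_) (sym ifac₀))) (F₁-lower 0 2)) (sym (f≡F 4)))))

    w : Seq
    w k = ι k * ξ ^ suc k

    -- k ξᵏ⁺¹ is largest at k = 10 and k = 11.
    w≤ : ∀ k → w k ≤ c₀′
    w≤ 0 = ≤!
    w≤ 1 = ≤!
    w≤ 2 = ≤!
    w≤ 3 = ≤!
    w≤ 4 = ≤!
    w≤ 5 = ≤!
    w≤ 6 = ≤!
    w≤ 7 = ≤!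
    w≤ 8 = ≤!
    w≤ 9 = ≤!
    w≤ (suc (suc (suc (suc (suc (suc (suc (suc (suc (suc k)))))))))) = go k
      where
      go : ∀ k → w (10 ℕ.+ k) ≤ c₀′
      go zero    = ≤!
      go (suc k) = ≤-trans (≡≤ (sym (ℚ.*-assoc (ι (11 ℕ.+ k)) ξ (ξ ^ (11 ℕ.+ k))))
        (≤* (ξ ^ (11 ℕ.+ k)) (0≤^ {ξ} (11 ℕ.+ k) ≤!) decrease)) (go k)
        where
        lem : ∀ k → ι 10 + k ≡ (ι 11 + k) * ξ + (ι 1 - ξ) * k
        lem = solve-∀ ℚ-ring
        decrease : ι (11 ℕ.+ k) * ξ ≤ ι (10 ℕ.+ k)
        decrease = ≡≤ (cong (_* ξ) (ι-+ 11 k)) (≤-by ((ι 1 - ξ) * ι k) (_0*_ {ι 1 - ξ} {ι k} ≤! (0≤ι k)) (trans (ι-+ 10 k) (lem (ι k))))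

    mean : ∀ m → ∑ (λ k → f 0 k * w k) m ≤ θ
    mean m = ≤≡ (weighted-sum {f 0} {w} {B} c₀′ (ℤ.+ 1 / 6) (ℤ.+ 1 / 12) (0≤f 0) (λ k → 0≤ι k 0* 0≤^ {ξ} (suc k) ≤!) f≤B ≤! w≤ (ℚ.*-zeroˡ (ξ ^ 1)) f₂ f₄ m)
      (cong (λ t → c₀′ * B - (t + ((c₀′ - ι 2 * ξ ^ 3) * (ℤ.+ 1 / 6) + (c₀′ - ι 4 * ξ ^ 5) * (ℤ.+ 1 / 12))))
        (trans (cong (c₀′ *_) (f₀ 0)) (ℚ.*-identityʳ c₀′)))

  -- A lower bound 3ᵏ for the binomial coefficient of n + k over k: each of its factors (n + j)/j
  -- with j ≤ k is at least 3 when n ≥ 2 k.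
  ifac-rise : ∀ k {n} → 2 ℕ.* k ℕ.≤ n → ι 3 ^ k * ifac (k ℕ.+ n) ≤ ifac n * ifac k
  ifac-rise zero    {n} _ = ≤≡ (ℚ.≤-reflexive (ℚ.*-comm 1ℚ (ifac n))) (cong (ifac n *_) (sym ifac₀))
  ifac-rise (suc k) {n} h = *-cancel-≤ (ι (suc k)) (0<ι k) (begin
    ι (suc k) * (ι 3 * ι 3 ^ k * w)
      ≡⟨ lem₁ (ι (suc k)) (ι 3) (ι 3 ^ k) w ⟩
    ι 3 ^ k * w * (ι 3 * ι (suc k))
      ≤⟨ *≤ (ι 3 ^ k * w) (0≤^ k (0≤ι 3) 0* 0≤ifac (suc (k ℕ.+ n))) (≡≤ (sym (ι-* 3 (suc k))) (ι-mono 3k≤)) ⟩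
    ι 3 ^ k * w * ι (suc (k ℕ.+ n))
      ≡⟨ lem₂ (ι 3 ^ k) w (ι (suc (k ℕ.+ n))) ⟩
    ι 3 ^ k * (ι (suc (k ℕ.+ n)) * w)
      ≡⟨ cong (ι 3 ^ k *_) (suc-ifac (k ℕ.+ n)) ⟩
    ι 3 ^ k * ifac (k ℕ.+ n)
      ≤⟨ ifac-rise k (ℕ.≤-trans (ℕ.*-monoʳ-≤ 2 (ℕ.n≤1+n k)) h) ⟩
    ifac n * ifac k
      ≡⟨ cong (ifac n *_) (suc-ifac k) ⟨
    ifac n * (ι (suc k) * ifac (suc k))
      ≡⟨ lem₃ (ifac n) (ι (suc k)) (ifac (suc k)) ⟩
    ι (suc k) * (ifac n * ifac (suc k)) ∎)
    where
    open ℚ.≤-Reasoning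
    w = ifac (suc (k ℕ.+ n))
    3k≤ : 3 ℕ.* suc k ℕ.≤ suc (k ℕ.+ n)
    3k≤ = ℕ.+-monoʳ-≤ (suc k) h
    lem₁ : ∀ a b c d → a * (b * c * d) ≡ c * d * (b * a)
    lem₁ = solve-∀ ℚ-ring
    lem₂ : ∀ a b c → a * b * c ≡ a * (c * b)
    lem₂ = solve-∀ ℚ-ring
    lem₃ : ∀ a b c → a * (b * c) ≡ b * (a * c)
    lem₃ = solve-∀ ℚ-ring

  private
    opaque
      unfolding ifac inv

      base-case : ifac 6 * (ι 6 + (ℤ.+ 3 / 2) * (ℤ.+ 9 / 4) ^ 3) * (ℤ.+ 288 / 25) ≤ (ℤ.+ 3 / 2) * (ifac 2 * ifac 2)
      base-case = ≤!

      ifac₂ : ifac 2 ≡ ½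
      ifac₂ = refl

  private
    ⅓ ¾ 1½ 2¼ : ℚ
    ⅓  = ℤ.+ 1 / 3
    ¾  = ℤ.+ 3 / 4
    1½ = ℤ.+ 3 / 2
    2¼ = ℤ.+ 9 / 4

    -- The slack in the induction step of `base`, at m = ι n: after multiplying out, only
    -- nonnegative coefficients remain.
    base-slack : ∀ m w h E → (ι 2 + ι 2 * m) * (ι 1 + ι 2 * m) * ⅓ * (w * (ι 2 * m + E) * h) ≡
      m * m * (w * ((ι 2 + ι 2 * m) + ¾ * E) * h) +
      ⅓ * (w * h) * (ι 2 * m * m * m + ι 6 * m * m + ι 4 * m + E * ((ℤ.+ 7 / 4) * m * m + ι 6 * m + ι 2))
    base-slack = solve-∀ ℚ-ring

  module Nonbinary (γ : ℕ) where

    private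
      β b p : ℕ
      β = suc γ
      b = 3 ℕ.+ γ
      p = 2 ℕ.+ γ

      K : ℕ → ℚ
      K k = 1½ * ⅓ ^ k

      0≤K : ∀ k → 0ℚ ≤ K k
      0≤K k = _0*_ {1½} ≤! (0≤^ {⅓} k ≤!)

      -- X exceeds x by the factor 6/5, which exhibits geometric decay of f; ψ is then determined by
      -- X ψ = 1/2.
      X ψ : ℚ
      X = (ℤ.+ 6 / 5) * x β
      ψ = (ℤ.+ 5 / 12) * ifac p

      0≤ψ : 0ℚ ≤ ψ
      0≤ψ = _0*_ {ℤ.+ 5 / 12} ≤! (0≤ifac p)

      0≤X : 0ℚ ≤ X
      0≤X = _0*_ {ℤ.+ 6 / 5} ≤! (<⇒≤ (0<x β))

      Xψ : X * ψ ≡ ½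
      Xψ = trans (lem (ℤ.+ 6 / 5) (ℤ.+ 5 / 12) (x β) (ifac p)) (cong ((ℤ.+ 6 / 5) * (ℤ.+ 5 / 12) *_) (x*ifac β))
        where
        lem : ∀ a b c d → a * c * (b * d) ≡ a * b * (c * d)
        lem = solve-∀ ℚ-ring

      -- The inequality `crude₀` in a form suited to induction on the base: 9/4 = (3/2)² and 288/25
      -- = 2/(5/12)².
      base : ∀ k → let n = 3 ℕ.+ k in
        ifac (2 ℕ.* n) * (ι (2 ℕ.* n) + K k * 2¼ ^ n) * (ℤ.+ 288 / 25) ≤ K k * (ifac (2 ℕ.+ k) * ifac (2 ℕ.+ k))
      base zero    = base-case
      base (suc k) = *-cancel-≤ (ι n * ι n) (pos* (0<ι (2 ℕ.+ k)) (0<ι (2 ℕ.+ k))) (begin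
        ι n * ι n * (ifac (2 ℕ.* suc n) * (ι (2 ℕ.* suc n) + K (suc k) * q ^ suc n) * h)
          ≡⟨ cong (λ t → ι n * ι n * (ifac t * (ι t + K (suc k) * q ^ suc n) * h)) (ℕ.*-suc 2 n) ⟩
        ι n * ι n * (w * (ι (2 ℕ.+ N) + 1½ * (⅓ * ⅓ ^ k) * (q * q ^ n)) * h)
          ≡⟨ cong₂ (λ s t → ι n * ι n * (w * (s + t) * h)) (trans (ι-+ 2 N) (cong (ι 2 +_) (ι-* 2 n))) (lem₁ 1½ ⅓ (⅓ ^ k) q (q ^ n)) ⟩
        ι n * ι n * (w * ((ι 2 + ι 2 * ι n) + ¾ * E) * h)
          ≤⟨ ≤-by _ (0≤⅓wh 0* (0≤poly 0+ (0≤E 0* 0≤poly′))) (base-slack (ι n) w h E) ⟩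
        (ι 2 + ι 2 * ι n) * (ι 1 + ι 2 * ι n) * ⅓ * (w * (ι 2 * ι n + E) * h)
          ≡⟨ cong₂ (λ s t → s * (ι 1 + t) * ⅓ * (w * (t + E) * h))
               (sym (trans (ι-+ 2 N) (cong (ι 2 +_) (ι-* 2 n)))) (sym (ι-* 2 n)) ⟩
        ι (2 ℕ.+ N) * (ι 1 + ι N) * ⅓ * (w * (ι N + E) * h)
          ≡⟨ cong (λ t → ι (2 ℕ.+ N) * t * ⅓ * (w * (ι N + E) * h)) (sym (ι-suc N)) ⟩
        ι (2 ℕ.+ N) * ι (suc N) * ⅓ * (w * (ι N + E) * h)
          ≡⟨ lem₃ (ι (2 ℕ.+ N)) (ι (suc N)) ⅓ w (ι N + E) h ⟩
        ⅓ * (ι (suc N) * (ι (2 ℕ.+ N) * w) * (ι N + E) * h)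
          ≡⟨ cong (λ t → ⅓ * (t * (ι N + E) * h)) (trans (cong (ι (suc N) *_) (suc-ifac (suc N))) (suc-ifac N)) ⟩
        ⅓ * (ifac N * (ι N + E) * h)
          ≤⟨ *≤ ⅓ ≤! (base k) ⟩
        ⅓ * (K k * (ifac (2 ℕ.+ k) * ifac (2 ℕ.+ k)))
          ≡⟨ cong (λ t → ⅓ * (K k * (t * t))) (suc-ifac (2 ℕ.+ k)) ⟨
        ⅓ * (K k * (ι n * ifac n * (ι n * ifac n)))
          ≡⟨ lem₄ ⅓ 1½ (⅓ ^ k) (ι n) (ifac n) ⟩
        ι n * ι n * (K (suc k) * (ifac n * ifac n)) ∎)
        where
        open ℚ.≤-Reasoning
        n = 3 ℕ.+ k
        N = 2 ℕ.* n
        q h w E : ℚ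
        q = 2¼
        h = ℤ.+ 288 / 25
        w = ifac (2 ℕ.+ N)
        E = K k * q ^ n
        lem₁ : ∀ a b c d e → a * (b * c) * (d * e) ≡ b * d * (a * c * e)
        lem₁ = solve-∀ ℚ-ring
        lem₃ : ∀ a b c d e f → a * b * c * (d * e * f) ≡ c * (b * (a * d) * e * f)
        lem₃ = solve-∀ ℚ-ring
        lem₄ : ∀ t a c n i → t * (a * c * (n * i * (n * i))) ≡ n * n * (a * (t * c) * (i * i))
        lem₄ = solve-∀ ℚ-ring
        0≤m = 0≤ι n
        0≤E : 0ℚ ≤ E
        0≤E = 0≤K k 0* 0≤^ {2¼} n ≤!
        0≤⅓wh : 0ℚ ≤ ⅓ * (w * h)
        0≤⅓wh = _0*_ {⅓} ≤! (_0*_ {w} {h} (0≤ifac (2 ℕ.+ N)) ≤!)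
        0≤poly : 0ℚ ≤ ι 2 * ι n * ι n * ι n + ι 6 * ι n * ι n + ι 4 * ι n
        0≤poly = (0≤ι 2 0* 0≤m 0* 0≤m 0* 0≤m) 0+ (0≤ι 6 0* 0≤m 0* 0≤m) 0+ (0≤ι 4 0* 0≤m)
        0≤poly′ : 0ℚ ≤ (ℤ.+ 7 / 4) * ι n * ι n + ι 6 * ι n + ι 2
        0≤poly′ = (_0*_ {ℤ.+ 7 / 4} {ι n} ≤! 0≤m 0* 0≤m) 0+ (0≤ι 6 0* 0≤m) 0+ 0≤ι 2

      ^-2* : ∀ q n → q ^ (2 ℕ.* n) ≡ (q * q) ^ n
      ^-2* q n = trans (^-+ q n (n ℕ.+ 0)) (trans (cong (λ m → q ^ n * q ^ m) (ℕ.+-identityʳ n)) (sym (*-^ q q n)))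

      crude₀ : Crude ½ ψ (K γ) (2 ℕ.* b) 2
      crude₀ = begin
        (ι (2 ℕ.* b) + K γ * 1½ ^ (2 ℕ.* b)) * w
          ≡⟨ cong (λ t → (ι (2 ℕ.* b) + K γ * t) * w) (^-2* 1½ b) ⟩
        (ι (2 ℕ.* b) + K γ * 2¼ ^ b) * w
          ≡⟨ lem₁ (ι (2 ℕ.* b) + K γ * 2¼ ^ b) w ⟩
        (ℤ.+ 25 / 288) * (w * (ι (2 ℕ.* b) + K γ * 2¼ ^ b) * (ℤ.+ 288 / 25))
          ≤⟨ *≤ (ℤ.+ 25 / 288) ≤! (base γ) ⟩
        (ℤ.+ 25 / 288) * (K γ * (ifac p * ifac p))
          ≡⟨ lem₂ (K γ) (ifac p) ⟩
        K γ * (ψ * (ψ * 1ℚ) * ½)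
          ≡⟨ cong (λ t → K γ * (ψ * (ψ * 1ℚ) * t)) ifac₂ ⟨
        K γ * exp ψ 2 ∎
        where
        open ℚ.≤-Reasoning
        w = ifac (2 ℕ.* b)
        lem₁ : ∀ a w → a * w ≡ (ℤ.+ 25 / 288) * (w * a * (ℤ.+ 288 / 25))
        lem₁ = solve-∀ ℚ-ring
        lem₂ : ∀ k i → (ℤ.+ 25 / 288) * (k * (i * i)) ≡ k * ((ℤ.+ 5 / 12) * i * ((ℤ.+ 5 / 12) * i * 1ℚ) * ½)
        lem₂ = solve-∀ ℚ-ring

      -- Chosen for `shrink`: b + n = (i + 3) b cancels one factor of the factorial of b + n, and
      -- `ifac-rise` accounts for the other b - 1.
      r : ℚ
      r = (ℤ.+ 5 / 12) * (ι b * ι 3 ^ p)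

      r≥ : ∀ {q} → q ≤ ι 3 ^ p → (ℤ.+ 5 / 4) * q ≤ r
      r≥ {q} h = ≤-trans (*≤ (ℤ.+ 5 / 4) ≤! h) (≡≤ (lem (ι 3 ^ p)) (*≤ (ℤ.+ 5 / 12) ≤!
        (≤* (ι 3 ^ p) (0≤^ p (0≤ι 3)) (ι-mono (ℕ.m≤m+n 3 γ)))))
        where
        lem : ∀ t → (ℤ.+ 5 / 4) * t ≡ (ℤ.+ 5 / 12) * (ι 3 * t)
        lem = solve-∀ ℚ-ring

      1½^≤ : ∀ k → 1½ ^ (2 ℕ.+ k) ≤ ½ * ι 3 ^ (2 ℕ.+ k)
      1½^≤ zero    = ≤!
      1½^≤ (suc k) = ≤≡ (*≤* {1½} {ι 3} {1½ ^ (2 ℕ.+ k)} {½ * ι 3 ^ (2 ℕ.+ k)} ≤! (_0*_ {½} ≤! (0≤^ (2 ℕ.+ k) (0≤ι 3))) ≤! (1½^≤ k))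
        (lem (ι 3) (ι 3 ^ (2 ℕ.+ k)))
        where
        lem : ∀ a b → a * (½ * b) ≡ ½ * (a * b)
        lem = solve-∀ ℚ-ring

      9≤3^p : ι 9 ≤ ι 3 ^ p
      9≤3^p = go γ
        where
        go : ∀ k → ι 9 ≤ ι 3 ^ (2 ℕ.+ k)
        go zero    = ≤!
        go (suc k) = ≤-trans (go k) (≡≤ (sym (ℚ.*-identityˡ (ι 3 ^ (2 ℕ.+ k)))) (≤* {1ℚ} {ι 3} (ι 3 ^ (2 ℕ.+ k)) (0≤^ (2 ℕ.+ k) (0≤ι 3)) ≤!))

      crude : ∀ i → Crude ½ ψ (K γ) ((2 ℕ.+ i) ℕ.* b) (2 ℕ.+ i)
      crude zero    = crude₀
      crude (suc i) = crude-step {½} {ψ} {K γ} {r} b n (2 ℕ.+ i) ≤! 0≤ψ (0≤K γ) shrink r≥₁ r≥₂ (crude i)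
        where
        open ℚ.≤-Reasoning
        n = (2 ℕ.+ i) ℕ.* b
        w = ifac (b ℕ.+ n)
        b≤n : b ℕ.≤ n
        b≤n = ℕ.m≤m+n b ((1 ℕ.+ i) ℕ.* b)
        2p≤n : 2 ℕ.* p ℕ.≤ n
        2p≤n = ℕ.≤-trans (ℕ.*-monoʳ-≤ 2 (ℕ.n≤1+n p)) (ℕ.*-monoˡ-≤ b (ℕ.m≤m+n 2 i))
        lem₁ : ∀ a b t s w → a * (b * t) * s * w ≡ a * (t * (s * b * w))
        lem₁ = solve-∀ ℚ-ring
        lem₂ : ∀ a b c → a * (b * c) ≡ a * c * b
        lem₂ = solve-∀ ℚ-ring
        shrink : r * ι (3 ℕ.+ i) * w ≤ ψ * ifac n
        shrink = begin
          r * ι (3 ℕ.+ i) * w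
            ≡⟨ lem₁ (ℤ.+ 5 / 12) (ι b) (ι 3 ^ p) (ι (3 ℕ.+ i)) w ⟩
          (ℤ.+ 5 / 12) * (ι 3 ^ p * (ι (3 ℕ.+ i) * ι b * w))
            ≡⟨ cong (λ t → (ℤ.+ 5 / 12) * (ι 3 ^ p * (t * w))) (ι-* (3 ℕ.+ i) b) ⟨
          (ℤ.+ 5 / 12) * (ι 3 ^ p * (ι (b ℕ.+ n) * w))
            ≡⟨ cong (λ t → (ℤ.+ 5 / 12) * (ι 3 ^ p * t)) (suc-ifac (p ℕ.+ n)) ⟩
          (ℤ.+ 5 / 12) * (ι 3 ^ p * ifac (p ℕ.+ n))
            ≤⟨ *≤ (ℤ.+ 5 / 12) ≤! (ifac-rise p 2p≤n) ⟩
          (ℤ.+ 5 / 12) * (ifac n * ifac p)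
            ≡⟨ lem₂ (ℤ.+ 5 / 12) (ifac n) (ifac p) ⟩
          ψ * ifac n ∎
        r≥₁ : 1½ ^ b ≤ r
        r≥₁ = ≤-trans (≤≡ (*≤ 1½ ≤! (1½^≤ γ)) (sym (ℚ.*-assoc 1½ ½ (ι 3 ^ p))))
          (≤-trans (≤* {¾} {ℤ.+ 5 / 4} (ι 3 ^ p) (0≤^ p (0≤ι 3)) ≤!) (r≥ ≤-refl))
        r≥₂ : ι (b ℕ.+ n) ≤ r * ι n
        r≥₂ = ≤-trans (ι-mono (ℕ.≤-trans (ℕ.+-monoˡ-≤ n b≤n) (ℕ.≤-reflexive (cong (n ℕ.+_) (sym (ℕ.+-identityʳ n))))))
          (≡≤ (ι-* 2 n) (≤* (ι n) (0≤ι n) (≤-trans {ι 2} {(ℤ.+ 5 / 4) * ι 9} ≤! (r≥ 9≤3^p))))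

      -- The value of (1 + 1/2)ᵏ⁺³ with the terms 0 and 1 of its binomial expansion removed.
      excess : ℕ → ℚ
      excess k = 1½ ^ (3 ℕ.+ k) - 1ℚ - ½ * ι (3 ℕ.+ k)

      excess-suc : ∀ k → excess (suc k) ≡ 1½ * excess k + (ℤ.+ 1 / 4) * ι (3 ℕ.+ k)
      excess-suc k = trans (cong (λ t → 1½ ^ (4 ℕ.+ k) - 1ℚ - ½ * t) (ι-suc (3 ℕ.+ k))) (lem (1½ ^ (3 ℕ.+ k)) (ι (3 ℕ.+ k)))
        where
        lem : ∀ P m → 1½ * P - 1ℚ - ½ * (1ℚ + m) ≡ 1½ * (P - 1ℚ - ½ * m) + (ℤ.+ 1 / 4) * m
        lem = solve-∀ ℚ-ring

      excess-lower : ∀ k → (ℤ.+ 1 / 4) * ι (3 ℕ.+ k) ≤ excess k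
      excess-lower zero    = ≤!
      excess-lower (suc k) = ≤-trans (≡≤ (cong ((ℤ.+ 1 / 4) *_) (ι-suc (3 ℕ.+ k))) (≤-by _ (p≤q⇒ k) (lem (ι (3 ℕ.+ k)))))
        (≤≡ (*≤ 1½ ≤! (excess-lower k) +≤+ ≤-refl {(ℤ.+ 1 / 4) * ι (3 ℕ.+ k)}) (sym (excess-suc k)))
        where
        lem : ∀ m → 1½ * ((ℤ.+ 1 / 4) * m) + (ℤ.+ 1 / 4) * m ≡ (ℤ.+ 1 / 4) * (1ℚ + m) + (ℤ.+ 3 / 8) * (m - (ℤ.+ 2 / 3))
        lem = solve-∀ ℚ-ring
        p≤q⇒ : ∀ k → 0ℚ ≤ (ℤ.+ 3 / 8) * (ι (3 ℕ.+ k) - (ℤ.+ 2 / 3))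
        p≤q⇒ k = _0*_ {ℤ.+ 3 / 8} ≤! (0≤q-p (≤-trans {ℤ.+ 2 / 3} {ι 3} ≤! (ι-mono (ℕ.m≤m+n 3 k))))

      -- Equality holds at k = 0. From k to k + 1 the factor K loses a factor 3, while by
      -- `excess-lower` the excess grows at most by the factor 5/2.
      excess-bound : ∀ k → K k * excess k ≤ (ℤ.+ 21 / 16)
      excess-bound zero    = ≤!
      excess-bound (suc k) = ≤-trans (begin
        K (suc k) * excess (suc k)
          ≡⟨ cong (K (suc k) *_) (excess-suc k) ⟩
        1½ * (⅓ * ⅓ ^ k) * (1½ * excess k + (ℤ.+ 1 / 4) * ι (3 ℕ.+ k))
          ≡⟨ lem (⅓ ^ k) (excess k) ((ℤ.+ 1 / 4) * ι (3 ℕ.+ k)) ⟩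
        K k * (½ * excess k + ⅓ * ((ℤ.+ 1 / 4) * ι (3 ℕ.+ k)))
          ≤⟨ *≤ (K k) (0≤K k) (ℚ.+-monoʳ-≤ (½ * excess k) (*≤ ⅓ ≤! (excess-lower k))) ⟩
        K k * (½ * excess k + ⅓ * excess k)
          ≤⟨ *≤ (K k) (0≤K k) (≤-by ((ℤ.+ 1 / 6) * excess k) (_0*_ {ℤ.+ 1 / 6} ≤! (≤-trans (_0*_ {ℤ.+ 1 / 4} ≤! (0≤ι (3 ℕ.+ k))) (excess-lower k)))
               (lem′ (excess k))) ⟩
        K k * excess k ∎) (excess-bound k)
        where
        open ℚ.≤-Reasoning
        lem : ∀ t e m → 1½ * (⅓ * t) * (1½ * e + m) ≡ 1½ * t * (½ * e + ⅓ * m)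
        lem = solve-∀ ℚ-ring
        lem′ : ∀ e → e ≡ ½ * e + ⅓ * e + (ℤ.+ 1 / 6) * e
        lem′ = solve-∀ ℚ-ring

      expTail≡ : expTail ½ β ≡ ifac b * excess γ
      expTail≡ = begin
        expTail ½ β
          ≡⟨ lem₁ (ifac b) (½ * ifac p) (expTail ½ β) ⟩
        (ifac b + (½ * ifac p + expTail ½ β)) - ifac b - ½ * ifac p
          ≡⟨ cong₂ (λ s t → s - ifac b - ½ * t) (sym (expTail-exp ½ β)) (sym (suc-ifac p)) ⟩
        1½ ^ b * ifac b - ifac b - ½ * (ι b * ifac b)
          ≡⟨ lem₂ (1½ ^ b) (ifac b) (ι b) ⟩
        ifac b * excess γ ∎
        where
        open ≡-Reasoning
        lem₁ : ∀ a b c → c ≡ (a + (b + c)) - a - b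
        lem₁ = solve-∀ ℚ-ring
        lem₂ : ∀ P i m → P * i - i - ½ * (m * i) ≡ i * (P - 1ℚ - ½ * m)
        lem₂ = solve-∀ ℚ-ring

      -- Since x / b! = 1/b, the bound 21/16 improves to 21/(16 b) ≤ 7/16.
      small : x β * (K γ * expTail ½ β) ≤ (ℤ.+ 7 / 16)
      small = *-cancel-≤ (ι b) (0<ι p) (begin
        ι b * (x β * (K γ * expTail ½ β))
          ≡⟨ cong (λ t → ι b * (x β * (K γ * t))) expTail≡ ⟩
        ι b * (x β * (K γ * (ifac b * excess γ)))
          ≡⟨ lem (ι b) (x β) (K γ) (ifac b) (excess γ) ⟩
        x β * (ι b * ifac b) * (K γ * excess γ)
          ≡⟨ cong (λ t → x β * t * (K γ * excess γ)) (suc-ifac p) ⟩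
        x β * ifac p * (K γ * excess γ)
          ≡⟨ trans (cong (_* (K γ * excess γ)) (x*ifac β)) (ℚ.*-identityˡ _) ⟩
        K γ * excess γ
          ≤⟨ excess-bound γ ⟩
        (ℤ.+ 21 / 16)
          ≤⟨ ≤! ⟩
        ι 3 * (ℤ.+ 7 / 16)
          ≤⟨ ≤* (ℤ.+ 7 / 16) ≤! (ι-mono (ℕ.m≤m+n 3 γ)) ⟩
        ι b * (ℤ.+ 7 / 16) ∎)
        where
        open ℚ.≤-Reasoning
        lem : ∀ b x k i e → b * (x * (k * (i * e))) ≡ x * (b * i) * (k * e)
        lem = solve-∀ ℚ-ring

      -- B = 6/5 (1 + 7/16) bounds the sums of f k sᵏ⁺¹, and c₀′ is the maximum of k (5/6)ᵏ⁺¹,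
      -- attained at k = 5 and k = 6. The zeros are trivial lower bounds for the terms 2 and 4,
      -- since here θ < 1 without their help.
      s B c₀′ θ : ℚ
      s   = ℤ.+ 6 / 5
      B   = ℤ.+ 69 / 40
      c₀′ = ι 5 * (ℤ.+ 5 / 6) ^ 6
      θ   = c₀′ * B - (c₀′ * s + ((c₀′ - ι 2 * (ℤ.+ 5 / 6) ^ 3) * 0ℚ + (c₀′ - ι 4 * (ℤ.+ 5 / 6) ^ 5) * 0ℚ))

      f′ w : Seq
      f′ k = f β k * s ^ suc k
      w k  = ι k * (ℤ.+ 5 / 6) ^ suc k

      f′≤B : ∀ m → ∑ f′ m ≤ B
      f′≤B m = begin
        ∑ f′ m
          ≡⟨ ∑-cong m (λ k _ → trans (lem (x β) (F β 1 k) (x β ^ k) s (s ^ k)) (cong (λ t → X * (F β 1 k * t)) (sym (*-^ s (x β) k)))) ⟩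
        ∑ (λ k → X * (F β 1 k * X ^ k)) m
          ≡⟨ ∑-*ˡ X _ m ⟩
        X * ∑ (λ k → F β 1 k * X ^ k) m
          ≤⟨ *≤ X 0≤X (F-generating-bound β X ½ ψ (K γ) 0≤X 0≤ψ (0≤K γ) Xψ
               (λ i → crude⇒ {½} {ψ} {K γ} ≤! (0≤K γ) (β ℕ.+ suc i ℕ.* b) (2 ℕ.+ i) (crude i)) m) ⟩
        X * (ifac p + K γ * expTail ½ β)
          ≡⟨ lem′ (x β) (ifac p) (K γ * expTail ½ β) ⟩
        s * (x β * ifac p) + s * (x β * (K γ * expTail ½ β))
          ≤⟨ ℚ.≤-reflexive (cong (s *_) (x*ifac β)) +≤+ *≤ s ≤! small ⟩
        s * 1ℚ + s * (ℤ.+ 7 / 16)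
          ≤⟨ ≤! ⟩
        B ∎
        where
        open ℚ.≤-Reasoning
        lem : ∀ x f y s t → x * (f * y) * (s * t) ≡ s * x * (f * (t * y))
        lem = solve-∀ ℚ-ring
        lem′ : ∀ x i t → (ℤ.+ 6 / 5) * x * (i + t) ≡ (ℤ.+ 6 / 5) * (x * i) + (ℤ.+ 6 / 5) * (x * t)
        lem′ = solve-∀ ℚ-ring

      f≤B : ∀ m → ∑ (f β) m ≤ B
      f≤B m = ≤-trans (∑-mono m (λ k _ → ≡≤ (sym (ℚ.*-identityʳ (f β k))) (*≤ (f β k) (0≤f β k) (1≤^ {s} (suc k) ≤!)))) (f′≤B m)

      w≤ : ∀ k → w k ≤ c₀′
      w≤ 0 = ≤!
      w≤ 1 = ≤!
      w≤ 2 = ≤!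
      w≤ 3 = ≤!
      w≤ 4 = ≤!
      w≤ (suc (suc (suc (suc (suc k))))) = go k
        where
        v : ℚ
        v = ℤ.+ 5 / 6
        go : ∀ k → w (5 ℕ.+ k) ≤ c₀′
        go zero    = ≤!
        go (suc k) = ≤-trans (≡≤ (sym (ℚ.*-assoc (ι (6 ℕ.+ k)) v (v ^ (6 ℕ.+ k))))
          (≤* (v ^ (6 ℕ.+ k)) (0≤^ {v} (6 ℕ.+ k) ≤!) decrease)) (go k)
          where
          lem : ∀ k → ι 5 + k ≡ (ι 6 + k) * (ℤ.+ 5 / 6) + (ℤ.+ 1 / 6) * k
          lem = solve-∀ ℚ-ring
          decrease : ι (6 ℕ.+ k) * v ≤ ι (5 ℕ.+ k)
          decrease = ≡≤ (cong (_* v) (ι-+ 6 k)) (≤-by ((ℤ.+ 1 / 6) * ι k) (_0*_ {ℤ.+ 1 / 6} {ι k} ≤! (0≤ι k)) (trans (ι-+ 5 k) (lem (ι k))))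

      0≤f′ : ∀ k → 0ℚ ≤ f′ k
      0≤f′ k = 0≤f β k 0* 0≤^ {s} (suc k) ≤!

      -- Because s · 5/6 = 1, the growing factor sᵏ⁺¹ in f′ is compensated by the decay of w, which
      -- is why ξ = 1 is possible.
      mean : ∀ m → ∑ (λ k → f β k * (ι k * 1ℚ ^ suc k)) m ≤ θ
      mean m = ≡≤ (∑-cong m (λ k _ → trans (cong (λ t → f β k * (ι k * t)) (trans (1^ (suc k)) (trans (sym (1^ (suc k)))
          (*-^ s (ℤ.+ 5 / 6) (suc k))))) (lem (f β k) (ι k) (s ^ suc k) ((ℤ.+ 5 / 6) ^ suc k))))
        (≤≡ (weighted-sum {f′} {w} {B} c₀′ 0ℚ 0ℚ 0≤f′ (λ k → 0≤ι k 0* 0≤^ {ℤ.+ 5 / 6} (suc k) ≤!) f′≤B ≤! w≤ refl (0≤f′ 2) (0≤f′ 4) m)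
          (cong (λ t → c₀′ * B - (c₀′ * t + ((c₀′ - ι 2 * (ℤ.+ 5 / 6) ^ 3) * 0ℚ + (c₀′ - ι 4 * (ℤ.+ 5 / 6) ^ 5) * 0ℚ)))
            (trans (cong (_* s ^ 1) (f₀ β)) refl)))
        where
        lem : ∀ f i s v → f * (i * (s * v)) ≡ f * s * (i * v)
        lem = solve-∀ ℚ-ring

      0<f₂ : 0ℚ < f β 2
      0<f₂ = pos* (0<x β) (pos* (ℚ.<-≤-trans (pos* (0<ifac (2 ℕ.* b ℕ.∸ 1)) (0<ifac β))
        (≤-trans (≤* (ifac β) (0≤ifac β) (F₂₀-lower β)) (F₁-lower β 0))) (0<^ 2 (0<x β)))

      -- For ξ = 1 any μ < 1 suffices, so the mere positivity of f 2 provides enough growth.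
      l μ : ℚ
      l = f β 2 * inv (B * B)
      μ = inv (1ℚ + l)

      0<B² : 0ℚ < B * B
      0<B² = <!

      0<l : 0ℚ < l
      0<l = pos* 0<f₂ (0<inv 0<B²)

      0<1+l : 0ℚ < 1ℚ + l
      0<1+l = ℚ.+-mono-< 0<1 0<l

      μ<1 : μ < 1ℚ
      μ<1 = subst₂ _<_ (ℚ.*-identityʳ μ) (trans (ℚ.*-comm μ (1ℚ + l)) (*-inv 0<1+l))
        (*<* μ (0<inv 0<1+l) (subst (_< 1ℚ + l) (ℚ.+-identityʳ 1ℚ) (ℚ.+-monoʳ-< 1ℚ 0<l)))

    ratios : GeometricRatios (c β)
    ratios = geometric β B μ 1ℚ θ f≤B (0<inv 0<1+l) μ<1 ≤-refl <! mean
      (y-lower β {B} {μ} {l} {0ℚ} f≤B (0≤inv 0<1+l) (<⇒≤ 0<l) ≤-refl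
        (ℚ.≤-reflexive (trans (lem (f β 2) (inv (B * B)) (B * B)) (trans (cong (f β 2 *_) (*-inv 0<B²)) (ℚ.*-identityʳ _))))
        (≡≤ (ℚ.*-zeroˡ (B * B * (B * B))) (0≤f β 4))
        (ℚ.≤-reflexive (sym (trans (cong (μ *_) (ℚ.+-identityʳ (1ℚ + l))) (trans (ℚ.*-comm μ (1ℚ + l)) (*-inv 0<1+l))))))
      where
      lem : ∀ a b c → a * b * c ≡ a * (c * b)
      lem = solve-∀ ℚ-ring

  geometric-ratios : ∀ β → GeometricRatios (c β)
  geometric-ratios zero    = binary-ratios
  geometric-ratios (suc γ) = Nonbinary.ratios γ

-- Bounds, limits and reciprocals of Cauchy reals.

module Reals where

  open import Data.Nat as ℕ using (ℕ; zero; suc)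
  import Data.Nat.Properties as ℕ
  open import Data.Product using (∃-syntax; _×_; _,_; proj₁; proj₂)
  open import Data.Rational as ℚ
    using (ℚ; 0ℚ; 1ℚ; ½; _+_; _*_; _-_; -_; _≤_; _<_; ∣_∣; _⊔_)
  open import Data.Rational.Properties as ℚ using (≤-refl; ≤-trans; <⇒≤)
  open import Data.Sum using (_⊎_; inj₁; inj₂)
  open import Relation.Binary.PropositionalEquality
  open import Tactic.RingSolver using (solve-∀)
  open import Defs
  open Rationals
  open Sums

  ev-map : ∀ {P Q : ℕ → Set} → (∀ n → P n → Q n) → Eventually P → Eventually Q
  ev-map f (N , h) = N , λ n N≤n → f n (h n N≤n)

  ev-∩ : ∀ {P Q : ℕ → Set} → Eventually P → Eventually Q → Eventually (λ n → P n × Q n)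
  ev-∩ (M , h) (N , k) = M ℕ.⊔ N , λ n le → h n (ℕ.m⊔n≤o⇒m≤o M N le) , k n (ℕ.m⊔n≤o⇒n≤o M N le)

  ev-map₂ : ∀ {P Q R : ℕ → Set} → (∀ n → P n → Q n → R n) → Eventually P → Eventually Q → Eventually R
  ev-map₂ f P Q = ev-map (λ n (p , q) → f n p q) (ev-∩ P Q)

  ev-witness : ∀ {P : ℕ → Set} → Eventually P → ∃[ n ] P n
  ev-witness (N , h) = N , h N ℕ.≤-refl

  infix 4 _≐_
  infixl 6 _-ᴿ_

  -- Equality of the approximating sequences themselves. The operations act termwise, so ring
  -- identities hold in this sense and need no ε.
  _≐_ : ℝ → ℝ → Set
  x ≐ y = ∀ n → seq x n ≡ seq y n

  _-ᴿ_ : ℝ → ℝ → ℝ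
  x -ᴿ y = x +ᴿ fromℚ (- 1ℚ) *ᴿ y

  ≐⇒≃ : ∀ {x y} → x ≐ y → x ≃ y
  ≐⇒≃ {x} {y} h ε 0<ε = 0 , λ n _ → ≤-trans
    (ℚ.≤-reflexive (cong ∣_∣ (trans (cong (_- seq y n) (h n)) (ℚ.+-inverseʳ (seq y n))))) (<⇒≤ 0<ε)

  ≃-sym : ∀ {x y} → x ≃ y → y ≃ x
  ≃-sym {x} {y} h ε 0<ε = ev-map (λ n → ≡≤ (∣p-q∣≡∣q-p∣ (seq y n) (seq x n))) (h ε 0<ε)

  ≃-trans : ∀ {x y z} → x ≃ y → y ≃ z → x ≃ z
  ≃-trans {x} {y} {z} h k ε 0<ε = ev-map₂
    (λ n p q → ≤-trans (∣p-r∣≤ (seq x n) (seq y n) (seq z n)) (≤≡ (p +≤+ q) (½ε+½ε≡ε ε)))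
    (h (½ * ε) (pos* 0<½ 0<ε)) (k (½ * ε) (pos* 0<½ 0<ε))

  -- ∣ x ∣ ≤ q
  record Bd (q : ℚ) (x : ℝ) : Set where
    constructor bd
    field
      within : ∀ ε → 0ℚ < ε → Eventually λ n → ∣ seq x n ∣ ≤ q + ε

  open Bd public

  Bd-≐ : ∀ {q x y} → x ≐ y → Bd q y → Bd q x
  Bd-≐ h (bd b) = bd λ ε 0<ε → ev-map (λ n → ≡≤ (cong ∣_∣ (h n))) (b ε 0<ε)

  Bd-mono : ∀ {p q x} → p ≤ q → Bd p x → Bd q x
  Bd-mono p≤q (bd b) = bd λ ε 0<ε → ev-map (λ n h → ≤-trans h (ℚ.+-monoˡ-≤ ε p≤q)) (b ε 0<ε)

  Bd-ev : ∀ {q x} → Eventually (λ n → ∣ seq x n ∣ ≤ q) → Bd q x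
  Bd-ev h = bd λ ε 0<ε → ev-map (λ n le → ≤-trans le (p≤p+q (<⇒≤ 0<ε))) h

  Bd-+ : ∀ {p q x y} → Bd p x → Bd q y → Bd (p + q) (x +ᴿ y)
  Bd-+ {p} {q} {x} {y} (bd bx) (bd by) = bd λ ε 0<ε → ev-map₂
    (λ n h k → ≤≡ (∣p+q∣≤ {seq x n} h k) (trans (lem p q (½ * ε)) (cong (p + q +_) (½ε+½ε≡ε ε))))
    (bx (½ * ε) (pos* 0<½ 0<ε)) (by (½ * ε) (pos* 0<½ 0<ε))
    where
    lem : ∀ p q e → p + e + (q + e) ≡ p + q + (e + e)
    lem = solve-∀ ℚ-ring

  bounded : ∀ x → ∃[ q ] 0ℚ < q × Eventually (λ n → ∣ seq x n ∣ ≤ q)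
  bounded x = eventuallyBounded {seq x} (cauchy x)

  -- δ = min(1, ε / (p + q + 1)) makes (p + δ)(q + δ) ≤ pq + ε.
  product-slack : ∀ p q ε → 0ℚ ≤ p → 0ℚ ≤ q → 0ℚ < ε → ∃[ e ] 0ℚ < e × (p + e) * (q + e) ≤ p * q + ε
  product-slack p q ε 0≤p 0≤q 0<ε = e , 0<e , ≤≡ (begin
      (p + e) * (q + e)              ≡⟨ lem p q e ⟩
      p * q + e * (p + q + e)        ≤⟨ ℚ.+-monoʳ-≤ (p * q) (*≤* 0≤e (<⇒≤ 0<s) (ℚ.p⊓q≤q 1ℚ (ε * inv s))
                                          (ℚ.+-monoʳ-≤ (p + q) (ℚ.p⊓q≤p 1ℚ (ε * inv s)))) ⟩
      p * q + ε * inv s * s          ≡⟨ cong (p * q +_) (trans (lem′ ε (inv s) s) (cong (ε *_) (*-inv 0<s))) ⟩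
      p * q + ε * 1ℚ                 ∎) (cong (p * q +_) (ℚ.*-identityʳ ε))
    where
    open ℚ.≤-Reasoning
    s e : ℚ
    s = p + q + 1ℚ
    0<s : 0ℚ < s
    0<s = ℚ.+-mono-≤-< (0≤p 0+ 0≤q) 0<1
    e = 1ℚ ℚ.⊓ (ε * inv s)
    0<e : 0ℚ < e
    0<e with ℚ.≤-total 1ℚ (ε * inv s)
    ... | inj₁ le = subst (0ℚ <_) (sym (ℚ.p≤q⇒p⊓q≡p le)) 0<1
    ... | inj₂ le = subst (0ℚ <_) (sym (ℚ.p≥q⇒p⊓q≡q le)) (pos* 0<ε (0<inv 0<s))
    0≤e = <⇒≤ 0<e
    lem : ∀ p q e → (p + e) * (q + e) ≡ p * q + e * (p + q + e)
    lem = solve-∀ ℚ-ring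
    lem′ : ∀ a b c → a * b * c ≡ a * (c * b)
    lem′ = solve-∀ ℚ-ring

  Bd-* : ∀ {p q x y} → 0ℚ ≤ p → 0ℚ ≤ q → Bd p x → Bd q y → Bd (p * q) (x *ᴿ y)
  Bd-* {p} {q} {x} {y} 0≤p 0≤q (bd bx) (bd by) = bd λ ε 0<ε →
    let e , 0<e , h = product-slack p q ε 0≤p 0≤q 0<ε
    in ev-map₂ (λ n hx hy → ≤-trans (∣p*q∣≤ {seq x n} {seq y n} hx hy) h) (bx e 0<e) (by e 0<e)

  Bd-bounded : ∀ x → ∃[ q ] 0ℚ ≤ q × Bd q x
  Bd-bounded x = let q , 0<q , h = bounded x in q , <⇒≤ 0<q , Bd-ev {q} {x} h

  Bd-0 : ∀ {q} x → 0ℚ ≤ q → x ≐ 0ᴿ → Bd q x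
  Bd-0 {q} x 0≤q h = Bd-ev {q} {x} (0 , λ n _ → ≡≤ (cong ∣_∣ (h n)) 0≤q)

  seq-^ : ∀ x m n → seq (x ^ᴿ m) n ≡ seq x n ^ m
  seq-^ x zero    n = refl
  seq-^ x (suc m) n = cong (seq x n *_) (seq-^ x m n)

  module Limit (z : ℕ → ℝ) (C κ : ℚ) (0≤C : 0ℚ ≤ C) (0<κ : 0ℚ < κ) (κ<1 : κ < 1ℚ)
    (step : ∀ m → Bd (C * κ ^ m) (z (suc m) -ᴿ z m)) where

    private
      K : ℚ
      K = C * inv (1ℚ - κ)

      0≤K : 0ℚ ≤ K
      0≤K = 0≤C 0* 0≤inv (0<q-p κ<1)

      0≤κ^ : ∀ m → 0ℚ ≤ κ ^ m
      0≤κ^ m = 0≤^ m (<⇒≤ 0<κ)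

      C≡ : C ≡ K * (1ℚ - κ)
      C≡ = sym (trans (lem C (inv (1ℚ - κ)) (1ℚ - κ)) (trans (cong (C *_) (*-inv (0<q-p κ<1))) (ℚ.*-identityʳ C)))
        where
        lem : ∀ a b c → a * b * c ≡ a * (c * b)
        lem = solve-∀ ℚ-ring

      spread : ∀ m k → Bd (K * (κ ^ m - κ ^ (k ℕ.+ m))) (z (k ℕ.+ m) -ᴿ z m)
      spread m zero    = Bd-0 (z m -ᴿ z m) (ℚ.≤-reflexive (sym (lem K (κ ^ m)))) (λ n → lem′ (seq (z m) n))
        where
        lem : ∀ a b → a * (b - b) ≡ 0ℚ
        lem = solve-∀ ℚ-ring
        lem′ : ∀ a → a + - 1ℚ * a ≡ 0ℚ
        lem′ = solve-∀ ℚ-ring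
      spread m (suc k) = Bd-mono {x = z (suc (k ℕ.+ m)) -ᴿ z m} (ℚ.≤-reflexive bound)
        (Bd-≐ {x = z (suc (k ℕ.+ m)) -ᴿ z m} {y = (z (suc (k ℕ.+ m)) -ᴿ z (k ℕ.+ m)) +ᴿ (z (k ℕ.+ m) -ᴿ z m)}
          (λ n → lem (seq (z (suc (k ℕ.+ m))) n) (seq (z (k ℕ.+ m)) n) (seq (z m) n))
          (Bd-+ {x = z (suc (k ℕ.+ m)) -ᴿ z (k ℕ.+ m)} {y = z (k ℕ.+ m) -ᴿ z m} (step (k ℕ.+ m)) (spread m k)))
        where
        lem : ∀ a b c → a + - 1ℚ * c ≡ (a + - 1ℚ * b) + (b + - 1ℚ * c)
        lem = solve-∀ ℚ-ring
        lem″ : ∀ K κ a t → K * (1ℚ - κ) * t + K * (a - t) ≡ K * (a - κ * t)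
        lem″ = solve-∀ ℚ-ring
        bound : C * κ ^ (k ℕ.+ m) + K * (κ ^ m - κ ^ (k ℕ.+ m)) ≡ K * (κ ^ m - κ * κ ^ (k ℕ.+ m))
        bound = trans (cong (λ c → c * κ ^ (k ℕ.+ m) + K * (κ ^ m - κ ^ (k ℕ.+ m))) C≡) (lem″ K κ (κ ^ m) (κ ^ (k ℕ.+ m)))

      spread≤ : ∀ {m n} → m ℕ.≤ n → Bd (K * κ ^ m) (z n -ᴿ z m)
      spread≤ {m} {n} m≤n = Bd-mono {x = z n -ᴿ z m}
        (*≤ K 0≤K (≤-by (κ ^ (n ℕ.∸ m ℕ.+ m)) (0≤κ^ (n ℕ.∸ m ℕ.+ m)) (lem (κ ^ m) (κ ^ (n ℕ.∸ m ℕ.+ m)))))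
        (subst (λ j → Bd (K * (κ ^ m - κ ^ (n ℕ.∸ m ℕ.+ m))) (z j -ᴿ z m)) (ℕ.m∸n+n≡m m≤n) (spread m (n ℕ.∸ m)))
        where
        lem : ∀ a b → a ≡ a - b + b
        lem = solve-∀ ℚ-ring

      -- zₖ is approximated to within κᵏ from index ν k on.
      ν : ℕ → ℕ
      ν k = proj₁ (cauchy (z k) (κ ^ k) (0<^ k 0<κ))

      diag : ℕ → ℚ
      diag k = seq (z k) (ν k)

      diag-near : ∀ k n → ν k ℕ.≤ n → ∣ seq (z k) n - diag k ∣ ≤ κ ^ k
      diag-near k n ν≤n = proj₂ (cauchy (z k) (κ ^ k) (0<^ k 0<κ)) n (ν k) ν≤n ℕ.≤-refl

      -- K κʲ comes from `spread≤`, one κʲ from its slack, and one from each of the two diagonal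
      -- approximations.
      diag-spread : ∀ {j k} → j ℕ.≤ k → ∣ diag k - diag j ∣ ≤ (K + (1ℚ + 1ℚ) + 1ℚ) * κ ^ j
      diag-spread {j} {k} j≤k =
        let n , (nj , nk) , s = ev-witness (ev-∩ (ev-∩ (ν j , λ n → diag-near j n) (ν k , λ n → diag-near k n))
                                  (within (spread≤ j≤k) (κ ^ j) (0<^ j 0<κ)))
        in begin
        ∣ diag k - diag j ∣
          ≤⟨ ∣p-r∣≤ (diag k) (seq (z k) n) (diag j) ⟩
        ∣ diag k - seq (z k) n ∣ + ∣ seq (z k) n - diag j ∣
          ≤⟨ ℚ.+-monoʳ-≤ ∣ diag k - seq (z k) n ∣ (∣p-r∣≤ (seq (z k) n) (seq (z j) n) (diag j)) ⟩
        ∣ diag k - seq (z k) n ∣ + (∣ seq (z k) n - seq (z j) n ∣ + ∣ seq (z j) n - diag j ∣)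
          ≤⟨ ≡≤ (∣p-q∣≡∣q-p∣ (diag k) (seq (z k) n)) (≤-trans nk (^-anti (<⇒≤ 0<κ) (<⇒≤ κ<1) j≤k))
             +≤+ (≡≤ (cong ∣_∣ (lem (seq (z k) n) (seq (z j) n))) s +≤+ nj) ⟩
        κ ^ j + (K * κ ^ j + κ ^ j + κ ^ j)
          ≡⟨ lem′ K (κ ^ j) ⟩
        (K + (1ℚ + 1ℚ) + 1ℚ) * κ ^ j ∎
        where
        open ℚ.≤-Reasoning
        lem : ∀ a b → a - b ≡ a + - 1ℚ * b
        lem = solve-∀ ℚ-ring
        lem′ : ∀ K t → t + (K * t + t + t) ≡ (K + (1ℚ + 1ℚ) + 1ℚ) * t
        lem′ = solve-∀ ℚ-ring

      T : ℚ
      T = K + (1ℚ + 1ℚ) + 1ℚ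

      0<T : 0ℚ < T
      0<T = ℚ.+-mono-≤-< (0≤K 0+ ≤!) 0<1

      small : ∀ ε → 0ℚ < ε → ∃[ N ] ∀ n → N ℕ.≤ n → T * κ ^ n ≤ ε
      small ε 0<ε = let N , h = ^→0 (<⇒≤ 0<κ) κ<1 (ε * inv T) (pos* 0<ε (0<inv 0<T)) in N , λ n N≤n → ≤≡ (*≤ T (<⇒≤ 0<T) (h n N≤n)) (trans (lem T ε (inv T))
        (trans (cong (ε *_) (*-inv 0<T)) (ℚ.*-identityʳ ε)))
        where
        lem : ∀ a b c → a * (b * c) ≡ b * (a * c)
        lem = solve-∀ ℚ-ring

      diag-cauchy : IsCauchy diag
      diag-cauchy ε 0<ε = N , λ m n N≤m N≤n → go m n N≤m N≤n (ℕ.≤-total m n)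
        where
        N = proj₁ (small ε 0<ε)
        h = proj₂ (small ε 0<ε)
        go : ∀ m n → N ℕ.≤ m → N ℕ.≤ n → (m ℕ.≤ n) ⊎ (n ℕ.≤ m) → ∣ diag m - diag n ∣ ≤ ε
        go m n N≤m N≤n (inj₁ m≤n) = ≡≤ (∣p-q∣≡∣q-p∣ (diag m) (diag n)) (≤-trans (diag-spread m≤n) (h m N≤m))
        go m n N≤m N≤n (inj₂ n≤m) = ≤-trans (diag-spread n≤m) (h n N≤n)

    limit : ℝ
    limit = mkℝ diag diag-cauchy

    limit-bound : ∀ m → Bd (K * κ ^ m) (z m -ᴿ limit)
    limit-bound m = bd near
      where
      open ℚ.≤-Reasoning
      1≤T : 1ℚ ≤ T
      1≤T = p≤q+p (0≤K 0+ ≤!)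
      lem : ∀ a b → a + - 1ℚ * b ≡ a - b
      lem = solve-∀ ℚ-ring
      lem″ : ∀ a b → a - b ≡ a + - 1ℚ * b
      lem″ = solve-∀ ℚ-ring
      lem‴ : ∀ a e → a + ½ * e + (½ * ½ * e + ½ * ½ * e) ≡ a + e
      lem‴ = solve-∀ ℚ-ring
      near : ∀ ε → 0ℚ < ε → Eventually λ n → ∣ seq (z m -ᴿ limit) n ∣ ≤ K * κ ^ m + ε
      -- With T κʲ ≤ ε/4, both the distance of z j from its diagonal entry and that between this
      -- entry and later ones are at most ε/4; the remaining ε/2 is the slack of `spread≤`.
      near ε 0<ε = ev-map₂ (λ n (s , near) j≤n → begin
          ∣ seq (z m) n + - 1ℚ * diag n ∣
            ≡⟨ cong ∣_∣ (lem (seq (z m) n) (diag n)) ⟩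
          ∣ seq (z m) n - diag n ∣
            ≤⟨ ∣p-r∣≤ (seq (z m) n) (seq (z j) n) (diag n) ⟩
          ∣ seq (z m) n - seq (z j) n ∣ + ∣ seq (z j) n - diag n ∣
            ≤⟨ ℚ.+-monoʳ-≤ ∣ seq (z m) n - seq (z j) n ∣ (∣p-r∣≤ (seq (z j) n) (diag j) (diag n)) ⟩
          ∣ seq (z m) n - seq (z j) n ∣ + (∣ seq (z j) n - diag j ∣ + ∣ diag j - diag n ∣)
            ≤⟨ ≡≤ (trans (∣p-q∣≡∣q-p∣ (seq (z m) n) (seq (z j) n)) (cong ∣_∣ (lem″ (seq (z j) n) (seq (z m) n)))) s
               +≤+ (≤-trans near (≤-trans (≡≤ (sym (ℚ.*-identityˡ (κ ^ j))) (≤* (κ ^ j) (0≤κ^ j) 1≤T)) (h j N≤j))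
               +≤+ ≡≤ (∣p-q∣≡∣q-p∣ (diag j) (diag n)) (≤-trans (diag-spread j≤n) (h j N≤j))) ⟩
          K * κ ^ m + ½ * ε + (½ * ½ * ε + ½ * ½ * ε)
            ≡⟨ lem‴ (K * κ ^ m) ε ⟩
          K * κ ^ m + ε ∎)
        (ev-∩ (within (spread≤ m≤j) (½ * ε) (pos* 0<½ 0<ε)) (ν j , λ n → diag-near j n)) (j , λ n j≤n → j≤n)
        where
        N = proj₁ (small (½ * ½ * ε) (pos* (pos* 0<½ 0<½) 0<ε))
        h = proj₂ (small (½ * ½ * ε) (pos* (pos* 0<½ 0<½) 0<ε))
        j = N ℕ.⊔ m
        N≤j = ℕ.m≤m⊔n N m
        m≤j = ℕ.m≤n⊔m N m

  geometric-limit : ∀ (z : ℕ → ℝ) {C κ} → 0ℚ ≤ C → 0ℚ < κ → κ < 1ℚ →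
    (∀ m → Bd (C * κ ^ m) (z (suc m) -ᴿ z m)) →
    ∃[ L ] ∃[ K ] 0ℚ ≤ K × ∀ m → Bd (K * κ ^ m) (z m -ᴿ L)
  geometric-limit z {C} {κ} 0≤C 0<κ κ<1 step = limit , C * inv (1ℚ - κ) , 0≤C 0* 0≤inv (0<q-p κ<1) , limit-bound
    where open Limit z C κ 0≤C 0<κ κ<1 step

  ∣⊔-⊔∣≤ : ∀ p a b → ∣ (p ⊔ a) - (p ⊔ b) ∣ ≤ ∣ a - b ∣
  ∣⊔-⊔∣≤ p a b with ℚ.≤-total p a | ℚ.≤-total p b
  ... | inj₁ pa | inj₁ pb rewrite ℚ.p≤q⇒p⊔q≡q pa | ℚ.p≤q⇒p⊔q≡q pb = ≤-refl
  ... | inj₁ pa | inj₂ bp rewrite ℚ.p≤q⇒p⊔q≡q pa | ℚ.p≥q⇒p⊔q≡p bp =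
    ≡≤ (ℚ.0≤p⇒∣p∣≡p (0≤q-p pa)) (≤-trans (ℚ.+-monoʳ-≤ a (ℚ.neg-antimono-≤ bp)) (p≤∣p∣ (a - b)))
  ... | inj₂ ap | inj₁ pb rewrite ℚ.p≥q⇒p⊔q≡p ap | ℚ.p≤q⇒p⊔q≡q pb =
    ≡≤ (∣p-q∣≡∣q-p∣ p b) (≡≤ (ℚ.0≤p⇒∣p∣≡p (0≤q-p pb)) (≤-trans (ℚ.+-monoʳ-≤ b (ℚ.neg-antimono-≤ ap))
      (≤≡ (p≤∣p∣ (b - a)) (∣p-q∣≡∣q-p∣ b a))))
  ... | inj₂ ap | inj₂ bp rewrite ℚ.p≥q⇒p⊔q≡p ap | ℚ.p≥q⇒p⊔q≡p bp = ≡≤ (cong ∣_∣ (ℚ.+-inverseʳ p)) (ℚ.0≤∣p∣ (a - b))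

  -- The inverse of max(d, x)
  module Reciprocal (d : ℚ) (0<d : 0ℚ < d) where

    private
      clip : ℚ → ℚ
      clip p = inv (d ⊔ p)

      0<⊔ : ∀ p → 0ℚ < d ⊔ p
      0<⊔ p = ℚ.<-≤-trans 0<d (ℚ.p≤p⊔q d p)

      clip≤ : ∀ p → clip p ≤ inv d
      clip≤ p = inv-≤ 0<d (ℚ.p≤p⊔q d p)

      0≤clip : ∀ p → 0ℚ ≤ clip p
      0≤clip p = 0≤inv (0<⊔ p)

      -- 1/p - 1/q = (q - p)/(p q), and both denominators are at least d after clipping. The
      -- Lipschitz bound keeps reciprocals Cauchy.
      clip-lipschitz : ∀ a b → ∣ clip a - clip b ∣ ≤ inv d * inv d * ∣ a - b ∣
      clip-lipschitz a b = begin
        ∣ clip a - clip b ∣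
          ≡⟨ cong ∣_∣ (sym (trans (lem (clip a) (clip b) (d ⊔ b) (d ⊔ a))
               (trans (cong₂ (λ s t → clip a * s - clip b * t) (*-inv (0<⊔ b)) (*-inv (0<⊔ a)))
                 (cong₂ _-_ (ℚ.*-identityʳ (clip a)) (ℚ.*-identityʳ (clip b)))))) ⟩
        ∣ clip a * clip b * ((d ⊔ b) - (d ⊔ a)) ∣
          ≤⟨ ∣p*q∣≤ {clip a * clip b} (≡≤ (ℚ.0≤p⇒∣p∣≡p (0≤clip a 0* 0≤clip b))
               (*≤* (0≤clip a) (0≤inv 0<d) (clip≤ a) (clip≤ b)))
               (≤≡ (∣⊔-⊔∣≤ d b a) (∣p-q∣≡∣q-p∣ b a)) ⟩
        inv d * inv d * ∣ a - b ∣ ∎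
        where
        open ℚ.≤-Reasoning
        lem : ∀ a b s t → a * b * (s - t) ≡ a * (s * b) - b * (t * a)
        lem = solve-∀ ℚ-ring

    recip : ℝ → ℝ
    recip x = mkℝ (λ n → clip (seq x n)) λ ε 0<ε →
      let e , 0<e , eq = scaled (inv d * inv d) ε (pos* (0<inv 0<d) (0<inv 0<d)) 0<ε
          N , h = cauchy x e 0<e
      in N , λ m n N≤m N≤n → ≤-trans (clip-lipschitz (seq x m) (seq x n))
        (≤≡ (*≤ (inv d * inv d) (0≤inv 0<d 0* 0≤inv 0<d) (h m n N≤m N≤n)) eq)

    Bd-recip : ∀ x → Bd (inv d) (recip x)
    Bd-recip x = Bd-ev {inv d} {recip x} (0 , λ n _ → ≡≤ (ℚ.0≤p⇒∣p∣≡p (0≤clip (seq x n))) (clip≤ (seq x n)))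

    recip-seq : ∀ x n → d ≤ seq x n → seq x n * seq (recip x) n ≡ 1ℚ
    recip-seq x n le rewrite ℚ.p≤q⇒p⊔q≡q le = *-inv (ℚ.<-≤-trans 0<d le)

-- Polynomials up to geometrically small errors.

module Polys where

  open import Data.Nat as ℕ using (ℕ; zero; suc)
  import Data.Nat.Properties as ℕ
  open import Data.Product using (∃-syntax; _×_; _,_; proj₁; proj₂)
  open import Data.Rational as ℚ
    using (ℚ; 0ℚ; 1ℚ; _+_; _*_; _-_; -_; _≤_; _<_)
  open import Data.Rational.Properties as ℚ using (≤-refl; <⇒≤)
  open import Data.Vec as Vec using (Vec; []; _∷_; _∷ʳ_; last)
  open import Function using (_∘_)
  open import Relation.Binary.PropositionalEquality
  open import Tactic.RingSolver using (solve-∀)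
  open import Defs
  open Rationals
  open Sums
  open Ratios
  open Reals

  infixl 7 _⋆ᴿ_

  ∑ᴿ : (ℕ → ℝ) → ℕ → ℝ
  ∑ᴿ x zero    = x 0
  ∑ᴿ x (suc m) = ∑ᴿ x m +ᴿ x (suc m)

  _⋆ᴿ_ : (ℕ → ℝ) → (ℕ → ℝ) → ℕ → ℝ
  (x ⋆ᴿ y) zero    = x 0 *ᴿ y 0
  (x ⋆ᴿ y) (suc m) = x 0 *ᴿ y (suc m) +ᴿ (x ∘ suc ⋆ᴿ y) m

  at : (ℕ → ℝ) → ℕ → Seq
  at x n i = seq (x i) n

  seq-∑ : ∀ x m n → seq (∑ᴿ x m) n ≡ ∑ (at x n) m
  seq-∑ x zero    n = refl
  seq-∑ x (suc m) n = cong (_+ seq (x (suc m)) n) (seq-∑ x m n)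

  seq-⋆ : ∀ x y m n → seq ((x ⋆ᴿ y) m) n ≡ (at x n ⋆ at y n) m
  seq-⋆ x y zero    n = refl
  seq-⋆ x y (suc m) n = cong (seq (x 0) n * seq (y (suc m)) n +_) (seq-⋆ (x ∘ suc) y m n)

  Bd-⋆ : ∀ {x y p q} m → (∀ i → 0ℚ ≤ p i) → (∀ i → 0ℚ ≤ q i) →
    (∀ i → Bd (p i) (x i)) → (∀ i → Bd (q i) (y i)) → Bd ((p ⋆ q) m) ((x ⋆ᴿ y) m)
  Bd-⋆ {x} {y} zero    0≤p 0≤q hx hy = Bd-* {x = x 0} {y = y 0} (0≤p 0) (0≤q 0) (hx 0) (hy 0)
  Bd-⋆ {x} {y} (suc m) 0≤p 0≤q hx hy = Bd-+ {x = x 0 *ᴿ y (suc m)} {y = (x ∘ suc ⋆ᴿ y) m}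
    (Bd-* {x = x 0} {y = y (suc m)} (0≤p 0) (0≤q (suc m)) (hx 0) (hy (suc m)))
    (Bd-⋆ {x ∘ suc} {y} m (0≤p ∘ suc) 0≤q (hx ∘ suc) hy)

  -- The telescoping sum behind the convolution of two geometric errors: for different rates it is
  -- of the order of the larger one.
  geometric-⋆ : ∀ a b m → (a - b) * ((a ^_) ⋆ (b ^_)) m ≡ a ^ suc m - b ^ suc m
  geometric-⋆ a b zero    = lem a b
    where
    lem : ∀ a b → (a - b) * (1ℚ * 1ℚ) ≡ a * 1ℚ - b * 1ℚ
    lem = solve-∀ ℚ-ring
  geometric-⋆ a b (suc m) = begin
    (a - b) * (1ℚ * b ^ suc m + ((λ i → a * a ^ i) ⋆ (b ^_)) m)
      ≡⟨ cong (λ t → (a - b) * (1ℚ * b ^ suc m + t)) (⋆-*ˡ a (a ^_) (b ^_) m) ⟩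
    (a - b) * (1ℚ * b ^ suc m + a * ((a ^_) ⋆ (b ^_)) m)
      ≡⟨ lem₁ a b (b ^ suc m) (((a ^_) ⋆ (b ^_)) m) ⟩
    (a - b) * b ^ suc m + a * ((a - b) * ((a ^_) ⋆ (b ^_)) m)
      ≡⟨ cong (λ t → (a - b) * b ^ suc m + a * t) (geometric-⋆ a b m) ⟩
    (a - b) * b ^ suc m + a * (a ^ suc m - b ^ suc m)
      ≡⟨ lem₂ a b (a ^ suc m) (b ^ suc m) ⟩
    a ^ suc (suc m) - b ^ suc (suc m) ∎
    where
    open ≡-Reasoning
    lem₁ : ∀ a b s t → (a - b) * (1ℚ * s + a * t) ≡ (a - b) * s + a * ((a - b) * t)
    lem₁ = solve-∀ ℚ-ring
    lem₂ : ∀ a b s t → (a - b) * t + a * (s - t) ≡ a * s - b * t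
    lem₂ = solve-∀ ℚ-ring

  -- Bin k m is the binomial coefficient of m + k over k.
  Bin : ℕ → Seq
  Bin zero    = 𝟙
  Bin (suc k) = ∑ (Bin k)

  private
    *-cancel-≡ : ∀ {p q} k → ι (suc k) * p ≡ ι (suc k) * q → p ≡ q
    *-cancel-≡ k eq = ℚ.≤-antisym (*-cancel-≤ (ι (suc k)) (0<ι k) (ℚ.≤-reflexive eq))
      (*-cancel-≤ (ι (suc k)) (0<ι k) (ℚ.≤-reflexive (sym eq)))

    -- The quotient rules in m (`Bin-up`) and in k (`Bin-rec`) need one another. With the rule in m
    -- for column k as a hypothesis here, the induction on k closes.
    Bin-rec-from : ∀ k → (∀ m → (1ℚ + ι m) * Bin k (suc m) ≡ (ι m + ι (suc k)) * Bin k m) →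
      ∀ m → ι (suc k) * Bin (suc k) m ≡ (ι m + ι (suc k)) * Bin k m
    Bin-rec-from k h zero    = lem (ι (suc k)) (Bin k 0)
      where
      lem : ∀ a b → a * b ≡ (0ℚ + a) * b
      lem = solve-∀ ℚ-ring
    Bin-rec-from k h (suc m) = begin
      ι (suc k) * (Bin (suc k) m + Bin k (suc m))
        ≡⟨ ℚ.*-distribˡ-+ (ι (suc k)) _ _ ⟩
      ι (suc k) * Bin (suc k) m + ι (suc k) * Bin k (suc m)
        ≡⟨ cong (_+ ι (suc k) * Bin k (suc m)) (trans (Bin-rec-from k h m) (sym (h m))) ⟩
      (1ℚ + ι m) * Bin k (suc m) + ι (suc k) * Bin k (suc m)
        ≡⟨ trans (sym (ℚ.*-distribʳ-+ (Bin k (suc m)) (1ℚ + ι m) (ι (suc k))))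
             (cong (λ t → (t + ι (suc k)) * Bin k (suc m)) (sym (ι-suc m))) ⟩
      (ι (suc m) + ι (suc k)) * Bin k (suc m) ∎
      where open ≡-Reasoning

    Bin-up : ∀ k m → (1ℚ + ι m) * Bin k (suc m) ≡ (ι m + ι (suc k)) * Bin k m
    Bin-up zero    m = cong (_* 1ℚ) (ℚ.+-comm 1ℚ (ι m))
    Bin-up (suc k) m = *-cancel-≡ k (begin
      ι (suc k) * ((1ℚ + ι m) * Bin (suc k) (suc m))
        ≡⟨ lem₁ (ι (suc k)) (1ℚ + ι m) _ ⟩
      (1ℚ + ι m) * (ι (suc k) * Bin (suc k) (suc m))
        ≡⟨ cong ((1ℚ + ι m) *_) (Bin-rec-from k (Bin-up k) (suc m)) ⟩
      (1ℚ + ι m) * ((ι (suc m) + ι (suc k)) * Bin k (suc m))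
        ≡⟨ lem₁ (1ℚ + ι m) (ι (suc m) + ι (suc k)) (Bin k (suc m)) ⟩
      (ι (suc m) + ι (suc k)) * ((1ℚ + ι m) * Bin k (suc m))
        ≡⟨ cong₂ (λ s t → s * t) shift (trans (Bin-up k m) (sym (Bin-rec-from k (Bin-up k) m))) ⟩
      (ι m + ι (2 ℕ.+ k)) * (ι (suc k) * Bin (suc k) m)
        ≡⟨ lem₁ (ι m + ι (2 ℕ.+ k)) (ι (suc k)) _ ⟩
      ι (suc k) * ((ι m + ι (2 ℕ.+ k)) * Bin (suc k) m) ∎)
      where
      open ≡-Reasoning
      lem₁ : ∀ a b c → a * (b * c) ≡ b * (a * c)
      lem₁ = solve-∀ ℚ-ring
      lem₂ : ∀ a b → 1ℚ + a + b ≡ a + (1ℚ + b)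
      lem₂ = solve-∀ ℚ-ring
      shift : ι (suc m) + ι (suc k) ≡ ι m + ι (2 ℕ.+ k)
      shift = trans (cong (_+ ι (suc k)) (ι-suc m)) (trans (lem₂ (ι m) (ι (suc k))) (cong (ι m +_) (sym (ι-suc (suc k)))))

  Bin-rec : ∀ k m → ι (suc k) * Bin (suc k) m ≡ (ι m + ι (suc k)) * Bin k m
  Bin-rec k = Bin-rec-from k (Bin-up k)

  -- The entries of the vector are coefficients in the basis Bin 0, Bin 1, …
  N : ∀ {d} → Vec ℝ d → ℕ → ℝ
  N []       m = 0ᴿ
  N (c ∷ cs) m = c +ᴿ ∑ᴿ (N cs) m

  N+ : ∀ {d} (cs ds : Vec ℝ d) m → N (Vec.zipWith _+ᴿ_ cs ds) m ≐ N cs m +ᴿ N ds m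
  N+ []       []       m n = refl
  N+ (c ∷ cs) (d ∷ ds) m n = begin
    (seq c n + seq d n) + seq (∑ᴿ (N (Vec.zipWith _+ᴿ_ cs ds)) m) n
      ≡⟨ cong (seq c n + seq d n +_) (trans (seq-∑ _ m n) (trans (∑-cong m (λ i _ → N+ cs ds i n)) (∑-+ _ _ m))) ⟩
    (seq c n + seq d n) + (∑ (at (N cs) n) m + ∑ (at (N ds) n) m)
      ≡⟨ cong₂ (λ s t → (seq c n + seq d n) + (s + t)) (seq-∑ (N cs) m n) (seq-∑ (N ds) m n) ⟨
    (seq c n + seq d n) + (seq (∑ᴿ (N cs) m) n + seq (∑ᴿ (N ds) m) n)
      ≡⟨ lem (seq c n) (seq d n) _ _ ⟩
    seq (N (c ∷ cs) m +ᴿ N (d ∷ ds) m) n ∎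
    where
    open ≡-Reasoning
    lem : ∀ a b c d → (a + b) + (c + d) ≡ (a + c) + (b + d)
    lem = solve-∀ ℚ-ring

  N* : ∀ {d} a (cs : Vec ℝ d) m → N (Vec.map (a *ᴿ_) cs) m ≐ a *ᴿ N cs m
  N* a []       m n = sym (ℚ.*-zeroʳ (seq a n))
  N* a (c ∷ cs) m n = begin
    seq a n * seq c n + seq (∑ᴿ (N (Vec.map (a *ᴿ_) cs)) m) n
      ≡⟨ cong (seq a n * seq c n +_) (trans (seq-∑ _ m n) (trans (∑-cong m (λ i _ → N* a cs i n)) (∑-*ˡ (seq a n) _ m))) ⟩
    seq a n * seq c n + seq a n * ∑ (at (N cs) n) m
      ≡⟨ cong (λ t → seq a n * seq c n + seq a n * t) (seq-∑ (N cs) m n) ⟨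
    seq a n * seq c n + seq a n * seq (∑ᴿ (N cs) m) n
      ≡⟨ ℚ.*-distribˡ-+ (seq a n) _ _ ⟨
    seq (a *ᴿ N (c ∷ cs) m) n ∎
    where open ≡-Reasoning

  N0 : ∀ d m → N (Vec.replicate d 0ᴿ) m ≐ 0ᴿ
  N0 zero    m n = refl
  N0 (suc d) m n = trans (cong (0ℚ +_) (trans (seq-∑ _ m n) (trans (∑-cong m (λ i _ → trans (N0 d i n) (sym (ℚ.*-zeroˡ 0ℚ))))
    (trans (∑-*ˡ 0ℚ (λ _ → 0ℚ) m) (ℚ.*-zeroˡ (∑ (λ _ → 0ℚ) m)))))) refl

  N∷ʳ : ∀ {d} (cs : Vec ℝ d) a m → N (cs ∷ʳ a) m ≐ N cs m +ᴿ a *ᴿ fromℚ (Bin d m)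
  N∷ʳ []       a m n = trans (cong (seq a n +_) (trans (seq-∑ _ m n) (trans (∑-cong m (λ i _ → sym (ℚ.*-zeroˡ 0ℚ)))
      (trans (∑-*ˡ 0ℚ (λ _ → 0ℚ) m) (ℚ.*-zeroˡ (∑ (λ _ → 0ℚ) m)))))) (lem (seq a n))
    where
    lem : ∀ a → a + 0ℚ ≡ 0ℚ + a * 1ℚ
    lem = solve-∀ ℚ-ring
  N∷ʳ {suc d} (c ∷ cs) a m n = begin
    seq c n + seq (∑ᴿ (N (cs ∷ʳ a)) m) n
      ≡⟨ cong (seq c n +_) (trans (seq-∑ _ m n) (trans (∑-cong m (λ i _ → N∷ʳ cs a i n)) (trans (∑-+ _ _ m)
           (cong₂ _+_ (sym (seq-∑ (N cs) m n)) (∑-*ˡ (seq a n) (Bin d) m))))) ⟩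
    seq c n + (seq (∑ᴿ (N cs) m) n + seq a n * Bin (suc d) m)
      ≡⟨ ℚ.+-assoc (seq c n) _ _ ⟨
    seq (N (c ∷ cs) m +ᴿ a *ᴿ fromℚ (Bin (suc d) m)) n ∎
    where open ≡-Reasoning

  opaque
    Close : ∀ {d} → ℚ → (ℕ → ℝ) → Vec ℝ d → ℚ → Set
    Close κ y cs C = ∀ m → Bd (C * κ ^ m) (y m -ᴿ N cs m)

    close : ∀ {d κ y C} (cs : Vec ℝ d) → (∀ m → Bd (C * κ ^ m) (y m -ᴿ N cs m)) → Close κ y cs C
    close cs h = h

    unclose : ∀ {d κ y C} (cs : Vec ℝ d) → Close κ y cs C → ∀ m → Bd (C * κ ^ m) (y m -ᴿ N cs m)
    unclose cs h = h

  -- Polynomials of degree less than d, up to O(κᵐ). (Close is opaque because the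
  -- positivity checker would otherwise inspect the whole arithmetic of ℝ.)
  record Near (d : ℕ) (κ : ℚ) (y : ℕ → ℝ) : Set where
    constructor mkNear
    field
      coeffs  : Vec ℝ d
      C       : ℚ
      0≤C     : 0ℚ ≤ C
      isClose : Close κ y coeffs C

  near : ∀ {d κ y} (cs : Vec ℝ d) C → 0ℚ ≤ C → (∀ m → Bd (C * κ ^ m) (y m -ᴿ N cs m)) → Near d κ y
  near {y = y} cs C 0≤C h = mkNear cs C 0≤C (close {y = y} cs h)

  near-close : ∀ {d κ} y (cs : Vec ℝ d) C → Close κ y cs C → ∀ m → Bd (C * κ ^ m) (y m -ᴿ N cs m)
  near-close y cs C = unclose cs

  Small : ℚ → (ℕ → ℝ) → Set
  Small κ y = ∃[ C ] 0ℚ ≤ C × ∀ m → Bd (C * κ ^ m) (y m)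

  near-≐ : ∀ {d κ y z} → (∀ m → y m ≐ z m) → Near d κ z → Near d κ y
  near-≐ {y = y} {z} h (mkNear cs C 0≤C cl) = near cs C 0≤C λ m →
    Bd-≐ {x = y m -ᴿ N cs m} {y = z m -ᴿ N cs m} (λ n → cong (_+ - 1ℚ * seq (N cs m) n) (h m n)) (near-close z cs C cl m)

  near-+ : ∀ {d κ y z} → Near d κ y → Near d κ z → Near d κ (λ m → y m +ᴿ z m)
  near-+ {d} {κ} {y} {z} (mkNear cs C 0≤C cl) (mkNear ds D 0≤D dl) = near (Vec.zipWith _+ᴿ_ cs ds) (C + D) (0≤C 0+ 0≤D) λ m →
    subst (λ q → Bd q ((y m +ᴿ z m) -ᴿ N (Vec.zipWith _+ᴿ_ cs ds) m)) (sym (ℚ.*-distribʳ-+ (κ ^ m) C D))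
      (Bd-≐ {x = (y m +ᴿ z m) -ᴿ N (Vec.zipWith _+ᴿ_ cs ds) m} {y = (y m -ᴿ N cs m) +ᴿ (z m -ᴿ N ds m)}
        (λ n → trans (cong (λ t → seq (y m) n + seq (z m) n + - 1ℚ * t) (N+ cs ds m n))
          (lem (seq (y m) n) (seq (z m) n) (seq (N cs m) n) (seq (N ds m) n)))
        (Bd-+ {x = y m -ᴿ N cs m} {y = z m -ᴿ N ds m} (near-close y cs C cl m) (near-close z ds D dl m)))
    where
    lem : ∀ a b c d → a + b + - 1ℚ * (c + d) ≡ (a + - 1ℚ * c) + (b + - 1ℚ * d)
    lem = solve-∀ ℚ-ring

  near-* : ∀ {d κ y} a → 0ℚ ≤ κ → Near d κ y → Near d κ (λ m → a *ᴿ y m)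
  near-* {d} {κ} {y} a 0≤κ (mkNear cs C 0≤C cl) = near (Vec.map (a *ᴿ_) cs) (q * C) (0≤q 0* 0≤C) λ m →
    subst (λ p → Bd p ((a *ᴿ y m) -ᴿ N (Vec.map (a *ᴿ_) cs) m)) (sym (ℚ.*-assoc q C (κ ^ m)))
      (Bd-≐ {x = (a *ᴿ y m) -ᴿ N (Vec.map (a *ᴿ_) cs) m} {y = a *ᴿ (y m -ᴿ N cs m)}
        (λ n → trans (cong (λ t → seq a n * seq (y m) n + - 1ℚ * t) (N* a cs m n)) (lem (seq a n) (seq (y m) n) (seq (N cs m) n)))
        (Bd-* {x = a} {y = y m -ᴿ N cs m} 0≤q (0≤C 0* 0≤^ m 0≤κ) (proj₂ (proj₂ (Bd-bounded a))) (near-close y cs C cl m)))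
    where
    q   = proj₁ (Bd-bounded a)
    0≤q = proj₁ (proj₂ (Bd-bounded a))
    lem : ∀ a b c → a * b + - 1ℚ * (a * c) ≡ a * (b + - 1ℚ * c)
    lem = solve-∀ ℚ-ring

  near-small : ∀ {κ y} d → Small κ y → Near d κ y
  near-small {κ} {y} d (C , 0≤C , h) = near (Vec.replicate d 0ᴿ) C 0≤C λ m →
    Bd-≐ {x = y m -ᴿ N (Vec.replicate d 0ᴿ) m} {y = y m} (λ n → trans (cong (λ t → seq (y m) n + - 1ℚ * t) (N0 d m n)) (lem (seq (y m) n))) (h m)
    where
    lem : ∀ a → a + - 1ℚ * 0ℚ ≡ a
    lem = solve-∀ ℚ-ring

  near-suc : ∀ {d κ y} → Near d κ y → Near (suc d) κ y
  near-suc {d} {κ} {y} (mkNear cs C 0≤C cl) = near (cs ∷ʳ 0ᴿ) C 0≤C λ m →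
    Bd-≐ {x = y m -ᴿ N (cs ∷ʳ 0ᴿ) m} {y = y m -ᴿ N cs m}
      (λ n → trans (cong (λ t → seq (y m) n + - 1ℚ * t) (N∷ʳ cs 0ᴿ m n)) (lem (seq (y m) n) (seq (N cs m) n) (Bin d m))) (near-close y cs C cl m)
    where
    lem : ∀ a b c → a + - 1ℚ * (b + 0ℚ * c) ≡ a + - 1ℚ * b
    lem = solve-∀ ℚ-ring

  small-mono : ∀ {κ κ′ y} → 0ℚ ≤ κ → κ ≤ κ′ → Small κ y → Small κ′ y
  small-mono {y = y} 0≤κ κ≤κ′ (C , 0≤C , h) = C , 0≤C , λ m → Bd-mono {x = y m} (*≤ C 0≤C (^-mono m 0≤κ κ≤κ′)) (h m)

  module _ {κ : ℚ} (0<κ : 0ℚ < κ) (κ<1 : κ < 1ℚ) where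

    private
      0≤κ = <⇒≤ 0<κ

    small-∑ : ∀ {g} → Small κ g → ∃[ S ] Small κ (λ m → ∑ᴿ g m -ᴿ S)
    small-∑ {g} (C , 0≤C , h) =
      let L , K , 0≤K , near = geometric-limit (∑ᴿ g) (0≤C 0* 0≤κ) 0<κ κ<1 (λ m →
            subst (λ q → Bd q (∑ᴿ g (suc m) -ᴿ ∑ᴿ g m)) (sym (ℚ.*-assoc C κ (κ ^ m)))
              (Bd-≐ {x = ∑ᴿ g (suc m) -ᴿ ∑ᴿ g m} {y = g (suc m)} (λ n → lem (seq (∑ᴿ g m) n) (seq (g (suc m)) n)) (h (suc m))))
      in L , K , 0≤K , near
      where
      lem : ∀ a b → a + b + - 1ℚ * a ≡ b
      lem = solve-∀ ℚ-ring

    -- In the basis Bin summation merely shifts the coefficients. The summed errors converge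
    -- geometrically, and their limit S becomes the new constant coefficient.
    near-∑ : ∀ {d y} → Near d κ y → Near (suc d) κ (∑ᴿ y)
    near-∑ {d} {y} (mkNear cs C 0≤C cl) = near (S ∷ cs) D 0≤D λ m →
      Bd-≐ {x = ∑ᴿ y m -ᴿ N (S ∷ cs) m} {y = ∑ᴿ g m -ᴿ S} (identity m) (h m)
      where
      g : ℕ → ℝ
      g m = y m -ᴿ N cs m
      sum = small-∑ {g} (C , 0≤C , near-close y cs C cl)
      S   = proj₁ sum
      D   = proj₁ (proj₂ sum)
      0≤D = proj₁ (proj₂ (proj₂ sum))
      h   = proj₂ (proj₂ (proj₂ sum))
      lem : ∀ a s t → a + - 1ℚ * (s + t) ≡ (a + - 1ℚ * t) + - 1ℚ * s
      lem = solve-∀ ℚ-ring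
      identity : ∀ m → ∑ᴿ y m -ᴿ N (S ∷ cs) m ≐ ∑ᴿ g m -ᴿ S
      identity m n = begin
        seq (∑ᴿ y m) n + - 1ℚ * (seq S n + seq (∑ᴿ (N cs) m) n)
          ≡⟨ lem (seq (∑ᴿ y m) n) (seq S n) (seq (∑ᴿ (N cs) m) n) ⟩
        (seq (∑ᴿ y m) n + - 1ℚ * seq (∑ᴿ (N cs) m) n) + - 1ℚ * seq S n
          ≡⟨ cong (_+ - 1ℚ * seq S n) (trans (cong₂ (λ s t → s + - 1ℚ * t) (seq-∑ y m n) (seq-∑ (N cs) m n))
               (trans (cong (∑ (at y n) m +_) (sym (∑-*ˡ (- 1ℚ) (at (N cs) n) m)))
               (trans (sym (∑-+ (at y n) (λ i → - 1ℚ * at (N cs) n i) m)) (sym (seq-∑ g m n))))) ⟩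
        seq (∑ᴿ g m) n + - 1ℚ * seq S n ∎
        where open ≡-Reasoning

    module _ {κ₀ : ℚ} (0≤κ₀ : 0ℚ ≤ κ₀) (κ₀<κ : κ₀ < κ) {e : ℕ → ℝ} (e-small : Small κ₀ e) where

      private
        small-κ : Small κ e
        small-κ = small-mono {y = e} 0≤κ₀ (<⇒≤ κ₀<κ) e-small

      -- The strict inequality κ₀ < κ matters: equal rates would produce an additional factor of
      -- order m.
      small-⋆ : ∀ {g} → Small κ g → Small κ (g ⋆ᴿ e)
      small-⋆ {g} (C , 0≤C , h) = let D , 0≤D , k = e-small in
        C * D * (inv (κ - κ₀) * κ) , 0≤C 0* 0≤D 0* (0≤inv (0<q-p κ₀<κ) 0* 0≤κ) , λ m →
        Bd-mono {x = (g ⋆ᴿ e) m} (bound C D 0≤C 0≤D m)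
          (Bd-⋆ {g} {e} m (λ i → 0≤C 0* 0≤^ i 0≤κ) (λ i → 0≤D 0* 0≤^ i 0≤κ₀) h k)
        where
        open ℚ.≤-Reasoning
        lem : ∀ c d i k x → c * d * (i * (k * x)) ≡ c * d * (i * k) * x
        lem = solve-∀ ℚ-ring
        lem′ : ∀ c d z → c * (d * z) ≡ c * d * z
        lem′ = solve-∀ ℚ-ring
        lem″ : ∀ i s z → i * (s * z) ≡ s * i * z
        lem″ = solve-∀ ℚ-ring
        bound : ∀ C D → 0ℚ ≤ C → 0ℚ ≤ D → ∀ m →
          ((λ i → C * κ ^ i) ⋆ (λ i → D * κ₀ ^ i)) m ≤ C * D * (inv (κ - κ₀) * κ) * κ ^ m
        bound C D 0≤C 0≤D m = begin
          ((λ i → C * κ ^ i) ⋆ (λ i → D * κ₀ ^ i)) m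
            ≡⟨ trans (⋆-*ˡ C (κ ^_) _ m) (cong (C *_) (⋆-*ʳ D (κ ^_) (κ₀ ^_) m)) ⟩
          C * (D * ((κ ^_) ⋆ (κ₀ ^_)) m)
            ≡⟨ lem′ C D _ ⟩
          C * D * ((κ ^_) ⋆ (κ₀ ^_)) m
            ≡⟨ cong (C * D *_) (trans (sym (ℚ.*-identityˡ _)) (trans (cong (_* ((κ ^_) ⋆ (κ₀ ^_)) m) (sym (*-inv (0<q-p κ₀<κ))))
                 (sym (lem″ (inv (κ - κ₀)) (κ - κ₀) (((κ ^_) ⋆ (κ₀ ^_)) m))))) ⟩
          C * D * (inv (κ - κ₀) * ((κ - κ₀) * ((κ ^_) ⋆ (κ₀ ^_)) m))
            ≡⟨ cong (λ t → C * D * (inv (κ - κ₀) * t)) (geometric-⋆ κ κ₀ m) ⟩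
          C * D * (inv (κ - κ₀) * (κ ^ suc m - κ₀ ^ suc m))
            ≤⟨ *≤ (C * D) (0≤C 0* 0≤D) (*≤ (inv (κ - κ₀)) (0≤inv (0<q-p κ₀<κ))
                 (≤-by (κ₀ ^ suc m) (0≤^ (suc m) 0≤κ₀) (lem‴ (κ ^ suc m) (κ₀ ^ suc m)))) ⟩
          C * D * (inv (κ - κ₀) * κ ^ suc m)
            ≡⟨ lem C D (inv (κ - κ₀)) κ (κ ^ m) ⟩
          C * D * (inv (κ - κ₀) * κ) * κ ^ m ∎
          where
          lem‴ : ∀ a b → a ≡ a - b + b
          lem‴ = solve-∀ ℚ-ring

      private
        -- Convolution with a summable e does not raise the degree: N (c ∷ cs) is a constant plus a
        -- sum, convolution commutes with summation, and the partial sums of e converge.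
        N⋆ : ∀ {d} (cs : Vec ℝ d) → Near d κ (N cs ⋆ᴿ e)
        N⋆ []       = near-small 0 (0ℚ , ≤-refl , λ m → Bd-0 ((N [] ⋆ᴿ e) m) (≤-refl′ m)
          (λ n → trans (seq-⋆ (N []) e m n) (⋆-zeroˡ (at e n) m (λ _ _ → refl))))
          where
          ≤-refl′ : ∀ m → 0ℚ ≤ 0ℚ * κ ^ m
          ≤-refl′ m = ≤-refl 0* 0≤^ m 0≤κ
        N⋆ {suc d} (c ∷ cs) = near-≐ {y = N (c ∷ cs) ⋆ᴿ e} {z = λ m → c *ᴿ ∑ᴿ e m +ᴿ ∑ᴿ (N cs ⋆ᴿ e) m} identity
          (near-+ {y = λ m → c *ᴿ ∑ᴿ e m} {z = ∑ᴿ (N cs ⋆ᴿ e)}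
            (near-* {y = ∑ᴿ e} c 0≤κ (near-∑ {y = e} (near-small d small-κ)))
            (near-∑ {y = N cs ⋆ᴿ e} (N⋆ cs)))
          where
          open ≡-Reasoning
          identity : ∀ m → (N (c ∷ cs) ⋆ᴿ e) m ≐ c *ᴿ ∑ᴿ e m +ᴿ ∑ᴿ (N cs ⋆ᴿ e) m
          identity m n = begin
            seq ((N (c ∷ cs) ⋆ᴿ e) m) n
              ≡⟨ trans (seq-⋆ (N (c ∷ cs)) e m n) (⋆-congˡ (at e n) m λ i →
                   cong₂ _+_ (sym (ℚ.*-identityʳ (seq c n))) (seq-∑ (N cs) i n)) ⟩
            ((λ i → seq c n * 𝟙 i + ∑ (at (N cs) n) i) ⋆ at e n) m
              ≡⟨ ⋆-+ˡ _ (∑ (at (N cs) n)) (at e n) m ⟩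
            ((λ i → seq c n * 𝟙 i) ⋆ at e n) m + (∑ (at (N cs) n) ⋆ at e n) m
              ≡⟨ cong₂ _+_ (trans (⋆-*ˡ (seq c n) 𝟙 (at e n) m) (cong (seq c n *_) (trans (𝟙-⋆ (at e n) m) (sym (seq-∑ e m n)))))
                   (trans (sym (∑-⋆ (at (N cs) n) (at e n) m)) (trans (∑-cong m (λ i _ → sym (seq-⋆ (N cs) e i n)))
                     (sym (seq-∑ (N cs ⋆ᴿ e) m n)))) ⟩
            seq (c *ᴿ ∑ᴿ e m +ᴿ ∑ᴿ (N cs ⋆ᴿ e) m) n ∎

      near-⋆ : ∀ {d y} → Near d κ y → Near d κ (y ⋆ᴿ e)
      near-⋆ {d} {y} (mkNear cs C 0≤C cl) = near-≐ {y = y ⋆ᴿ e} {z = λ m → (N cs ⋆ᴿ e) m +ᴿ (g ⋆ᴿ e) m} identity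
        (near-+ {y = N cs ⋆ᴿ e} {z = g ⋆ᴿ e} (N⋆ cs) (near-small d (small-⋆ {g} (C , 0≤C , near-close y cs C cl))))
        where
        g : ℕ → ℝ
        g m = y m -ᴿ N cs m
        open ≡-Reasoning
        lem : ∀ a b → a ≡ b + (a + - 1ℚ * b)
        lem = solve-∀ ℚ-ring
        identity : ∀ m → (y ⋆ᴿ e) m ≐ (N cs ⋆ᴿ e) m +ᴿ (g ⋆ᴿ e) m
        identity m n = begin
          seq ((y ⋆ᴿ e) m) n
            ≡⟨ trans (seq-⋆ y e m n) (⋆-congˡ (at e n) m (λ i → lem (seq (y i) n) (seq (N cs i) n))) ⟩
          ((λ i → seq (N cs i) n + seq (g i) n) ⋆ at e n) m
            ≡⟨ trans (⋆-+ˡ (at (N cs) n) (at g n) (at e n) m) (cong₂ _+_ (sym (seq-⋆ (N cs) e m n)) (sym (seq-⋆ g e m n))) ⟩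
          seq ((N cs ⋆ᴿ e) m +ᴿ (g ⋆ᴿ e) m) n ∎

      binᴿ : ℕ → ℕ → ℝ
      binᴿ k m = fromℚ (Bin k m)

      Bin⋆ : ∀ k → Near (suc k) κ (binᴿ k ⋆ᴿ e)
      Bin⋆ zero    = near-≐ {y = binᴿ 0 ⋆ᴿ e} {z = ∑ᴿ e}
        (λ m n → trans (seq-⋆ (binᴿ 0) e m n) (trans (𝟙-⋆ (at e n) m) (sym (seq-∑ e m n))))
        (near-∑ {y = e} (near-small 0 small-κ))
      Bin⋆ (suc k) = near-≐ {y = binᴿ (suc k) ⋆ᴿ e} {z = ∑ᴿ (binᴿ k ⋆ᴿ e)}
        (λ m n → trans (seq-⋆ (binᴿ (suc k)) e m n) (trans (sym (∑-⋆ (Bin k) (at e n) m))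
          (trans (∑-cong m (λ i _ → sym (seq-⋆ (binᴿ k) e i n))) (sym (seq-∑ (binᴿ k ⋆ᴿ e) m n)))))
        (near-∑ {y = binᴿ k ⋆ᴿ e} (Bin⋆ k))

    -- y(m) = a mᵈ / d! + lower terms, up to O(κᵐ)
    Leading : ℕ → ℝ → (ℕ → ℝ) → Set
    Leading d a y = Near d κ (λ m → y m -ᴿ (a *ᴿ fromℚ (Bin d m)))

    -- Write y = a Bin d + r and x = α + e. The product of the main terms is α a Bin (d + 1), since
    -- convolution with a constant is summation; the terms a Bin d ⋆ e, α ∑ r and r ⋆ e have smaller
    -- degree.
    leading-⋆ : ∀ {κ₀ d a y x α} → 0ℚ ≤ κ₀ → κ₀ < κ → Small κ₀ (λ m → x m -ᴿ α) →
      Leading d a y → Leading (suc d) (α *ᴿ a) (y ⋆ᴿ x)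
    leading-⋆ {κ₀} {d} {a} {y} {x} {α} 0≤κ₀ κ₀<κ x-small y-near =
      near-≐ {y = λ m → (y ⋆ᴿ x) m -ᴿ ((α *ᴿ a) *ᴿ fromℚ (Bin (suc d) m))}
        {z = λ m → (a *ᴿ (bin ⋆ᴿ e) m +ᴿ α *ᴿ ∑ᴿ r m) +ᴿ (r ⋆ᴿ e) m} identity
        (near-+ {y = λ m → a *ᴿ (bin ⋆ᴿ e) m +ᴿ α *ᴿ ∑ᴿ r m} {z = r ⋆ᴿ e}
          (near-+ {y = λ m → a *ᴿ (bin ⋆ᴿ e) m} {z = λ m → α *ᴿ ∑ᴿ r m}
            (near-* {y = bin ⋆ᴿ e} a 0≤κ (Bin⋆ 0≤κ₀ κ₀<κ {e} x-small d))
            (near-* {y = ∑ᴿ r} α 0≤κ (near-∑ {y = r} y-near)))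
          (near-suc (near-⋆ 0≤κ₀ κ₀<κ {e} x-small {y = r} y-near)))
      where
      e r bin : ℕ → ℝ
      e m   = x m -ᴿ α
      bin m = fromℚ (Bin d m)
      r m   = y m -ᴿ (a *ᴿ bin m)
      open ≡-Reasoning
      lem₁ : ∀ y a b → y ≡ a * b + (y + - 1ℚ * (a * b))
      lem₁ = solve-∀ ℚ-ring
      lem₂ : ∀ x a → x ≡ a * 1ℚ + (x + - 1ℚ * a)
      lem₂ = solve-∀ ℚ-ring
      lem₃ : ∀ a α S E P Q → (a * (α * S) + a * E) + (α * P + Q) + - 1ℚ * (α * a * S) ≡ (a * E + α * P) + Q
      lem₃ = solve-∀ ℚ-ring
      identity : ∀ m → (y ⋆ᴿ x) m -ᴿ ((α *ᴿ a) *ᴿ fromℚ (Bin (suc d) m)) ≐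
        (a *ᴿ (bin ⋆ᴿ e) m +ᴿ α *ᴿ ∑ᴿ r m) +ᴿ (r ⋆ᴿ e) m
      identity m n = begin
        seq ((y ⋆ᴿ x) m) n + - 1ℚ * (αₙ * aₙ * ∑ (Bin d) m)
          ≡⟨ cong (_+ - 1ℚ * (αₙ * aₙ * ∑ (Bin d) m)) (trans (seq-⋆ y x m n) (trans
               (⋆-congˡ (at x n) m (λ i → lem₁ (seq (y i) n) aₙ (Bin d i)))
               (trans (⋆-+ˡ (λ i → aₙ * Bin d i) (at r n) (at x n) m)
                 (cong₂ _+_ (trans (split (λ i → aₙ * Bin d i)) (cong₂ _+_
                     (trans (cong (αₙ *_) (∑-*ˡ aₙ (Bin d) m)) (lem₄ αₙ aₙ (∑ (Bin d) m)))
                     (trans (⋆-*ˡ aₙ (Bin d) (at e n) m) (cong (aₙ *_) (sym (seq-⋆ bin e m n))))))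
                   (trans (split (at r n)) (cong₂ _+_ (cong (αₙ *_) (sym (seq-∑ r m n))) (sym (seq-⋆ r e m n)))))))) ⟩
        (aₙ * (αₙ * ∑ (Bin d) m) + aₙ * seq ((bin ⋆ᴿ e) m) n) + (αₙ * seq (∑ᴿ r m) n + seq ((r ⋆ᴿ e) m) n)
          + - 1ℚ * (αₙ * aₙ * ∑ (Bin d) m)
          ≡⟨ lem₃ aₙ αₙ (∑ (Bin d) m) _ _ _ ⟩
        seq ((a *ᴿ (bin ⋆ᴿ e) m +ᴿ α *ᴿ ∑ᴿ r m) +ᴿ (r ⋆ᴿ e) m) n ∎
        where
        aₙ = seq a n
        αₙ = seq α n
        lem₄ : ∀ a b c → a * (b * c) ≡ b * (a * c)
        lem₄ = solve-∀ ℚ-ring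
        split : ∀ (z : Seq) → (z ⋆ at x n) m ≡ αₙ * ∑ z m + (z ⋆ at e n) m
        split z = trans (⋆-congʳ z m (λ i → lem₂ (seq (x i) n) αₙ)) (trans (⋆-+ʳ z (λ _ → αₙ * 1ℚ) (at e n) m)
          (cong (_+ (z ⋆ at e n) m) (trans (⋆-*ʳ αₙ z 𝟙 m) (cong (αₙ *_) (trans (⋆-comm z 𝟙 m) (𝟙-⋆ z m))))))

  addHead : ∀ {d} → ℝ → Vec ℝ (suc d) → Vec ℝ (suc d)
  addHead c (p ∷ ps) = (c +ᴿ p) ∷ ps

  -- Multiplication by 1 + u X as polynomials in X; for u = 1/(k + 1) and X = m this factor is the
  -- quotient of Bin (k + 1) m by Bin k m.
  mulLinear : ∀ {d} → ℚ → Vec ℝ d → Vec ℝ (suc d)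
  mulLinear u []       = 0ᴿ ∷ []
  mulLinear u (p ∷ ps) = p ∷ addHead (p *ᴿ fromℚ u) (mulLinear u ps)

  eval-addHead : ∀ {d} c (ps : Vec ℝ (suc d)) x → evalPoly (addHead c ps) x ≐ c +ᴿ evalPoly ps x
  eval-addHead c (p ∷ ps) x n = ℚ.+-assoc (seq c n) (seq p n) _

  eval-mulLinear : ∀ {d} u (ps : Vec ℝ d) x → evalPoly (mulLinear u ps) x ≐ (1ᴿ +ᴿ x *ᴿ fromℚ u) *ᴿ evalPoly ps x
  eval-mulLinear u []       x n = lem (seq x n) u
    where
    lem : ∀ x u → 0ℚ + x * 0ℚ ≡ (1ℚ + x * u) * 0ℚ
    lem = solve-∀ ℚ-ring
  eval-mulLinear u (p ∷ ps) x n = trans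
    (cong (λ t → seq p n + seq x n * t) (trans (eval-addHead (p *ᴿ fromℚ u) (mulLinear u ps) x n)
      (cong (seq p n * u +_) (eval-mulLinear u ps x n))))
    (lem (seq p n) (seq x n) u (seq (evalPoly ps x) n))
    where
    lem : ∀ p x u q → p + x * (p * u + (1ℚ + x * u) * q) ≡ (1ℚ + x * u) * (p + x * q)
    lem = solve-∀ ℚ-ring

  -- Horner's scheme for the basis Bin k, Bin (k + 1), … divided by Bin k
  toPoly : ∀ {d} → ℕ → Vec ℝ d → Vec ℝ d
  toPoly k []       = []
  toPoly k (c ∷ cs) = addHead c (mulLinear (inv (ι (suc k))) (toPoly (suc k) cs))

  N-offset : ∀ {d} → ℕ → Vec ℝ d → ℕ → ℝ
  N-offset k []       m = 0ᴿ
  N-offset k (c ∷ cs) m = c *ᴿ fromℚ (Bin k m) +ᴿ N-offset (suc k) cs m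

  ∑-N-offset : ∀ {d} k (cs : Vec ℝ d) m n → ∑ (at (N-offset k cs) n) m ≡ seq (N-offset (suc k) cs m) n
  ∑-N-offset k []       m n = trans (∑-cong m (λ i _ → sym (ℚ.*-zeroˡ 0ℚ))) (trans (∑-*ˡ 0ℚ (λ _ → 0ℚ) m) (ℚ.*-zeroˡ (∑ (λ _ → 0ℚ) m)))
  ∑-N-offset k (c ∷ cs) m n = trans (∑-+ _ (at (N-offset (suc k) cs) n) m)
    (cong₂ _+_ (∑-*ˡ (seq c n) (Bin k) m) (∑-N-offset (suc k) cs m n))

  N-offset-0 : ∀ {d} (cs : Vec ℝ d) m → N cs m ≐ N-offset 0 cs m
  N-offset-0 []       m n = refl
  N-offset-0 (c ∷ cs) m n = cong₂ _+_ (sym (ℚ.*-identityʳ (seq c n)))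
    (trans (seq-∑ (N cs) m n) (trans (∑-cong m (λ i _ → N-offset-0 cs i n)) (∑-N-offset 0 cs m n)))

  eval-toPoly : ∀ {d} k (cs : Vec ℝ d) m → evalPoly (toPoly k cs) (fromℕ m) *ᴿ fromℚ (Bin k m) ≐ N-offset k cs m
  eval-toPoly k []       m n = ℚ.*-zeroˡ (Bin k m)
  eval-toPoly k (c ∷ cs) m n = begin
    seq (evalPoly (toPoly k (c ∷ cs)) (fromℕ m)) n * Bin k m
      ≡⟨ cong (_* Bin k m) (trans (eval-addHead c (mulLinear u (toPoly (suc k) cs)) (fromℕ m) n)
           (cong (seq c n +_) (eval-mulLinear u (toPoly (suc k) cs) (fromℕ m) n))) ⟩
    (seq c n + (1ℚ + ι m * u) * H) * Bin k m
      ≡⟨ lem₁ (seq c n) (1ℚ + ι m * u) H (Bin k m) ⟩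
    seq c n * Bin k m + H * ((1ℚ + ι m * u) * Bin k m)
      ≡⟨ cong (λ t → seq c n * Bin k m + H * t) step ⟩
    seq c n * Bin k m + H * Bin (suc k) m
      ≡⟨ cong (seq c n * Bin k m +_) (eval-toPoly (suc k) cs m n) ⟩
    seq (N-offset k (c ∷ cs) m) n ∎
    where
    open ≡-Reasoning
    u H : ℚ
    u = inv (ι (suc k))
    H = seq (evalPoly (toPoly (suc k) cs) (fromℕ m)) n
    lem₁ : ∀ a b c d → (a + b * c) * d ≡ a * d + c * (b * d)
    lem₁ = solve-∀ ℚ-ring
    lem₂ : ∀ m u s b → (s * u + m * u) * b ≡ u * ((m + s) * b)
    lem₂ = solve-∀ ℚ-ring
    lem₃ : ∀ u s b → u * (s * b) ≡ s * u * b
    lem₃ = solve-∀ ℚ-ring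
    su≡1 : ι (suc k) * u ≡ 1ℚ
    su≡1 = *-inv (0<ι k)
    step : (1ℚ + ι m * u) * Bin k m ≡ Bin (suc k) m
    step = begin
      (1ℚ + ι m * u) * Bin k m                  ≡⟨ cong (λ t → (t + ι m * u) * Bin k m) (sym su≡1) ⟩
      (ι (suc k) * u + ι m * u) * Bin k m       ≡⟨ lem₂ (ι m) u (ι (suc k)) (Bin k m) ⟩
      u * ((ι m + ι (suc k)) * Bin k m)         ≡⟨ cong (u *_) (sym (Bin-rec k m)) ⟩
      u * (ι (suc k) * Bin (suc k) m)           ≡⟨ lem₃ u (ι (suc k)) (Bin (suc k) m) ⟩
      ι (suc k) * u * Bin (suc k) m             ≡⟨ trans (cong (_* Bin (suc k) m) su≡1) (ℚ.*-identityˡ _) ⟩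
      Bin (suc k) m ∎

  eval-toPoly-0 : ∀ {d} (cs : Vec ℝ d) m → evalPoly (toPoly 0 cs) (fromℕ m) ≐ N cs m
  eval-toPoly-0 cs m n = trans (sym (ℚ.*-identityʳ _)) (trans (eval-toPoly 0 cs m n) (sym (N-offset-0 cs m n)))

  last-addHead : ∀ {d} c (ps : Vec ℝ (suc (suc d))) → last (addHead c ps) ≡ last ps
  last-addHead c (p ∷ ps) = refl

  last-mulLinear : ∀ {d} u (ps : Vec ℝ (suc d)) → last (mulLinear u ps) ≐ last ps *ᴿ fromℚ u
  last-mulLinear u (p ∷ [])     n = ℚ.+-identityʳ _
  last-mulLinear u (p ∷ q ∷ ps) n = trans (cong (λ t → seq t n) (last-addHead (p *ᴿ fromℚ u) (mulLinear u (q ∷ ps))))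
    (last-mulLinear u (q ∷ ps) n)

  -- Every step of the scheme divides the leading coefficient by k + 1; the factor `ifac k` on the
  -- left avoids a quotient of factorials.
  last-toPoly : ∀ {d} k (cs : Vec ℝ d) a n → seq (last (toPoly k (cs ∷ʳ a))) n * ifac k ≡ seq a n * ifac (k ℕ.+ d)
  last-toPoly k []       a n = cong₂ (λ s t → s * ifac t) (ℚ.+-identityʳ (seq a n)) (sym (ℕ.+-identityʳ k))
  last-toPoly {suc d} k (c ∷ cs) a n = begin
    seq (last (addHead c (mulLinear u (toPoly (suc k) (cs ∷ʳ a))))) n * ifac k
      ≡⟨ cong (λ t → seq t n * ifac k) (last-addHead c (mulLinear u (toPoly (suc k) (cs ∷ʳ a)))) ⟩
    seq (last (mulLinear u (toPoly (suc k) (cs ∷ʳ a)))) n * ifac k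
      ≡⟨ cong (_* ifac k) (last-mulLinear u (toPoly (suc k) (cs ∷ʳ a)) n) ⟩
    seq (last (toPoly (suc k) (cs ∷ʳ a))) n * u * ifac k
      ≡⟨ trans (ℚ.*-assoc (seq (last (toPoly (suc k) (cs ∷ʳ a))) n) u (ifac k)) (cong (seq (last (toPoly (suc k) (cs ∷ʳ a))) n *_) (sym (ifac-suc k))) ⟩
    seq (last (toPoly (suc k) (cs ∷ʳ a))) n * ifac (suc k)
      ≡⟨ last-toPoly (suc k) cs a n ⟩
    seq a n * ifac (suc k ℕ.+ d)
      ≡⟨ cong (λ t → seq a n * ifac t) (sym (ℕ.+-suc k d)) ⟩
    seq a n * ifac (k ℕ.+ suc d) ∎
    where
    open ≡-Reasoning
    u = inv (ι (suc k))

  last-toPoly-0 : ∀ {d} (cs : Vec ℝ d) a → last (toPoly 0 (cs ∷ʳ a)) ≐ a *ᴿ fromℚ (ifac d)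
  last-toPoly-0 {d} cs a n = trans (sym (ℚ.*-identityʳ _)) (trans (cong (seq (last (toPoly 0 (cs ∷ʳ a))) n *_) (sym ifac₀)) (last-toPoly 0 cs a n))

-- From geometric ratios to the asymptotic expansions.

module Asymptotics where

  open import Data.Nat as ℕ using (ℕ; zero; suc; z≤n)
  import Data.Nat.Properties as ℕ
  open import Data.Product using (∃-syntax; _×_; _,_; proj₁; proj₂)
  open import Data.Rational as ℚ
    using (ℚ; 0ℚ; 1ℚ; ½; _+_; _*_; _-_; -_; _≤_; _<_; ∣_∣)
  open import Data.Rational.Properties as ℚ using (≤-refl; ≤-trans; <⇒≤)
  open import Data.Vec using (Vec; _∷ʳ_; last)
  open import Function using (_∘_)
  open import Relation.Binary.PropositionalEquality
  open import Tactic.RingSolver using (solve-∀)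
  open import Defs
  open Rationals
  open Sums
  open Ratios
  open Numerics using (GeometricRatios)
  open Reals
  open Polys

  -- The (s + 1)-fold convolution power
  power : Seq → ℕ → Seq
  power c zero    = c
  power c (suc s) = power c s ⋆ c

  powerᴿ : (ℕ → ℝ) → ℕ → ℕ → ℝ
  powerᴿ x zero    = x
  powerᴿ x (suc s) = powerᴿ x s ⋆ᴿ x

  -- Finitely many initial terms only enlarge the constant, as κ is positive.
  small-extend : ∀ {κ} n {e : ℕ → ℝ} → 0ℚ < κ → Small κ (e ∘ (n ℕ.+_)) → Small κ e
  small-extend zero    0<κ h = h
  small-extend {κ} (suc n) {e} 0<κ h with small-extend n {e ∘ suc} 0<κ h
  ... | C , 0≤C , bound = C * inv κ + q , (0≤C 0* 0≤inv 0<κ) 0+ 0≤q , all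
    where
    q = proj₁ (Bd-bounded (e 0))
    0≤q = proj₁ (proj₂ (Bd-bounded (e 0)))
    lem : ∀ c i k x → c * x ≡ c * (k * i) * x → c * x ≡ c * i * (k * x)
    lem c i k x eq = trans eq (go c i k x)
      where
      go : ∀ c i k x → c * (k * i) * x ≡ c * i * (k * x)
      go = solve-∀ ℚ-ring
    all : ∀ m → Bd ((C * inv κ + q) * κ ^ m) (e m)
    all zero    = Bd-mono {x = e 0} (≤≡ (p≤q+p (0≤C 0* 0≤inv 0<κ)) (sym (ℚ.*-identityʳ _))) (proj₂ (proj₂ (Bd-bounded (e 0))))
    all (suc m) = Bd-mono {x = e (suc m)} (≡≤ (lem C (inv κ) κ (κ ^ m) (cong (_* κ ^ m) (trans (sym (ℚ.*-identityʳ C)) (cong (C *_) (sym (*-inv 0<κ))))))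
      (≤* {C * inv κ} {C * inv κ + q} (κ ^ suc m) (0≤^ (suc m) (<⇒≤ 0<κ)) (p≤p+q 0≤q))) (bound m)

  -- A positive sequence whose relative increments are geometrically small, with
  -- total at most 1/2, stays within a factor 2.
  module NearlyConstant (y : Seq) (L κ : ℚ) (n : ℕ) (0≤L : 0ℚ ≤ L) (0≤κ : 0ℚ ≤ κ) (κ<1 : κ < 1ℚ)
    (0≤y : ∀ i → 0ℚ ≤ y i)
    (step : ∀ i → i ℕ.< n → ∣ y (suc i) - y i ∣ ≤ L * κ ^ i * y i)
    (total : L * inv (1ℚ - κ) ≤ ½) where

    private
      K : ℚ
      K = L * inv (1ℚ - κ)

      0≤K : 0ℚ ≤ K
      0≤K = 0≤L 0* 0≤inv (0<q-p κ<1)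

      S : Seq
      S j = K * (1ℚ - κ ^ j)

      S-suc : ∀ j → S (suc j) ≡ S j + L * κ ^ j
      S-suc j = trans (lem K κ (κ ^ j)) (cong (λ t → S j + t * κ ^ j) (trans (lem′ L (inv (1ℚ - κ)) (1ℚ - κ))
        (trans (cong (L *_) (*-inv (0<q-p κ<1))) (ℚ.*-identityʳ L))))
        where
        lem : ∀ K k x → K * (1ℚ - k * x) ≡ K * (1ℚ - x) + K * (1ℚ - k) * x
        lem = solve-∀ ℚ-ring
        lem′ : ∀ a b c → a * b * c ≡ a * (c * b)
        lem′ = solve-∀ ℚ-ring

      0≤S : ∀ j → 0ℚ ≤ S j
      0≤S j = 0≤K 0* 0≤q-p (^≤1 j 0≤κ (<⇒≤ κ<1))

      S≤½ : ∀ j → S j ≤ ½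
      S≤½ j = ≤-trans (≤-by (K * κ ^ j) (0≤K 0* 0≤^ j 0≤κ) (lem K (κ ^ j))) total
        where
        lem : ∀ K x → K ≡ K * (1ℚ - x) + K * x
        lem = solve-∀ ℚ-ring

      0≤t : ∀ j → 0ℚ ≤ L * κ ^ j
      0≤t j = 0≤L 0* 0≤^ j 0≤κ

      t≤1 : ∀ j → L * κ ^ j ≤ 1ℚ
      t≤1 j = ≤-trans (p≤q+p (0≤S j)) (≡≤ (sym (S-suc j)) (≤-trans (S≤½ (suc j)) ≤!))

      y0≥0 = 0≤y 0

      -- With S the sum of the relative steps tᵢ, the product of the 1 + tᵢ is at most 1 + 2 S
      -- because S ≤ 1/2; in `lower′` the product of the 1 - tᵢ is at least 1 - S.
      upper′ : ∀ j → j ℕ.≤ n → y j ≤ y 0 * (1ℚ + (S j + S j))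
      upper′ zero    _   = ℚ.≤-reflexive (lem (y 0) K)
        where
        lem : ∀ a K → a ≡ a * (1ℚ + (K * (1ℚ - 1ℚ) + K * (1ℚ - 1ℚ)))
        lem = solve-∀ ℚ-ring
      upper′ (suc j) j<n = begin
        y (suc j)
          ≡⟨ lem₁ (y (suc j)) (y j) ⟩
        y j + (y (suc j) - y j)
          ≤⟨ ℚ.+-monoʳ-≤ (y j) (≤-trans (p≤∣p∣ (y (suc j) - y j)) (step j j<n)) ⟩
        y j + t * y j
          ≡⟨ lem₂ (y j) t ⟩
        (1ℚ + t) * y j
          ≤⟨ *≤ (1ℚ + t) (0≤1 0+ 0≤t j) (upper′ j (ℕ.<⇒≤ j<n)) ⟩
        (1ℚ + t) * (y 0 * (1ℚ + (S j + S j)))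
          ≤⟨ ≤-by (y 0 * (t * (1ℚ - (S j + S j)))) (y0≥0 0* (0≤t j 0* 0≤q-p (S≤½ j +≤+ S≤½ j))) (lem₃ (y 0) t (S j)) ⟩
        y 0 * (1ℚ + ((S j + t) + (S j + t)))
          ≡⟨ cong (λ s → y 0 * (1ℚ + (s + s))) (S-suc j) ⟨
        y 0 * (1ℚ + (S (suc j) + S (suc j))) ∎
        where
        open ℚ.≤-Reasoning
        t = L * κ ^ j
        lem₁ : ∀ a b → a ≡ b + (a - b)
        lem₁ = solve-∀ ℚ-ring
        lem₂ : ∀ a t → a + t * a ≡ (1ℚ + t) * a
        lem₂ = solve-∀ ℚ-ring
        lem₃ : ∀ y t s → y * (1ℚ + ((s + t) + (s + t))) ≡ (1ℚ + t) * (y * (1ℚ + (s + s))) + y * (t * (1ℚ - (s + s)))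
        lem₃ = solve-∀ ℚ-ring

      lower′ : ∀ j → j ℕ.≤ n → y 0 * (1ℚ - S j) ≤ y j
      lower′ zero    _   = ℚ.≤-reflexive (lem (y 0) K)
        where
        lem : ∀ a K → a * (1ℚ - K * (1ℚ - 1ℚ)) ≡ a
        lem = solve-∀ ℚ-ring
      lower′ (suc j) j<n = begin
        y 0 * (1ℚ - S (suc j))
          ≡⟨ cong (λ s → y 0 * (1ℚ - s)) (S-suc j) ⟩
        y 0 * (1ℚ - (S j + t))
          ≤⟨ ≤-by (y 0 * (S j * t)) (y0≥0 0* (0≤S j 0* 0≤t j)) (lem₃ (y 0) t (S j)) ⟩
        (1ℚ - t) * (y 0 * (1ℚ - S j))
          ≤⟨ *≤ (1ℚ - t) (0≤q-p (t≤1 j)) (lower′ j (ℕ.<⇒≤ j<n)) ⟩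
        (1ℚ - t) * y j
          ≡⟨ lem₂ (y j) t ⟩
        y j - t * y j
          ≤⟨ ℚ.+-monoʳ-≤ (y j) (ℚ.neg-antimono-≤ (≤-trans (-p≤∣p∣ (y (suc j) - y j)) (step j j<n))) ⟩
        y j - - (y (suc j) - y j)
          ≡⟨ lem₁ (y (suc j)) (y j) ⟩
        y (suc j) ∎
        where
        open ℚ.≤-Reasoning
        t = L * κ ^ j
        lem₁ : ∀ a b → b - - (a - b) ≡ a
        lem₁ = solve-∀ ℚ-ring
        lem₂ : ∀ a t → (1ℚ - t) * a ≡ a - t * a
        lem₂ = solve-∀ ℚ-ring
        lem₃ : ∀ y t s → (1ℚ - t) * (y * (1ℚ - s)) ≡ y * (1ℚ - (s + t)) + y * (s * t)
        lem₃ = solve-∀ ℚ-ring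

    upper : ∀ j → j ℕ.≤ n → y j ≤ (1ℚ + 1ℚ) * y 0
    upper j j≤n = ≤-trans (upper′ j j≤n) (≤≡ (*≤ (y 0) y0≥0 (ℚ.+-monoʳ-≤ 1ℚ (S≤½ j +≤+ S≤½ j))) (ℚ.*-comm (y 0) (1ℚ + 1ℚ)))

    lower : ∀ j → j ℕ.≤ n → ½ * y 0 ≤ y j
    lower j j≤n = ≤-trans (≡≤ (ℚ.*-comm ½ (y 0)) (*≤ (y 0) y0≥0 (≤-by (½ - S j) (0≤q-p (S≤½ j)) (lem (S j))))) (lower′ j j≤n)
      where
      lem : ∀ s → 1ℚ - s ≡ ½ + (½ - s)
      lem = solve-∀ ℚ-ring

  HasExpansion : Seq → Set
  HasExpansion c = ∃[ α ] ∃[ γ ] ∃[ κ ] (0ᴿ ≤ᴿ κ) × (κ <ᴿ 1ᴿ) ×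
    (λ m → fromℚ (c m)) ≈ (λ m → α *ᴿ γ ^ᴿ m) [1+O (λ m → κ ^ᴿ m) ] ×
    (∀ s → ∃[ P ] (last P ≐ α ^ᴿ suc s *ᴿ fromℚ (ifac s)) ×
      (λ m → fromℚ (power c s m)) ≈ (λ m → evalPoly {suc s} P (fromℕ m) *ᴿ γ ^ᴿ m) [1+O (λ m → κ ^ᴿ m) ])

  -- x(m) = c(m)/γᵐ converges geometrically to α and stays above V.
  module Expansion (c : Seq) (c₀ : c 0 ≡ 1ℚ) (0<c : ∀ m → 0ℚ < c m)
    (R : Seq) (0<R : ∀ n → 0ℚ < R n) (γ : ℝ) (γ-seq : ∀ n → seq γ n ≡ R n)
    (x : ℕ → ℝ) (x-seq : ∀ m n → seq (x m) n ≡ c m * inv (R n) ^ m)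
    (κ₀ : ℚ) (0<κ₀ : 0ℚ < κ₀) (κ₀<1 : κ₀ < 1ℚ) (α : ℝ) (x-small : Small κ₀ (λ m → x m -ᴿ α))
    (V : ℚ) (0<V : 0ℚ < V) (start : ℕ) (x-lower : ∀ j → Eventually λ n → V ≤ seq (x (start ℕ.+ j)) n) where

    private
      0≤κ₀ = <⇒≤ 0<κ₀

    -- Halfway between κ₀ and 1: convolution needs room above κ₀, and a single κ has to serve all s.
    κ : ℚ
    κ = ½ * (κ₀ + 1ℚ)

    κ₀<κ : κ₀ < κ
    κ₀<κ = subst (_< κ) (lem κ₀) (*<* ½ 0<½ (ℚ.+-monoʳ-< κ₀ κ₀<1))
      where
      lem : ∀ k → ½ * (k + k) ≡ k
      lem = solve-∀ ℚ-ring

    κ<1 : κ < 1ℚ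
    κ<1 = *<* ½ 0<½ (ℚ.+-monoˡ-< 1ℚ κ₀<1)

    0<κ : 0ℚ < κ
    0<κ = ℚ.<-trans 0<κ₀ κ₀<κ

    private
      base-small : Small κ (λ m → x m -ᴿ (α ^ᴿ 1 *ᴿ fromℚ (Bin 0 m)))
      base-small = proj₁ small , proj₁ (proj₂ small) , λ m →
        Bd-≐ {x = x m -ᴿ (α ^ᴿ 1 *ᴿ fromℚ (Bin 0 m))} {y = x m -ᴿ α} (λ n → lem (seq (x m) n) (seq α n)) (proj₂ (proj₂ small) m)
        where
        small : Small κ (λ m → x m -ᴿ α)
        small = small-mono {y = λ m → x m -ᴿ α} 0≤κ₀ (<⇒≤ κ₀<κ) x-small
        lem : ∀ x a → x + - 1ℚ * (a * 1ℚ * 1ℚ) ≡ x + - 1ℚ * a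
        lem = solve-∀ ℚ-ring

      leading-zero : Leading 0<κ κ<1 zero (α ^ᴿ suc zero) (powerᴿ x zero)
      leading-zero = near-≐ {zero} {κ} {λ m → powerᴿ x zero m -ᴿ (α ^ᴿ suc zero *ᴿ fromℚ (Bin zero m))}
        {λ m → x m -ᴿ (α ^ᴿ 1 *ᴿ fromℚ (Bin 0 m))} (λ m n → refl)
        (near-small {κ} {λ m → x m -ᴿ (α ^ᴿ 1 *ᴿ fromℚ (Bin 0 m))} 0 base-small)

      leading-suc : ∀ s → Leading 0<κ κ<1 s (α ^ᴿ suc s) (powerᴿ x s) →
        Leading 0<κ κ<1 (suc s) (α ^ᴿ suc (suc s)) (powerᴿ x (suc s))
      leading-suc s h = near-≐ {suc s} {κ} {λ m → powerᴿ x (suc s) m -ᴿ (α ^ᴿ suc (suc s) *ᴿ fromℚ (Bin (suc s) m))}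
        {λ m → (powerᴿ x s ⋆ᴿ x) m -ᴿ ((α *ᴿ α ^ᴿ suc s) *ᴿ fromℚ (Bin (suc s) m))} (λ m n → refl)
        (leading-⋆ 0<κ κ<1 {κ₀} {s} {α ^ᴿ suc s} {powerᴿ x s} {x} {α} 0≤κ₀ κ₀<κ x-small h)

    leading : ∀ s → Leading 0<κ κ<1 s (α ^ᴿ suc s) (powerᴿ x s)
    leading zero    = leading-zero
    leading (suc s) = leading-suc s (leading s)

    private
      powerᴿ-seq : ∀ s m n → seq (powerᴿ x s m) n ≡ power c s m * inv (R n) ^ m
      powerᴿ-seq zero    m n = x-seq m n
      powerᴿ-seq (suc s) m n = trans (seq-⋆ (powerᴿ x s) x m n)
        (trans (⋆-cong {at (powerᴿ x s) n} m (λ i _ → powerᴿ-seq s i n) (λ i _ → x-seq i n)) (sym (*^-⋆ (inv (R n)) (power c s) c m)))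

      -- Holds because c 0 = 1. It carries the lower bound V over to all convolution powers, so that
      -- division by the approximating polynomial is possible.
      power-lower : ∀ s m → c m ≤ power c s m
      power-lower zero    m = ≤-refl
      power-lower (suc s) m = ≤-trans (power-lower s m) (≡≤ (trans (sym (ℚ.*-identityˡ (power c s m))) (cong (_* power c s m) (sym c₀)))
        (≤≡ (⋆-head≤ m (λ i → <⇒≤ (0<c i)) (0≤power s)) (⋆-comm c (power c s) m)))
        where
        0≤power : ∀ s i → 0ℚ ≤ power c s i
        0≤power zero    i = <⇒≤ (0<c i)
        0≤power (suc s) i = ⋆-≥0 i (0≤power s) (λ i → <⇒≤ (0<c i))

      power-x-lower : ∀ s j → Eventually λ n → V ≤ seq (powerᴿ x s (start ℕ.+ j)) n
      power-x-lower s j = ev-map (λ n h → ≤-trans h (≡≤ (x-seq (start ℕ.+ j) n)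
        (≤≡ (≤* (inv (R n) ^ (start ℕ.+ j)) (0≤^ (start ℕ.+ j) (0≤inv (0<R n))) (power-lower s (start ℕ.+ j))) (sym (powerᴿ-seq s (start ℕ.+ j) n)))))
        (x-lower j)

    -- The relative error is E = (y − Q)/Q, where y(m) = power c s m / γᵐ.
    module Error (s : ℕ) (Q : ℕ → ℝ) (C : ℚ) (0≤C : 0ℚ ≤ C)
      (close : ∀ m → Bd (C * κ ^ m) (powerᴿ x s m -ᴿ Q m)) where

      d : ℚ
      d = ½ * V
      0<d : 0ℚ < d
      0<d = pos* 0<½ 0<V
      E : ℕ → ℝ
      -- The inverse is cut off at d, which defines E for all m; once Q m ≥ d it is the true
      -- relative error.
      E m = (powerᴿ x s m -ᴿ Q m) *ᴿ Reciprocal.recip d 0<d (Q m)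

      E-bd : ∀ m → Bd (C * κ ^ m * inv d) (E m)
      E-bd m = Bd-≐ {x = E m} {y = (powerᴿ x s m -ᴿ Q m) *ᴿ Reciprocal.recip d 0<d (Q m)} (λ n → refl)
        (Bd-* {C * κ ^ m} {inv d} {powerᴿ x s m -ᴿ Q m} {Reciprocal.recip d 0<d (Q m)}
          (0≤C 0* 0≤^ m (<⇒≤ 0<κ)) (0≤inv 0<d) (close m) (Reciprocal.Bd-recip d 0<d (Q m)))

      E-bound : ∀ m → ∣ E m ∣ᴿ ≤ᴿ fromℚ (C * inv d) *ᴿ ∣ fromℚ κ ^ᴿ m ∣ᴿ
      E-bound m ε 0<ε = ev-map (λ n h → ≤≡ h (cong (_+ ε) (trans (lem C (κ ^ m) (inv d)) (cong (C * inv d *_)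
        (sym (trans (cong ∣_∣ (seq-^ (fromℚ κ) m n)) (ℚ.0≤p⇒∣p∣≡p (0≤^ m (<⇒≤ 0<κ)))))))))
        (within (E-bd m) ε 0<ε)
        where
        lem : ∀ a b c → a * b * c ≡ a * c * b
        lem = solve-∀ ℚ-ring

      η : ℚ
      η = ½ * d

      0<η : 0ℚ < η
      0<η = pos* 0<½ 0<d

      0<C+1 : 0ℚ < C + 1ℚ
      0<C+1 = ℚ.+-mono-≤-< 0≤C 0<1

      η′ : ℚ
      η′ = η * inv (C + 1ℚ)

      0<η′ : 0ℚ < η′
      0<η′ = pos* {η} {inv (C + 1ℚ)} 0<η (0<inv 0<C+1)

      error-small : ∀ m → κ ^ m ≤ η′ → C * κ ^ m ≤ η
      error-small m h = ≤-trans (*≤* {C} {C + 1ℚ} {κ ^ m} {η′} 0≤C (<⇒≤ 0<η′) (p≤p+q 0≤1) h)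
        (ℚ.≤-reflexive (trans (lem (C + 1ℚ) η (inv (C + 1ℚ))) (trans (cong (η *_) (*-inv 0<C+1)) (ℚ.*-identityʳ η))))
        where
        lem : ∀ a b c → a * (b * c) ≡ b * (a * c)
        lem = solve-∀ ℚ-ring

      -- One η covers the geometric error and one the slack of the bound; V - 2 η = V - d = d.
      Q-lower : ∀ j → κ ^ (start ℕ.+ j) ≤ η′ → Eventually λ n → d ≤ seq (Q (start ℕ.+ j)) n
      Q-lower j small = ev-map₂ (λ n low near → bound (seq (powerᴿ x s (start ℕ.+ j)) n) (seq (Q (start ℕ.+ j)) n) low
          (≤-trans near (ℚ.+-monoˡ-≤ η (error-small (start ℕ.+ j) small))))
        (power-x-lower s j) (within (close (start ℕ.+ j)) η 0<η)
        where
        lem₁ : ∀ v → ½ * v ≡ v - (½ * (½ * v) + ½ * (½ * v))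
        lem₁ = solve-∀ ℚ-ring
        lem₂ : ∀ p q → p - (p + - 1ℚ * q) ≡ q
        lem₂ = solve-∀ ℚ-ring
        bound : ∀ p q → V ≤ p → ∣ p + - 1ℚ * q ∣ ≤ η + η → d ≤ q
        bound p q V≤p h = ≡≤ (lem₁ V) (≤≡ (V≤p +≤+ ℚ.neg-antimono-≤ (≤-trans (p≤∣p∣ (p + - 1ℚ * q)) h)) (lem₂ p q))

      E-correct : ∀ j → κ ^ (start ℕ.+ j) ≤ η′ → let m = start ℕ.+ j in
        fromℚ (power c s m) ≃ (Q m *ᴿ γ ^ᴿ m) *ᴿ (1ᴿ +ᴿ E m)
      E-correct j small ε 0<ε = ev-map (λ n d≤Q → ≡≤ (cong ∣_∣ (trans (cong (λ t → power c s m - t) (exact n d≤Q)) (ℚ.+-inverseʳ (power c s m)))) (<⇒≤ 0<ε))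
        (Q-lower j small)
        where
        m = start ℕ.+ j
        open ≡-Reasoning
        lem₁ : ∀ q g p i → q * g * (1ℚ + (p + - 1ℚ * q) * i) ≡ g * (q + (p + - 1ℚ * q) * (q * i))
        lem₁ = solve-∀ ℚ-ring
        lem₂ : ∀ g q p → g * (q + (p + - 1ℚ * q) * 1ℚ) ≡ g * p
        lem₂ = solve-∀ ℚ-ring
        lem₃ : ∀ g w i → g * (w * i) ≡ w * (g * i)
        lem₃ = solve-∀ ℚ-ring
        -- γ and the denominators of x have the same approximations R n, so the powers cancel
        -- exactly at each such n.
        exact : ∀ n → d ≤ seq (Q m) n → seq ((Q m *ᴿ γ ^ᴿ m) *ᴿ (1ᴿ +ᴿ E m)) n ≡ power c s m
        exact n d≤Q = begin
          seq (Q m) n * seq (γ ^ᴿ m) n * (1ℚ + (seq (powerᴿ x s m) n + - 1ℚ * seq (Q m) n) * seq (Reciprocal.recip d 0<d (Q m)) n)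
            ≡⟨ lem₁ (seq (Q m) n) (seq (γ ^ᴿ m) n) (seq (powerᴿ x s m) n) (seq (Reciprocal.recip d 0<d (Q m)) n) ⟩
          seq (γ ^ᴿ m) n * (seq (Q m) n + (seq (powerᴿ x s m) n + - 1ℚ * seq (Q m) n) * (seq (Q m) n * seq (Reciprocal.recip d 0<d (Q m)) n))
            ≡⟨ cong (λ t → seq (γ ^ᴿ m) n * (seq (Q m) n + (seq (powerᴿ x s m) n + - 1ℚ * seq (Q m) n) * t)) (Reciprocal.recip-seq d 0<d (Q m) n d≤Q) ⟩
          seq (γ ^ᴿ m) n * (seq (Q m) n + (seq (powerᴿ x s m) n + - 1ℚ * seq (Q m) n) * 1ℚ)
            ≡⟨ lem₂ (seq (γ ^ᴿ m) n) (seq (Q m) n) (seq (powerᴿ x s m) n) ⟩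
          seq (γ ^ᴿ m) n * seq (powerᴿ x s m) n
            ≡⟨ cong₂ _*_ (trans (seq-^ γ m n) (cong (_^ m) (γ-seq n))) (powerᴿ-seq s m n) ⟩
          R n ^ m * (power c s m * inv (R n) ^ m)
            ≡⟨ lem₃ (R n ^ m) (power c s m) (inv (R n) ^ m) ⟩
          power c s m * (R n ^ m * inv (R n) ^ m)
            ≡⟨ cong (power c s m *_) (trans (sym (*-^ (R n) (inv (R n)) m)) (trans (cong (_^ m) (*-inv (0<R n))) (1^ m))) ⟩
          power c s m * 1ℚ
            ≡⟨ ℚ.*-identityʳ _ ⟩
          power c s m ∎

    expansion : ∀ s (Q : ℕ → ℝ) → Small κ (λ m → powerᴿ x s m -ᴿ Q m) →
      (λ m → fromℚ (power c s m)) ≈ (λ m → Q m *ᴿ γ ^ᴿ m) [1+O (λ m → fromℚ κ ^ᴿ m) ]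
    expansion s Q (C , 0≤C , close) = Error.E s Q C 0≤C close
      , (fromℚ (C * inv (½ * V)) , 0 , λ m _ → Error.E-bound s Q C 0≤C close m)
      , E-eventually (^→0 (<⇒≤ 0<κ) κ<1 (Error.η′ s Q C 0≤C close) (Error.0<η′ s Q C 0≤C close))
      where
      Goal : ℕ → Set
      Goal m = fromℚ (power c s m) ≃ (Q m *ᴿ γ ^ᴿ m) *ᴿ (1ᴿ +ᴿ Error.E s Q C 0≤C close m)
      E-eventually : ∃[ J ] (∀ n → J ℕ.≤ n → κ ^ n ≤ Error.η′ s Q C 0≤C close) → Eventually Goal
      E-eventually (J , h) = start ℕ.+ J , λ m le → subst Goal (ℕ.m+[n∸m]≡n (ℕ.m+n≤o⇒m≤o start le))
        (Error.E-correct s Q C 0≤C close (m ℕ.∸ start)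
          (h (start ℕ.+ (m ℕ.∸ start)) (ℕ.≤-trans (ℕ.m+n≤o⇒n≤o start le) (ℕ.≤-reflexive (sym (ℕ.m+[n∸m]≡n (ℕ.m+n≤o⇒m≤o start le)))))))

    κᴿ : ℝ
    κᴿ = fromℚ κ

    0≤κᴿ : 0ᴿ ≤ᴿ κᴿ
    0≤κᴿ ε 0<ε = 0 , λ n _ → ≤-trans (<⇒≤ 0<κ) (p≤p+q (<⇒≤ 0<ε))

    κᴿ<1 : κᴿ <ᴿ 1ᴿ
    κᴿ<1 = 1ℚ - κ , 0<q-p κ<1 , 0 , λ n _ → ℚ.≤-reflexive (lem κ)
      where
      lem : ∀ k → k + (1ℚ - k) ≡ 1ℚ
      lem = solve-∀ ℚ-ring

    first-order : (λ m → fromℚ (c m)) ≈ (λ m → α *ᴿ γ ^ᴿ m) [1+O (λ m → κᴿ ^ᴿ m) ]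
    first-order = expansion 0 (λ _ → α) (small-mono {y = λ m → x m -ᴿ α} 0≤κ₀ (<⇒≤ κ₀<κ) x-small)

    polynomial : ∀ s → Vec ℝ (suc s)
    polynomial s = toPoly 0 (Near.coeffs (leading s) ∷ʳ α ^ᴿ suc s)

    polynomial-last : ∀ s → last (polynomial s) ≐ α ^ᴿ suc s *ᴿ fromℚ (ifac s)
    polynomial-last s = last-toPoly-0 (Near.coeffs (leading s)) (α ^ᴿ suc s)

    private
      near-polynomial : ∀ s a (h : Leading 0<κ κ<1 s a (powerᴿ x s)) →
        Small κ (λ m → powerᴿ x s m -ᴿ evalPoly (toPoly 0 (Near.coeffs h ∷ʳ a)) (fromℕ m))
      near-polynomial s a (mkNear cs C 0≤C cl) = C , 0≤C , λ m →
        Bd-≐ {x = powerᴿ x s m -ᴿ evalPoly (toPoly 0 (cs ∷ʳ a)) (fromℕ m)} {y = (powerᴿ x s m -ᴿ (a *ᴿ fromℚ (Bin s m))) -ᴿ N cs m}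
          (λ n → trans (cong (λ t → seq (powerᴿ x s m) n + - 1ℚ * t)
              (trans (eval-toPoly-0 (cs ∷ʳ a) m n) (N∷ʳ cs a m n)))
            (lem (seq (powerᴿ x s m) n) (seq (N cs m) n) (seq a n) (Bin s m)))
          (near-close (λ m → powerᴿ x s m -ᴿ (a *ᴿ fromℚ (Bin s m))) cs C cl m)
        where
        lem : ∀ p q a b → p + - 1ℚ * (q + a * b) ≡ (p + - 1ℚ * (a * b)) + - 1ℚ * q
        lem = solve-∀ ℚ-ring

    polynomial-order : ∀ s → (λ m → fromℚ (power c s m)) ≈ (λ m → evalPoly (polynomial s) (fromℕ m) *ᴿ γ ^ᴿ m) [1+O (λ m → κᴿ ^ᴿ m) ]
    polynomial-order s = expansion s (λ m → evalPoly (polynomial s) (fromℕ m)) (near-polynomial s (α ^ᴿ suc s) (leading s))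

  module Growth (c : Seq) (c₀ : c 0 ≡ 1ℚ) (0<c : ∀ m → 0ℚ < c m)
    (l : ℚ) (0<l : 0ℚ < l) (l-bound : ∀ m → l * c m ≤ c (suc m))
    (κ₀ : ℚ) (0<κ₀ : 0ℚ < κ₀) (κ₀<1 : κ₀ < 1ℚ) (A : ℚ) (N₀ : ℕ)
    (increments : ∀ i → ∣ ratio c (suc (N₀ ℕ.+ i)) - ratio c (N₀ ℕ.+ i) ∣ ≤ A * κ₀ ^ i) where

    private
      0≤κ₀ = <⇒≤ 0<κ₀

      0≤A : 0ℚ ≤ A
      0≤A = ≤≡ (≤-trans (ℚ.0≤∣p∣ (ratio c (suc (N₀ ℕ.+ 0)) - ratio c (N₀ ℕ.+ 0))) (increments 0)) (ℚ.*-identityʳ A)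

      R : Seq
      R i = ratio c (N₀ ℕ.+ i)

      R-step : ∀ i → ∣ R (suc i) - R i ∣ ≤ A * κ₀ ^ i
      R-step i = ≡≤ (cong (λ j → ∣ ratio c j - R i ∣) (ℕ.+-suc N₀ i)) (increments i)

      l≤ratio : ∀ m → l ≤ ratio c m
      l≤ratio m = ≡≤ (sym (trans (ℚ.*-assoc l (c m) (inv (c m))) (trans (cong (l *_) (*-inv (0<c m))) (ℚ.*-identityʳ l))))
        (≤* (inv (c m)) (0≤inv (0<c m)) (l-bound m))

      0<R : ∀ i → 0ℚ < R i
      0<R i = ℚ.<-≤-trans 0<l (l≤ratio (N₀ ℕ.+ i))

      A′ : ℚ
      A′ = A * inv (1ℚ - κ₀)

      0≤A′ : 0ℚ ≤ A′
      0≤A′ = 0≤A 0* 0≤inv (0<q-p κ₀<1)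

      telescoped : ∀ i k → ∣ R (k ℕ.+ i) - R i ∣ ≤ A′ * (κ₀ ^ i - κ₀ ^ (k ℕ.+ i))
      telescoped i zero    = ≡≤ (cong ∣_∣ (ℚ.+-inverseʳ (R i))) (ℚ.≤-reflexive (sym (lem A′ (κ₀ ^ i))))
        where
        lem : ∀ a b → a * (b - b) ≡ 0ℚ
        lem = solve-∀ ℚ-ring
      telescoped i (suc k) = begin
        ∣ R (suc k ℕ.+ i) - R i ∣
          ≤⟨ ∣p-r∣≤ (R (suc k ℕ.+ i)) (R (k ℕ.+ i)) (R i) ⟩
        ∣ R (suc k ℕ.+ i) - R (k ℕ.+ i) ∣ + ∣ R (k ℕ.+ i) - R i ∣
          ≤⟨ R-step (k ℕ.+ i) +≤+ telescoped i k ⟩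
        A * κ₀ ^ (k ℕ.+ i) + A′ * (κ₀ ^ i - κ₀ ^ (k ℕ.+ i))
          ≡⟨ cong (λ a → a * κ₀ ^ (k ℕ.+ i) + A′ * (κ₀ ^ i - κ₀ ^ (k ℕ.+ i))) A≡ ⟩
        A′ * (1ℚ - κ₀) * κ₀ ^ (k ℕ.+ i) + A′ * (κ₀ ^ i - κ₀ ^ (k ℕ.+ i))
          ≡⟨ lem A′ κ₀ (κ₀ ^ i) (κ₀ ^ (k ℕ.+ i)) ⟩
        A′ * (κ₀ ^ i - κ₀ * κ₀ ^ (k ℕ.+ i)) ∎
        where
        open ℚ.≤-Reasoning
        lem : ∀ K κ a t → K * (1ℚ - κ) * t + K * (a - t) ≡ K * (a - κ * t)
        lem = solve-∀ ℚ-ring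
        lem′ : ∀ a b c → a * b * c ≡ a * (c * b)
        lem′ = solve-∀ ℚ-ring
        A≡ : A ≡ A′ * (1ℚ - κ₀)
        A≡ = sym (trans (lem′ A (inv (1ℚ - κ₀)) (1ℚ - κ₀)) (trans (cong (A *_) (*-inv (0<q-p κ₀<1))) (ℚ.*-identityʳ A)))

      R-near : ∀ {i n} → i ℕ.≤ n → ∣ R n - R i ∣ ≤ A′ * κ₀ ^ i
      R-near {i} {n} i≤n = ≤-trans (≡≤ (cong (λ j → ∣ R j - R i ∣) (sym (ℕ.m∸n+n≡m i≤n))) (telescoped i (n ℕ.∸ i)))
        (*≤ A′ 0≤A′ (≤-by (κ₀ ^ (n ℕ.∸ i ℕ.+ i)) (0≤^ (n ℕ.∸ i ℕ.+ i) 0≤κ₀) (lem (κ₀ ^ i) (κ₀ ^ (n ℕ.∸ i ℕ.+ i)))))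
        where
        lem : ∀ a b → a ≡ a - b + b
        lem = solve-∀ ℚ-ring

      Rᴿ : ℕ → ℝ
      Rᴿ i = fromℚ (R i)

      Rᴿ-step : ∀ i → Bd (A * κ₀ ^ i) (Rᴿ (suc i) -ᴿ Rᴿ i)
      Rᴿ-step i = Bd-ev {x = Rᴿ (suc i) -ᴿ Rᴿ i} (0 , λ _ _ → ≡≤ (cong ∣_∣ (lem (R (suc i)) (R i))) (R-step i))
        where
        lem : ∀ a b → a + - 1ℚ * b ≡ a - b
        lem = solve-∀ ℚ-ring

      module L = Limit Rᴿ A κ₀ 0≤A 0<κ₀ κ₀<1 Rᴿ-step

    -- The reals Rᴿ i are constant sequences, so the diagonal sequence of their limit is R itself,
    -- definitionally.
    γ : ℝ
    γ = L.limit

    private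
      r : ℕ → ℚ
      r n = inv (R n)

      0<r : ∀ n → 0ℚ < r n
      0<r n = 0<inv (0<R n)

      r≤ : ∀ n → r n ≤ inv l
      r≤ n = inv-≤ 0<l (l≤ratio (N₀ ℕ.+ n))

      module Rec = Reciprocal l 0<l

      ρ : ℝ
      ρ = Rec.recip γ

      ρ-seq : ∀ n → seq ρ n ≡ r n
      ρ-seq n = cong inv (ℚ.p≤q⇒p⊔q≡q (l≤ratio (N₀ ℕ.+ n)))

      x : ℕ → ℝ
      x m = fromℚ (c m) *ᴿ ρ ^ᴿ m

      x-seq : ∀ m n → seq (x m) n ≡ c m * r n ^ m
      x-seq m n = cong (c m *_) (trans (seq-^ ρ m n) (cong (_^ m) (ρ-seq n)))

      -- The n-th approximation of x m, with R n in place of γ. The quotients R i / R n are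
      -- controlled for i ≤ n only, which is why the bounds below hold for j up to about n.
      y : ℕ → Seq
      y n m = c m * r n ^ m

      0≤y : ∀ n m → 0ℚ ≤ y n m
      0≤y n m = <⇒≤ (0<c m) 0* 0≤^ m (<⇒≤ (0<r n))

      L₀ : ℚ
      L₀ = inv l * A′

      0≤L₀ : 0ℚ ≤ L₀
      0≤L₀ = 0≤inv 0<l 0* 0≤A′

      -- y n (m + 1) = y n m · R(m)/R(n)
      y-step : ∀ n i → i ℕ.≤ n → ∣ y n (suc (N₀ ℕ.+ i)) - y n (N₀ ℕ.+ i) ∣ ≤ L₀ * κ₀ ^ i * y n (N₀ ℕ.+ i)
      y-step n i i≤n = begin
        ∣ c (suc m) * (r n * r n ^ m) - c m * r n ^ m ∣
          ≡⟨ cong ∣_∣ (trans (cong₂ (λ s t → s * (r n * r n ^ m) - t) (sym (ratio-* {c} m (0<c m)))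
               (trans (sym (ℚ.*-identityˡ (c m * r n ^ m))) (cong (_* (c m * r n ^ m)) (sym (*-inv (0<R n))))))
               (lem (R i) (c m) (r n) (r n ^ m) (R n))) ⟩
        ∣ - r n * (R n - R i) * (c m * r n ^ m) ∣
          ≤⟨ ∣p*q∣≤ { - r n * (R n - R i)} (∣p*q∣≤ { - r n} (≡≤ (trans (ℚ.∣-p∣≡∣p∣ (r n)) (ℚ.0≤p⇒∣p∣≡p (<⇒≤ (0<r n)))) (r≤ n)) (R-near i≤n))
               (ℚ.≤-reflexive (ℚ.0≤p⇒∣p∣≡p (0≤y n m))) ⟩
        inv l * (A′ * κ₀ ^ i) * (c m * r n ^ m)
          ≡⟨ cong (_* (c m * r n ^ m)) (sym (ℚ.*-assoc (inv l) A′ (κ₀ ^ i))) ⟩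
        L₀ * κ₀ ^ i * y n m ∎
        where
        open ℚ.≤-Reasoning
        m = N₀ ℕ.+ i
        lem : ∀ s c r x t → s * c * (r * x) - t * r * (c * x) ≡ - r * (t - s) * (c * x)
        lem = solve-∀ ℚ-ring

      0<1-κ₀ : 0ℚ < 1ℚ - κ₀
      0<1-κ₀ = 0<q-p κ₀<1

    -- From index M on, the relative increments add up to at most 1/2.
    threshold : ∃[ M ] L₀ * κ₀ ^ M * inv (1ℚ - κ₀) ≤ ½
    threshold = M , ≤-trans (ℚ.≤-reflexive (lem L₀ (κ₀ ^ M) (inv (1ℚ - κ₀)))) (≤-trans
        (*≤* (0≤L₀ 0* 0≤inv 0<1-κ₀) (_0*_ {½} ≤! (0≤inv 0<D)) (p≤p+q 0≤1) (h M ℕ.≤-refl))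
        (ℚ.≤-reflexive (trans (lem′ D (inv D)) (cong (½ *_) (*-inv 0<D)))))
      where
      D : ℚ
      D = L₀ * inv (1ℚ - κ₀) + 1ℚ
      0<D : 0ℚ < D
      0<D = ℚ.+-mono-≤-< (0≤L₀ 0* 0≤inv 0<1-κ₀) 0<1
      found = ^→0 0≤κ₀ κ₀<1 (½ * inv D) (pos* 0<½ (0<inv 0<D))
      M = proj₁ found
      h = proj₂ found
      lem : ∀ a b c → a * b * c ≡ a * c * b
      lem = solve-∀ ℚ-ring
      lem′ : ∀ a b → a * (½ * b) ≡ ½ * (a * b)
      lem′ = solve-∀ ℚ-ring

    module From (M : ℕ) (threshold≤ : L₀ * κ₀ ^ M * inv (1ℚ - κ₀) ≤ ½) where

      private
        start : ℕ
        start = N₀ ℕ.+ M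

        module NC (n : ℕ) = NearlyConstant (λ j → y (M ℕ.+ n) (start ℕ.+ j)) (L₀ * κ₀ ^ M) κ₀ (suc n)
          (0≤L₀ 0* 0≤^ M 0≤κ₀) 0≤κ₀ κ₀<1 (λ j → 0≤y (M ℕ.+ n) (start ℕ.+ j))
          (λ j j≤n → ≤-trans (≡≤ (cong₂ (λ a b → ∣ y (M ℕ.+ n) a - y (M ℕ.+ n) b ∣) (trans (ℕ.+-suc start j) (cong suc (ℕ.+-assoc N₀ M j))) (ℕ.+-assoc N₀ M j))
            (y-step (M ℕ.+ n) (M ℕ.+ j) (ℕ.+-monoʳ-≤ M (ℕ.≤-pred j≤n))))
            (ℚ.≤-reflexive (cong₂ _*_ (trans (cong (L₀ *_) (^-+ κ₀ M j)) (sym (ℚ.*-assoc L₀ (κ₀ ^ M) (κ₀ ^ j)))) (cong (y (M ℕ.+ n)) (sym (ℕ.+-assoc N₀ M j))))))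
          threshold≤

        -- Bounds at `start` independent of the approximation index, from l ≤ R n ≤ Rmax; V already
        -- includes the factor ½ from `NearlyConstant`.
        U V Rmax : ℚ
        Rmax = R 0 + A′
        U    = c start * inv l ^ start
        V    = ½ * (c start * inv Rmax ^ start)

        0<Rmax : 0ℚ < Rmax
        0<Rmax = ℚ.+-mono-<-≤ (0<R 0) 0≤A′

        R≤Rmax : ∀ n → R n ≤ Rmax
        R≤Rmax n = ≤-trans (ℚ.≤-reflexive (lem (R n) (R 0))) (ℚ.+-monoʳ-≤ (R 0)
          (≤-trans (p≤∣p∣ (R n - R 0)) (≤≡ (R-near {0} {n} z≤n) (ℚ.*-identityʳ A′))))
          where
          lem : ∀ a b → a ≡ b + (a - b)
          lem = solve-∀ ℚ-ring

        0≤U : 0ℚ ≤ U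
        0≤U = <⇒≤ (0<c start) 0* 0≤^ start (0≤inv 0<l)

      0<V : 0ℚ < V
      0<V = pos* 0<½ (pos* (0<c start) (0<^ start (0<inv 0<Rmax)))

      private
        y≤ : ∀ {j n} → j ℕ.≤ suc n → y (M ℕ.+ n) (start ℕ.+ j) ≤ (1ℚ + 1ℚ) * U
        y≤ {j} {n} j≤n = ≤-trans (NC.upper n j j≤n) (*≤ (1ℚ + 1ℚ) ≤!
          (≡≤ (cong (y (M ℕ.+ n)) (ℕ.+-identityʳ start)) (*≤ (c start) (<⇒≤ (0<c start)) (^-mono start (<⇒≤ (0<r (M ℕ.+ n))) (r≤ (M ℕ.+ n))))))

        ≤y : ∀ {j n} → j ℕ.≤ suc n → V ≤ y (M ℕ.+ n) (start ℕ.+ j)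
        ≤y {j} {n} j≤n = ≤-trans (*≤ ½ ≤! (≤≡ (*≤ (c start) (<⇒≤ (0<c start)) (^-mono start (0≤inv 0<Rmax) (inv-≤ (0<R (M ℕ.+ n)) (R≤Rmax (M ℕ.+ n)))))
          (cong (y (M ℕ.+ n)) (sym (ℕ.+-identityʳ start))))) (NC.lower n j j≤n)

        from-M : ∀ {P : ℕ → Set} j → (∀ n → j ℕ.≤ n → P (M ℕ.+ n)) → Eventually P
        from-M {P} j h = M ℕ.+ j , λ n le → subst P (ℕ.m+[n∸m]≡n (ℕ.m+n≤o⇒m≤o M le))
          (h (n ℕ.∸ M) (ℕ.≤-trans (ℕ.≤-reflexive (sym (ℕ.m+n∸m≡n M j))) (ℕ.∸-monoˡ-≤ M le)))

      x-lower : ∀ j → Eventually λ n → V ≤ seq (x (start ℕ.+ j)) n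
      x-lower j = from-M {λ n → V ≤ seq (x (start ℕ.+ j)) n} j λ n j≤n → ≤≡ (≤y {j} {n} (ℕ.m≤n⇒m≤1+n j≤n)) (sym (x-seq (start ℕ.+ j) (M ℕ.+ n)))

      private
        C₁ : ℚ
        C₁ = (1ℚ + 1ℚ) * U * (L₀ * κ₀ ^ M)

        0≤C₁ : 0ℚ ≤ C₁
        0≤C₁ = (_0*_ {1ℚ + 1ℚ} ≤! 0≤U) 0* (0≤L₀ 0* 0≤^ M 0≤κ₀)

        z : ℕ → ℝ
        z j = x (start ℕ.+ j)

        y-diff : ∀ j n → j ℕ.≤ n → ∣ y (M ℕ.+ n) (start ℕ.+ suc j) - y (M ℕ.+ n) (start ℕ.+ j) ∣ ≤ C₁ * κ₀ ^ j
        y-diff j n j≤n = ≤-trans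
          (≡≤ (cong₂ (λ a b → ∣ y (M ℕ.+ n) a - y (M ℕ.+ n) b ∣)
                (trans (ℕ.+-suc start j) (cong suc (ℕ.+-assoc N₀ M j))) (ℕ.+-assoc N₀ M j))
              (y-step (M ℕ.+ n) (M ℕ.+ j) (ℕ.+-monoʳ-≤ M j≤n)))
          (≤-trans
            (ℚ.≤-reflexive (cong₂ (λ s t → L₀ * s * y (M ℕ.+ n) t) (^-+ κ₀ M j) (sym (ℕ.+-assoc N₀ M j))))
            (≤≡ (*≤ (L₀ * (κ₀ ^ M * κ₀ ^ j)) (0≤L₀ 0* (0≤^ M 0≤κ₀ 0* 0≤^ j 0≤κ₀)) (y≤ {j} {n} (ℕ.m≤n⇒m≤1+n j≤n)))
              (lem L₀ (κ₀ ^ M) (κ₀ ^ j) ((1ℚ + 1ℚ) * U))))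
          where
          lem : ∀ l a b u → l * (a * b) * u ≡ u * (l * a) * b
          lem = solve-∀ ℚ-ring

        z-diff : ∀ j n → j ℕ.≤ n → ∣ seq (z (suc j) -ᴿ z j) (M ℕ.+ n) ∣ ≤ C₁ * κ₀ ^ j
        z-diff j n j≤n = ≡≤ (cong ∣_∣ (trans (cong₂ (λ s t → s + - 1ℚ * t) (x-seq (start ℕ.+ suc j) (M ℕ.+ n)) (x-seq (start ℕ.+ j) (M ℕ.+ n)))
          (lem (y (M ℕ.+ n) (start ℕ.+ suc j)) (y (M ℕ.+ n) (start ℕ.+ j))))) (y-diff j n j≤n)
          where
          lem : ∀ a b → a + - 1ℚ * b ≡ a - b
          lem = solve-∀ ℚ-ring

        z-step : ∀ j → Bd (C₁ * κ₀ ^ j) (z (suc j) -ᴿ z j)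
        z-step j = Bd-ev {x = z (suc j) -ᴿ z j} (from-M {λ n → ∣ seq (z (suc j) -ᴿ z j) n ∣ ≤ C₁ * κ₀ ^ j} j (z-diff j))

        limit : ∃[ L ] Small κ₀ (λ m → z m -ᴿ L)
        limit = geometric-limit z 0≤C₁ 0<κ₀ κ₀<1 z-step

      α : ℝ
      α = proj₁ limit

      x-small : Small κ₀ (λ m → x m -ᴿ α)
      x-small = small-extend start {λ m → x m -ᴿ α} 0<κ₀
        (proj₁ z-small , proj₁ (proj₂ z-small) , λ j → Bd-≐ {x = x (start ℕ.+ j) -ᴿ α} {y = z j -ᴿ α} (λ n → refl) (proj₂ (proj₂ z-small) j))
        where
        z-small : Small κ₀ (λ m → z m -ᴿ α)
        z-small = proj₂ limit

      expansion : HasExpansion c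
      expansion = α , γ , E.κᴿ , E.0≤κᴿ , E.κᴿ<1 , E.first-order ,
        λ s → E.polynomial s , E.polynomial-last s , E.polynomial-order s
        where
        module E = Expansion c c₀ 0<c R 0<R γ (λ _ → refl) x x-seq κ₀ 0<κ₀ κ₀<1 α x-small V 0<V start x-lower

  has-expansion : ∀ {c} → GeometricRatios c → c 0 ≡ 1ℚ → HasExpansion c
  has-expansion {c} (0<c , l , 0<l , l-bound , κ₀ , 0<κ₀ , κ₀<1 , A , N₀ , increments) c₀ =
    G.From.expansion (proj₁ G.threshold) (proj₂ G.threshold)
    where
    module G = Growth c c₀ 0<c l 0<l l-bound κ₀ 0<κ₀ κ₀<1 A N₀ increments

-- Counting ordered sums through exponential generating functions.

module Counting where

  open import Data.Fin as Fin using (Fin; zero; suc)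
  import Data.Fin.Properties as Fin
  open import Data.Nat as ℕ using (ℕ; zero; suc; s≤s; _!)
  import Data.Nat.Properties as ℕ
  open import Data.Product using (Σ-syntax; _,_; proj₁)
  open import Data.Rational as ℚ
    using (ℚ; 0ℚ; 1ℚ; _+_; _*_; _≤_; _<_)
  import Data.Rational.Properties as ℚ
  open import Data.Sum using (_⊎_; inj₁; inj₂)
  open import Data.Sum.Function.Propositional using (_⊎-↔_)
  open import Data.Vec as Vec using (Vec; []; _∷_)
  open import Function using (_∘_; _↔_; mk↔ₛ′)
  open import Function.Properties.Inverse using (↔-sym; ↔-trans)
  open import Relation.Binary.PropositionalEquality
  open import Tactic.RingSolver using (solve-∀)
  open Rationals
  open Sums

  shℕ : ℕ → (ℕ → ℕ) → ℕ → ℕ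
  shℕ zero    g ℓ       = g ℓ
  shℕ (suc k) g zero    = 0
  shℕ (suc k) g (suc ℓ) = shℕ k g ℓ

  δℕ : ℕ → ℕ
  δℕ zero    = 1
  δℕ (suc _) = 0

  U∑ : ∀ {L} → (Fin L → ℕ) → (ℕ → ℕ) → ℕ → ℕ
  U∑ {zero}  h g ℓ = 0
  U∑ {suc L} h g ℓ = shℕ (h zero) g ℓ ℕ.+ U∑ (h ∘ suc) g ℓ

  -- The number of ways to write ℓ as an ordered sum of n of the weights h
  U : ∀ {L} → (Fin L → ℕ) → ℕ → ℕ → ℕ
  U h zero    = δℕ
  U h (suc n) = U∑ h (U h n)

  Sols : ∀ {L} → (Fin L → ℕ) → ℕ → ℕ → Set
  Sols {L} h n ℓ = Σ[ v ∈ Vec (Fin L) n ] Vec.sum (Vec.map h v) ≡ ℓ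

  Σ-≡ : ∀ {A : Set} {f : A → ℕ} {ℓ} {p q : Σ[ a ∈ A ] f a ≡ ℓ} → proj₁ p ≡ proj₁ q → p ≡ q
  Σ-≡ {p = a , e} {q = .a , e′} refl = cong (a ,_) (ℕ.≡-irrelevant e e′)

  shift-↔ : ∀ {A : Set} {f : A → ℕ} {g : ℕ → ℕ} → (∀ ℓ → (Σ[ a ∈ A ] f a ≡ ℓ) ↔ Fin (g ℓ)) →
    ∀ k ℓ → (Σ[ a ∈ A ] k ℕ.+ f a ≡ ℓ) ↔ Fin (shℕ k g ℓ)
  shift-↔ h zero    ℓ       = h ℓ
  shift-↔ h (suc k) zero    = mk↔ₛ′ (λ { (_ , ()) }) (λ ()) (λ ()) (λ { (_ , ()) })
  shift-↔ {A} {f} h (suc k) (suc ℓ) = ↔-trans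
    (mk↔ₛ′ (λ (a , e) → a , ℕ.suc-injective e) (λ (a , e) → a , cong suc e)
      (λ _ → Σ-≡ refl) (λ _ → Σ-≡ refl))
    (shift-↔ h k ℓ)

  U∑-↔ : ∀ {A : Set} {f : A → ℕ} {g : ℕ → ℕ} → (∀ ℓ → (Σ[ a ∈ A ] f a ≡ ℓ) ↔ Fin (g ℓ)) →
    ∀ {L} (h : Fin L → ℕ) ℓ → (Σ[ k ∈ Fin L ] Σ[ a ∈ A ] h k ℕ.+ f a ≡ ℓ) ↔ Fin (U∑ h g ℓ)
  U∑-↔ e {zero}  h ℓ = mk↔ₛ′ (λ { (() , _) }) (λ ()) (λ ()) (λ { (() , _) })
  U∑-↔ {A} {f} e {suc L} h ℓ = ↔-trans
    (mk↔ₛ′ to from (λ { (inj₁ _) → refl ; (inj₂ _) → refl }) (λ { (zero , _) → refl ; (suc _ , _) → refl }))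
    (↔-trans (shift-↔ e (h zero) ℓ ⊎-↔ U∑-↔ e (h ∘ suc) ℓ) (↔-sym Fin.+↔⊎))
    where
    Head Tail All : Set
    Head = Σ[ a ∈ A ] h zero ℕ.+ f a ≡ ℓ
    Tail = Σ[ k ∈ Fin L ] Σ[ a ∈ A ] h (suc k) ℕ.+ f a ≡ ℓ
    All  = Σ[ k ∈ Fin (suc L) ] Σ[ a ∈ A ] h k ℕ.+ f a ≡ ℓ
    to : All → Head ⊎ Tail
    to (zero  , p) = inj₁ p
    to (suc k , p) = inj₂ (k , p)
    from : Head ⊎ Tail → All
    from (inj₁ p)       = zero , p
    from (inj₂ (k , p)) = suc k , p

  Sols-↔ : ∀ {L} (h : Fin L → ℕ) n ℓ → Sols h n ℓ ↔ Fin (U h n ℓ)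
  Sols-↔ h zero zero    = mk↔ₛ′ (λ _ → zero) (λ _ → [] , refl) (λ { zero → refl }) (λ { ([] , refl) → refl })
  Sols-↔ h zero (suc ℓ) = mk↔ₛ′ (λ { ([] , ()) }) (λ ()) (λ ()) (λ { ([] , ()) })
  Sols-↔ {L} h (suc n) ℓ = ↔-trans (mk↔ₛ′ to from (λ _ → refl) (λ { (_ ∷ _ , _) → refl }))
    (U∑-↔ {Vec (Fin L) n} {λ v → Vec.sum (Vec.map h v)} {U h n} (Sols-↔ h n) h ℓ)
    where
    Split : Set
    Split = Σ[ k ∈ Fin L ] Σ[ v ∈ Vec (Fin L) n ] h k ℕ.+ Vec.sum (Vec.map h v) ≡ ℓ
    to : Sols h (suc n) ℓ → Split
    to (k ∷ v , e) = k , v , e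
    from : Split → Sols h (suc n) ℓ
    from (k , v , e) = k ∷ v , e

  -- Exponential generating functions: wt h n ℓ = U h n ℓ / n!

  infixl 7 _⊛_

  _⊛_ : (ℕ → Seq → Seq) → Family → Family
  (f ⊛ g) zero    ℓ = f 0 (g 0) ℓ
  (f ⊛ g) (suc n) ℓ = f 0 (g (suc n)) ℓ + (f ∘ suc ⊛ g) n ℓ

  -- The coefficient of tʲ in exp(t zʷ), acting by multiplication on power series in z.
  expOp : ℕ → ℕ → Seq → Seq
  expOp w j s ℓ = ifac j * sh (j ℕ.* w) s ℓ

  wt : ∀ {L} → (Fin L → ℕ) → Family
  wt {zero}  h n ℓ = δ n * δ ℓ
  wt {suc L} h     = expOp (h zero) ⊛ wt (h ∘ suc)

  sh∑ : ∀ {L} → (Fin L → ℕ) → Seq → Seq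
  sh∑ {zero}  h s ℓ = 0ℚ
  sh∑ {suc L} h s ℓ = sh (h zero) s ℓ + sh∑ (h ∘ suc) s ℓ

  -- The features of multiplication by a power series in z on which the calculus of `_⊛_` rests.
  record Linear (f : Seq → Seq) : Set where
    field
      cong-f : ∀ {s t} → (∀ ℓ → s ℓ ≡ t ℓ) → ∀ ℓ → f s ℓ ≡ f t ℓ
      plus   : ∀ s t ℓ → f (λ k → s k + t k) ℓ ≡ f s ℓ + f t ℓ
      times  : ∀ c s ℓ → f (λ k → c * s k) ℓ ≡ c * f s ℓ
      commutes : ∀ k s ℓ → f (sh k s) ℓ ≡ sh k (f s) ℓ

  open Linear

  sh-comm : ∀ j k s ℓ → sh j (sh k s) ℓ ≡ sh k (sh j s) ℓ
  sh-comm j k s ℓ = trans (sh-sh j k s ℓ) (trans (cong (λ i → sh i s ℓ) (ℕ.+-comm j k)) (sym (sh-sh k j s ℓ)))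

  expOp-linear : ∀ w j → Linear (expOp w j)
  expOp-linear w j = record
    { cong-f = λ h ℓ → cong (ifac j *_) (sh-cong (j ℕ.* w) ℓ (λ i _ → h i))
    ; plus   = λ s t ℓ → trans (cong (ifac j *_) (sh-+ (j ℕ.* w) s t ℓ)) (ℚ.*-distribˡ-+ (ifac j) _ _)
    ; times  = λ c s ℓ → trans (cong (ifac j *_) (sh-* (j ℕ.* w) c s ℓ)) (lem (ifac j) c _)
    ; commutes = λ k s ℓ → trans (cong (ifac j *_) (sh-comm (j ℕ.* w) k s ℓ)) (sym (sh-* k (ifac j) (sh (j ℕ.* w) s) ℓ))
    }
    where
    lem : ∀ a b c → a * (b * c) ≡ b * (a * c)
    lem = solve-∀ ℚ-ring

  ⊛-cong : ∀ {f f′ g g′} → (∀ j → Linear (f j)) → (∀ j s ℓ → f j s ℓ ≡ f′ j s ℓ) → (∀ j ℓ → g j ℓ ≡ g′ j ℓ) →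
    ∀ n ℓ → (f ⊛ g) n ℓ ≡ (f′ ⊛ g′) n ℓ
  ⊛-cong lin hf hg zero    ℓ = trans (cong-f (lin 0) (hg 0) ℓ) (hf 0 _ ℓ)
  ⊛-cong lin hf hg (suc n) ℓ = cong₂ _+_ (trans (cong-f (lin 0) (hg (suc n)) ℓ) (hf 0 _ ℓ)) (⊛-cong (lin ∘ suc) (hf ∘ suc) hg n ℓ)

  ⊛-sh : ∀ {f} → (∀ j → Linear (f j)) → ∀ k g n ℓ → (f ⊛ (λ i → sh k (g i))) n ℓ ≡ sh k ((f ⊛ g) n) ℓ
  ⊛-sh lin k g zero    ℓ = commutes (lin 0) k (g 0) ℓ
  ⊛-sh lin k g (suc n) ℓ = trans (cong₂ _+_ (commutes (lin 0) k (g (suc n)) ℓ) (⊛-sh (lin ∘ suc) k g n ℓ)) (sym (sh-+ k _ _ ℓ))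

  sh-⊛ : ∀ k f g n ℓ → ((λ j s → sh k (f j s)) ⊛ g) n ℓ ≡ sh k ((f ⊛ g) n) ℓ
  sh-⊛ k f g zero    ℓ = refl
  sh-⊛ k f g (suc n) ℓ = trans (cong (sh k (f 0 (g (suc n))) ℓ +_) (sh-⊛ k (f ∘ suc) g n ℓ)) (sym (sh-+ k _ _ ℓ))

  ⊛-+ : ∀ {f} → (∀ j → Linear (f j)) → ∀ g g′ n ℓ → (f ⊛ (λ i k → g i k + g′ i k)) n ℓ ≡ (f ⊛ g) n ℓ + (f ⊛ g′) n ℓ
  ⊛-+ lin g g′ zero    ℓ = plus (lin 0) (g 0) (g′ 0) ℓ
  ⊛-+ {f} lin g g′ (suc n) ℓ = trans (cong₂ _+_ (plus (lin 0) (g (suc n)) (g′ (suc n)) ℓ) (⊛-+ (lin ∘ suc) g g′ n ℓ))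
    (lem (f 0 (g (suc n)) ℓ) (f 0 (g′ (suc n)) ℓ) _ _)
    where
    lem : ∀ a b c d → a + b + (c + d) ≡ a + c + (b + d)
    lem = solve-∀ ℚ-ring

  ⊛-0 : ∀ {f} → (∀ j → Linear (f j)) → ∀ n ℓ → (f ⊛ (λ _ _ → 0ℚ)) n ℓ ≡ 0ℚ
  -- The zero family is rewritten as 0 · 0, so that `times` applies to it.
  ⊛-0 {f} lin n ℓ = trans (⊛-cong lin (λ _ _ _ → refl) (λ j k → sym (ℚ.*-zeroˡ 0ℚ)) n ℓ) (go lin n)
    where
    go : ∀ {f} → (∀ j → Linear (f j)) → ∀ n → (f ⊛ (λ _ _ → 0ℚ * 0ℚ)) n ℓ ≡ 0ℚ
    go {f} lin zero    = trans (times (lin 0) 0ℚ (λ _ → 0ℚ) ℓ) (ℚ.*-zeroˡ (f 0 (λ _ → 0ℚ) ℓ))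
    go {f} lin (suc n) = trans (cong₂ _+_ (trans (times (lin 0) 0ℚ (λ _ → 0ℚ) ℓ) (ℚ.*-zeroˡ (f 0 (λ _ → 0ℚ) ℓ))) (go (lin ∘ suc) n)) refl

  ⊛-sh∑ : ∀ {f} → (∀ j → Linear (f j)) → ∀ {L} (h : Fin L → ℕ) g n ℓ →
    (f ⊛ (λ i → sh∑ h (g i))) n ℓ ≡ sh∑ h ((f ⊛ g) n) ℓ
  ⊛-sh∑ lin {zero}  h g n ℓ = ⊛-0 lin n ℓ
  ⊛-sh∑ lin {suc L} h g n ℓ = trans (⊛-+ lin _ _ n ℓ) (cong₂ _+_ (⊛-sh lin (h zero) g n ℓ) (⊛-sh∑ lin (h ∘ suc) g n ℓ))

  ⊛-leibniz : ∀ {f} → (∀ j → Linear (f j)) → ∀ g n ℓ → ι (suc n) * (f ⊛ g) (suc n) ℓ ≡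
    ((λ j s k → ι (suc j) * f (suc j) s k) ⊛ g) n ℓ + (f ⊛ (λ j k → ι (suc j) * g (suc j) k)) n ℓ
  ⊛-leibniz {f} lin g zero ℓ = trans (lem (f 0 (g 1) ℓ) (f 1 (g 0) ℓ)) (cong (ι 1 * f 1 (g 0) ℓ +_) (sym (times (lin 0) (ι 1) (g 1) ℓ)))
    where
    lem : ∀ a b → ι 1 * (a + b) ≡ ι 1 * b + ι 1 * a
    lem = solve-∀ ℚ-ring
  ⊛-leibniz {f} lin g (suc n) ℓ = begin
    ι (2 ℕ.+ n) * (a + b)
      ≡⟨ trans (cong (_* (a + b)) (ι-suc (suc n))) (lem₁ a b (ι (suc n))) ⟩
    (1ℚ + ι (suc n)) * a + (b + ι (suc n) * b)
      ≡⟨ cong₂ (λ s t → s * a + (b + t)) (sym (ι-suc (suc n))) (⊛-leibniz (lin ∘ suc) g n ℓ) ⟩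
    ι (2 ℕ.+ n) * a + ((f 1 (g (suc n)) ℓ + c) + (p + q))
      ≡⟨ lem₂ (ι (2 ℕ.+ n) * a) (f 1 (g (suc n)) ℓ) c p q ⟩
    (ι 1 * f 1 (g (suc n)) ℓ + (c + p)) + (ι (2 ℕ.+ n) * a + q)
      ≡⟨ cong₂ (λ s t → (ι 1 * f 1 (g (suc n)) ℓ + s) + (t + q)) (combine (λ j → f (2 ℕ.+ j)) (λ j → ι (suc j)) (λ j → ι (2 ℕ.+ j)) (λ j → ι-suc (suc j)) n)
           (sym (times (lin 0) (ι (2 ℕ.+ n)) (g (2 ℕ.+ n)) ℓ)) ⟩
    ((λ j s k → ι (suc j) * f (suc j) s k) ⊛ g) (suc n) ℓ + (f ⊛ (λ j k → ι (suc j) * g (suc j) k)) (suc n) ℓ ∎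
    where
    open ≡-Reasoning
    a b c p q : ℚ
    a = f 0 (g (2 ℕ.+ n)) ℓ
    b = (f ∘ suc ⊛ g) (suc n) ℓ
    c = ((λ j → f (2 ℕ.+ j)) ⊛ g) n ℓ
    p = ((λ j s k → ι (suc j) * f (2 ℕ.+ j) s k) ⊛ g) n ℓ
    q = (f ∘ suc ⊛ (λ j k → ι (suc j) * g (suc j) k)) n ℓ
    lem₁ : ∀ a b n → (1ℚ + n) * (a + b) ≡ (1ℚ + n) * a + (b + n * b)
    lem₁ = solve-∀ ℚ-ring
    lem₂ : ∀ A f c p q → A + ((f + c) + (p + q)) ≡ (ι 1 * f + (c + p)) + (A + q)
    lem₂ = solve-∀ ℚ-ring
    lem₃ : ∀ x k → x + k * x ≡ (1ℚ + k) * x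
    lem₃ = solve-∀ ℚ-ring
    lem₄ : ∀ x k u v → (x + u) + (k * x + v) ≡ (1ℚ + k) * x + (u + v)
    lem₄ = solve-∀ ℚ-ring
    combine : ∀ (f : ℕ → Seq → Seq) (φ ψ : Seq) → (∀ j → ψ j ≡ 1ℚ + φ j) → ∀ n →
      (f ⊛ g) n ℓ + ((λ j s k → φ j * f j s k) ⊛ g) n ℓ ≡ ((λ j s k → ψ j * f j s k) ⊛ g) n ℓ
    combine f φ ψ h zero    = trans (lem₃ (f 0 (g 0) ℓ) (φ 0)) (cong (_* f 0 (g 0) ℓ) (sym (h 0)))
    combine f φ ψ h (suc n) = trans (lem₄ (f 0 (g (suc n)) ℓ) (φ 0) _ _)
      (cong₂ _+_ (cong (_* f 0 (g (suc n)) ℓ) (sym (h 0))) (combine (f ∘ suc) (φ ∘ suc) (ψ ∘ suc) (h ∘ suc) n))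

  ⊛-congˡ : ∀ {f f′} g n ℓ → (∀ j s k → f j s k ≡ f′ j s k) → (f ⊛ g) n ℓ ≡ (f′ ⊛ g) n ℓ
  ⊛-congˡ g zero    ℓ h = h 0 (g 0) ℓ
  ⊛-congˡ g (suc n) ℓ h = cong₂ _+_ (h 0 (g (suc n)) ℓ) (⊛-congˡ g n ℓ (h ∘ suc))

  ⊛-∑ : ∀ f g n ℓ → (f ⊛ g) n ℓ ≡ ∑ (λ j → f j (g (n ℕ.∸ j)) ℓ) n
  ⊛-∑ f g zero    ℓ = refl
  ⊛-∑ f g (suc n) ℓ = trans (cong (f 0 (g (suc n)) ℓ +_) (⊛-∑ (f ∘ suc) g n ℓ))
    (sym (∑-head (λ j → f j (g (suc n ℕ.∸ j)) ℓ) n))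

  ⋆-∑ : ∀ x y m → (x ⋆ y) m ≡ ∑ (λ j → x j * y (m ℕ.∸ j)) m
  ⋆-∑ x y zero    = refl
  ⋆-∑ x y (suc m) = trans (cong (x 0 * y (suc m) +_) (⋆-∑ (x ∘ suc) y m))
    (sym (∑-head (λ j → x j * y (suc m ℕ.∸ j)) m))

  ∑-truncate : ∀ {f : Seq} {m n} → m ℕ.≤ n → (∀ j → m ℕ.< j → f j ≡ 0ℚ) → ∑ f n ≡ ∑ f m
  ∑-truncate {f} {m} m≤n h = go (ℕ.≤⇒≤′ m≤n)
    where
    go : ∀ {n} → m ℕ.≤′ n → ∑ f n ≡ ∑ f m
    go ℕ.≤′-refl            = refl
    go (ℕ.≤′-step {n} m≤′n) = trans (cong₂ _+_ (go m≤′n) (h (suc n) (s≤s (ℕ.≤′⇒≤ m≤′n)))) (ℚ.+-identityʳ _)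

  -- Differentiating the product of the factors exp(t zʰ) with respect to t multiplies it by the sum
  -- of the zʰ; the Leibniz rule handles one factor at a time.
  wt-rec : ∀ {L} (h : Fin L → ℕ) n ℓ → ι (suc n) * wt h (suc n) ℓ ≡ sh∑ h (wt h n) ℓ
  wt-rec {zero}  h n ℓ = trans (cong (ι (suc n) *_) (ℚ.*-zeroˡ (δ ℓ))) (ℚ.*-zeroʳ (ι (suc n)))
  wt-rec {suc L} h n ℓ = begin
    ι (suc n) * (E ⊛ W) (suc n) ℓ
      ≡⟨ ⊛-leibniz (expOp-linear w) W n ℓ ⟩
    ((λ j s k → ι (suc j) * E (suc j) s k) ⊛ W) n ℓ + (E ⊛ (λ j k → ι (suc j) * W (suc j) k)) n ℓ
      ≡⟨ cong₂ _+_ (trans (⊛-congˡ W n ℓ E-deriv) (sh-⊛ w E W n ℓ))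
           (trans (⊛-cong (expOp-linear w) (λ _ _ _ → refl) (λ j k → wt-rec (h ∘ suc) j k) n ℓ)
             (⊛-sh∑ (expOp-linear w) (h ∘ suc) W n ℓ)) ⟩
    sh∑ h (wt h n) ℓ ∎
    where
    open ≡-Reasoning
    w = h zero
    E = expOp w
    W = wt (h ∘ suc)
    E-deriv : ∀ j s k → ι (suc j) * E (suc j) s k ≡ sh w (E j s) k
    E-deriv j s k = begin
      ι (suc j) * (ifac (suc j) * sh (w ℕ.+ j ℕ.* w) s k)
        ≡⟨ ℚ.*-assoc (ι (suc j)) (ifac (suc j)) _ ⟨
      ι (suc j) * ifac (suc j) * sh (w ℕ.+ j ℕ.* w) s k
        ≡⟨ cong₂ _*_ (suc-ifac j) (sym (sh-sh w (j ℕ.* w) s k)) ⟩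
      ifac j * sh w (sh (j ℕ.* w) s) k
        ≡⟨ sh-* w (ifac j) (sh (j ℕ.* w) s) k ⟨
      sh w (E j s) k ∎

  wt-0 : ∀ {L} (h : Fin L → ℕ) ℓ → wt h 0 ℓ ≡ δ ℓ
  wt-0 {zero}  h ℓ = ℚ.*-identityˡ (δ ℓ)
  wt-0 {suc L} h ℓ = trans (cong (_* wt (h ∘ suc) 0 ℓ) ifac₀) (trans (ℚ.*-identityˡ _) (wt-0 (h ∘ suc) ℓ))

  ι-shℕ : ∀ k g ℓ → ι (shℕ k g ℓ) ≡ sh k (λ i → ι (g i)) ℓ
  ι-shℕ zero    g ℓ       = refl
  ι-shℕ (suc k) g zero    = refl
  ι-shℕ (suc k) g (suc ℓ) = ι-shℕ k g ℓ

  ι-U∑ : ∀ {L} (h : Fin L → ℕ) g ℓ → ι (U∑ h g ℓ) ≡ sh∑ h (λ i → ι (g i)) ℓ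
  ι-U∑ {zero}  h g ℓ = refl
  ι-U∑ {suc L} h g ℓ = trans (ι-+ (shℕ (h zero) g ℓ) (U∑ (h ∘ suc) g ℓ)) (cong₂ _+_ (ι-shℕ (h zero) g ℓ) (ι-U∑ (h ∘ suc) g ℓ))

  sh∑-cong : ∀ {L} (h : Fin L → ℕ) {s t} ℓ → (∀ k → s k ≡ t k) → sh∑ h s ℓ ≡ sh∑ h t ℓ
  sh∑-cong {zero}  h ℓ e = refl
  sh∑-cong {suc L} h ℓ e = cong₂ _+_ (sh-cong (h zero) ℓ (λ i _ → e i)) (sh∑-cong (h ∘ suc) ℓ e)

  sh∑-* : ∀ {L} (h : Fin L → ℕ) c s ℓ → sh∑ h (λ k → c * s k) ℓ ≡ c * sh∑ h s ℓ
  sh∑-* {zero}  h c s ℓ = sym (ℚ.*-zeroʳ c)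
  sh∑-* {suc L} h c s ℓ = trans (cong₂ _+_ (sh-* (h zero) c s ℓ) (sh∑-* (h ∘ suc) c s ℓ)) (sym (ℚ.*-distribˡ-+ c _ _))

  -- By `wt-rec` both sides obey the same recursion over the number of parts. U is built part by
  -- part and `wt` weight by weight; the latter order is the one in which levels appear.
  U-wt : ∀ {L} (h : Fin L → ℕ) n ℓ → ι (U h n ℓ) ≡ ι (n !) * wt h n ℓ
  U-wt h zero ℓ = trans (base ℓ) (sym (trans (ℚ.*-identityˡ (wt h 0 ℓ)) (wt-0 h ℓ)))
    where
    base : ∀ ℓ → ι (δℕ ℓ) ≡ δ ℓ
    base zero    = refl
    base (suc ℓ) = refl
  U-wt h (suc n) ℓ = begin
    ι (U∑ h (U h n) ℓ)                     ≡⟨ ι-U∑ h (U h n) ℓ ⟩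
    sh∑ h (λ i → ι (U h n i)) ℓ            ≡⟨ sh∑-cong h ℓ (U-wt h n) ⟩
    sh∑ h (λ i → ι (n !) * wt h n i) ℓ     ≡⟨ sh∑-* h (ι (n !)) (wt h n) ℓ ⟩
    ι (n !) * sh∑ h (wt h n) ℓ             ≡⟨ cong (ι (n !) *_) (wt-rec h n ℓ) ⟨
    ι (n !) * (ι (suc n) * wt h (suc n) ℓ) ≡⟨ lem (ι (n !)) (ι (suc n)) (wt h (suc n) ℓ) ⟩
    ι (suc n) * ι (n !) * wt h (suc n) ℓ   ≡⟨ cong (_* wt h (suc n) ℓ) (ι-* (suc n) (n !)) ⟨
    ι (suc n !) * wt h (suc n) ℓ           ∎
    where
    open ≡-Reasoning
    lem : ∀ a b c → a * (b * c) ≡ b * a * c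
    lem = solve-∀ ℚ-ring

-- Level weights along a digit string: the upper bound and its equality case.

module Levels where

  open import Data.Fin using (Fin; zero; suc)
  open import Data.List using (List; []; _∷_; _++_; length; replicate)
  import Data.List.Properties as List
  open import Data.List.Relation.Unary.All using (All; []; _∷_)
  open import Data.Nat as ℕ using (ℕ; zero; suc; z≤n; s≤s)
  import Data.Nat.Properties as ℕ
  open import Data.Nat.Induction using (<-rec)
  open import Data.Nat.ListAction using (sum)
  open import Data.Rational as ℚ
    using (ℚ; 0ℚ; 1ℚ; _+_; _*_; _≤_; _<_)
  open import Data.Rational.Properties as ℚ using (≤-refl; ≤-trans)
  open import Function using (_∘_)
  open import Relation.Nullary using (yes; no)
  open import Relation.Binary.PropositionalEquality
  open import Tactic.RingSolver using (solve-∀)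
  open Rationals
  open Sums
  open Trees
  open Counting

  module _ (β : ℕ) where

    private
      b : ℕ
      b = suc (suc β)

    -- Digits are listed from the most significant one.
    val : ℕ → List ℕ → ℕ
    val i []       = i
    val i (d ∷ ds) = val (i ℕ.* b ℕ.+ d) ds

    val-split : ∀ r ds → val r ds ≡ r ℕ.* b ℕ.^ length ds ℕ.+ val 0 ds
    val-split r []       = trans (sym (ℕ.*-identityʳ r)) (sym (ℕ.+-identityʳ (r ℕ.* 1)))
    val-split r (d ∷ ds) = begin
      val (r ℕ.* b ℕ.+ d) ds
        ≡⟨ val-split (r ℕ.* b ℕ.+ d) ds ⟩
      (r ℕ.* b ℕ.+ d) ℕ.* w ℕ.+ val 0 ds
        ≡⟨ cong (ℕ._+ val 0 ds) (ℕ.*-distribʳ-+ w (r ℕ.* b) d) ⟩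
      r ℕ.* b ℕ.* w ℕ.+ d ℕ.* w ℕ.+ val 0 ds
        ≡⟨ ℕ.+-assoc (r ℕ.* b ℕ.* w) (d ℕ.* w) (val 0 ds) ⟩
      r ℕ.* b ℕ.* w ℕ.+ (d ℕ.* w ℕ.+ val 0 ds)
        ≡⟨ cong₂ ℕ._+_ (ℕ.*-assoc r b w) (sym (val-split d ds)) ⟩
      r ℕ.* (b ℕ.* w) ℕ.+ val d ds ∎
      where
      open ≡-Reasoning
      w = b ℕ.^ length ds

    Digits : List ℕ → Set
    Digits = All (ℕ._< b)

    val<b^ : ∀ ds → Digits ds → val 0 ds ℕ.< b ℕ.^ length ds
    val<b^ []       []         = s≤s z≤n
    val<b^ (d ∷ ds) (d<b ∷ ok) = begin-strict
      val d ds                   ≡⟨ val-split d ds ⟩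
      d ℕ.* w ℕ.+ val 0 ds       <⟨ ℕ.+-monoʳ-< (d ℕ.* w) (val<b^ ds ok) ⟩
      d ℕ.* w ℕ.+ w              ≡⟨ ℕ.+-comm (d ℕ.* w) w ⟩
      suc d ℕ.* w                ≤⟨ ℕ.*-monoˡ-≤ w d<b ⟩
      b ℕ.* w                    ∎
      where
      open ℕ.≤-Reasoning
      w = b ℕ.^ length ds

    val<* : ∀ r j ds → Digits ds → r ℕ.< j → val r ds ℕ.< j ℕ.* b ℕ.^ length ds
    val<* r j ds ok r<j = ℕ.≤-trans (ℕ.≤-trans (ℕ.≤-reflexive (cong suc (val-split r ds)))
      (ℕ.≤-trans (ℕ.+-monoʳ-< (r ℕ.* b ℕ.^ length ds) (val<b^ ds ok)) (ℕ.≤-reflexive (ℕ.+-comm (r ℕ.* b ℕ.^ length ds) (b ℕ.^ length ds)))))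
      (ℕ.*-monoˡ-≤ (b ℕ.^ length ds) r<j)

    -- In decreasing order, so that unfolding `wt` takes the parts level by level from the leading
    -- digit.
    powers : ∀ L → Fin L → ℕ
    powers (suc L) zero    = b ℕ.^ L
    powers (suc L) (suc k) = powers L k

    -- T ds i m is the total weight of the level sequences with m internal nodes
    -- that start below a level with i internal nodes, where dₖ further nodes are
    -- added at the k-th level.
    T : List ℕ → Family
    T []       i m = δ i * δ m
    T (d ∷ ds) i m = ((λ j → sh j (T ds j) m) ⋆ ifac) (i ℕ.* b ℕ.+ d)

    private
      module Step (d : ℕ) (ds : List ℕ) (ok : Digits ds) (i : ℕ) where
        r w L : ℕ
        r = i ℕ.* b ℕ.+ d
        L = length ds
        w = b ℕ.^ L

        -- Of the r nodes of this level, the d added ones included, j become parts bᴸ and the other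
        -- r - j are internal.
        term : ℕ → Seq
        term n j = ifac j * sh (j ℕ.* w) (wt (powers L) (n ℕ.∸ j)) (val r ds)

        wt-sum : ∀ n → wt (powers (suc L)) n (val r ds) ≡ ∑ (term n) n
        wt-sum n = ⊛-∑ (expOp w) (wt (powers L)) n (val r ds)

        term-inside : ∀ n j → j ℕ.≤ r → term n j ≡ ifac j * wt (powers L) (n ℕ.∸ j) (val (r ℕ.∸ j) ds)
        term-inside n j j≤r = cong (ifac j *_) (trans (cong (sh (j ℕ.* w) (wt (powers L) (n ℕ.∸ j))) split)
          (sh-diag (j ℕ.* w) (wt (powers L) (n ℕ.∸ j)) (val (r ℕ.∸ j) ds)))
          where
          open ≡-Reasoning
          split : val r ds ≡ j ℕ.* w ℕ.+ val (r ℕ.∸ j) ds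
          split = begin
            val r ds                                             ≡⟨ val-split r ds ⟩
            r ℕ.* w ℕ.+ val 0 ds                                 ≡⟨ cong (λ t → t ℕ.* w ℕ.+ val 0 ds) (sym (ℕ.m+[n∸m]≡n j≤r)) ⟩
            (j ℕ.+ (r ℕ.∸ j)) ℕ.* w ℕ.+ val 0 ds                 ≡⟨ cong (ℕ._+ val 0 ds) (ℕ.*-distribʳ-+ w j (r ℕ.∸ j)) ⟩
            j ℕ.* w ℕ.+ (r ℕ.∸ j) ℕ.* w ℕ.+ val 0 ds             ≡⟨ ℕ.+-assoc (j ℕ.* w) _ _ ⟩
            j ℕ.* w ℕ.+ ((r ℕ.∸ j) ℕ.* w ℕ.+ val 0 ds)           ≡⟨ cong (j ℕ.* w ℕ.+_) (val-split (r ℕ.∸ j) ds) ⟨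
            j ℕ.* w ℕ.+ val (r ℕ.∸ j) ds                         ∎

        term-outside : ∀ n j → r ℕ.< j → term n j ≡ 0ℚ
        term-outside n j r<j = trans (cong (ifac j *_) (sh-below (j ℕ.* w) (wt (powers L) (n ℕ.∸ j)) (val r ds) (val<* r j ds ok r<j)))
          (ℚ.*-zeroʳ (ifac j))

      ∑-zero : ∀ {f : Seq} n → (∀ j → j ℕ.≤ n → f j ≡ 0ℚ) → ∑ f n ≡ 0ℚ
      ∑-zero zero    h = h 0 z≤n
      ∑-zero (suc n) h = trans (cong₂ _+_ (∑-zero n (λ j j≤n → h j (ℕ.m≤n⇒m≤1+n j≤n))) (h (suc n) ℕ.≤-refl)) (ℚ.+-identityʳ 0ℚ)

      i≤i*b : ∀ i → i ℕ.≤ i ℕ.* b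
      i≤i*b i = ℕ.m≤m*n i b

    -- A number with the digits ds has at least digit sum many parts.
    too-few : ∀ ds → Digits ds → ∀ i n → n ℕ.< i ℕ.* b ℕ.+ sum ds → wt (powers (length ds)) n (val i ds) ≡ 0ℚ
    too-few [] [] zero    n ()
    too-few [] [] (suc i) n _ = ℚ.*-zeroʳ (δ n)
    too-few (d ∷ ds) (_ ∷ ok) i n n< = trans (wt-sum n) (∑-zero n go)
      where
      open Step d ds ok i
      n<r+ : n ℕ.< r ℕ.+ sum ds
      n<r+ = subst (n ℕ.<_) (sym (ℕ.+-assoc (i ℕ.* b) d (sum ds))) n<
      go : ∀ j → j ℕ.≤ n → term n j ≡ 0ℚ
      go j j≤n with j ℕ.≤? r
      ... | no  j≰r = term-outside n j (ℕ.≰⇒> j≰r)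
      ... | yes j≤r = trans (term-inside n j j≤r) (trans (cong (ifac j *_) (too-few ds ok (r ℕ.∸ j) (n ℕ.∸ j) bound)) (ℚ.*-zeroʳ (ifac j)))
        where
        open ℕ.≤-Reasoning
        bound : n ℕ.∸ j ℕ.< (r ℕ.∸ j) ℕ.* b ℕ.+ sum ds
        bound = begin-strict
          n ℕ.∸ j                       <⟨ ℕ.∸-monoˡ-< n<r+ j≤n ⟩
          r ℕ.+ sum ds ℕ.∸ j            ≡⟨ ℕ.+-∸-comm (sum ds) j≤r ⟩
          r ℕ.∸ j ℕ.+ sum ds            ≤⟨ ℕ.+-monoˡ-≤ (sum ds) (i≤i*b (r ℕ.∸ j)) ⟩
          (r ℕ.∸ j) ℕ.* b ℕ.+ sum ds    ∎

    -- An internal node replaces one part by b parts, so m of them add (b - 1) m to the initial i b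
    -- + sum ds. In the induction step, a choice with more than m internal nodes leaves too few
    -- parts and contributes 0 on both sides.
    wt-T : ∀ ds → Digits ds → ∀ i m → wt (powers (length ds)) (i ℕ.* b ℕ.+ sum ds ℕ.+ suc β ℕ.* m) (val i ds) ≡ T ds i m
    wt-T [] [] zero zero    = cong (λ k → δ k * 1ℚ) (ℕ.*-zeroʳ (suc β))
    wt-T [] [] zero (suc m) = refl
    wt-T [] [] (suc i) m    = trans (ℚ.*-zeroʳ (δ (suc i ℕ.* b ℕ.+ 0 ℕ.+ suc β ℕ.* m))) (sym (ℚ.*-zeroˡ (δ m)))
    wt-T (d ∷ ds) (_ ∷ ok) i m = begin
      wt (powers (suc L)) (i ℕ.* b ℕ.+ (d ℕ.+ sum ds) ℕ.+ e) (val r ds)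
        ≡⟨ cong (λ k → wt (powers (suc L)) k (val r ds)) (trans (cong (ℕ._+ e) (sym (ℕ.+-assoc (i ℕ.* b) d (sum ds)))) (ℕ.+-assoc r (sum ds) e)) ⟩
      wt (powers (suc L)) n (val r ds)
        ≡⟨ wt-sum n ⟩
      ∑ (term n) n
        ≡⟨ ∑-truncate (ℕ.m≤m+n r (sum ds ℕ.+ e)) (term-outside n) ⟩
      ∑ (term n) r
        ≡⟨ ∑-cong r (λ j j≤r → trans (term-inside n j j≤r) (cong (ifac j *_) (shifted j j≤r))) ⟩
      ∑ (λ j → ifac j * sh (r ℕ.∸ j) (T ds (r ℕ.∸ j)) m) r
        ≡⟨ ⋆-∑ ifac (λ j → sh j (T ds j) m) r ⟨
      (ifac ⋆ (λ j → sh j (T ds j) m)) r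
        ≡⟨ ⋆-comm ifac (λ j → sh j (T ds j) m) r ⟩
      T (d ∷ ds) i m ∎
      where
      open ≡-Reasoning
      open Step d ds ok i
      e n : ℕ
      e = suc β ℕ.* m
      n = r ℕ.+ (sum ds ℕ.+ e)
      shifted : ∀ j → j ℕ.≤ r → wt (powers L) (n ℕ.∸ j) (val (r ℕ.∸ j) ds) ≡ sh (r ℕ.∸ j) (T ds (r ℕ.∸ j)) m
      shifted j j≤r with r ℕ.∸ j | ℕ.+-∸-comm (sum ds ℕ.+ e) j≤r
      ... | i′ | n∸j≡ with i′ ℕ.≤? m
      ...   | no  i′≰m = trans (too-few ds ok i′ (n ℕ.∸ j) few) (sym (sh-below i′ (T ds i′) m (ℕ.≰⇒> i′≰m)))
        where
        few : n ℕ.∸ j ℕ.< i′ ℕ.* b ℕ.+ sum ds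
        few = R.begin-strict
          n ℕ.∸ j                                        R.≡⟨ n∸j≡ ⟩
          i′ ℕ.+ (sum ds ℕ.+ suc β ℕ.* m)                R.≡⟨ cong (i′ ℕ.+_) (ℕ.+-comm (sum ds) _) ⟩
          i′ ℕ.+ (suc β ℕ.* m ℕ.+ sum ds)                R.≡⟨ ℕ.+-assoc i′ _ _ ⟨
          i′ ℕ.+ suc β ℕ.* m ℕ.+ sum ds                  R.<⟨ ℕ.+-monoˡ-< (sum ds) (ℕ.+-monoʳ-< i′ (ℕ.*-monoʳ-< (suc β) (ℕ.≰⇒> i′≰m))) ⟩
          i′ ℕ.+ suc β ℕ.* i′ ℕ.+ sum ds                 R.≡⟨ cong (ℕ._+ sum ds) (ℕ.*-comm b i′) ⟩
          i′ ℕ.* b ℕ.+ sum ds                            R.∎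
          where module R = ℕ.≤-Reasoning
      ...   | yes i′≤m = trans (cong (λ k → wt (powers L) k (val i′ ds)) parts)
          (trans (wt-T ds ok i′ (m ℕ.∸ i′)) (sym (trans (cong (sh i′ (T ds i′)) (sym (ℕ.m+[n∸m]≡n i′≤m))) (sh-diag i′ (T ds i′) (m ℕ.∸ i′)))))
        where
        parts : n ℕ.∸ j ≡ i′ ℕ.* b ℕ.+ sum ds ℕ.+ suc β ℕ.* (m ℕ.∸ i′)
        parts = begin
          n ℕ.∸ j
            ≡⟨ n∸j≡ ⟩
          i′ ℕ.+ (sum ds ℕ.+ suc β ℕ.* m)
            ≡⟨ cong (λ k → i′ ℕ.+ (sum ds ℕ.+ suc β ℕ.* k)) (sym (ℕ.m+[n∸m]≡n i′≤m)) ⟩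
          i′ ℕ.+ (sum ds ℕ.+ suc β ℕ.* (i′ ℕ.+ (m ℕ.∸ i′)))
            ≡⟨ cong (λ k → i′ ℕ.+ (sum ds ℕ.+ k)) (ℕ.*-distribˡ-+ (suc β) i′ (m ℕ.∸ i′)) ⟩
          i′ ℕ.+ (sum ds ℕ.+ (suc β ℕ.* i′ ℕ.+ suc β ℕ.* (m ℕ.∸ i′)))
            ≡⟨ cong (i′ ℕ.+_) (sym (ℕ.+-assoc (sum ds) _ _)) ⟩
          i′ ℕ.+ (sum ds ℕ.+ suc β ℕ.* i′ ℕ.+ suc β ℕ.* (m ℕ.∸ i′))
            ≡⟨ cong (λ k → i′ ℕ.+ (k ℕ.+ suc β ℕ.* (m ℕ.∸ i′))) (ℕ.+-comm (sum ds) _) ⟩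
          i′ ℕ.+ (suc β ℕ.* i′ ℕ.+ sum ds ℕ.+ suc β ℕ.* (m ℕ.∸ i′))
            ≡⟨ ℕ.+-assoc i′ _ _ ⟨
          i′ ℕ.+ (suc β ℕ.* i′ ℕ.+ sum ds) ℕ.+ suc β ℕ.* (m ℕ.∸ i′)
            ≡⟨ cong (ℕ._+ suc β ℕ.* (m ℕ.∸ i′)) (trans (sym (ℕ.+-assoc i′ _ _)) (cong (ℕ._+ sum ds) (ℕ.*-comm b i′))) ⟩
          i′ ℕ.* b ℕ.+ sum ds ℕ.+ suc β ℕ.* (m ℕ.∸ i′) ∎

    cpow : ℕ → Seq
    cpow zero    = δ
    cpow (suc s) = cpow s ⋆ c β

    private
      cpow≥0 : ∀ s m → 0ℚ ≤ cpow s m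
      cpow≥0 zero    zero    = 0≤1
      cpow≥0 zero    (suc m) = ≤-refl
      cpow≥0 (suc s) m       = ⋆-≥0 m (cpow≥0 s) (C≥0 β 1)

    cpow-+ : ∀ s t m → (cpow s ⋆ cpow t) m ≡ cpow (t ℕ.+ s) m
    cpow-+ s zero    m = trans (⋆-comm (cpow s) δ m) (δ-⋆ (cpow s) m)
    cpow-+ s (suc t) m = trans (sym (⋆-assoc (cpow s) (cpow t) (c β) m)) (⋆-congˡ (c β) m (cpow-+ s t))

    -- Binomial coefficients are at least 1.
    ifac-submult : ∀ m n → ifac (m ℕ.+ n) ≤ ifac n * ifac m
    ifac-submult zero    n = ℚ.≤-reflexive (sym (trans (cong (ifac n *_) ifac₀) (ℚ.*-identityʳ (ifac n))))
    ifac-submult (suc m) n = *-cancel-≤ (ι (suc m)) (0<ι m) (begin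
      ι (suc m) * ifac (suc (m ℕ.+ n))
        ≤⟨ ≤* (ifac (suc (m ℕ.+ n))) (0≤ifac _) (ι-mono (s≤s (ℕ.m≤m+n m n))) ⟩
      ι (suc (m ℕ.+ n)) * ifac (suc (m ℕ.+ n))   ≡⟨ suc-ifac (m ℕ.+ n) ⟩
      ifac (m ℕ.+ n)                             ≤⟨ ifac-submult m n ⟩
      ifac n * ifac m                            ≡⟨ cong (ifac n *_) (suc-ifac m) ⟨
      ifac n * (ι (suc m) * ifac (suc m))        ≡⟨ lem (ifac n) (ι (suc m)) (ifac (suc m)) ⟩
      ι (suc m) * (ifac n * ifac (suc m))        ∎)
      where
      open ℚ.≤-Reasoning
      lem : ∀ a b c → a * (b * c) ≡ b * (a * c)
      lem = solve-∀ ℚ-ring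

    private
      -- Splits the sum over 0 ≤ i ≤ r₁ + r₂ at i = r₁.
      split-sum : ∀ r₁ r₂ (x z : Seq) → (∀ i → 0ℚ ≤ x i) → (∀ i → i ℕ.< r₁ → x i * ifac r₂ ≤ z i) →
        (x ∘ (r₁ ℕ.+_) ⋆ ifac) r₂ ≤ z r₁ → (x ⋆ ifac) (r₁ ℕ.+ r₂) ≤ (z ⋆ ifac) r₁
      split-sum zero r₂ x z 0≤x h h′ = ≤≡ h′ (sym (trans (cong (z 0 *_) ifac₀) (ℚ.*-identityʳ (z 0))))
      split-sum (suc r₁) r₂ x z 0≤x h h′ =
        ≤-trans (*≤ (x 0) (0≤x 0) (ifac-submult (suc r₁) r₂))
          (≡≤ (sym (ℚ.*-assoc (x 0) (ifac r₂) (ifac (suc r₁)))) (≤* (ifac (suc r₁)) (0≤ifac (suc r₁)) (h 0 (s≤s z≤n))))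
        +≤+ split-sum r₁ r₂ (x ∘ suc) (z ∘ suc) (0≤x ∘ suc) (λ i i<r₁ → h (suc i) (s≤s i<r₁)) h′

      C₀≡ : ∀ r → C β r 0 ≡ ifac r
      C₀≡ zero    = trans (cong (_* ifac 0) (D₀ β 0)) (ℚ.*-identityˡ (ifac 0))
      C₀≡ (suc r) = trans (cong₂ _+_ (trans (cong (_* ifac (suc r)) (D₀ β 0)) (ℚ.*-identityˡ (ifac (suc r)))) (⋆-zeroˡ ifac r (λ _ _ → refl)))
        (ℚ.+-identityʳ _)

      C-0 : ∀ m → C β 0 m ≡ δ m
      C-0 m = trans (cong₂ _*_ (D₀ β m) ifac₀) (ℚ.*-identityʳ (δ m))

      x≥ : ∀ (x y : Seq) → (∀ i → 0ℚ ≤ x i) → (∀ i → 0ℚ ≤ y i) → ∀ m → x m * y 0 ≤ (x ⋆ y) m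
      x≥ x y 0≤x 0≤y m = ≡≤ (ℚ.*-comm (x m) (y 0)) (≤≡ (⋆-head≤ m 0≤y 0≤x) (⋆-comm y x m))

    -- The leaves of a level with r₁ + r₂ nodes are first taken from the r₂ nodes.
    C-submult : ∀ m r₁ r₂ → C β (r₁ ℕ.+ r₂) m ≤ (C β r₁ ⋆ C β r₂) m
    C-submult = <-rec _ step
      where
      step : ∀ m → (∀ {k} → k ℕ.< m → ∀ r₁ r₂ → C β (r₁ ℕ.+ r₂) k ≤ (C β r₁ ⋆ C β r₂) k) →
        ∀ r₁ r₂ → C β (r₁ ℕ.+ r₂) m ≤ (C β r₁ ⋆ C β r₂) m
      step m ih zero     r₂ = ℚ.≤-reflexive (sym (trans (⋆-congˡ (C β r₂) m C-0) (δ-⋆ (C β r₂) m)))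
      step m ih (suc r₁) r₂ = ≤≡ (split-sum (suc r₁) r₂ (λ i → sh i (D β i) m) (λ i → (sh i (D β i) ⋆ C β r₂) m)
          (λ i → sh-≥0 i m (λ k → D≥0 β k i)) early late)
        (⋆-exchange (λ i → sh i (D β i)) ifac (C β r₂) (suc r₁) m)
        where
        open ℚ.≤-Reasoning
        -- Here all r₂ nodes are leaves, which is the constant term ifac r₂ of C r₂.
        early : ∀ i → i ℕ.< suc r₁ → sh i (D β i) m * ifac r₂ ≤ (sh i (D β i) ⋆ C β r₂) m
        early i _ = ≡≤ (cong (sh i (D β i) m *_) (sym (C₀≡ r₂))) (x≥ (sh i (D β i)) (C β r₂) (λ k → sh-≥0 i k (λ l → D≥0 β l i)) (C≥0 β r₂) m)
        -- The induction hypothesis for the next level. The shift by suc r₁ is positive, so only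
        -- entries k < m are read; an empty first part has its own case for this reason.
        D-submult : ∀ k j → k ℕ.< m → D β (suc r₁ ℕ.+ j) k ≤ (D β j ⋆ D β (suc r₁)) k
        D-submult k j k<m = begin
          D β (suc r₁ ℕ.+ j) k
            ≡⟨ D≡C β (suc r₁ ℕ.+ j) k ⟩
          C β ((suc r₁ ℕ.+ j) ℕ.* b) k
            ≡⟨ cong (λ r → C β r k) (ℕ.*-distribʳ-+ b (suc r₁) j) ⟩
          C β (suc r₁ ℕ.* b ℕ.+ j ℕ.* b) k
            ≤⟨ ih k<m (suc r₁ ℕ.* b) (j ℕ.* b) ⟩
          (C β (suc r₁ ℕ.* b) ⋆ C β (j ℕ.* b)) k
            ≡⟨ ⋆-comm (C β (suc r₁ ℕ.* b)) (C β (j ℕ.* b)) k ⟩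
          (C β (j ℕ.* b) ⋆ C β (suc r₁ ℕ.* b)) k
            ≡⟨ ⋆-cong {C β (j ℕ.* b)} k (λ l _ → sym (D≡C β j l)) (λ l _ → sym (D≡C β (suc r₁) l)) ⟩
          (D β j ⋆ D β (suc r₁)) k ∎
        late : ((λ j → sh (suc r₁ ℕ.+ j) (D β (suc r₁ ℕ.+ j)) m) ⋆ ifac) r₂ ≤ (sh (suc r₁) (D β (suc r₁)) ⋆ C β r₂) m
        late = begin
          ((λ j → sh (suc r₁ ℕ.+ j) (D β (suc r₁ ℕ.+ j)) m) ⋆ ifac) r₂
            ≤⟨ ⋆-mono r₂ (λ j → sh-≥0 (suc r₁ ℕ.+ j) m (λ k → D≥0 β k (suc r₁ ℕ.+ j))) 0≤ifac
                 (λ j _ → sh-mono-< (r₁ ℕ.+ j) m (λ k k<m → D-submult k j k<m)) (λ _ _ → ≤-refl) ⟩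
          ((λ j → sh (suc r₁ ℕ.+ j) (D β j ⋆ D β (suc r₁)) m) ⋆ ifac) r₂
            ≡⟨ ⋆-congˡ ifac r₂ (λ j → trans (trans (sym (sh-sh (suc r₁) j (D β j ⋆ D β (suc r₁)) m))
                 (sh-comm (suc r₁) j (D β j ⋆ D β (suc r₁)) m)) (trans (sh-cong j m (λ k _ → trans (sh-cong (suc r₁) k (λ l _ → ⋆-comm (D β j) (D β (suc r₁)) l))
                   (trans (sym (sh-⋆ (suc r₁) (D β (suc r₁)) (D β j) k)) (⋆-comm (sh (suc r₁) (D β (suc r₁))) (D β j) k))))
                   (sym (sh-⋆ j (D β j) (sh (suc r₁) (D β (suc r₁))) m)))) ⟩
          ((λ j → (sh j (D β j) ⋆ sh (suc r₁) (D β (suc r₁))) m) ⋆ ifac) r₂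
            ≡⟨ ⋆-exchange (λ j → sh j (D β j)) ifac (sh (suc r₁) (D β (suc r₁))) r₂ m ⟩
          (C β r₂ ⋆ sh (suc r₁) (D β (suc r₁))) m
            ≡⟨ ⋆-comm (C β r₂) (sh (suc r₁) (D β (suc r₁))) m ⟩
          (sh (suc r₁) (D β (suc r₁)) ⋆ C β r₂) m ∎

    C≤cpow : ∀ r m → C β r m ≤ cpow r m
    C≤cpow zero    m = ℚ.≤-reflexive (C-0 m)
    C≤cpow (suc r) m = ≤-trans (≡≤ (cong (λ k → C β k m) (ℕ.+-comm 1 r)) (C-submult m r 1))
      (⋆-mono m (C≥0 β r) (C≥0 β 1) (λ k _ → C≤cpow r k) (λ _ _ → ≤-refl))

    private
      T≥0 : ∀ ds i m → 0ℚ ≤ T ds i m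
      T≥0 []       zero    zero    = 0≤1
      T≥0 []       zero    (suc m) = ≤-refl
      T≥0 []       (suc i) m       = ℚ.≤-reflexive (sym (ℚ.*-zeroˡ (δ m)))
      T≥0 (d ∷ ds) i       m       = ⋆-≥0 (i ℕ.* b ℕ.+ d) (λ j → sh-≥0 j m (T≥0 ds j)) 0≤ifac

    -- At every level `C-submult` separates the d added nodes from the i b inherited ones, and they
    -- contribute d factors c.
    T-upper : ∀ ds i m → T ds i m ≤ (D β i ⋆ cpow (sum ds)) m
    T-upper [] zero m = ≤≡ (ℚ.≤-reflexive (trans (ℚ.*-identityˡ (δ m)) (sym (D₀ β m))))
      (sym (trans (⋆-comm (D β 0) δ m) (δ-⋆ (D β 0) m)))
    T-upper [] (suc i) m = ≡≤ (ℚ.*-zeroˡ (δ m)) (⋆-≥0 m (λ k → D≥0 β k (suc i)) (cpow≥0 0))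
    T-upper (d ∷ ds) i m = begin
      ((λ j → sh j (T ds j) m) ⋆ ifac) r
        ≤⟨ ⋆-mono r (λ j → sh-≥0 j m (T≥0 ds j)) 0≤ifac
             (λ j _ → sh-mono j m (λ k _ → T-upper ds j k)) (λ _ _ → ≤-refl) ⟩
      ((λ j → sh j (D β j ⋆ cpow S) m) ⋆ ifac) r
        ≡⟨ ⋆-congˡ ifac r (λ j → sym (sh-⋆ j (D β j) (cpow S) m)) ⟩
      ((λ j → (sh j (D β j) ⋆ cpow S) m) ⋆ ifac) r
        ≡⟨ ⋆-exchange (λ j → sh j (D β j)) ifac (cpow S) r m ⟩
      (C β r ⋆ cpow S) m
        ≤⟨ ⋆-mono m (C≥0 β r) (cpow≥0 S) (λ k _ → ≤-trans (C-submult k (i ℕ.* b) d)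
             (⋆-mono k (C≥0 β (i ℕ.* b)) (cpow≥0 d) (λ l _ → ℚ.≤-reflexive (sym (D≡C β i l))) (λ l _ → C≤cpow d l)))
             (λ _ _ → ≤-refl) ⟩
      ((D β i ⋆ cpow d) ⋆ cpow S) m
        ≡⟨ trans (⋆-assoc (D β i) (cpow d) (cpow S) m) (⋆-congʳ (D β i) m (λ k → trans (cpow-+ d S k) (cong (λ t → cpow t k) (ℕ.+-comm S d)))) ⟩
      (D β i ⋆ cpow (d ℕ.+ S)) m ∎
      where
      open ℚ.≤-Reasoning
      r = i ℕ.* b ℕ.+ d
      S = sum ds

    private
      sh-< : ∀ j {x y} m {M} → m ℕ.≤ M → (∀ k → k ℕ.< M → x k ≡ y k) → sh (suc j) x m ≡ sh (suc j) y m
      sh-< j m m≤M h = sh-cong-< j m (λ k k<m → h k (ℕ.<-≤-trans k<m m≤M))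

      T-zero : ∀ ds m → T (0 ∷ ds) 0 m ≡ T ds 0 m
      T-zero ds m = trans (cong (T ds 0 m *_) ifac₀) (ℚ.*-identityʳ _)

      T-zeros : ∀ M ds m → T (replicate M 0 ++ ds) 0 m ≡ T ds 0 m
      T-zeros zero    ds m = refl
      T-zeros (suc M) ds m = trans (T-zero (replicate M 0 ++ ds) m) (T-zeros M ds m)

      -- If more levels follow than there are internal nodes, the subtrees do not
      -- reach the digits ds.
      T-gap-level : ∀ M ds → (∀ i m → m ℕ.< M → T (replicate M 0 ++ ds) i m ≡ (D β i ⋆ T ds 0) m) →
        ∀ r m → m ℕ.≤ M → ((λ j → sh j (T (replicate M 0 ++ ds) j) m) ⋆ ifac) r ≡ (C β r ⋆ T ds 0) m
      T-gap-level M ds h r m m≤M = trans (⋆-congˡ ifac r term) (⋆-exchange (λ j → sh j (D β j)) ifac (T ds 0) r m)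
        where
        term : ∀ j → sh j (T (replicate M 0 ++ ds) j) m ≡ (sh j (D β j) ⋆ T ds 0) m
        term zero    = trans (T-zeros M ds m) (sym (trans (⋆-congˡ (T ds 0) m (D₀ β)) (δ-⋆ (T ds 0) m)))
        term (suc j) = trans (sh-< j m m≤M (λ k k<M → h (suc j) k k<M)) (sym (sh-⋆ (suc j) (D β (suc j)) (T ds 0) m))

      T-gap : ∀ M ds i m → m ℕ.< M → T (replicate M 0 ++ ds) i m ≡ (D β i ⋆ T ds 0) m
      T-gap (suc M) ds i m (s≤s m≤M) = trans (T-gap-level M ds (T-gap M ds) (i ℕ.* b ℕ.+ 0) m m≤M)
        (⋆-congˡ (T ds 0) m (λ k → trans (cong (λ r → C β r k) (ℕ.+-identityʳ (i ℕ.* b))) (sym (D≡C β i k))))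

    -- The last digit 1 is followed by M zeros as well, since its subtree needs the same room.
    spaced : ℕ → ℕ → List ℕ
    spaced M zero    = []
    spaced M (suc s) = 1 ∷ (replicate M 0 ++ spaced M s)

    T-spaced : ∀ M s m → m ℕ.≤ M → T (spaced M s) 0 m ≡ cpow s m
    T-spaced M zero    m _   = ℚ.*-identityˡ (δ m)
    T-spaced M (suc s) m m≤M = trans (T-gap-level M (spaced M s) (T-gap M (spaced M s)) 1 m m≤M)
      (trans (⋆-cong {c β} m (λ _ _ → refl) (λ k k≤m → T-spaced M s k (ℕ.≤-trans k≤m m≤M))) (⋆-comm (c β) (cpow s) m))

    spaced-digits : ∀ M s → Digits (spaced M s)
    spaced-digits M zero    = []
    spaced-digits M (suc s) = s≤s (s≤s z≤n) ∷ go M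
      where
      go : ∀ k → Digits (replicate k 0 ++ spaced M s)
      go zero    = spaced-digits M s
      go (suc k) = s≤s z≤n ∷ go k

    spaced-sum : ∀ M s → sum (spaced M s) ≡ s
    spaced-sum M zero    = refl
    spaced-sum M (suc s) = cong suc (trans (go M) (spaced-sum M s))
      where
      go : ∀ k → sum (replicate k 0 ++ spaced M s) ≡ sum (spaced M s)
      go zero    = refl
      go (suc k) = go k

-- Representations and compositions as counted objects; digit sums.

module Representations where

  open import Data.Digit using (toDigits; fromDigits; Expansion)
  open import Data.Empty using (⊥)
  open import Data.Fin as Fin using (Fin; zero; suc; toℕ; fromℕ<; opposite)
  import Data.Fin.Properties as Fin
  import Data.Integer as ℤ
  open import Data.List as List using (List; []; _∷_; _++_; length; replicate; reverse)
  import Data.List.Properties as List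
  open import Data.List.Relation.Unary.All as ListAll using ([]; _∷_)
  import Data.List.Relation.Unary.All.Properties as ListAll
  open import Data.Nat as ℕ using (ℕ; zero; suc; z≤n; s≤s; _!; NonZero)
  import Data.Nat.DivMod as ℕ
  import Data.Nat.Properties as ℕ
  open import Data.Nat.ListAction using (sum)
  open import Data.Nat.ListAction.Properties using (sum-++)
  open import Data.Product using (∃-syntax; Σ-syntax; _×_; _,_; proj₁; proj₂)
  open import Data.Rational as ℚ
    using (ℚ; 0ℚ; 1ℚ; _+_; _*_; _≤_; _<_; _/_)
  open import Data.Rational.Properties as ℚ using (≤-refl; ≤-trans)
  open import Data.Vec as Vec using (Vec; []; _∷_)
  open import Data.Vec.Relation.Unary.All as All using (All; []; _∷_)
  open import Function using (_∘_; _↔_; mk↔ₛ′; Inverse)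
  open import Function.Properties.Inverse using (↔-trans)
  open import Relation.Nullary.Decidable using (True)
  open import Relation.Binary.PropositionalEquality
  open import Tactic.RingSolver using (solve-∀)
  open import Defs using (Representation; Composition; _^-_)
  open Rationals
  open Sums
  open Counting
  open Levels

  /-inv : ∀ m d .{{_ : NonZero d}} → (ℤ.+ m / d) ≡ ι m * inv (ι d)
  /-inv m (suc d) = /-as-inv m d

  Total : ∀ {A : Set} → (A → ℕ) → ∀ {n} → Vec A n → ℕ
  Total f v = Vec.sum (Vec.map f v)

  -- Tuples of natural numbers below L versus tuples in Fin L, for an enumeration
  -- e of the numbers below L
  module Reindex {L : ℕ} (e : Fin L → ℕ) (un : ∀ a → a ℕ.< L → Fin L)
    (e-un : ∀ a a<L → e (un a a<L) ≡ a) (un-e : ∀ k e<L → un (e k) e<L ≡ k)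
    (f : ℕ → ℕ) (h : Fin L → ℕ) (f-e : ∀ k → f (e k) ≡ h k) where

    into : ∀ {n} (v : Vec ℕ n) → All (ℕ._< L) v → Vec (Fin L) n
    into []       []         = []
    into (a ∷ v) (a<L ∷ all) = un a a<L ∷ into v all

    into-total : ∀ {n} (v : Vec ℕ n) all → Total h (into v all) ≡ Total f v
    into-total []      []          = refl
    into-total (a ∷ v) (a<L ∷ all) = cong₂ ℕ._+_ (trans (sym (f-e (un a a<L))) (cong f (e-un a a<L))) (into-total v all)

    out-total : ∀ {n} (w : Vec (Fin L) n) → Total f (Vec.map e w) ≡ Total h w
    out-total []      = refl
    out-total (k ∷ w) = cong₂ ℕ._+_ (f-e k) (out-total w)

    into-out : ∀ {n} (w : Vec (Fin L) n) all → into (Vec.map e w) all ≡ w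
    into-out []      []          = refl
    into-out (k ∷ w) (e<L ∷ all) = cong₂ _∷_ (un-e k e<L) (into-out w all)

    out-into : ∀ {n} (v : Vec ℕ n) all → Vec.map e (into v all) ≡ v
    out-into []      []          = refl
    out-into (a ∷ v) (a<L ∷ all) = cong₂ _∷_ (e-un a a<L) (out-into v all)

    reindex : ∀ {n ℓ} {Q : Vec ℕ n → Set} → (∀ v (p q : Q v) → p ≡ q) → (∀ v → Q v → All (ℕ._< L) v) →
      (∀ v → Q v → Total f v ≡ ℓ) → (∀ w → Total h w ≡ ℓ → Q (Vec.map e w)) → (Σ[ v ∈ Vec ℕ n ] Q v) ↔ Sols h n ℓ
    reindex {n} {ℓ} {Q} irr bounded total from-total = mk↔ₛ′ to from to-from from-to
      where
      to : (Σ[ v ∈ Vec ℕ n ] Q v) → Sols h n ℓ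
      to (v , q) = into v (bounded v q) , trans (into-total v (bounded v q)) (total v q)
      from : Sols h n ℓ → Σ[ v ∈ Vec ℕ n ] Q v
      from (w , p) = Vec.map e w , from-total w p
      to-from : ∀ s → to (from s) ≡ s
      to-from (w , p) = Σ-≡ (into-out w (bounded (Vec.map e w) (from-total w p)))
      Q-≡ : ∀ {v v′} (eq : v ≡ v′) (q : Q v) (q′ : Q v′) → (v , q) ≡ (v′ , q′)
      Q-≡ {v} refl q q′ = cong (v ,_) (irr v q q′)
      from-to : ∀ s → from (to s) ≡ s
      from-to (v , q) = Q-≡ (out-into v (bounded v q)) _ q

  module _ (β : ℕ) where

    private
      b : ℕ
      b = suc (suc β)

      0<b^ : ∀ k → 0 ℕ.< b ℕ.^ k
      0<b^ k = ℕ.m^n>0 b k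

    powers-opposite : ∀ L k → b ℕ.^ toℕ (opposite k) ≡ powers β L k
    powers-opposite (suc L) zero    = cong (b ℕ.^_) (Fin.toℕ-fromℕ L)
    powers-opposite (suc L) (suc k) = trans (cong (b ℕ.^_) (Fin.toℕ-inject₁ (opposite k))) (powers-opposite L k)

    powers-∸ : ∀ m k → b ℕ.^ (m ℕ.∸ toℕ k) ≡ powers β (suc m) k
    powers-∸ m       zero    = refl
    powers-∸ (suc m) (suc k) = powers-∸ m k

    -- The bound ℓ < bᴸ forces all exponents below L; `opposite` accounts for the decreasing order
    -- of `powers`.
    representations : ∀ L n ℓ → ℓ ℕ.< b ℕ.^ L → Representation b ℓ n ↔ Fin (U (powers β L) n ℓ)
    representations L n ℓ ℓ<b^L = ↔-trans
      (reindex (λ _ → ℕ.≡-irrelevant) (λ v p → bounded v (subst (ℕ._< b ℕ.^ L) (sym p) ℓ<b^L))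
        (λ _ p → p) (λ w p → trans (out-total w) p))
      (Sols-↔ (powers β L) n ℓ)
      where
      e : Fin L → ℕ
      e k = toℕ (opposite k)
      un : ∀ a → a ℕ.< L → Fin L
      un a a<L = opposite (fromℕ< a<L)
      open Reindex e un
        (λ a a<L → trans (cong toℕ (Fin.opposite-involutive (fromℕ< a<L))) (Fin.toℕ-fromℕ< a<L))
        (λ k e<L → trans (cong opposite (Fin.fromℕ<-toℕ (opposite k) e<L)) (Fin.opposite-involutive k))
        (b ℕ.^_) (powers β L) (powers-opposite L)
      bounded : ∀ {n} (v : Vec ℕ n) → Total (b ℕ.^_) v ℕ.< b ℕ.^ L → All (ℕ._< L) v
      bounded []      _ = []
      bounded (a ∷ v) h = small ∷ bounded v (ℕ.≤-<-trans (ℕ.m≤n+m (Total (b ℕ.^_) v) (b ℕ.^ a)) h)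
        where
        small : a ℕ.< L
        small = ℕ.≰⇒> λ L≤a → ℕ.<⇒≱ (ℕ.≤-<-trans (ℕ.m≤m+n (b ℕ.^ a) (Total (b ℕ.^_) v)) h) (ℕ.^-monoʳ-≤ b L≤a)

    ^-as-ι : ∀ {k K} → k ℕ.≤ K → ι (b ℕ.^ K) * (b ^- k) ≡ ι (b ℕ.^ (K ℕ.∸ k))
    ^-as-ι {k} {K} k≤K = begin
      ι (b ℕ.^ K) * (b ^- k)
        ≡⟨ cong (ι (b ℕ.^ K) *_) (/-inv 1 (b ℕ.^ k) {{ℕ.m^n≢0 b k}}) ⟩
      ι (b ℕ.^ K) * (ι 1 * inv (ι (b ℕ.^ k)))
        ≡⟨ cong (λ t → ι (b ℕ.^ t) * (ι 1 * inv (ι (b ℕ.^ k)))) (sym (ℕ.m+[n∸m]≡n k≤K)) ⟩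
      ι (b ℕ.^ (k ℕ.+ (K ℕ.∸ k))) * (ι 1 * inv (ι (b ℕ.^ k)))
        ≡⟨ cong (_* (ι 1 * inv (ι (b ℕ.^ k)))) (trans (cong ι (ℕ.^-distribˡ-+-* b k (K ℕ.∸ k))) (ι-* (b ℕ.^ k) (b ℕ.^ (K ℕ.∸ k)))) ⟩
      ι (b ℕ.^ k) * ι (b ℕ.^ (K ℕ.∸ k)) * (ι 1 * inv (ι (b ℕ.^ k)))
        ≡⟨ lem (ι (b ℕ.^ k)) (ι (b ℕ.^ (K ℕ.∸ k))) (inv (ι (b ℕ.^ k))) ⟩
      ι (b ℕ.^ (K ℕ.∸ k)) * (ι (b ℕ.^ k) * inv (ι (b ℕ.^ k)))
        ≡⟨ trans (cong (ι (b ℕ.^ (K ℕ.∸ k)) *_) (*-inv (ι-mono-< (0<b^ k)))) (ℚ.*-identityʳ _) ⟩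
      ι (b ℕ.^ (K ℕ.∸ k)) ∎
      where
      open ≡-Reasoning
      lem : ∀ a c i → a * c * (1ℚ * i) ≡ c * (a * i)
      lem = solve-∀ ℚ-ring

    negative-total : ∀ {n} → Vec ℕ n → ℚ
    negative-total v = Vec.foldr′ _+_ 0ℚ (Vec.map (b ^-_) v)

    total-scale : ∀ K {n} (v : Vec ℕ n) → All (ℕ._≤ K) v →
      ι (b ℕ.^ K) * negative-total v ≡ ι (Total (λ k → b ℕ.^ (K ℕ.∸ k)) v)
    total-scale K []      []          = ℚ.*-zeroʳ (ι (b ℕ.^ K))
    total-scale K (k ∷ v) (k≤K ∷ all) = trans (ℚ.*-distribˡ-+ (ι (b ℕ.^ K)) (b ^- k) (negative-total v))
      (trans (cong₂ _+_ (^-as-ι k≤K) (total-scale K v all)) (sym (ι-+ (b ℕ.^ (K ℕ.∸ k)) (Total (λ k → b ℕ.^ (K ℕ.∸ k)) v))))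

    total-natural : ∀ K {n} (v : Vec ℕ n) → All (ℕ._≤ K) v → negative-total v ≡ 1ℚ →
      Total (λ k → b ℕ.^ (K ℕ.∸ k)) v ≡ b ℕ.^ K
    total-natural K v all eq = ι-injective (trans (sym (total-scale K v all))
      (trans (cong (ι (b ℕ.^ K) *_) eq) (ℚ.*-identityʳ (ι (b ℕ.^ K)))))

    total-rational : ∀ K {n} (v : Vec ℕ n) → All (ℕ._≤ K) v →
      Total (λ k → b ℕ.^ (K ℕ.∸ k)) v ≡ b ℕ.^ K → negative-total v ≡ 1ℚ
    total-rational K v all eq = ℚ.≤-antisym (cancel (ℚ.≤-reflexive scaled)) (cancel (ℚ.≤-reflexive (sym scaled)))
      where
      0<ιb^K : 0ℚ < ι (b ℕ.^ K)
      0<ιb^K = ι-mono-< (0<b^ K)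
      scaled : ι (b ℕ.^ K) * negative-total v ≡ ι (b ℕ.^ K) * 1ℚ
      scaled = trans (total-scale K v all) (trans (cong ι eq) (sym (ℚ.*-identityʳ (ι (b ℕ.^ K)))))
      cancel : ∀ {p q} → ι (b ℕ.^ K) * p ≤ ι (b ℕ.^ K) * q → p ≤ q
      cancel = *-cancel-≤ (ι (b ℕ.^ K)) 0<ιb^K

    entries≤sum : ∀ {n} (v : Vec ℕ n) → All (ℕ._≤ Vec.sum v) v
    entries≤sum []      = []
    entries≤sum (a ∷ v) = ℕ.m≤m+n a (Vec.sum v) ∷ All.map (λ le → ℕ.≤-trans le (ℕ.m≤n+m (Vec.sum v) a)) (entries≤sum v)

    remove : ∀ {n} (g : ℕ → ℕ) {P : ℕ → Set} (v : Vec ℕ n) (i : Fin n) → All P v →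
      ∃[ n′ ] n ≡ suc n′ × Σ[ v′ ∈ Vec ℕ n′ ] All P v′ × Total g v ≡ g (Vec.lookup v i) ℕ.+ Total g v′
    remove g (a ∷ v) zero    (p ∷ all) = _ , refl , v , all , refl
    remove g (a ∷ v) (suc i) (p ∷ all) with remove g v i all
    ... | n′ , refl , v′ , all′ , eq = suc n′ , refl , a ∷ v′ , p ∷ all′ , (begin
      g a ℕ.+ Total g v                                ≡⟨ cong (g a ℕ.+_) eq ⟩
      g a ℕ.+ (g (Vec.lookup v i) ℕ.+ Total g v′)      ≡⟨ ℕ.+-assoc (g a) _ _ ⟨
      g a ℕ.+ g (Vec.lookup v i) ℕ.+ Total g v′        ≡⟨ cong (ℕ._+ Total g v′) (ℕ.+-comm (g a) _) ⟩
      g (Vec.lookup v i) ℕ.+ g a ℕ.+ Total g v′        ≡⟨ ℕ.+-assoc (g (Vec.lookup v i)) _ _ ⟩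
      g (Vec.lookup v i) ℕ.+ (g a ℕ.+ Total g v′)      ∎)
      where open ≡-Reasoning

    val-++ : ∀ i xs ys → val β i (xs ++ ys) ≡ val β (val β i xs) ys
    val-++ i []       ys = refl
    val-++ i (x ∷ xs) ys = val-++ (i ℕ.* b ℕ.+ x) xs ys

    val-zeros : ∀ i k → val β i (replicate k 0) ≡ i ℕ.* b ℕ.^ k
    val-zeros i zero    = sym (ℕ.*-identityʳ i)
    val-zeros i (suc k) = trans (val-zeros (i ℕ.* b ℕ.+ 0) k)
      (trans (cong (ℕ._* b ℕ.^ k) (ℕ.+-identityʳ (i ℕ.* b))) (ℕ.*-assoc i b (b ℕ.^ k)))

    val-nines : ∀ i k → suc (val β i (replicate k (suc β))) ≡ suc i ℕ.* b ℕ.^ k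
    val-nines i zero    = cong suc (sym (ℕ.*-identityʳ i))
    val-nines i (suc k) = trans (val-nines (i ℕ.* b ℕ.+ suc β) k)
      (trans (cong (ℕ._* b ℕ.^ k) (trans (sym (ℕ.+-suc (i ℕ.* b) (suc β))) (ℕ.+-comm (i ℕ.* b) b))) (ℕ.*-assoc (suc i) b (b ℕ.^ k)))

    -- b ^ K − b ^ (K − k) has k digits b − 1, so it is not the sum of fewer than
    -- (b − 1) k powers of b.
    private
      module Deep (K k : ℕ) (k≤K : k ℕ.≤ K) where
        -- The leading 0 makes the length K + 1, the number of exponents from 0 to K.
        ds : List ℕ
        ds = 0 ∷ (replicate k (suc β) ++ replicate (K ℕ.∸ k) 0)

        ds-digits : Digits β ds
        ds-digits = s≤s z≤n ∷ ListAll.++⁺ (ListAll.replicate⁺ k ℕ.≤-refl) (ListAll.replicate⁺ (K ℕ.∸ k) (s≤s z≤n))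

        ds-length : length ds ≡ suc K
        ds-length = cong suc (trans (List.length-++ (replicate k (suc β)))
          (trans (cong₂ ℕ._+_ (List.length-replicate k) (List.length-replicate (K ℕ.∸ k))) (ℕ.m+[n∸m]≡n k≤K)))

        sum-replicate : ∀ j d → sum (replicate j d) ≡ d ℕ.* j
        sum-replicate zero    d = sym (ℕ.*-zeroʳ d)
        sum-replicate (suc j) d = trans (cong (d ℕ.+_) (sum-replicate j d)) (sym (ℕ.*-suc d j))

        ds-sum : sum ds ≡ suc β ℕ.* k
        ds-sum = trans (sum-++ (replicate k (suc β)) (replicate (K ℕ.∸ k) 0))
          (trans (cong₂ ℕ._+_ (sum-replicate k (suc β)) (sum-replicate (K ℕ.∸ k) 0)) (ℕ.+-identityʳ (suc β ℕ.* k)))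

        ds-val : b ℕ.^ (K ℕ.∸ k) ℕ.+ val β 0 ds ≡ b ℕ.^ K
        ds-val = begin
          b ℕ.^ (K ℕ.∸ k) ℕ.+ val β 0 (replicate k (suc β) ++ replicate (K ℕ.∸ k) 0)
            ≡⟨ cong (b ℕ.^ (K ℕ.∸ k) ℕ.+_) (trans (val-++ 0 (replicate k (suc β)) (replicate (K ℕ.∸ k) 0)) (val-zeros (val β 0 (replicate k (suc β))) (K ℕ.∸ k))) ⟩
          suc (val β 0 (replicate k (suc β))) ℕ.* b ℕ.^ (K ℕ.∸ k)
            ≡⟨ cong (ℕ._* b ℕ.^ (K ℕ.∸ k)) (trans (val-nines 0 k) (ℕ.*-identityˡ (b ℕ.^ k))) ⟩
          b ℕ.^ k ℕ.* b ℕ.^ (K ℕ.∸ k)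
            ≡⟨ trans (sym (ℕ.^-distribˡ-+-* b k (K ℕ.∸ k))) (cong (b ℕ.^_) (ℕ.m+[n∸m]≡n k≤K)) ⟩
          b ℕ.^ K ∎
          where open ≡-Reasoning

        few-parts : ∀ n → n ℕ.< suc β ℕ.* k → U (powers β (suc K)) n (val β 0 ds) ≡ 0
        few-parts n n< = subst (λ L → U (powers β L) n (val β 0 ds) ≡ 0) ds-length (ι-injective (begin
          ι (U (powers β (length ds)) n (val β 0 ds))
            ≡⟨ U-wt (powers β (length ds)) n (val β 0 ds) ⟩
          ι (n !) * wt (powers β (length ds)) n (val β 0 ds)
            ≡⟨ cong (ι (n !) *_) (too-few β ds ds-digits 0 n (subst (n ℕ.<_) (sym ds-sum) n<)) ⟩
          ι (n !) * 0ℚ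
            ≡⟨ ℚ.*-zeroʳ (ι (n !)) ⟩
          ι 0 ∎))
          where open ≡-Reasoning

    module Depths (K : ℕ) = Reindex {suc K} toℕ (λ _ a<L → fromℕ< a<L)
      (λ _ a<L → Fin.toℕ-fromℕ< a<L) (λ k e<L → Fin.fromℕ<-toℕ k e<L)
      (λ k → b ℕ.^ (K ℕ.∸ k)) (powers β (suc K)) (powers-∸ K)

    -- Multiply by bᴷ, where K, the sum of the exponents, bounds each of them, and remove the part
    -- with exponent k. The other (b - 1) m parts represent bᴷ - bᴷ⁻ᵏ, which takes at least (b - 1)
    -- k powers of b.
    depth-bound : ∀ m (v : Vec ℕ (suc β ℕ.* m ℕ.+ 1)) → negative-total v ≡ 1ℚ → ∀ i → Vec.lookup v i ℕ.≤ m
    depth-bound m v eq i with remove (λ k → b ℕ.^ (Vec.sum v ℕ.∸ k)) v i (entries≤sum v)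
    ... | n′ , n≡ , v′ , all′ , split = ℕ.*-cancelˡ-≤ (suc β) (ℕ.≮⇒≥ λ n′< → impossible
          (subst (λ u → Fin u) (few-parts n′ (subst (ℕ._< suc β ℕ.* k) n′≡ n′<))
            (Inverse.to (Sols-↔ (powers β (suc K)) n′ (val β 0 ds)) (Depths.into K v′ all< , trans (Depths.into-total K v′ all<) rest))))
      where
      K k : ℕ
      K = Vec.sum v
      k = Vec.lookup v i
      n′≡ : suc β ℕ.* m ≡ n′
      n′≡ = ℕ.suc-injective (trans (ℕ.+-comm 1 (suc β ℕ.* m)) n≡)
      lookup-all : ∀ {n} {P : ℕ → Set} {v : Vec ℕ n} → All P v → ∀ i → P (Vec.lookup v i)
      lookup-all (p ∷ all) zero    = p
      lookup-all (p ∷ all) (suc i) = lookup-all all i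
      open Deep K k (lookup-all (entries≤sum v) i)
      all< : All (ℕ._< suc K) v′
      all< = All.map s≤s all′
      rest : Total (λ k → b ℕ.^ (K ℕ.∸ k)) v′ ≡ val β 0 ds
      rest = ℕ.+-cancelˡ-≡ (b ℕ.^ (K ℕ.∸ k)) _ _ (trans (sym split)
        (trans (total-natural K v (entries≤sum v) eq) (sym ds-val)))
      impossible : Fin 0 → ⊥
      impossible ()

    compositions : ∀ m → Composition b (suc β ℕ.* m ℕ.+ 1) ↔ Fin (U (powers β (suc m)) (suc β ℕ.* m ℕ.+ 1) (b ℕ.^ m))
    compositions m = ↔-trans
      (Depths.reindex m (λ v p q → uip p q) (λ v eq → all-below v (depth-bound m v eq))
        (λ v eq → total-natural m v (All.map ℕ.≤-pred (all-below v (depth-bound m v eq))) eq)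
        (λ w p → total-rational m (Vec.map toℕ w) (all-toℕ w) (trans (Depths.out-total m w) p)))
      (Sols-↔ (powers β (suc m)) (suc β ℕ.* m ℕ.+ 1) (b ℕ.^ m))
      where
      uip : ∀ {p q : ℚ} (e e′ : p ≡ q) → e ≡ e′
      uip refl refl = refl
      all-below : ∀ {n} (v : Vec ℕ n) → (∀ i → Vec.lookup v i ℕ.≤ m) → All (ℕ._< suc m) v
      all-below []      h = []
      all-below (a ∷ v) h = s≤s (h zero) ∷ all-below v (h ∘ suc)
      all-toℕ : ∀ {n} (w : Vec (Fin (suc m)) n) → All (ℕ._≤ m) (Vec.map toℕ w)
      all-toℕ []      = []
      all-toℕ (k ∷ w) = ℕ.≤-pred (Fin.toℕ<n k) ∷ all-toℕ w

    -- Unlike val, with the least significant digit first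
    value : List ℕ → ℕ
    value []       = 0
    value (d ∷ ds) = d ℕ.+ value ds ℕ.* b

    val-reverse : ∀ ds → val β 0 (reverse ds) ≡ value ds
    val-reverse []       = refl
    val-reverse (d ∷ ds) = trans (cong (val β 0) (List.unfold-reverse d ds)) (trans (val-++ 0 (reverse ds) (d ∷ []))
      (trans (cong (λ v → v ℕ.* b ℕ.+ d) (val-reverse ds)) (ℕ.+-comm (value ds ℕ.* b) d)))

    sum-reverse : ∀ ds → sum (reverse ds) ≡ sum ds
    sum-reverse []       = refl
    sum-reverse (d ∷ ds) = trans (cong sum (List.unfold-reverse d ds)) (trans (sum-++ (reverse ds) (d ∷ []))
      (trans (cong₂ ℕ._+_ (sum-reverse ds) (ℕ.+-identityʳ d)) (ℕ.+-comm (sum ds) d)))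

    digits-reverse : ∀ ds → Digits β ds → Digits β (reverse ds)
    digits-reverse []       []       = []
    digits-reverse (d ∷ ds) (p ∷ ok) = subst (Digits β) (sym (List.unfold-reverse d ds)) (ListAll.++⁺ (digits-reverse ds ok) (p ∷ []))

    private
      split-digit : ∀ {x y X Y} → x ℕ.< b → y ℕ.< b → x ℕ.+ X ℕ.* b ≡ y ℕ.+ Y ℕ.* b → x ≡ y × X ≡ Y
      split-digit {x} {y} {X} {Y} x<b y<b eq = x≡y ,
        ℕ.*-cancelʳ-≡ X Y b (ℕ.+-cancelˡ-≡ y _ _ (trans (cong (ℕ._+ X ℕ.* b) (sym x≡y)) eq))
        where
        x≡y : x ≡ y
        x≡y = trans (sym (ℕ.m<n⇒m%n≡m x<b)) (trans (sym (ℕ.[m+kn]%n≡m%n x X b)) (trans (cong (ℕ._% b) eq)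
          (trans (ℕ.[m+kn]%n≡m%n y Y b) (ℕ.m<n⇒m%n≡m y<b))))

    -- Expansions of the same number may differ by zeros at the most significant end, so the digit
    -- sums are compared instead of the lists.
    sum-unique : ∀ xs ys → Digits β xs → Digits β ys → value xs ≡ value ys → sum xs ≡ sum ys
    sum-unique []       []       _ _ _ = refl
    sum-unique []       (y ∷ ys) _ (y<b ∷ oky) eq with split-digit {0} {y} {0} {value ys} (s≤s z≤n) y<b eq
    ... | 0≡y , 0≡Y = cong₂ ℕ._+_ 0≡y (sum-unique [] ys [] oky 0≡Y)
    sum-unique (x ∷ xs) []       (x<b ∷ okx) _ eq with split-digit {x} {0} {value xs} {0} x<b (s≤s z≤n) eq
    ... | x≡0 , X≡0 = cong₂ ℕ._+_ x≡0 (sum-unique xs [] okx [] X≡0)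
    sum-unique (x ∷ xs) (y ∷ ys) (x<b ∷ okx) (y<b ∷ oky) eq with split-digit {x} {y} {value xs} {value ys} x<b y<b eq
    ... | x≡y , X≡Y = cong₂ ℕ._+_ x≡y (sum-unique xs ys okx oky X≡Y)

    expansion-digits : ∀ (ds : Expansion b) → Digits β (List.map toℕ ds)
    expansion-digits []       = []
    expansion-digits (d ∷ ds) = Fin.toℕ<n d ∷ expansion-digits ds

    expansion-value : ∀ (ds : Expansion b) → value (List.map toℕ ds) ≡ fromDigits ds
    expansion-value []       = refl
    expansion-value (d ∷ ds) = cong (λ v → toℕ d ℕ.+ v ℕ.* b) (expansion-value ds)

    digit-list : ∀ {2≤b : True (2 ℕ.≤? b)} ℓ → ∃[ ds ] Digits β ds × val β 0 ds ≡ ℓ × sum ds ≡ sum (List.map toℕ (proj₁ (toDigits b {2≤b} ℓ)))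
    digit-list {2≤b} ℓ = reverse xs , digits-reverse xs (expansion-digits (proj₁ E)) ,
      trans (val-reverse xs) (trans (expansion-value (proj₁ E)) (proj₂ E)) , sum-reverse xs
      where
      E = toDigits b {2≤b} ℓ
      xs = List.map toℕ (proj₁ E)

    digitSum-val : ∀ {2≤b : True (2 ℕ.≤? b)} ds → Digits β ds → sum (List.map toℕ (proj₁ (toDigits b {2≤b} (val β 0 ds)))) ≡ sum ds
    digitSum-val {2≤b} ds ok = trans (sum-unique (List.map toℕ (proj₁ E)) (reverse ds) (expansion-digits (proj₁ E)) (digits-reverse ds ok)
        (trans (expansion-value (proj₁ E)) (trans (proj₂ E) (trans (cong (val β 0) (sym (List.reverse-involutive ds))) (val-reverse (reverse ds))))))
      (sum-reverse ds)
      where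
      E = toDigits b {2≤b} (val β 0 ds)

-- The maximum of the counts and its normalisation by n!.

module Maxima where

  open import Data.Fin using (Fin)
  import Data.Integer as ℤ
  open import Data.List as List using (List; _∷_; _++_; length; replicate)
  import Data.List.Properties as List
  open import Data.Nat as ℕ using (ℕ; zero; suc; _!)
  import Data.Nat.Properties as ℕ
  open import Data.Nat.ListAction using (sum)
  open import Data.Product using (∃-syntax; _×_; _,_)
  open import Data.Rational as ℚ using (ℚ; 0ℚ; 1ℚ; _+_; _*_; _≤_; _<_)
  open import Data.Rational.Properties as ℚ using (≤-refl; ≤-trans; <⇒≤)
  open import Function using (_↔_)
  open import Relation.Binary.PropositionalEquality
  open import Defs
  open Rationals
  open Sums
  open Trees
  open Reals
  open Asymptotics
  open Counting
  open Levels
  open Representations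

  0<ι! : ∀ n → 0ℚ < ι (n !)
  0<ι! n with n ! | ℕ.1≤n! n
  ... | suc k | _ = 0<ι k

  /!-≐ : ∀ {w n q} → ι w ≡ ι (n !) * q → (w /! n) ≐ fromℚ q
  /!-≐ {w} {n} {q} eq _ = begin
    (ℤ.+ w ℚ./ n !) {{n ℕ.!≢0}}     ≡⟨ /-inv w (n !) {{n ℕ.!≢0}} ⟩
    ι w * inv (ι (n !))             ≡⟨ cong (_* inv (ι (n !))) (trans eq (ℚ.*-comm (ι (n !)) q)) ⟩
    q * ι (n !) * inv (ι (n !))     ≡⟨ ℚ.*-assoc q (ι (n !)) (inv (ι (n !))) ⟩
    q * (ι (n !) * inv (ι (n !)))   ≡⟨ cong (q *_) (*-inv (0<ι! n)) ⟩
    q * 1ℚ                          ≡⟨ ℚ.*-identityʳ q ⟩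
    q                               ∎
    where open ≡-Reasoning

  !-ifac : ∀ n → ι (n !) * ifac n ≡ 1ℚ
  !-ifac zero    = trans (ℚ.*-identityˡ (ifac 0)) ifac₀
  !-ifac (suc n) = begin
    ι (suc n ℕ.* n !) * ifac (suc n)        ≡⟨ cong (_* ifac (suc n)) (trans (ι-* (suc n) (n !)) (ℚ.*-comm (ι (suc n)) (ι (n !)))) ⟩
    ι (n !) * ι (suc n) * ifac (suc n)      ≡⟨ ℚ.*-assoc (ι (n !)) (ι (suc n)) (ifac (suc n)) ⟩
    ι (n !) * (ι (suc n) * ifac (suc n))    ≡⟨ cong (ι (n !) *_) (suc-ifac n) ⟩
    ι (n !) * ifac n                        ≡⟨ !-ifac n ⟩
    1ℚ                                      ∎
    where open ≡-Reasoning

  1/!≐ifac : ∀ n → (1 /! n) ≐ fromℚ (ifac n)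
  1/!≐ifac n = /!-≐ {1} {n} (sym (!-ifac n))

  ≈-resp-≐ : ∀ f f′ g h → (∀ m → f m ≐ f′ m) → f′ ≈ g [1+O h ] → f ≈ g [1+O h ]
  ≈-resp-≐ f f′ g h eq (E , E-small , approx) = E , E-small ,
    ev-map (λ m → ≃-trans {f m} {f′ m} {g m *ᴿ (1ᴿ +ᴿ E m)} (≐⇒≃ {f m} {f′ m} (eq m))) approx

  scale-1/! : ∀ x y n → x ≐ y *ᴿ fromℚ (ifac n) → x ≃ y *ᴿ (1 /! n)
  scale-1/! x y n eq = ≐⇒≃ {x} {y *ᴿ (1 /! n)} λ k → trans (eq k) (cong (seq y k *_) (sym (1/!≐ifac n k)))

  module _ (β : ℕ) where

    private
      b : ℕ
      b = suc (suc β)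

    count : List ℕ → ℕ → ℕ
    count ds n = U (powers β (length ds)) n (val β 0 ds)

    count-T : ∀ ds → Digits β ds → ∀ m → let n = suc β ℕ.* m ℕ.+ sum ds in ι (count ds n) ≡ ι (n !) * T β ds 0 m
    count-T ds ok m = trans (U-wt (powers β (length ds)) n (val β 0 ds)) (cong (ι (n !) *_)
      (trans (cong (λ k → wt (powers β (length ds)) k (val β 0 ds)) (ℕ.+-comm (suc β ℕ.* m) (sum ds))) (wt-T β ds ok 0 m)))
      where
      n = suc β ℕ.* m ℕ.+ sum ds

    count-↔ : ∀ ds → Digits β ds → ∀ n → Representation b (val β 0 ds) n ↔ Fin (count ds n)
    count-↔ ds ok n = representations β (length ds) n (val β 0 ds) (val<b^ β ds ok)

    -- The gaps grow with m: m zeros are what `T-spaced` asks for at m internal nodes.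
    W : ℕ → ℕ → ℕ
    W s m = count (spaced β m s) (suc β ℕ.* m ℕ.+ s)

    W-cpow : ∀ s m → ι (W s m) ≡ ι ((suc β ℕ.* m ℕ.+ s) !) * cpow β s m
    W-cpow s m = trans (subst (λ t → ι (count (spaced β m s) (suc β ℕ.* m ℕ.+ t)) ≡ ι ((suc β ℕ.* m ℕ.+ t) !) * T β (spaced β m s) 0 m)
        (spaced-sum β m s) (count-T (spaced β m s) (spaced-digits β m s) m))
      (cong (ι ((suc β ℕ.* m ℕ.+ s) !) *_) (T-spaced β m s m ℕ.≤-refl))

    -- At the root i = 0, where D 0 = δ, `T-upper` bounds the weight by `cpow`, and W attains this
    -- value.
    count≤W : ∀ ds → Digits β ds → ∀ m → count ds (suc β ℕ.* m ℕ.+ sum ds) ℕ.≤ W (sum ds) m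
    count≤W ds ok m = ι-cancel-≤ (≡≤ (count-T ds ok m) (≤≡ (*≤ (ι (n !)) (<⇒≤ (0<ι! n))
        (≤≡ (T-upper β ds 0 m) (trans (⋆-congˡ (cpow β (sum ds)) m (D₀ β)) (δ-⋆ (cpow β (sum ds)) m))))
      (sym (W-cpow (sum ds) m))))
      where
      n = suc β ℕ.* m ℕ.+ sum ds

    0<val-spaced : ∀ M s → 0 ℕ.< val β 0 (spaced β M (suc s))
    0<val-spaced M s = ℕ.≤-trans (ℕ.m^n>0 b (length ds)) (ℕ.≤-trans (ℕ.m≤m+n (b ℕ.^ length ds) 0)
      (ℕ.≤-trans (ℕ.m≤m+n (1 ℕ.* b ℕ.^ length ds) (val β 0 ds)) (ℕ.≤-reflexive (sym (val-split β 1 ds)))))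
      where
      ds = replicate M 0 ++ spaced β M s

    W-maximum : ∀ s m → IsW b (suc s) (suc β ℕ.* m ℕ.+ suc s) (W (suc s) m)
    W-maximum s m = (val β 0 ds , 0<val-spaced m s , trans (digitSum-val β ds ok) (spaced-sum β m (suc s)) , count-↔ ds ok n) , upper
      where
      n = suc β ℕ.* m ℕ.+ suc s
      ds = spaced β m (suc s)
      ok = spaced-digits β m (suc s)
      upper : ∀ ℓ → 0 ℕ.< ℓ → digitSum b ℓ ≡ suc s → ∃[ u ] IsU b ℓ n u × u ℕ.≤ W (suc s) m
      upper ℓ _ sum≡ with digit-list β ℓ
      ... | es , es-ok , refl , es-sum = count es n , count-↔ es es-ok n ,
        subst (λ t → count es (suc β ℕ.* m ℕ.+ t) ℕ.≤ W t m) (trans es-sum sum≡) (count≤W es es-ok m)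

    -- `spaced m 1` is the digit 1 followed by m zeros, hence the expansion of bᵐ.
    q≡W : ∀ m → U (powers β (suc m)) (suc β ℕ.* m ℕ.+ 1) (b ℕ.^ m) ≡ W 1 m
    q≡W m = sym (trans (cong (λ es → count (1 ∷ es) n) (List.++-identityʳ (replicate m 0)))
      (cong₂ (λ L → U (powers β (suc L)) n) (List.length-replicate m) (trans (val-zeros β 1 m) (ℕ.*-identityˡ (b ℕ.^ m)))))
      where
      n = suc β ℕ.* m ℕ.+ 1

    W-compositions : ∀ m → Composition b (suc β ℕ.* m ℕ.+ 1) ↔ Fin (W 1 m)
    W-compositions m = subst (λ k → Composition b (suc β ℕ.* m ℕ.+ 1) ↔ Fin k) (q≡W m) (compositions β m)

    cpow-power : ∀ s m → cpow β (suc s) m ≡ power (c β) s m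
    cpow-power zero    m = δ-⋆ (c β) m
    cpow-power (suc s) m = ⋆-congˡ (c β) m (cpow-power s)

    W-≈ : ∀ s g h → (λ m → fromℚ (power (c β) s m)) ≈ g [1+O h ] →
      (λ m → W (suc s) m /! (suc β ℕ.* m ℕ.+ suc s)) ≈ g [1+O h ]
    W-≈ s g h = ≈-resp-≐ (λ m → W (suc s) m /! (suc β ℕ.* m ℕ.+ suc s)) (λ m → fromℚ (power (c β) s m)) g h
      λ m → /!-≐ {W (suc s) m} {suc β ℕ.* m ℕ.+ suc s}
        (trans (W-cpow (suc s) m) (cong (ι ((suc β ℕ.* m ℕ.+ suc s) !) *_) (cpow-power s m)))

-- Assembly of the expansions and the exact counts.

open import Data.Nat using (nonTrivial⇒n>1; ≢-nonZero⁻¹)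
open import Data.Nat.Properties using (n≮0; n≮n)
open import Data.Product using (_,_)
open import Function using (case_of_)
open import Relation.Binary.PropositionalEquality using (refl)
open import Relation.Nullary using (contradiction)
open Trees using (c₀)
open Numerics using (geometric-ratios)
open Asymptotics using (has-expansion)
open Maxima
open import Defs
open import Data.Nat using (ℕ; suc; _+_; _*_; _∸_; NonZero; NonTrivial)
open import Data.Product using (∃-syntax; Σ-syntax; _×_)
open import Data.Vec using (Vec; last)

theorem3 : ∀ (b : ℕ) .{{_ : NonTrivial b}} →
    ∃[ α ] ∃[ γ ] ∃[ κ ] (0ᴿ ≤ᴿ κ) × (κ <ᴿ 1ᴿ) ×
    (Σ[ q ∈ (ℕ → ℕ) ]
    (∀ m → IsQ b m (q m)) ×
    (∀ m → IsW b 1 ((b ∸ 1) * m + 1) (q m)) ×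
    ((λ m → q m /! ((b ∸ 1) * m + 1))
    ≈ (λ m → α *ᴿ γ ^ᴿ m) [1+O (λ m → κ ^ᴿ m) ])) ×
    (∀ (s : ℕ) .{{_ : NonZero s}} →
    Σ[ W ∈ (ℕ → ℕ) ] Σ[ P ∈ Vec ℝ (suc (s ∸ 1)) ]
    (∀ m → IsW b s ((b ∸ 1) * m + s) (W m)) ×
    (last P ≃ α ^ᴿ s *ᴿ (1 /! (s ∸ 1))) ×
    ((λ m → W m /! ((b ∸ 1) * m + s))
    ≈ (λ m → evalPoly P (fromℕ m) *ᴿ γ ^ᴿ m) [1+O (λ m → κ ^ᴿ m) ]))
theorem3 0 = contradiction (nonTrivial⇒n>1 0) n≮0
theorem3 1 = contradiction (nonTrivial⇒n>1 1) (n≮n 1)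
theorem3 b@(suc (suc β)) = case has-expansion (geometric-ratios β) (c₀ β) of
  λ (α , γ , κ , 0≤κ , κ<1 , first-order , expansions) →
    α , γ , κ , 0≤κ , κ<1 ,
    (W β 1 , W-compositions β , W-maximum β 0 ,
      W-≈ β 0 (λ m → α *ᴿ γ ^ᴿ m) (λ m → κ ^ᴿ m) first-order) ,
    λ where
      0       → contradiction refl (≢-nonZero⁻¹ 0)
      (suc s) → case expansions s of λ (P , leading , order) →
        W β (suc s) , P , W-maximum β s , scale-1/! (last P) (α ^ᴿ suc s) s leading ,
        W-≈ β s (λ m → evalPoly P (fromℕ m) *ᴿ γ ^ᴿ m) (λ m → κ ^ᴿ m) order
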